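{- Let $\ell\ge0$ be an integer and $x_0\ge2$. There exist positive constants $\mathcal A_\ell(x_0),\mathcal A'_\ell(x_0)$ such that for all $x\ge x_0$ $$\frac{e^{ -\gamma_E}}{\log x}\Big(1-\frac{\mathcal A_\ell(x_0)}{(\log x)^\ell}\Big)\le\prod_{p\le x}\Big(1-\frac1p\Big)\le\frac{e^{ -\gamma_E}}{\log x}\Big(1+\frac{\mathcal A'_\ell(x_0)}{(\log x)^\ell}\Big).$$ Here one may take for $\mathcal A_\ell(x_0)$ any positive constant with $$\Big|\sum_{p\le x}\frac1p-\log\log x-M\Big|\le\frac{\mathcal A_\ell(x_0)}{(\log x)^\ell}\quad\text{for all }x\ge x_0,$$ and then $$\mathcal A'_\ell(x_0)=\Big(\mathcal A_\ell(x_0)+Z_1\max_{x\ge x_0}\frac{(\log x)^{\ell-1}}{x-1}\Big)\frac{e^m-1}m,\qquad m=\frac{\mathcal A_\ell(x_0)}{(\log x_0)^\ell}+\frac{Z_1}{(x_0-1)\log x_0}.$$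
   Context: Products and sums are over primes $p$. $\gamma_E$ is Euler's constant and $M=\gamma_E+\sum_p\big(\log(1-\frac1p)+\frac1p\big)$. $Z_1=1+1.93378\cdot10^{ -8}$; it is a known result that $\vartheta(x)=\sum_{p\le x}\log p<Z_1x$ for all $x>0$. -}

module Defs where

open import Algebra.Bundles using (CommutativeRing; Semiring)
open import Axiom.ExcludedMiddle using (ExcludedMiddle)
open import Data.Integer.Base as ℤ using (ℤ)
open import Data.List.Base using (List; filter; foldr; map; upTo)
open import Data.Nat.Base as ℕ using (ℕ; suc; _!)
open import Data.Nat.Primality using (prime?)
open import Data.Product.Base using (_×_; _,_; ∃; ∃-syntax)
open import Level using (0ℓ)
open import Relation.Binary.Bundles using (TotalOrder)
open import Relation.Binary.Core using (Rel)
open import Relation.Binary.Structures using (IsTotalOrder)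
open import Relation.Nullary using (¬_; yes; no)
import Algebra.Construct.NaturalChoice.Max as Max
import Algebra.Definitions.RawSemiring as RawSemiringDefinitions
import Relation.Binary.Construct.NonStrictToStrict as NonStrictToStrict

-- The real numbers enter as an arbitrary Dedekind-complete ordered field;
-- classically there is exactly one up to isomorphism.
record CompleteOrderedField : Set₁ where
  infix 4 _≤_
  field
    commutativeRing : CommutativeRing 0ℓ 0ℓ

  open CommutativeRing commutativeRing public

  field
    0≉1          : ¬ (0# ≈ 1#)
    inverse      : ∀ x → ¬ (x ≈ 0#) → ∃[ y ] x * y ≈ 1#
    _≤_          : Rel Carrier 0ℓ
    isTotalOrder : IsTotalOrder _≈_ _≤_
    +-monoʳ-≤    : ∀ x {y z} → y ≤ z → x + y ≤ x + z
    *-nonNeg     : ∀ {x y} → 0# ≤ x → 0# ≤ y → 0# ≤ x * y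

  IsUpperBound : (Carrier → Set) → Carrier → Set
  IsUpperBound P b = ∀ x → P x → x ≤ b

  field
    complete : (P : Carrier → Set) → ∃ P → ∃ (IsUpperBound P) →
               ∃[ s ] (IsUpperBound P s × (∀ b → IsUpperBound P b → s ≤ b))

  totalOrder : TotalOrder 0ℓ 0ℓ 0ℓ
  totalOrder = record { isTotalOrder = isTotalOrder }


module Analysis (em : ExcludedMiddle 0ℓ) (field′ : CompleteOrderedField) where

  open CompleteOrderedField field′ public renaming (Carrier to ℝ)
  open NonStrictToStrict _≈_ _≤_ public using (_<_)
  open Max totalOrder public using (_⊔_)
  open RawSemiringDefinitions (Semiring.rawSemiring semiring) public
    using (_^_) renaming (_×_ to _·_)

  -- Definite description: some element satisfying P, or the default value d
  -- if there is none. Below, P determines its solutions up to equality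
  -- whenever the argument lies in the mathematically meaningful domain.
  the : {A : Set} (d : A) (P : A → Set) → A
  the d P with em {∃ P}
  ... | yes (a , _) = a
  ... | no  _       = d

  fromℕ : ℕ → ℝ
  fromℕ n = n · 1#

  infix 9 _⁻¹
  infixl 7 _/_
  infixr 8 _^ᶻ_

  _⁻¹ : ℝ → ℝ
  x ⁻¹ = the 0# λ y → x * y ≈ 1#

  _/_ : ℝ → ℝ → ℝ
  x / y = x * y ⁻¹

  _^ᶻ_ : ℝ → ℤ → ℝ
  x ^ᶻ (ℤ.+ n)    = x ^ n
  x ^ᶻ ℤ.-[1+ n ] = (x ^ suc n) ⁻¹

  ∣_∣ : ℝ → ℝ
  ∣ x ∣ = x ⊔ - x

  ⌊_⌋ : ℝ → ℕ
  ⌊ x ⌋ = the 0 λ n → fromℕ n ≤ x × x < fromℕ (suc n)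

  IsMaximumOn : (ℝ → Set) → (ℝ → ℝ) → ℝ → Set
  IsMaximumOn D f m = (∃[ x ] D x × f x ≈ m) × (∀ x → D x → f x ≤ m)

  infix 4 _⟶_

  _⟶_ : (ℕ → ℝ) → ℝ → Set
  a ⟶ l = ∀ ε → 0# < ε → ∃[ N ] (∀ n → N ℕ.≤ n → ∣ a n - l ∣ < ε)

  lim : (ℕ → ℝ) → ℝ
  lim a = the 0# (a ⟶_)

  ∑ ∏ : List ℕ → (ℕ → ℝ) → ℝ
  ∑ ns f = foldr _+_ 0# (map f ns)
  ∏ ns f = foldr _*_ 1# (map f ns)

  exp : ℝ → ℝ
  exp x = lim λ n → ∑ (upTo n) λ k → x ^ k / fromℕ (k !)

  log : ℝ → ℝ
  log x = the 0# λ y → exp y ≈ x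

  primesUpTo : ℕ → List ℕ
  primesUpTo n = filter prime? (upTo (suc n))

  -- Since primes are integers, p ≤ x is p ≤ ⌊ x ⌋; negative x yields no primes.
  primes≤ : ℝ → List ℕ
  primes≤ x = primesUpTo ⌊ x ⌋

  ϑ : ℝ → ℝ
  ϑ x = ∑ (primes≤ x) λ p → log (fromℕ p)

  γᴱ : ℝ
  γᴱ = lim λ n → ∑ (upTo n) (λ k → 1# / fromℕ (suc k)) - log (fromℕ n)

  M : ℝ
  M = γᴱ + lim λ n → ∑ (primesUpTo n) λ p →
        log (1# - 1# / fromℕ p) + 1# / fromℕ p

  -- 1 + 1.93378 · 10⁻⁸
  Z₁ : ℝ
  Z₁ = 1# + fromℕ 193378 / fromℕ 10 ^ 13

module Submission where

-- Let E(x) be the sum of 1/p over p ≤ x minus log log x + M, and let τ(x) be the sum of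
-- - log (1 - 1/p) - 1/p over p > x. Taking logarithms, the product over p ≤ x equals
-- exp (- γ) / log x * exp (τ(x) - E(x)) (product-formula). Both inequalities therefore follow
-- from a bound |E(x)| ≤ A / (log x)^ℓ: the lower one because τ ≥ 0 and exp (- y) ≥ 1 - y, the
-- upper one from τ(x) ≤ Z₁ / ((x - 1) log x), obtained by partial summation from ϑ(x) < Z₁ x
-- (tail-theta-bound), and from exp y ≤ 1 + y (exp m - 1) / m for 0 ≤ y ≤ m, which is convexity.
-- The maximum K exists because the function is upper semicontinuous and decays
-- (majorant-maximum).
--
-- The first half of the theorem needs E(x) = O((log x)^(- ℓ)) for every ℓ, that is, the prime
-- number theorem with an error term. Let a character be a map E with E (u + v) = E u * E v from
-- the reals to a complete normed algebra, decaying exponentially and differentiable at 0 with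
-- derivative - w. Each character has a zeta function Z, the sum of E (log n) / n, an Euler
-- product for it, and a bound for w Z by comparison with a telescoping sum. For
-- E u = exp (- (ε + i t) u) this is the zeta function at 1 + ε + i t. Passing from an algebra to
-- its dual numbers turns Z into the pair of Z and its derivative, and repeating the step gives
-- all derivatives; the algebra with j² = d j gives divided differences in the same way. So the
-- bounds for derivatives and differences of zeta are instances of one estimate, and no complex
-- analysis is needed.
--
-- The inequality behind 3 + 4 cos θ + cos 2θ ≥ 0 (three-four-one) shows that 1 / zeta grows at
-- most like a power of log |t| off the pole, uniformly in ε (zeta-inverse); near the pole w Z is
-- close to 1. Hence the sum of log p E (log p) / p differs from 1 / w by at most a power of
-- log |t|, together with its derivatives in w (primeSum-bound). As 1 / w is close to the
-- sum of η E (j η) over j, this compares the measure with mass log p / p at log p with the uniform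
-- measure on a grid of mesh η, tested on u^k exp (- (ε + i t) u). Averaging over t replaces the
-- exponential by the kernel cos (h (u - v))^(2 N), concentrated near v (kernel-agree). Here k is
-- large while ε = 1 / S, S being the size of log p, so that after division by v^(k + 1) the
-- error is a negative power of S. Covering an interval with such kernels gives the sum of 1/p
-- over x < p ≤ y as log (log y / log x) + O(S^(- ℓ)) for S ≤ log x ≤ log y ≤ 2 S
-- (window-theorem), and adding up dyadic windows gives E(x) = c - M + O((log x)^(- ℓ)) for some
-- constant c (deviation-bound).
--
-- Finally c = M (M≈): as δ tends to 0, the sum of p^(- 1 - δ) is compared, by partial summation,
-- with that of exp (- δ k) / k, which is - log (1 - exp (- δ)), and, by the Euler product, with
-- log zeta (1 + δ), which is - log δ + O(δ).
--
-- Equalities of polynomials are proved by the reflective procedure called by (byᴮ in a normed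
-- algebra); lin deduces an inequality from another with the same difference of the two sides.

open import Algebra.Bundles using (CommutativeRing; Semiring)
open import Level using (0ℓ)
open import Data.Bool.Base using (Bool; true; false; if_then_else_; _∧_; not) renaming (T to IsTrue)
open import Data.Fin.Base using (Fin; toℕ)
import Data.Fin.Properties as Finₚ
open import Data.List.Base using (List; []; _∷_; foldr; applyUpTo; upTo; filter)
import Data.List.Properties as Listₚ
open import Data.Nat.Base as N using (ℕ; zero; suc; _!)
import Data.Nat.Properties as N
open import Data.Product.Base using (_×_; _,_; ∃; ∃-syntax) renaming (proj₁ to fst; proj₂ to snd)
import Data.Product.Properties as Productₚ
open import Data.Vec.Base using (Vec; []; _∷_; lookup; allFin; map)
open import Data.Vec.N-ary using (N-ary; _$ⁿ_; curryⁿ; Eqʰ; ∀ⁿʰ)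
open import Relation.Nullary using (yes; no; does; Dec; ¬_)
open import Relation.Binary.PropositionalEquality as E using (_≡_) renaming (refl to ok)
import Algebra.Definitions.RawSemiring as RawSemiringDefinitions
import Algebra.Properties.Semiring.Mult as Mult
import Algebra.Properties.Monoid.Mult as MonoidMult
import Algebra.Properties.Ring as RingProperties
import Relation.Binary.Reasoning.Setoid as SetoidReasoning
open import Defs
open import Axiom.ExcludedMiddle using (ExcludedMiddle)
open import Data.Empty using (⊥-elim)
open import Data.Sum.Base using (_⊎_; inj₁; inj₂; [_,_]′)
open import Relation.Binary.Bundles using (TotalOrder; Poset)
open import Relation.Binary.Structures using (IsTotalOrder; IsEquivalence)
import Algebra.Construct.NaturalChoice.Max as Max
import Algebra.Properties.Semiring.Exp as SemiringExp
import Algebra.Properties.CommutativeSemiring.Exp as CommSemiringExp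
import Relation.Binary.Construct.NonStrictToStrict as NonStrictToStrict
import Relation.Binary.Reasoning.PartialOrder as PartialOrderReasoning
open import Function.Base using (_∘_)
import Data.Bool.Properties as Boolₚ
open import Data.Nat.Divisibility using (_∣_; _∣?_; ∣m+n∣m⇒∣n; ∣⇒≤; ∣1⇒≡1; ∣-trans; n∣m*n; ∣n⇒∣m*n; m∣m*n)
open import Data.Nat.Primality using (Prime; prime?; euclidsLemma; prime⇒irreducible; prime⇒nonTrivial; ¬prime[1]; _Rough_; 1-rough; 2-rough; ∤⇒rough-suc; rough∧∣⇒prime; rough⇒≤)
open import Relation.Nullary.Decidable using (does-⇔; dec-true; dec-false)
open import Function.Bundles using (mk⇔)
open import Data.Nat.Solver using (module +-*-Solver)
open import Data.Integer.Base using (_⊖_)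

-- Polynomial identities in commutative rings

infixl 6 _:+_ _:-_
infixl 7 _:*_
infix 8 :-_
infixr 9 _:^_
infix 4 _:=_

data Expr (n : ℕ) : Set where
 var : Fin n -> Expr n
 con : ℕ -> Expr n
 :0 :1 : Expr n
 _:+_ _:*_ : Expr n -> Expr n -> Expr n
 _:-_ : Expr n -> Expr n -> Expr n
 :-_ : Expr n -> Expr n
 _:^_ : Expr n -> ℕ -> Expr n

_:=_ : ∀ {n} -> Expr n -> Expr n -> Expr n × Expr n
_:=_ = _,_

private
 -- Monomials are sorted lists of variables, polynomials lists of monomials with coefficients.
 Monomial Poly : ℕ -> Set
 Monomial n = List (Fin n)
 Poly n = List (Monomial n × ℕ)

 _≟ᵐ_ : ∀ {n} (a b : Monomial n) -> Dec (a ≡ b)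
 _≟ᵐ_ = Listₚ.≡-dec Finₚ._≟_

 _<ᵐ_ : ∀ {n} -> Monomial n -> Monomial n -> Bool
 [] <ᵐ [] = false
 [] <ᵐ (_ ∷ _) = true
 (_ ∷ _) <ᵐ [] = false
 (i ∷ a) <ᵐ (j ∷ b) with does (i Finₚ.≟ j)
 ... | true = a <ᵐ b
 ... | false = toℕ i N.<ᵇ toℕ j

 insertVar : ∀ {n} -> Fin n -> Monomial n -> Monomial n
 insertVar i [] = i ∷ []
 insertVar i (j ∷ m) = if toℕ i N.≤ᵇ toℕ j then i ∷ j ∷ m else j ∷ insertVar i m

 mulMono : ∀ {n} -> Monomial n -> Monomial n -> Monomial n
 mulMono a b = foldr insertVar b a

 insert : ∀ {n} -> Monomial n -> ℕ -> Poly n -> Poly n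
 insert a c [] = (a , c) ∷ []
 insert a c ((b , d) ∷ p) with a ≟ᵐ b
 ... | yes _ = (b , c N.+ d) ∷ p
 ... | no _ = if a <ᵐ b then (a , c) ∷ (b , d) ∷ p else (b , d) ∷ insert a c p

 add : ∀ {n} -> Poly n -> Poly n -> Poly n
 add [] q = q
 add ((a , c) ∷ p) q = insert a c (add p q)

 mulTerm : ∀ {n} -> Monomial n -> ℕ -> Poly n -> Poly n -> Poly n
 mulTerm a c [] r = r
 mulTerm a c ((b , d) ∷ q) r = insert (mulMono a b) (c N.* d) (mulTerm a c q r)

 mul : ∀ {n} -> Poly n -> Poly n -> Poly n
 mul [] q = []
 mul ((a , c) ∷ p) q = mulTerm a c q (mul p q)

 -- A polynomial with integer coefficients, as a formal difference
 Diff : ℕ -> Set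
 Diff n = Poly n × Poly n

 mulD : ∀ {n} -> Diff n -> Diff n -> Diff n
 mulD (a , b) (c , d) = add (mul a c) (mul b d) , add (mul a d) (mul b c)

 powD : ∀ {n} -> Diff n -> ℕ -> Diff n
 powD a zero = (([] , 1) ∷ []) , []
 powD a (suc k) = mulD a (powD a k)

 norm : ∀ {n} -> Expr n -> Diff n
 norm (var i) = ((i ∷ []) , 1) ∷ [] , []
 norm (con k) = insert [] k [] , []
 norm :0 = [] , []
 norm :1 = ([] , 1) ∷ [] , []
 norm (e :+ f) = let (a , b) = norm e ; (c , d) = norm f in add a c , add b d
 norm (e :- f) = let (a , b) = norm e ; (c , d) = norm f in add a d , add b c
 norm (e :* f) = mulD (norm e) (norm f)
 norm (:- e) = let (a , b) = norm e in b , a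
 norm (e :^ k) = powD (norm e) k

 dropZero : ∀ {n} -> Poly n -> Poly n
 dropZero [] = []
 dropZero ((a , zero) ∷ p) = dropZero p
 dropZero ((a , suc c) ∷ p) = (a , suc c) ∷ dropZero p

 _≟ᵖ_ : ∀ {n} (a b : Poly n) -> Dec (a ≡ b)
 _≟ᵖ_ = Listₚ.≡-dec (Productₚ.≡-dec _≟ᵐ_ N._≟_)

 -- Whether two expressions have the same normal form
 check : ∀ {n} -> Expr n -> Expr n -> Bool
 check e f = let (a , b) = norm e ; (c , d) = norm f in
  does (dropZero (add a d) ≟ᵖ dropZero (add c b))

-- The expression given by a function of its variables
close : ∀ {A : Set} n -> N-ary n (Expr n) A -> A
close n f = f $ⁿ map var (allFin n)

module RingSolver (R : CommutativeRing 0ℓ 0ℓ) where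
 open CommutativeRing R
 open RawSemiringDefinitions (Semiring.rawSemiring semiring) using (_^_) renaming (_×_ to _·_)
 open Mult semiring using (×1-homo-*)
 open MonoidMult +-monoid using (×-homo-+)
 open RingProperties ring
 open SetoidReasoning setoid

 ⟦_⟧ : ∀ {n} -> Expr n -> Vec Carrier n -> Carrier
 ⟦ var i ⟧ ρ = lookup ρ i
 ⟦ con k ⟧ ρ = k · 1#
 ⟦ :0 ⟧ ρ = 0#
 ⟦ :1 ⟧ ρ = 1#
 ⟦ e :+ f ⟧ ρ = ⟦ e ⟧ ρ + ⟦ f ⟧ ρ
 ⟦ e :* f ⟧ ρ = ⟦ e ⟧ ρ * ⟦ f ⟧ ρ
 ⟦ e :- f ⟧ ρ = ⟦ e ⟧ ρ - ⟦ f ⟧ ρ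
 ⟦ :- e ⟧ ρ = - ⟦ e ⟧ ρ
 ⟦ e :^ k ⟧ ρ = ⟦ e ⟧ ρ ^ k

 private
  module _ {n : ℕ} (ρ : Vec Carrier n) where

   ⟦_⟧ᵐ : Monomial n -> Carrier
   ⟦ [] ⟧ᵐ = 1#
   ⟦ i ∷ m ⟧ᵐ = lookup ρ i * ⟦ m ⟧ᵐ

   ⟦_⟧ᵖ : Poly n -> Carrier
   ⟦ [] ⟧ᵖ = 0#
   ⟦ (m , c) ∷ p ⟧ᵖ = (c · 1#) * ⟦ m ⟧ᵐ + ⟦ p ⟧ᵖ

   ⟦_⟧ᵈ : Diff n -> Carrier
   ⟦ a , b ⟧ᵈ = ⟦ a ⟧ᵖ - ⟦ b ⟧ᵖ

   swap* : ∀ x y z -> x * (y * z) ≈ y * (x * z)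
   swap* x y z = trans (sym (*-assoc x y z)) (trans (*-congʳ (*-comm x y)) (*-assoc y x z))

   swap+ : ∀ x y z -> x + (y + z) ≈ y + (x + z)
   swap+ x y z = trans (sym (+-assoc x y z)) (trans (+-congʳ (+-comm x y)) (+-assoc y x z))

   insertVar-sound : ∀ i m -> ⟦ insertVar i m ⟧ᵐ ≈ lookup ρ i * ⟦ m ⟧ᵐ
   insertVar-sound i [] = refl
   insertVar-sound i (j ∷ m) with toℕ i N.≤ᵇ toℕ j
   ... | true = refl
   ... | false = trans (*-congˡ (insertVar-sound i m)) (swap* _ _ _)

   mulMono-sound : ∀ a b -> ⟦ mulMono a b ⟧ᵐ ≈ ⟦ a ⟧ᵐ * ⟦ b ⟧ᵐ
   mulMono-sound [] b = sym (*-identityˡ _)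
   mulMono-sound (i ∷ a) b = trans (insertVar-sound i (mulMono a b)) (trans (*-congˡ (mulMono-sound a b)) (sym (*-assoc _ _ _)))

   insert-sound : ∀ a c p -> ⟦ insert a c p ⟧ᵖ ≈ (c · 1#) * ⟦ a ⟧ᵐ + ⟦ p ⟧ᵖ
   insert-sound a c [] = refl
   insert-sound a c ((b , d) ∷ p) with a ≟ᵐ b
   ... | yes E.refl = begin ((c N.+ d) · 1#) * ⟦ a ⟧ᵐ + ⟦ p ⟧ᵖ ≈⟨ +-congʳ (*-congʳ (×-homo-+ 1# c d)) ⟩
    (c · 1# + d · 1#) * ⟦ a ⟧ᵐ + ⟦ p ⟧ᵖ ≈⟨ +-congʳ (distribʳ _ _ _) ⟩
    ((c · 1#) * ⟦ a ⟧ᵐ + (d · 1#) * ⟦ a ⟧ᵐ) + ⟦ p ⟧ᵖ ≈⟨ +-assoc _ _ _ ⟩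
    (c · 1#) * ⟦ a ⟧ᵐ + ((d · 1#) * ⟦ a ⟧ᵐ + ⟦ p ⟧ᵖ) ∎
   ... | no _ with a <ᵐ b
   ... | true = refl
   ... | false = trans (+-congˡ (insert-sound a c p)) (swap+ _ _ _)

   add-sound : ∀ p q -> ⟦ add p q ⟧ᵖ ≈ ⟦ p ⟧ᵖ + ⟦ q ⟧ᵖ
   add-sound [] q = sym (+-identityˡ _)
   add-sound ((a , c) ∷ p) q = trans (insert-sound a c (add p q)) (trans (+-congˡ (add-sound p q)) (sym (+-assoc _ _ _)))

   mulTerm-sound : ∀ a c q r -> ⟦ mulTerm a c q r ⟧ᵖ ≈ ((c · 1#) * ⟦ a ⟧ᵐ) * ⟦ q ⟧ᵖ + ⟦ r ⟧ᵖ
   mulTerm-sound a c [] r = sym (trans (+-congʳ (zeroʳ _)) (+-identityˡ _))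
   mulTerm-sound a c ((b , d) ∷ q) r = begin
    ⟦ insert (mulMono a b) (c N.* d) (mulTerm a c q r) ⟧ᵖ ≈⟨ insert-sound (mulMono a b) (c N.* d) (mulTerm a c q r) ⟩
    ((c N.* d) · 1#) * ⟦ mulMono a b ⟧ᵐ + ⟦ mulTerm a c q r ⟧ᵖ ≈⟨ +-cong (*-cong (×1-homo-* c d) (mulMono-sound a b)) (mulTerm-sound a c q r) ⟩
    ((c · 1#) * (d · 1#)) * (⟦ a ⟧ᵐ * ⟦ b ⟧ᵐ) + (((c · 1#) * ⟦ a ⟧ᵐ) * ⟦ q ⟧ᵖ + ⟦ r ⟧ᵖ) ≈⟨ sym (+-assoc _ _ _) ⟩
    (((c · 1#) * (d · 1#)) * (⟦ a ⟧ᵐ * ⟦ b ⟧ᵐ) + ((c · 1#) * ⟦ a ⟧ᵐ) * ⟦ q ⟧ᵖ) + ⟦ r ⟧ᵖ ≈⟨ +-congʳ (+-congʳ (trans (*-assoc _ _ _) (trans (*-congˡ (swap* _ _ _)) (sym (*-assoc _ _ _))))) ⟩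
    (((c · 1#) * ⟦ a ⟧ᵐ) * ((d · 1#) * ⟦ b ⟧ᵐ) + ((c · 1#) * ⟦ a ⟧ᵐ) * ⟦ q ⟧ᵖ) + ⟦ r ⟧ᵖ ≈⟨ +-congʳ (sym (distribˡ _ _ _)) ⟩
    ((c · 1#) * ⟦ a ⟧ᵐ) * ((d · 1#) * ⟦ b ⟧ᵐ + ⟦ q ⟧ᵖ) + ⟦ r ⟧ᵖ ∎

   mul-sound : ∀ p q -> ⟦ mul p q ⟧ᵖ ≈ ⟦ p ⟧ᵖ * ⟦ q ⟧ᵖ
   mul-sound [] q = sym (zeroˡ _)
   mul-sound ((a , c) ∷ p) q = trans (mulTerm-sound a c q (mul p q)) (trans (+-congˡ (mul-sound p q)) (sym (distribʳ _ _ _)))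

   exchange : ∀ a b c d -> (a - b) + (c - d) ≈ (a + c) - (b + d)
   exchange a b c d = begin (a - b) + (c - d) ≈⟨ +-assoc _ _ _ ⟩ a + (- b + (c - d)) ≈⟨ +-congˡ (swap+ _ _ _) ⟩
    a + (c + (- b - d)) ≈⟨ sym (+-assoc _ _ _) ⟩
    (a + c) + (- b - d) ≈⟨ +-congˡ (-‿+-comm b d) ⟩
    (a + c) - (b + d) ∎

   neg-sound : ∀ a b -> - (a - b) ≈ b - a
   neg-sound a b = begin - (a - b) ≈⟨ sym (-‿+-comm a (- b)) ⟩ - a + - (- b) ≈⟨ +-congˡ (-‿involutive b) ⟩ - a + b ≈⟨ +-comm _ _ ⟩ b - a ∎

   mulD-sound : ∀ p q -> ⟦ mulD p q ⟧ᵈ ≈ ⟦ p ⟧ᵈ * ⟦ q ⟧ᵈ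
   mulD-sound (a , b) (c , d) = begin ⟦ add (mul a c) (mul b d) ⟧ᵖ - ⟦ add (mul a d) (mul b c) ⟧ᵖ ≈⟨ +-cong (prods a c b d) (-‿cong (prods a d b c)) ⟩
    (A * C + B * D) - (A * D + B * C) ≈⟨ +-congˡ (-‿cong (+-comm _ _)) ⟩
    (A * C + B * D) - (B * C + A * D) ≈⟨ sym (exchange _ _ _ _) ⟩
    (A * C - B * C) + (B * D - A * D) ≈⟨ +-cong (sym ([y-z]x≈yx-zx C A B)) (sym ([y-z]x≈yx-zx D B A)) ⟩
    (A - B) * C + (B - A) * D ≈⟨ +-congˡ (*-congʳ (sym (neg-sound A B))) ⟩
    (A - B) * C + (- (A - B)) * D ≈⟨ +-congˡ (trans (sym (-‿distribˡ-* _ _)) (-‿distribʳ-* _ _)) ⟩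
    (A - B) * C + (A - B) * - D ≈⟨ sym (distribˡ _ _ _) ⟩
    (A - B) * (C - D) ∎
    where
    A = ⟦ a ⟧ᵖ
    B = ⟦ b ⟧ᵖ
    C = ⟦ c ⟧ᵖ
    D = ⟦ d ⟧ᵖ
    prods : ∀ a c b d -> ⟦ add (mul a c) (mul b d) ⟧ᵖ ≈ ⟦ a ⟧ᵖ * ⟦ c ⟧ᵖ + ⟦ b ⟧ᵖ * ⟦ d ⟧ᵖ
    prods a c b d = trans (add-sound (mul a c) (mul b d)) (+-cong (mul-sound a c) (mul-sound b d))

   x-0≈x : ∀ x -> x - 0# ≈ x
   x-0≈x x = trans (+-congˡ -0#≈0#) (+-identityʳ x)

   one-sound : ⟦ ([] , 1) ∷ [] , [] ⟧ᵈ ≈ 1#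
   one-sound = trans (x-0≈x _) (trans (+-identityʳ _) (trans (*-identityʳ _) (+-identityʳ _)))

   powD-sound : ∀ p k -> ⟦ powD p k ⟧ᵈ ≈ ⟦ p ⟧ᵈ ^ k
   powD-sound p zero = one-sound
   powD-sound p (suc k) = trans (mulD-sound p (powD p k)) (*-congˡ (powD-sound p k))

   ^-cong : ∀ {x y} k -> x ≈ y -> x ^ k ≈ y ^ k
   ^-cong zero eq = refl
   ^-cong (suc k) eq = *-cong eq (^-cong k eq)

   norm-sound : ∀ e -> ⟦ norm e ⟧ᵈ ≈ ⟦ e ⟧ ρ
   norm-sound (var i) = trans (x-0≈x _) (trans (+-identityʳ _) (trans (*-cong (+-identityʳ _) (*-identityʳ _)) (*-identityˡ _)))
   norm-sound (con k) = trans (x-0≈x _) (trans (+-identityʳ _) (*-identityʳ _))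
   norm-sound :0 = x-0≈x _
   norm-sound :1 = one-sound
   norm-sound (e :+ f) with norm e | norm f | norm-sound e | norm-sound f
   ... | a , b | c , d | eq₁ | eq₂ = trans (+-cong (add-sound a c) (-‿cong (add-sound b d))) (trans (sym (exchange _ _ _ _)) (+-cong eq₁ eq₂))
   norm-sound (e :- f) with norm e | norm f | norm-sound e | norm-sound f
   ... | a , b | c , d | eq₁ | eq₂ = trans (+-cong (add-sound a d) (-‿cong (add-sound b c)))
    (trans (sym (exchange _ _ _ _)) (+-cong eq₁ (trans (sym (neg-sound _ _)) (-‿cong eq₂))))
   norm-sound (e :* f) = trans (mulD-sound (norm e) (norm f)) (*-cong (norm-sound e) (norm-sound f))
   norm-sound (:- e) = trans (sym (neg-sound _ _)) (-‿cong (norm-sound e))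
   norm-sound (e :^ k) = trans (powD-sound (norm e) k) (^-cong k (norm-sound e))

   dropZero-sound : ∀ p -> ⟦ dropZero p ⟧ᵖ ≈ ⟦ p ⟧ᵖ
   dropZero-sound [] = refl
   dropZero-sound ((a , zero) ∷ p) = trans (dropZero-sound p) (sym (trans (+-congʳ (zeroˡ _)) (+-identityˡ _)))
   dropZero-sound ((a , suc c) ∷ p) = +-congˡ (dropZero-sound p)

   cross : ∀ a b c d -> a + d ≈ c + b -> a - b ≈ c - d
   cross a b c d eq = begin a - b ≈⟨ sym (x-0≈x _) ⟩ (a - b) - 0# ≈⟨ +-congˡ (-‿cong (sym (-‿inverseˡ d))) ⟩
    (a - b) - (- d + d) ≈⟨ +-congˡ (-‿cong (+-comm _ _)) ⟩
    (a - b) - (d - d) ≈⟨ +-congˡ (neg-sound d d) ⟩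
    (a - b) + (d - d) ≈⟨ exchange a b d d ⟩
    (a + d) - (b + d) ≈⟨ +-congʳ eq ⟩
    (c + b) - (b + d) ≈⟨ +-congˡ (-‿cong (+-comm b d)) ⟩
    (c + b) - (d + b) ≈⟨ sym (exchange c d b b) ⟩
    (c - d) + (b - b) ≈⟨ +-congˡ (-‿inverseʳ b) ⟩
    (c - d) + 0# ≈⟨ +-identityʳ _ ⟩
    c - d ∎

   check-sound : ∀ e f -> IsTrue (check e f) -> ⟦ e ⟧ ρ ≈ ⟦ f ⟧ ρ
   check-sound e f valid with norm e | norm f | norm-sound e | norm-sound f
   ... | a , b | c , d | eq₁ | eq₂ with dropZero (add a d) ≟ᵖ dropZero (add c b)
   ... | yes p = trans (sym eq₁) (trans (cross _ _ _ _ same) eq₂)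
    where
    same : ⟦ a ⟧ᵖ + ⟦ d ⟧ᵖ ≈ ⟦ c ⟧ᵖ + ⟦ b ⟧ᵖ
    same = begin ⟦ a ⟧ᵖ + ⟦ d ⟧ᵖ ≈⟨ sym (add-sound a d) ⟩ ⟦ add a d ⟧ᵖ ≈⟨ sym (dropZero-sound (add a d)) ⟩ ⟦ dropZero (add a d) ⟧ᵖ ≡⟨ E.cong ⟦_⟧ᵖ p ⟩
     ⟦ dropZero (add c b) ⟧ᵖ ≈⟨ dropZero-sound (add c b) ⟩
     ⟦ add c b ⟧ᵖ ≈⟨ add-sound c b ⟩
     ⟦ c ⟧ᵖ + ⟦ b ⟧ᵖ ∎

  generalise : ∀ n {P : Vec Carrier n -> Set} -> (∀ ρ -> P ρ) -> ∀ⁿʰ n (curryⁿ {n = n} P)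
  generalise zero p = p []
  generalise (suc n) p {x} = generalise n (\ ρ -> p (x ∷ ρ))

 by : ∀ n (f : N-ary n (Expr n) (Expr n × Expr n)) -> {_ : IsTrue (check (fst (close n f)) (snd (close n f)))} -> ∀ⁿʰ n (curryⁿ {n = n} \ ρ -> ⟦ fst (close n f) ⟧ ρ ≈ ⟦ snd (close n f) ⟧ ρ)
 by n f {valid} = generalise n (\ ρ -> check-sound ρ (fst (close n f)) (snd (close n f)) valid)

-- Finite sums, and the sieve of Eratosthenes

-- Finite sums Σ n f = f 0 + ... + f (n - 1) in a commutative ring.
module Sums (R : CommutativeRing 0ℓ 0ℓ) where
 open CommutativeRing R
 open RingSolver R using (by)
 open SetoidReasoning setoid

 Σ : ℕ -> (ℕ -> Carrier) -> Carrier
 Σ zero f = 0#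
 Σ (suc n) f = Σ n f + f n

 Σ-cong : ∀ n {f g} -> (∀ i -> i N.< n -> f i ≈ g i) -> Σ n f ≈ Σ n g
 Σ-cong zero h = refl
 Σ-cong (suc n) h = +-cong (Σ-cong n (\ i p -> h i (N.m<n⇒m<1+n p))) (h n N.≤-refl)

 Σ-cong′ : ∀ n {f g} -> (∀ i -> f i ≈ g i) -> Σ n f ≈ Σ n g
 Σ-cong′ n h = Σ-cong n (\ i _ -> h i)

 Σ-+ : ∀ n f g -> Σ n (\ i -> f i + g i) ≈ Σ n f + Σ n g
 Σ-+ zero f g = sym (+-identityˡ 0#)
 Σ-+ (suc n) f g = trans (+-congʳ (Σ-+ n f g)) (by 4 \ a b c d -> a :+ b :+ (c :+ d) := a :+ c :+ (b :+ d))

 Σ-neg : ∀ n f -> Σ n (\ i -> - f i) ≈ - Σ n f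
 Σ-neg zero f = by 0 (:0 := :- :0)
 Σ-neg (suc n) f = trans (+-congʳ (Σ-neg n f)) (by 2 \ a b -> :- a :+ :- b := :- (a :+ b))

 Σ-sub : ∀ n f g -> Σ n (\ i -> f i - g i) ≈ Σ n f - Σ n g
 Σ-sub n f g = trans (Σ-+ n f (\ i -> - g i)) (+-congˡ (Σ-neg n g))

 Σ-* : ∀ n c f -> Σ n (\ i -> c * f i) ≈ c * Σ n f
 Σ-* zero c f = sym (zeroʳ c)
 Σ-* (suc n) c f = trans (+-congʳ (Σ-* n c f)) (sym (distribˡ c _ _))

 Σ-zero : ∀ n {f} -> (∀ i -> i N.< n -> f i ≈ 0#) -> Σ n f ≈ 0#
 Σ-zero zero h = refl
 Σ-zero (suc n) h = trans (+-cong (Σ-zero n (\ i p -> h i (N.m<n⇒m<1+n p))) (h n N.≤-refl)) (+-identityˡ 0#)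

 Σ-split : ∀ m n f -> Σ (m N.+ n) f ≈ Σ m f + Σ n (\ i -> f (m N.+ i))
 Σ-split m zero f = trans (reflexive (E.cong (\ k -> Σ k f) (N.+-identityʳ m))) (sym (+-identityʳ _))
 Σ-split m (suc n) f = trans (reflexive (E.cong (\ k -> Σ k f) (N.+-suc m n))) (trans (+-congʳ (Σ-split m n f)) (+-assoc _ _ _))

 Σ-front : ∀ n f -> Σ (suc n) f ≈ f 0 + Σ n (\ i -> f (suc i))
 Σ-front n f = trans (Σ-split 1 n f) (+-congʳ (+-identityˡ _))

 Σ-telescope : ∀ n (f : ℕ -> Carrier) -> Σ n (\ i -> f i - f (suc i)) ≈ f 0 - f n
 Σ-telescope zero f = sym (-‿inverseʳ _)
 Σ-telescope (suc n) f = trans (+-congʳ (Σ-telescope n f)) (by 3 \ a b c -> a :- b :+ (b :- c) := a :- c)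

 Σ-swap : ∀ m n (f : ℕ -> ℕ -> Carrier) -> Σ m (\ i -> Σ n (f i)) ≈ Σ n (\ j -> Σ m (\ i -> f i j))
 Σ-swap zero n f = sym (Σ-zero n (\ _ _ -> refl))
 Σ-swap (suc m) n f = trans (+-congʳ (Σ-swap m n f)) (sym (Σ-+ n _ _))

isPrime : ℕ -> Bool
isPrime n = does (prime? n)

isPrime⇒Prime : ∀ {n} -> isPrime n ≡ true -> Prime n
isPrime⇒Prime {n} eq with prime? n
... | yes p = p
isPrime⇒Prime {n} () | no _

by-cases₀ : ∀ {X : Set} (b : Bool) -> (b ≡ true -> X) -> (b ≡ false -> X) -> X
by-cases₀ true f g = f ok
by-cases₀ false f g = g ok

-- sieve N i tells whether i + 1 has no prime divisor up to N.
sieve : ℕ -> ℕ -> Bool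
sieve zero i = true
sieve (suc N) i = sieve N i ∧ not (isPrime (suc N) ∧ does (suc N ∣? suc i))

sieve-composite : ∀ N i -> isPrime (suc N) ≡ false -> sieve (suc N) i ≡ sieve N i
sieve-composite N i eq rewrite eq = Boolₚ.∧-identityʳ (sieve N i)

sieve-∣ : ∀ N i -> isPrime (suc N) ≡ true -> suc N ∣ suc i -> sieve (suc N) i ≡ false
sieve-∣ N i eq d rewrite eq | dec-true (suc N ∣? suc i) d = Boolₚ.∧-zeroʳ (sieve N i)

sieve-∤ : ∀ N i -> ¬ (suc N ∣ suc i) -> sieve (suc N) i ≡ sieve N i
sieve-∤ N i d rewrite dec-false (suc N ∣? suc i) d | Boolₚ.∧-zeroʳ (isPrime (suc N)) = Boolₚ.∧-identityʳ (sieve N i)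

-- Multiplication by a larger prime does not change small prime divisors.
sieve-* : ∀ N {i j p} -> Prime p -> N N.< p -> suc i ≡ suc j N.* p -> sieve N i ≡ sieve N j
sieve-* zero pp N<p eq = ok
sieve-* (suc N) {i} {j} {p} pp N<p eq = E.cong₂ _∧_ (sieve-* N pp (N.<-trans (N.n<1+n N) N<p) eq)
 (E.cong not (by-cases₀ (isPrime (suc N)) prime-case composite-case))
 where
 composite-case : isPrime (suc N) ≡ false -> isPrime (suc N) ∧ does (suc N ∣? suc i) ≡ isPrime (suc N) ∧ does (suc N ∣? suc j)
 composite-case e rewrite e = ok
 prime-case : isPrime (suc N) ≡ true -> isPrime (suc N) ∧ does (suc N ∣? suc i) ≡ isPrime (suc N) ∧ does (suc N ∣? suc j)
 prime-case e = E.cong (isPrime (suc N) ∧_) (does-⇔ (mk⇔ to from) (suc N ∣? suc i) (suc N ∣? suc j))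
  where
  q∤p : ¬ (suc N ∣ p)
  q∤p d with prime⇒irreducible pp d
  ... | inj₁ r = ¬prime[1] (E.subst Prime r (isPrime⇒Prime e))
  ... | inj₂ r = N.<-irrefl r N<p
  to : suc N ∣ suc i -> suc N ∣ suc j
  to d with euclidsLemma (suc j) p (isPrime⇒Prime e) (E.subst (suc N ∣_) eq d)
  ... | inj₁ r = r
  ... | inj₂ r = ⊥-elim (q∤p r)
  from : suc N ∣ suc j -> suc N ∣ suc i
  from d = E.subst (suc N ∣_) (E.sym eq) (∣-trans d (m∣m*n p))

sieve-1 : ∀ N -> sieve N 0 ≡ true
sieve-1 zero = ok
sieve-1 (suc N) = by-cases₀ (isPrime (suc N)) (\ e -> E.trans (sieve-∤ N 0 (\ d -> ¬prime[1] (E.subst Prime (∣1⇒≡1 d) (isPrime⇒Prime e)))) (sieve-1 N))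
 (\ e -> E.trans (sieve-composite N 0 e) (sieve-1 N))

∧-trueʳ : ∀ {a b} -> a ∧ b ≡ true -> b ≡ true
∧-trueʳ {true} e = e

∧-trueˡ : ∀ {a b} -> a ∧ b ≡ true -> a ≡ true
∧-trueˡ {true} _ = ok

private
 rough-step : ∀ N i -> suc (suc N) Rough suc i -> sieve (suc (suc N)) i ≡ true -> suc (suc (suc N)) Rough suc i
 rough-step N i rough e = ∤⇒rough-suc ∤ rough
  where
  absurd : ¬ (false ≡ true)
  absurd ()
  ∤ : ¬ (suc (suc N) ∣ suc i)
  ∤ d = absurd (E.trans (E.sym (E.cong₂ (\ a b -> not (a ∧ b)) (dec-true (prime? (suc (suc N))) (rough∧∣⇒prime rough d)) (dec-true (suc (suc N) ∣? suc i) d)))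
   (∧-trueʳ {sieve (suc N) i} e))

sieve⇒rough : ∀ N i -> sieve N i ≡ true -> suc N Rough suc i
sieve⇒rough zero i e = 1-rough
sieve⇒rough (suc zero) i e = 2-rough
sieve⇒rough (suc (suc N)) i e = rough-step N i (sieve⇒rough (suc N) i (∧-trueˡ e)) e

sieve-small : ∀ N i -> suc i N.< N -> sieve N (suc i) ≡ false
sieve-small N i lt = by-cases₀ (sieve N (suc i)) (\ e -> ⊥-elim (N.<-irrefl ok (N.≤-trans (rough⇒≤ (sieve⇒rough N (suc i) e)) lt))) (\ e -> e)

private module Proof (em : ExcludedMiddle 0ℓ) (reals : CompleteOrderedField) where

 open CompleteOrderedField reals renaming (Carrier to ℝ; *-identityˡ to 1*; *-identityʳ to *1; +-identityˡ to 0+; +-identityʳ to +0; *-nonNeg to *≥0; *-congˡ to *ˡ; *-congʳ to *ʳ; +-congˡ to +ˡ; +-congʳ to +ʳ; -‿cong to -ᶜ)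
 open Analysis em reals using (_<_; _⊔_; _^_; _·_; the; _⁻¹; _/_; _^ᶻ_; ∣_∣; ⌊_⌋; IsMaximumOn; _⟶_; lim; ∑; ∏; exp; log; primesUpTo; primes≤; ϑ; γᴱ; M; Z₁) renaming (fromℕ to #)

 -- Arithmetic in the real field

 open RingSolver commutativeRing public using (by)
 open IsTotalOrder isTotalOrder public using ()
  renaming (refl to ≤-refl; trans to ≤-trans; antisym to ≤-antisym; total to ≤-total; reflexive to ≈⇒≤)
 module ≤-Reasoning = PartialOrderReasoning (TotalOrder.poset totalOrder)
 open MonoidMult +-monoid using (×-homo-+)
 open Mult semiring using (×1-homo-*)
 open SemiringExp semiring public using (^-congˡ; ^-homo-*; ^-assocʳ)
 open CommSemiringExp commutativeSemiring public using (^-distrib-*)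

 module Strict = NonStrictToStrict _≈_ _≤_

 -- Composition of inequalities and equalities; a tilde marks the side on which an
 -- equality stands.
 infixr 6 _>>_ _~>_ _>~_
 infixr 7 _&_
 _>>_ : ∀ {x y z} -> x ≤ y -> y ≤ z -> x ≤ z
 _>>_ = ≤-trans

 _~>_ : ∀ {x y z} -> x ≈ y -> y ≤ z -> x ≤ z
 _~>_ p = ≤-trans (≈⇒≤ p)

 _>~_ : ∀ {x y z} -> x ≤ y -> y ≈ z -> x ≤ z
 _>~_ h = \ p -> (≤-trans h) (≈⇒≤ p)

 _&_ : ∀ {x y z} -> x ≈ y -> y ≈ z -> x ≈ z
 _&_ = trans

 -- Linear arithmetic: x ≤ y follows from a ≤ b when y - x equals b - a.
 lin : ∀ {a b x y} -> a ≤ b -> x + b ≈ a + y -> x ≤ y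
 lin {a} {b} {x} {y} a≤b eq = begin x ≈⟨ by 2 (\ x a -> x := :- a :+ (x :+ a)) ⟩ - a + (x + a) ≤⟨ +-monoʳ-≤ (- a) (+-monoʳ-≤ x a≤b) ⟩
  - a + (x + b) ≈⟨ +ˡ eq ⟩
  - a + (a + y) ≈⟨ by 2 (\ y a -> :- a :+ (a :+ y) := y) ⟩
  y ∎
  where open ≤-Reasoning

 ≤-resp : ∀ {x x' y y'} -> x ≈ x' -> y ≈ y' -> x ≤ y -> x' ≤ y'
 ≤-resp p q h = sym p ~> h >~ q

 infixr 5 _⊞_
 _⊞_ : ∀ {a b c d} -> a ≤ b -> c ≤ d -> a + c ≤ b + d
 _⊞_ {a} {b} {c} {d} p q = +-monoʳ-≤ a q >> lin p (by 3 \ a b d -> a :+ d :+ b := a :+ (b :+ d))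

 x≤x+y : ∀ {x y} -> 0# ≤ y -> x ≤ x + y
 x≤x+y {x} {y} h = lin h (by 2 \ x y -> x :+ y := :0 :+ (x :+ y))

 x≤y+x : ∀ {x y} -> 0# ≤ y -> x ≤ y + x
 x≤y+x {x} {y} h = lin h (by 2 \ x y -> x :+ y := :0 :+ (y :+ x))

 +≥0 : ∀ {x y} -> 0# ≤ x -> 0# ≤ y -> 0# ≤ x + y
 +≥0 p q = p >> x≤x+y q

 neg-mono : ∀ {x y} -> x ≤ y -> - y ≤ - x
 neg-mono {x} {y} h = lin h (by 2 \ x y -> :- y :+ y := x :+ :- x)

 sub≥0 : ∀ {x y} -> x ≤ y -> 0# ≤ y - x
 sub≥0 h = lin h (by 2 \ x y -> :0 :+ y := x :+ (y :- x))

 *≤ˡ : ∀ {x y} z -> 0# ≤ z -> x ≤ y -> z * x ≤ z * y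
 *≤ˡ z hz h = lin (*≥0 hz (sub≥0 h)) (by 3 \ x y z -> z :* x :+ z :* (y :- x) := :0 :+ z :* y)

 *≤ʳ : ∀ {x y} z -> 0# ≤ z -> x ≤ y -> x * z ≤ y * z
 *≤ʳ z hz h = ≤-resp (*-comm _ _) (*-comm _ _) (*≤ˡ z hz h)

 *-mono : ∀ {a b c d} -> 0# ≤ a -> a ≤ b -> 0# ≤ c -> c ≤ d -> a * c ≤ b * d
 *-mono {a} {b} {c} {d} ha hab hc hcd = *≤ˡ a ha hcd >> *≤ʳ d (hc >> hcd) hab

 sq≥0 : ∀ x -> 0# ≤ x * x
 sq≥0 x with ≤-total 0# x
 ... | inj₁ h = *≥0 h h
 ... | inj₂ h = ≤-resp refl (by 1 \ x -> :- x :* :- x := x :* x) (*≥0 h′ h′)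
  where h′ = lin h (by 1 \ x -> :0 :+ :0 := x :+ :- x)

 0≤1 : 0# ≤ 1#
 0≤1 = ≤-resp refl (1* 1#) (sq≥0 1#)

 -- Strict order

 <≤ : ∀ {x y} -> x < y -> x ≤ y
 <≤ = fst

 <-≤-trans : ∀ {x y z} -> x < y -> y ≤ z -> x < z
 <-≤-trans = Strict.<-≤-trans sym ≤-trans ≤-antisym (\ p -> ≤-resp refl p)

 ≤-<-trans : ∀ {x y z} -> x ≤ y -> y < z -> x < z
 ≤-<-trans = Strict.≤-<-trans ≤-trans ≤-antisym (\ p -> ≤-resp p refl)

 <-resp : ∀ {x x' y y'} -> x ≈ x' -> y ≈ y' -> x < y -> x' < y'
 <-resp p q h = ≤-<-trans (≈⇒≤ (sym p)) (<-≤-trans h (≈⇒≤ q))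

 <⇒≱ : ∀ {x y} -> x < y -> ¬ (y ≤ x)
 <⇒≱ = Strict.<⇒≱ ≤-antisym

 ≤-or-> : ∀ x y -> x ≤ y ⊎ y < x
 ≤-or-> x y with em {x ≤ y}
 ... | yes h = inj₁ h
 ... | no h = inj₂ (Strict.≰⇒> sym ≈⇒≤ ≤-total h)

 by-contradiction : ∀ {x y} -> ¬ (y < x) -> x ≤ y
 by-contradiction {x} {y} h with ≤-or-> x y
 ... | inj₁ p = p
 ... | inj₂ p = ⊥-elim (h p)

 -- As lin, for the strict order.
 lin< : ∀ {a b x y} -> a < b -> x + b ≈ a + y -> x < y
 lin< {a} {b} {x} {y} (a≤b , a≉b) eq = lin a≤b eq , \ x≈y -> a≉b (by 2 (\ x a -> a := x :+ a :- x) & +ʳ (+ʳ x≈y & +-comm y a & sym eq) & by 2 \ x b -> x :+ b :- x := b)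

 0<1 : 0# < 1#
 0<1 = 0≤1 , 0≉1

 sub>0 : ∀ {x y} -> x < y -> 0# < y - x
 sub>0 h = lin< h (by 2 \ x y -> :0 :+ y := x :+ (y :- x))

 +>≥ : ∀ {x y} -> 0# < x -> 0# ≤ y -> 0# < x + y
 +>≥ p q = <-≤-trans p (x≤x+y q)

 +≥> : ∀ {x y} -> 0# ≤ x -> 0# < y -> 0# < x + y
 +≥> p q = <-≤-trans q (x≤y+x p)

 pos⇒≉0 : ∀ {x} -> 0# < x -> ¬ (x ≈ 0#)
 pos⇒≉0 (_ , h) p = h (sym p)

 zero-product : ∀ {x y} -> ¬ (x ≈ 0#) -> x * y ≈ 0# -> y ≈ 0#
 zero-product {x} {y} x≉0 h with inverse x x≉0
 ... | z , xz≈1 = begin y ≈⟨ sym (1* y) ⟩ 1# * y ≈⟨ *ʳ (sym xz≈1) ⟩ x * z * y ≈⟨ by 3 (\ x y z -> x :* z :* y := z :* (x :* y)) ⟩ z * (x * y) ≈⟨ *ˡ h ⟩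
  z * 0# ≈⟨ zeroʳ z ⟩
  0# ∎
  where open import Relation.Binary.Reasoning.Setoid setoid

 *>0 : ∀ {x y} -> 0# < x -> 0# < y -> 0# < x * y
 *>0 p q = *≥0 (<≤ p) (<≤ q) , \ h -> pos⇒≉0 q (zero-product (pos⇒≉0 p) (sym h))

 *-monoˡ-< : ∀ {x y} z -> 0# < z -> x < y -> z * x < z * y
 *-monoˡ-< z hz h = lin< (*>0 hz (sub>0 h)) (by 3 \ x y z -> z :* x :+ z :* (y :- x) := :0 :+ z :* y)

 *-cancelˡ-≤ : ∀ {x y} z -> 0# < z -> z * x ≤ z * y -> x ≤ y
 *-cancelˡ-≤ z hz h = by-contradiction \ y<x -> <⇒≱ (*-monoˡ-< z hz y<x) h

 *-cancelˡ : ∀ {x y} z -> ¬ (z ≈ 0#) -> z * x ≈ z * y -> x ≈ y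
 *-cancelˡ {x} {y} z hz h = begin x ≈⟨ by 2 (\ x y -> x := x :- y :+ y) ⟩ (x - y) + y ≈⟨ +ʳ (zero-product hz
  (by 3 (\ x y z -> z :* (x :- y) := z :* x :- z :* y) & +ʳ h & -‿inverseʳ _)) ⟩
  0# + y ≈⟨ 0+ y ⟩
  y ∎
  where open import Relation.Binary.Reasoning.Setoid setoid

 -- Inverses and division

 ⁻¹-inverse : ∀ {x} -> ¬ (x ≈ 0#) -> x * x ⁻¹ ≈ 1#
 ⁻¹-inverse {x} h with em {∃ \ y -> x * y ≈ 1#}
 ... | yes (_ , p) = p
 ... | no q = ⊥-elim (q (inverse x h))

 ⁻¹-zero : ∀ {x} -> x ≈ 0# -> x ⁻¹ ≈ 0#
 ⁻¹-zero {x} h with em {∃ \ y -> x * y ≈ 1#}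
 ... | yes (y , p) = ⊥-elim (0≉1 (sym (*ʳ h & zeroˡ y) & p))
 ... | no _ = refl

 ⁻¹-unique : ∀ {x y} -> x * y ≈ 1# -> x ⁻¹ ≈ y
 ⁻¹-unique {x} {y} h = *-cancelˡ x x≉0 (⁻¹-inverse x≉0 & sym h)
  where x≉0 : ¬ (x ≈ 0#)
        x≉0 p = 0≉1 (sym (*ʳ p & zeroˡ y) & h)

 ⁻¹-cong : ∀ {x y} -> x ≈ y -> x ⁻¹ ≈ y ⁻¹
 ⁻¹-cong {x} {y} h with em {x ≈ 0#}
 ... | yes p = ⁻¹-zero p & sym (⁻¹-zero (sym h & p))
 ... | no p = ⁻¹-unique (*ʳ h & (⁻¹-inverse \ q -> p (h & q)))

 /-cong : ∀ {x x' y y'} -> x ≈ x' -> y ≈ y' -> x / y ≈ x' / y'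
 /-cong p q = *-cong p (⁻¹-cong q)

 inv : ∀ {x} -> 0# < x -> x * x ⁻¹ ≈ 1#
 inv h = ⁻¹-inverse (pos⇒≉0 h)

 ⁻¹>0 : ∀ {x} -> 0# < x -> 0# < x ⁻¹
 ⁻¹>0 {x} h with ≤-or-> (x ⁻¹) 0#
 ... | inj₂ p = p
 ... | inj₁ p = ⊥-elim (<⇒≱ 0<1 (≤-resp (inv h) (zeroʳ x) (*≤ˡ x (<≤ h) p)))

 ⁻¹≥0 : ∀ {x} -> 0# < x -> 0# ≤ x ⁻¹
 ⁻¹≥0 h = <≤ (⁻¹>0 h)

 />0 : ∀ {x y} -> 0# < x -> 0# < y -> 0# < x / y
 />0 p q = *>0 p (⁻¹>0 q)

 /≥0 : ∀ {x y} -> 0# ≤ x -> 0# < y -> 0# ≤ x / y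
 /≥0 p q = *≥0 p (⁻¹≥0 q)

 /-mono : ∀ {x y z} -> 0# < z -> x ≤ y -> x / z ≤ y / z
 /-mono hz = *≤ʳ _ (⁻¹≥0 hz)

 /-cancel : ∀ {x y} -> 0# < y -> x / y * y ≈ x
 /-cancel {x} {y} h = begin x * y ⁻¹ * y ≈⟨ by 3 (\ x y z -> x :* z :* y := x :* (y :* z)) ⟩ x * (y * y ⁻¹) ≈⟨ *ˡ (inv h) ⟩ x * 1# ≈⟨ *1 x ⟩ x ∎
  where open import Relation.Binary.Reasoning.Setoid setoid

 ≤-/ : ∀ {x y z} -> 0# < y -> x * y ≤ z -> x ≤ z / y
 ≤-/ {x} {y} {z} hy h = *-cancelˡ-≤ y hy (≤-resp (*-comm x y) (sym (*-comm _ _ & /-cancel hy)) h)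

 /-≤ : ∀ {x y z} -> 0# < y -> x ≤ z * y -> x / y ≤ z
 /-≤ {x} {y} {z} hy h = *-cancelˡ-≤ y hy (≤-resp (sym (*-comm _ _ & /-cancel hy)) (*-comm z y) h)

 ≈-/ : ∀ {x y z} -> 0# < y -> x * y ≈ z -> x ≈ z / y
 ≈-/ {x} {y} {z} hy h = *-cancelˡ y (pos⇒≉0 hy) (*-comm y x & h & sym (*-comm y _ & /-cancel hy))

 ⁻¹-anti : ∀ {x y} -> 0# < x -> x ≤ y -> y ⁻¹ ≤ x ⁻¹
 ⁻¹-anti {x} {y} hx h = ≤-resp (1* _) (1* _) (≤-/ hx (≤-resp (by 2 \ x z -> x :* z := :1 :* z :* x) (inv hy) (*≤ʳ (y ⁻¹) (⁻¹≥0 hy) h)))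
  where hy = <-≤-trans hx h

 /-anti : ∀ {x y z} -> 0# ≤ z -> 0# < x -> x ≤ y -> z / y ≤ z / x
 /-anti hz hx h = *≤ˡ _ hz (⁻¹-anti hx h)

 ⁻¹-* : ∀ {x y} -> 0# < x -> 0# < y -> (x * y) ⁻¹ ≈ x ⁻¹ * y ⁻¹
 ⁻¹-* {x} {y} hx hy = ⁻¹-unique (by 4 (\ x y u v -> x :* y :* (u :* v) := x :* u :* (y :* v)) & *-cong (inv hx) (inv hy) & 1* 1#)

 1⁻¹ : 1# ⁻¹ ≈ 1#
 1⁻¹ = ⁻¹-unique (1* 1#)

 ⁻¹⁻¹ : ∀ {x} -> 0# < x -> x ⁻¹ ⁻¹ ≈ x
 ⁻¹⁻¹ h = ⁻¹-unique (*-comm _ _ & inv h)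

 -- Natural numbers

 #-+ : ∀ m n -> # (m N.+ n) ≈ # m + # n
 #-+ m n = ×-homo-+ 1# m n

 #-* : ∀ m n -> # (m N.* n) ≈ # m * # n
 #-* = ×1-homo-*

 #≥0 : ∀ n -> 0# ≤ # n
 #≥0 zero = ≤-refl
 #≥0 (suc n) = +≥0 0≤1 (#≥0 n)

 #>0 : ∀ n -> 0# < # (suc n)
 #>0 n = +>≥ 0<1 (#≥0 n)

 #-mono : ∀ {m n} -> m N.≤ n -> # m ≤ # n
 #-mono {n = n} N.z≤n = #≥0 n
 #-mono (N.s≤s h) = +-monoʳ-≤ 1# (#-mono h)

 1≤# : ∀ n -> 1# ≤ # (suc n)
 1≤# n = x≤x+y (#≥0 n)

 #-1 : # 1 ≈ 1#
 #-1 = +0 1#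

 #-cancel-≤ : ∀ {m n} -> # m ≤ # n -> m N.≤ n
 #-cancel-≤ {m} {n} h with m N.≤? n
 ... | yes p = p
 ... | no p = ⊥-elim (<⇒≱ (<-≤-trans step (#-mono (N.≰⇒> p))) h)
  where step : # n < # (suc n)
        step = lin< 0<1 (by 1 \ x -> x :+ :1 := :0 :+ (:1 :+ x))

 #-cancel-< : ∀ {m n} -> # m < # n -> m N.< n
 #-cancel-< {m} {n} h with suc m N.≤? n
 ... | yes p = p
 ... | no p = ⊥-elim (<⇒≱ h (#-mono (N.≤-pred (N.≰⇒> p))))

 archimedean : ∀ x -> ∃[ n ] x < # n
 archimedean x with em {∃[ n ] x < # n}
 ... | yes h = h
 ... | no h = ⊥-elim (<⇒≱ s-1<s (s-least (s - 1#) bound))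
  where
  P : ℝ -> Set
  P y = ∃[ n ] y ≈ # n
  sup = complete P (0# , 0 , refl) (x , \ where y (n , p) -> by-contradiction \ q -> h (n , <-resp refl p q))
  s = fst sup
  s-least = snd (snd sup)
  bound : IsUpperBound P (s - 1#)
  bound y (n , p) = lin (fst (snd sup) (# (suc n)) (suc n , refl)) (+ʳ p & by 2 \ s n -> n :+ s := :1 :+ n :+ (s :- :1))
  s-1<s : s - 1# < s
  s-1<s = lin< 0<1 (by 1 \ s -> s :- :1 :+ :1 := :0 :+ s)

 ⁻¹-swap-< : ∀ {x y} -> 0# < x -> x ⁻¹ < y -> y ⁻¹ < x
 ⁻¹-swap-< {x} {y} hx p = <-resp (by 3 (\ x u v -> x :* v :* u := v :* (x :* u)) & *ˡ (inv hx) & *1 _)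
  (by 3 (\ x y v -> x :* v :* y := x :* (y :* v)) & *ˡ (inv hy) & *1 _)
  (*-monoˡ-< (x * y ⁻¹) (*>0 hx (⁻¹>0 hy)) p)
  where hy = ≤-<-trans (⁻¹≥0 hx) p

 -- A positive number exceeds the inverse of some positive integer.
 archimedean⁻¹ : ∀ {x} -> 0# < x -> ∃[ n ] (# (suc n) ⁻¹ < x)
 archimedean⁻¹ {x} h with archimedean (x ⁻¹)
 ... | n , p = n , ⁻¹-swap-< h (<-≤-trans p (#-mono (N.n≤1+n n)))

 -- Halves
 ½ : ℝ
 ½ = # 2 ⁻¹

 0<½ : 0# < ½
 0<½ = ⁻¹>0 (#>0 1)

 2½ : # 2 * ½ ≈ 1#
 2½ = inv (#>0 1)

 half+half : ∀ x -> x * ½ + x * ½ ≈ x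
 half+half x = by 2 (\ x h -> x :* h :+ x :* h := x :* (con 2 :* h)) & *ˡ 2½ & *1 x

 ½+½≈1 : ½ + ½ ≈ 1#
 ½+½≈1 = by 1 (\ h -> h :+ h := con 2 :* h) & 2½

 ½≤1 : ½ ≤ 1#
 ½≤1 = lin (<≤ 0<½) (½+½≈1 & sym (0+ 1#))

 half>0 : ∀ {x} -> 0# < x -> 0# < x * ½
 half>0 h = *>0 h 0<½

 -- If x ≤ y + e for all positive e, then x ≤ y.
 ≤-limit : ∀ {x y} -> (∀ e -> 0# < e -> x ≤ y + e) -> x ≤ y
 ≤-limit {x} {y} h = by-contradiction \ y<x ->
  let 0<e = half>0 (sub>0 y<x)
  in <⇒≱ 0<e (lin (h ((x - y) * ½) 0<e)
   (by 2 (\ y e -> e :+ (y :+ e) := y :+ (e :+ e)) & +ˡ (half+half (x - y)) & by 2 \ x y -> y :+ (x :- y) := x :+ :0))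

 -- Powers

 ^≥0 : ∀ {x} n -> 0# ≤ x -> 0# ≤ x ^ n
 ^≥0 zero h = 0≤1
 ^≥0 (suc n) h = *≥0 h (^≥0 n h)

 ^>0 : ∀ {x} n -> 0# < x -> 0# < x ^ n
 ^>0 zero h = 0<1
 ^>0 (suc n) h = *>0 h (^>0 n h)

 ^-mono : ∀ {x y} n -> 0# ≤ x -> x ≤ y -> x ^ n ≤ y ^ n
 ^-mono zero h p = ≤-refl
 ^-mono (suc n) h p = *-mono h p (^≥0 n h) (^-mono n h p)

 1≤^ : ∀ {x} n -> 1# ≤ x -> 1# ≤ x ^ n
 1≤^ zero h = ≤-refl
 1≤^ (suc n) h = ≤-resp (1* 1#) refl (*-mono 0≤1 h 0≤1 (1≤^ n h))

 ^≤1 : ∀ {x} n -> 0# ≤ x -> x ≤ 1# -> x ^ n ≤ 1#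
 ^≤1 zero h p = ≤-refl
 ^≤1 (suc n) h p = ≤-resp refl (1* 1#) (*-mono h p (^≥0 n h) (^≤1 n h p))

 1^ : ∀ n -> 1# ^ n ≈ 1#
 1^ zero = refl
 1^ (suc n) = 1* _ & 1^ n

 ^-exp-mono : ∀ {x m n} -> 1# ≤ x -> m N.≤ n -> x ^ m ≤ x ^ n
 ^-exp-mono {x} {n = n} h N.z≤n = 1≤^ n h
 ^-exp-mono {x} h (N.s≤s p) = *≤ˡ x (0≤1 >> h) (^-exp-mono h p)

 bernoulli : ∀ {x} n -> - 1# ≤ x -> 1# + # n * x ≤ (1# + x) ^ n
 bernoulli {x} zero h = ≈⇒≤ (+ˡ (zeroˡ x) & +0 1#)
 bernoulli {x} (suc n) h = lin (*≥0 (#≥0 n) (sq≥0 x)) (by 2 \ x n -> :1 :+ (:1 :+ n) :* x :+ n :* (x :* x) := :0 :+ (:1 :+ x) :* (:1 :+ n :* x)) >> *≤ˡ (1# + x) (lin h (by 1 \ x -> :0 :+ x := :- :1 :+ (:1 :+ x))) (bernoulli n h)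

 ⁻¹-^ : ∀ {x} n -> 0# < x -> x ⁻¹ ^ n ≈ (x ^ n) ⁻¹
 ⁻¹-^ {x} zero h = sym 1⁻¹
 ⁻¹-^ {x} (suc n) h = *ˡ (⁻¹-^ n h) & sym (⁻¹-* h (^>0 n h))

 -- Absolute value

 abs≥0 : ∀ {x} -> 0# ≤ x -> ∣ x ∣ ≈ x
 abs≥0 h = Max.x≤y⇒y⊔x≈y totalOrder (lin h (by 1 \ x -> :- x :+ x := :0 :+ :0) >> h)

 abs-nonPos : ∀ {x} -> x ≤ 0# -> ∣ x ∣ ≈ - x
 abs-nonPos h = Max.x≤y⇒x⊔y≈y totalOrder (h >> lin h (by 1 \ x -> :0 :+ :0 := x :+ :- x))

 abs-cases : ∀ x -> (0# ≤ x × ∣ x ∣ ≈ x) ⊎ (x ≤ 0# × ∣ x ∣ ≈ - x)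
 abs-cases x with ≤-total 0# x
 ... | inj₁ h = inj₁ (h , abs≥0 h)
 ... | inj₂ h = inj₂ (h , abs-nonPos h)

 abs-cong : ∀ {x y} -> x ≈ y -> ∣ x ∣ ≈ ∣ y ∣
 abs-cong {x} {y} eq with abs-cases x
 ... | inj₁ (h , p) = p & eq & sym (abs≥0 (≤-resp refl eq h))
 ... | inj₂ (h , p) = p & -ᶜ eq & sym (abs-nonPos (≤-resp eq refl h))

 ≤abs : ∀ x -> x ≤ ∣ x ∣
 ≤abs x with abs-cases x
 ... | inj₁ (h , p) = ≈⇒≤ (sym p)
 ... | inj₂ (h , p) = ≤-resp refl (sym p) (h >> lin h (by 1 \ x -> :0 :+ :0 := x :+ :- x))

 -≤abs : ∀ x -> - x ≤ ∣ x ∣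
 -≤abs x with abs-cases x
 ... | inj₁ (h , p) = ≤-resp refl (sym p) (lin h (by 1 \ x -> :- x :+ x := :0 :+ :0) >> h)
 ... | inj₂ (h , p) = ≈⇒≤ (sym p)

 abs-≤ : ∀ {x c} -> x ≤ c -> - x ≤ c -> ∣ x ∣ ≤ c
 abs-≤ {x} p q with abs-cases x
 ... | inj₁ (_ , e) = ≤-resp (sym e) refl p
 ... | inj₂ (_ , e) = ≤-resp (sym e) refl q

 0≤abs : ∀ x -> 0# ≤ ∣ x ∣
 0≤abs x with abs-cases x
 ... | inj₁ (h , p) = ≤-resp refl (sym p) h
 ... | inj₂ (h , p) = ≤-resp refl (sym p) (lin h (by 1 \ x -> :0 :+ :0 := x :+ :- x))

 abs-neg : ∀ x -> ∣ - x ∣ ≈ ∣ x ∣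
 abs-neg x = ≤-antisym (abs-≤ (-≤abs x) (≤-resp (by 1 \ x -> x := :- (:- x)) refl (≤abs x)))
  (abs-≤ (≤-resp (by 1 \ x -> :- (:- x) := x) refl (-≤abs (- x))) (≤abs (- x)))

 abs-+ : ∀ x y -> ∣ x + y ∣ ≤ ∣ x ∣ + ∣ y ∣
 abs-+ x y = abs-≤ (≤abs x ⊞ ≤abs y) (≤-resp (by 2 \ x y -> :- x :+ :- y := :- (x :+ y)) refl (-≤abs x ⊞ -≤abs y))

 abs-* : ∀ x y -> ∣ x * y ∣ ≈ ∣ x ∣ * ∣ y ∣
 abs-* x y with abs-cases x | abs-cases y
 ... | inj₁ (h , p) | inj₁ (k , q) = abs≥0 (*≥0 h k) & sym (*-cong p q)
 ... | inj₁ (h , p) | inj₂ (k , q) = abs-nonPos (lin (*≥0 h (sub≥0 k)) (by 2 \ x y -> x :* y :+ x :* (:0 :- y) := :0 :+ :0)) & by 2 (\ x y -> :- (x :* y) := x :* :- y) & sym (*-cong p q)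
 ... | inj₂ (h , p) | inj₁ (k , q) = abs-nonPos (lin (*≥0 (sub≥0 h) k) (by 2 \ x y -> x :* y :+ (:0 :- x) :* y := :0 :+ :0)) & by 2 (\ x y -> :- (x :* y) := :- x :* y) & sym (*-cong p q)
 ... | inj₂ (h , p) | inj₂ (k , q) = abs≥0 (lin (*≥0 (sub≥0 h) (sub≥0 k)) (by 2 \ x y -> :0 :+ (:0 :- x) :* (:0 :- y) := :0 :+ x :* y)) & by 2 (\ x y -> x :* y := :- x :* :- y) & sym (*-cong p q)

 abs-sub : ∀ x y -> ∣ x - y ∣ ≈ ∣ y - x ∣
 abs-sub x y = abs-cong (by 2 \ x y -> x :- y := :- (y :- x)) & abs-neg _

 abs-sq : ∀ x -> ∣ x ∣ * ∣ x ∣ ≈ x * x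
 abs-sq x = sym (abs-* x x) & abs≥0 (sq≥0 x)

 -- Normed algebras and limits

 -- A complete normed commutative algebra over the reals; ι embeds the scalars.
 record NormedAlgebra : Set₁ where
  field
   ringᴮ : CommutativeRing 0ℓ 0ℓ

  module O = CommutativeRing ringᴮ
  open O public using () renaming
   ( Carrier to B; _≈_ to _≋_; _+_ to _⊕_; _*_ to _⊗_; -_ to ⊖_; _-_ to _⊝_; 0# to 𝟘; 1# to 𝟙)

  field
   ‖_‖ : B -> ℝ
   norm-cong : ∀ {x y} -> x ≋ y -> ‖ x ‖ ≈ ‖ y ‖
   norm-0 : ‖ 𝟘 ‖ ≈ 0#
   norm-neg : ∀ x -> ‖ ⊖ x ‖ ≈ ‖ x ‖
   norm-+ : ∀ x y -> ‖ x ⊕ y ‖ ≤ ‖ x ‖ + ‖ y ‖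
   norm-* : ∀ x y -> ‖ x ⊗ y ‖ ≤ ‖ x ‖ * ‖ y ‖
   norm≥0 : ∀ x -> 0# ≤ ‖ x ‖
   definite : ∀ x -> ‖ x ‖ ≤ 0# -> x ≋ 𝟘
   ι : ℝ -> B
   ι-cong : ∀ {a b} -> a ≈ b -> ι a ≋ ι b
   ι-+ : ∀ a b -> ι (a + b) ≋ ι a ⊕ ι b
   ι-* : ∀ a b -> ι (a * b) ≋ ι a ⊗ ι b
   ι-1 : ι 1# ≋ 𝟙
   norm-ι : ∀ a -> ‖ ι a ‖ ≤ ∣ a ∣

  infix 4 _⟶ᴮ_
  _⟶ᴮ_ : (ℕ -> B) -> B -> Set
  a ⟶ᴮ l = ∀ e -> 0# < e -> ∃[ N ] (∀ n -> N N.≤ n -> ‖ a n ⊝ l ‖ ≤ e)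

  -- The differences from the term with index N suffice, by the triangle inequality.
  Cauchy : (ℕ -> B) -> Set
  Cauchy a = ∀ e -> 0# < e -> ∃[ N ] (∀ n -> N N.≤ n -> ‖ a n ⊝ a N ‖ ≤ e)

  field
   cauchy-complete : ∀ a -> Cauchy a -> ∃ (a ⟶ᴮ_)

 module Normed (N : NormedAlgebra) where
  open NormedAlgebra N public
  open Sums ringᴮ public using () renaming
   (Σ to Σᴮ; Σ-cong to Σᴮ-cong; Σ-cong′ to Σᴮ-cong′; Σ-+ to Σᴮ-+; Σ-neg to Σᴮ-neg; Σ-sub to Σᴮ-sub; Σ-* to Σᴮ-*; Σ-zero to Σᴮ-zero;
    Σ-split to Σᴮ-split; Σ-front to Σᴮ-front; Σ-telescope to Σᴮ-telescope; Σ-swap to Σᴮ-swap)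
  open RingSolver ringᴮ public using () renaming (by to byᴮ)
  open Sums commutativeRing
  module ≋-Reasoning = SetoidReasoning O.setoid

  infixr 7 _⊙_
  _⊙_ : ∀ {x y z} -> x ≋ y -> y ≋ z -> x ≋ z
  _⊙_ = O.trans

  ι-neg : ∀ a -> ι (- a) ≋ ⊖ ι a
  ι-neg a = begin ι (- a) ≈⟨ byᴮ 2 (\ x y -> x := x :+ y :- y) ⟩ (ι (- a) ⊕ ι a) ⊝ ι a ≈⟨ O.+-congʳ (O.sym (ι-+ _ _) ⊙ ι-cong (-‿inverseˡ a)) ⟩
   ι 0# ⊝ ι a ≈⟨ O.+-congʳ ι-0 ⟩
   𝟘 ⊝ ι a ≈⟨ byᴮ 1 (\ x -> :0 :- x := :- x) ⟩
   ⊖ ι a ∎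
   where
   open ≋-Reasoning
   ι-0 : ι 0# ≋ 𝟘
   ι-0 = definite _ (norm-ι 0# >~ abs≥0 ≤-refl)

  ι-0 : ι 0# ≋ 𝟘
  ι-0 = definite _ (norm-ι 0# >~ abs≥0 ≤-refl)

  ι-sub : ∀ a b -> ι (a - b) ≋ ι a ⊝ ι b
  ι-sub a b = ι-+ a (- b) ⊙ O.+-congˡ (ι-neg b)

  ι-Σ : ∀ n f -> ι (Σ n f) ≋ Σᴮ n (\ i -> ι (f i))
  ι-Σ zero f = ι-0
  ι-Σ (suc n) f = ι-+ _ _ ⊙ O.+-congʳ (ι-Σ n f)

  norm-1 : ‖ 𝟙 ‖ ≤ 1#
  norm-1 = norm-cong (O.sym ι-1) ~> norm-ι 1# >~ abs≥0 0≤1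

  norm-ι⊗ : ∀ a x -> ‖ ι a ⊗ x ‖ ≤ ∣ a ∣ * ‖ x ‖
  norm-ι⊗ a x = norm-* _ _ >> *≤ʳ _ (norm≥0 x) (norm-ι a)

  norm-ι⊗₊ : ∀ {a} x -> 0# ≤ a -> ‖ ι a ⊗ x ‖ ≤ a * ‖ x ‖
  norm-ι⊗₊ {a} x h = norm-ι⊗ a x >~ *ʳ (abs≥0 h)

  norm-sub : ∀ x y -> ‖ x ⊝ y ‖ ≤ ‖ x ‖ + ‖ y ‖
  norm-sub x y = norm-+ _ _ >~ +ˡ (norm-neg y)

  norm-sub-sym : ∀ x y -> ‖ x ⊝ y ‖ ≈ ‖ y ⊝ x ‖
  norm-sub-sym x y = norm-cong (byᴮ 2 \ x y -> x :- y := :- (y :- x)) & norm-neg _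

  -- ‖x‖ ≤ ‖y‖ + ‖x - y‖
  norm-≤-+ : ∀ x y -> ‖ x ‖ ≤ ‖ y ‖ + ‖ x ⊝ y ‖
  norm-≤-+ x y = norm-cong (byᴮ 2 \ x y -> x := y :+ (x :- y)) ~> norm-+ _ _

  norm-*-≤ : ∀ {x y a b} -> ‖ x ‖ ≤ a -> ‖ y ‖ ≤ b -> ‖ x ⊗ y ‖ ≤ a * b
  norm-*-≤ {x} {y} p q = norm-* x y >> *-mono (norm≥0 x) p (norm≥0 y) q

  norm-+-≤ : ∀ {x y a b} -> ‖ x ‖ ≤ a -> ‖ y ‖ ≤ b -> ‖ x ⊕ y ‖ ≤ a + b
  norm-+-≤ {x} {y} p q = norm-+ x y >> (p ⊞ q)

  norm-Σ : ∀ n f -> ‖ Σᴮ n f ‖ ≤ Σ n (\ i -> ‖ f i ‖)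
  norm-Σ zero f = ≈⇒≤ norm-0
  norm-Σ (suc n) f = norm-+ _ _ >> (norm-Σ n f ⊞ ≤-refl)

  -- Limits

  ⟶-cong : ∀ {a b l l'} -> (∀ n -> a n ≋ b n) -> l ≋ l' -> a ⟶ᴮ l -> b ⟶ᴮ l'
  ⟶-cong p q h e he = let (N , k) = h e he in N , \ n le -> ≤-resp (norm-cong (O.+-cong (p n) (O.-‿cong q))) refl (k n le)

  ⟶-const : ∀ {a l} -> (∀ n -> a n ≋ l) -> a ⟶ᴮ l
  ⟶-const p e he = 0 , \ n _ -> norm-cong (O.+-congʳ (p n) ⊙ O.-‿inverseʳ _) & norm-0 ~> <≤ he

  ⟶-+ : ∀ {a b l m} -> a ⟶ᴮ l -> b ⟶ᴮ m -> (\ n -> a n ⊕ b n) ⟶ᴮ l ⊕ m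
  ⟶-+ {a} {b} {l} {m} h k e he = let (N , p) = h _ (half>0 he) ; (M , q) = k _ (half>0 he) in N N.⊔ M , \ n le ->
   norm-cong (byᴮ 4 \ a b l m -> a :+ b :- (l :+ m) := a :- l :+ (b :- m)) ~> ≤-resp refl (half+half e) (norm-+-≤ (p n (N.m⊔n≤o⇒m≤o N M le)) (q n (N.m⊔n≤o⇒n≤o N M le)))

  ⟶-neg : ∀ {a l} -> a ⟶ᴮ l -> (\ n -> ⊖ a n) ⟶ᴮ ⊖ l
  ⟶-neg h e he = let (N , p) = h e he in N , \ n le -> ≈⇒≤
   (norm-cong (byᴮ 2 \ a l -> :- a :- :- l := :- (a :- l)) & norm-neg _) >> p n le

  ⟶-sub : ∀ {a b l m} -> a ⟶ᴮ l -> b ⟶ᴮ m -> (\ n -> a n ⊝ b n) ⟶ᴮ l ⊝ m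
  ⟶-sub h k = ⟶-+ h (⟶-neg k)

  ⟶-scale : ∀ {a l} c -> a ⟶ᴮ l -> (\ n -> c ⊗ a n) ⟶ᴮ c ⊗ l
  ⟶-scale {a} {l} c h e he = let (N , p) = h (e * (1# + ‖ c ‖) ⁻¹) (*>0 he (⁻¹>0 hc)) in N , \ n le -> begin
   ‖ c ⊗ a n ⊝ c ⊗ l ‖ ≈⟨ norm-cong (byᴮ 3 \ c a l -> c :* a :- c :* l := c :* (a :- l)) ⟩
   ‖ c ⊗ (a n ⊝ l) ‖ ≤⟨ norm-*-≤ ≤-refl (p n le) ⟩
   ‖ c ‖ * (e * (1# + ‖ c ‖) ⁻¹) ≤⟨ *≤ʳ _ (*≥0 (<≤ he) (⁻¹≥0 hc)) (x≤y+x 0≤1) ⟩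
   (1# + ‖ c ‖) * (e * (1# + ‖ c ‖) ⁻¹) ≈⟨ by 3 (\ x y z -> x :* (y :* z) := x :* z :* y) ⟩
   ((1# + ‖ c ‖) * (1# + ‖ c ‖) ⁻¹) * e ≈⟨ *ʳ (inv hc) & 1* e ⟩
   e ∎
   where open ≤-Reasoning
         hc = +>≥ 0<1 (norm≥0 c)

  -- ‖l‖ ≤ c when eventually ‖a n‖ ≤ c.
  ⟶-bound : ∀ {a l c} N -> a ⟶ᴮ l -> (∀ n -> N N.≤ n -> ‖ a n ‖ ≤ c) -> ‖ l ‖ ≤ c
  ⟶-bound {a} {l} {c} N h k = ≤-limit \ e he ->
   let (M , p) = h e he ; n = N N.⊔ M in
   norm-≤-+ l (a n) >> (k n (N.m≤m⊔n N M) ⊞ ≤-resp (norm-sub-sym _ _) refl (p n (N.m≤n⊔m N M)))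

  ⟶-unique : ∀ {a l m} -> a ⟶ᴮ l -> a ⟶ᴮ m -> l ≋ m
  ⟶-unique {a} {l} {m} h k = byᴮ 2 (\ l m -> l := l :- m :+ m) ⊙ O.+-congʳ (definite _ (⟶-bound 0 (⟶-sub h k)
   (\ n _ -> ≈⇒≤ (norm-cong (O.-‿inverseʳ (a n)) & norm-0)))) ⊙ O.+-identityˡ m

  ⟶-diff : ∀ {a b l} -> a ⟶ᴮ l -> (\ n -> b n ⊝ a n) ⟶ᴮ 𝟘 -> b ⟶ᴮ l
  ⟶-diff {a} {b} {l} h k = ⟶-cong (\ n -> byᴮ 2 \ a b -> a :+ (b :- a) := b) (O.+-identityʳ l) (⟶-+ h k)

  -- Convergent sequences are eventually bounded.
  ⟶-bounded : ∀ {a l} -> a ⟶ᴮ l -> ∃[ N ] (∀ n -> N N.≤ n -> ‖ a n ‖ ≤ ‖ l ‖ + 1#)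
  ⟶-bounded {a} {l} h = let (N , p) = h 1# 0<1 in N , \ n le -> norm-≤-+ (a n) l >> +-monoʳ-≤ _ (p n le)

  ⟶-* : ∀ {a b l m} -> a ⟶ᴮ l -> b ⟶ᴮ m -> (\ n -> a n ⊗ b n) ⟶ᴮ l ⊗ m
  ⟶-* {a} {b} {l} {m} h k e he =
   let (N₁ , kb) = ⟶-bounded k
       (N₂ , p) = h (e * ½ * c ⁻¹) (*>0 (half>0 he) (⁻¹>0 hc))
       (N₃ , q) = ⟶-scale l k _ (half>0 he) in N₁ N.⊔ (N₂ N.⊔ N₃) , \ n le ->
   let n₁ = N.m⊔n≤o⇒m≤o N₁ _ le ; r = N.m⊔n≤o⇒n≤o N₁ _ le
       n₂ = N.m⊔n≤o⇒m≤o N₂ N₃ r ; n₃ = N.m⊔n≤o⇒n≤o N₂ N₃ r in begin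
   ‖ a n ⊗ b n ⊝ l ⊗ m ‖ ≈⟨ norm-cong (byᴮ 4 \ a b l m -> a :* b :- l :* m := (a :- l) :* b :+ (l :* b :- l :* m)) ⟩
   ‖ (a n ⊝ l) ⊗ b n ⊕ (l ⊗ b n ⊝ l ⊗ m) ‖ ≤⟨ norm-+-≤ (norm-*-≤ (p n n₂) (kb n n₁ >> x≤y+x 0≤1)) (q n n₃) ⟩
   e * ½ * c ⁻¹ * c + e * ½ ≈⟨ +ʳ (/-cancel hc) ⟩
   e * ½ + e * ½ ≈⟨ half+half e ⟩
   e ∎
   where open ≤-Reasoning
         c = 1# + (‖ m ‖ + 1#)
         hc = +>≥ 0<1 (+≥0 (norm≥0 m) 0≤1)

  ⟶-subseq : ∀ {a l} (s : ℕ -> ℕ) -> (∀ n -> n N.≤ s n) -> a ⟶ᴮ l -> (\ n -> a (s n)) ⟶ᴮ l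
  ⟶-subseq s inc h e he = let (N , p) = h e he in N , \ n le -> p (s n) (N.≤-trans le (inc n))

  ⟶-Σ : ∀ k {a : ℕ -> ℕ -> B} {l} -> (∀ i -> a i ⟶ᴮ l i) -> (\ n -> Σᴮ k (\ i -> a i n)) ⟶ᴮ Σᴮ k l
  ⟶-Σ zero h = ⟶-const (\ _ -> O.refl)
  ⟶-Σ (suc k) h = ⟶-+ (⟶-Σ k h) (h k)

 -- The reals as a normed algebra over themselves

 cauchy-converges : (a : ℕ -> ℝ) -> (∀ e -> 0# < e -> ∃[ N ] (∀ n -> N N.≤ n -> ∣ a n - a N ∣ ≤ e)) -> ∃[ l ] (∀ e -> 0# < e -> ∃[ N ] (∀ n -> N N.≤ n -> ∣ a n - l ∣ ≤ e))
 cauchy-converges a cauchy = s , \ e he -> let (N , h) = cauchy (e * ½) (half>0 he) in N , \ n le -> limit e N h n le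
  where
  P : ℝ -> Set
  P x = ∃[ N ] (∀ n -> N N.≤ n -> x ≤ a n)

  below : ∀ e N -> (∀ n -> N N.≤ n -> ∣ a n - a N ∣ ≤ e) -> ∀ n -> N N.≤ n -> a N - e ≤ a n
  below e N h n le = lin (-≤abs _ >> h n le) (by 3 \ x y e -> y :- e :+ e := :- (x :- y) :+ x)
  above : ∀ e N -> (∀ n -> N N.≤ n -> ∣ a n - a N ∣ ≤ e) -> ∀ n -> N N.≤ n -> a n ≤ a N + e
  above e N h n le = lin (≤abs _ >> h n le) (by 3 \ x y e -> x :+ e := x :- y :+ (y :+ e))

  ub : ∀ e N -> (∀ n -> N N.≤ n -> ∣ a n - a N ∣ ≤ e) -> IsUpperBound P (a N + e)
  ub e N h x (M , k) = k (M N.⊔ N) (N.m≤m⊔n M N) >> above e N h _ (N.m≤n⊔m M N)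

  N₁ = fst (cauchy 1# 0<1)
  h₁ = snd (cauchy 1# 0<1)
  sup = complete P (a N₁ - 1# , N₁ , below 1# N₁ h₁) (a N₁ + 1# , ub 1# N₁ h₁)
  s = fst sup

  limit : ∀ e N -> (∀ n -> N N.≤ n -> ∣ a n - a N ∣ ≤ e * ½) -> ∀ n -> N N.≤ n -> ∣ a n - s ∣ ≤ e
  limit e N h n le = abs-≤ (≤-resp refl (half+half e) (lin (above _ N h n le ⊞ fst (snd sup) _ (N , below _ N h))
   (by 4 \ x y s e -> x :- s :+ (y :+ e :+ s) := x :+ (y :- e) :+ (e :+ e))))
   (≤-resp refl (half+half e) (lin (below _ N h n le ⊞ snd (snd sup) _ (ub _ N h))
    (by 4 \ x y s e -> :- (x :- s) :+ (x :+ (y :+ e)) := y :- e :+ s :+ (e :+ e))))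

 realAlgebra : NormedAlgebra
 realAlgebra = record
  { ringᴮ = commutativeRing
  ; ‖_‖ = ∣_∣
  ; norm-cong = abs-cong
  ; norm-0 = abs≥0 ≤-refl
  ; norm-neg = abs-neg
  ; norm-+ = abs-+
  ; norm-* = \ x y -> ≈⇒≤ (abs-* x y)
  ; norm≥0 = 0≤abs
  ; definite = \ x h -> ≤-antisym (≤abs x >> h) (lin (-≤abs x >> h) (by 1 \ x -> :0 :+ :0 := :- x :+ x))
  ; ι = \ x -> x
  ; ι-cong = \ p -> p
  ; ι-+ = \ _ _ -> refl
  ; ι-* = \ _ _ -> refl
  ; ι-1 = refl
  ; norm-ι = \ _ -> ≤-refl
  ; cauchy-complete = cauchy-converges
  }

 -- Series and the exponential function of a normed algebra

 open Sums commutativeRing public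

 -- Real sums

 Σ-mono : ∀ n {f g} -> (∀ i -> i N.< n -> f i ≤ g i) -> Σ n f ≤ Σ n g
 Σ-mono zero h = ≤-refl
 Σ-mono (suc n) h = Σ-mono n (\ i p -> h i (N.m<n⇒m<1+n p)) ⊞ h n N.≤-refl

 const-sum : ∀ n y -> Σ n (\ _ -> y) ≈ # n * y
 const-sum zero y = sym (zeroˡ y)
 const-sum (suc n) y = +ʳ (const-sum n y) & by 2 (\ n y -> n :* y :+ y := (:1 :+ n) :* y)

 Σ-mono′ : ∀ n {f g} -> (∀ i -> f i ≤ g i) -> Σ n f ≤ Σ n g
 Σ-mono′ n h = Σ-mono n (\ i _ -> h i)

 Σ≥0 : ∀ n {f} -> (∀ i -> 0# ≤ f i) -> 0# ≤ Σ n f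
 Σ≥0 zero h = ≤-refl
 Σ≥0 (suc n) h = +≥0 (Σ≥0 n h) (h n)

 Σ-length-mono : ∀ {m n f} -> (∀ i -> 0# ≤ f i) -> m N.≤ n -> Σ m f ≤ Σ n f
 Σ-length-mono {m} {n} {f} h m≤n = x≤x+y (Σ≥0 (n N.∸ m) (\ i -> h (m N.+ i))) >~ sym (Σ-split m (n N.∸ m) f) & reflexive (E.cong (\ k -> Σ k f) (N.m+[n∸m]≡n m≤n))

 -- A bounded nondecreasing sequence comes arbitrarily close to all its later terms.
 monotone-cauchy : ∀ (a : ℕ -> ℝ) c -> (∀ {m n} -> m N.≤ n -> a m ≤ a n) -> (∀ n -> a n ≤ c) -> ∀ e -> 0# < e -> ∃[ N ] (∀ n -> N N.≤ n -> a n - a N ≤ e)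
 monotone-cauchy a c mono bound e he with em {∃[ N ] (∀ n -> a n ≤ a N + e)}
 ... | yes (N , h) = N , \ n _ -> lin (h n) (by 3 \ x y e -> x :- y :+ (y :+ e) := x :+ e)
 ... | no h = ⊥-elim (<⇒≱ he (lin (snd (snd sup) (fst sup - e) ub) (by 2 \ s e -> e :+ (s :- e) := s :+ :0)))
  where
  P : ℝ -> Set
  P x = ∃[ n ] x ≈ a n
  sup = complete P (a 0 , 0 , refl) (c , \ where x (n , eq) -> ≤-resp (sym eq) refl (bound n))
  ub : IsUpperBound P (fst sup - e)
  ub x (N , eq) = by-contradiction \ lt -> h (N , \ n -> fst (snd sup) (a n) (n , refl) >> lin (<≤ lt) (+ˡ eq & by 3 \ s e y -> s :+ y := s :- e :+ (y :+ e)))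

 module NormedSeries (N : NormedAlgebra) where
  open Normed N

  norm-Σ-≤ : ∀ n {f g} -> (∀ i -> i N.< n -> ‖ f i ‖ ≤ g i) -> ‖ Σᴮ n f ‖ ≤ Σ n g
  norm-Σ-≤ n h = norm-Σ n _ >> Σ-mono n h

  Σᴮ-diff : ∀ {m n} f -> m N.≤ n -> Σᴮ n f ⊝ Σᴮ m f ≋ Σᴮ (n N.∸ m) (\ i -> f (m N.+ i))
  Σᴮ-diff {m} {n} f m≤n = O.+-congʳ (O.reflexive (E.cong (\ k -> Σᴮ k f) (E.sym (N.m+[n∸m]≡n m≤n))) ⊙ Σᴮ-split m _ f) ⊙ byᴮ 2 (\ a b -> a :+ b :- a := b)

  norm-Σ-diff : ∀ {m n f g} -> (∀ i -> ‖ f i ‖ ≤ g i) -> m N.≤ n -> ‖ Σᴮ n f ⊝ Σᴮ m f ‖ ≤ Σ n g - Σ m g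
  norm-Σ-diff {m} {n} {f} {g} h m≤n = begin ‖ Σᴮ n f ⊝ Σᴮ m f ‖ ≈⟨ norm-cong (Σᴮ-diff f m≤n) ⟩
   ‖ Σᴮ (n N.∸ m) (\ i -> f (m N.+ i)) ‖ ≤⟨ norm-Σ-≤ (n N.∸ m) (\ i _ -> h (m N.+ i)) ⟩
   Σ (n N.∸ m) (\ i -> g (m N.+ i)) ≈⟨ sym R.Σᴮ-diff′ ⟩
   Σ n g - Σ m g ∎
   where
   open ≤-Reasoning
   module R where
    Σᴮ-diff′ : Σ n g - Σ m g ≈ Σ (n N.∸ m) (\ i -> g (m N.+ i))
    Σᴮ-diff′ = +ʳ (reflexive (E.cong (\ k -> Σ k g) (E.sym (N.m+[n∸m]≡n m≤n))) & Σ-split m _ g) & by 2 (\ a b -> a :+ b :- a := b)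

  majorised : ∀ (f : ℕ -> B) (g : ℕ -> ℝ) (c : ℝ) -> (∀ i -> ‖ f i ‖ ≤ g i) -> (∀ n -> Σ n g ≤ c) -> ∃ (\ l -> (\ n -> Σᴮ n f) ⟶ᴮ l)
  majorised f g c h k = cauchy-complete _ \ e he ->
   let (M , p) = monotone-cauchy (\ n -> Σ n g) c (\ q -> Σ-length-mono (\ i -> norm≥0 _ >> h i) q) k e he in
   M , \ n le -> norm-Σ-diff h le >> p n le

  -- The distance of a sum of a series from a partial sum is at most any bound for the sums of later majorants.
  tail-bound : ∀ {f : ℕ -> B} {g : ℕ -> ℝ} {l c} m -> (\ n -> Σᴮ n f) ⟶ᴮ l -> (∀ i -> ‖ f (m N.+ i) ‖ ≤ g i) -> (∀ n -> Σ n g ≤ c) -> ‖ l ⊝ Σᴮ m f ‖ ≤ c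
  tail-bound {f} {g} {l} {c} m h k q = ⟶-bound m (⟶-sub h (⟶-const (\ _ -> O.refl))) \ n le -> norm-cong (Σᴮ-diff f le) ~> norm-Σ-≤ (n N.∸ m) (\ i _ -> k i) >> q (n N.∸ m)

 -- A nonnegative sequence that is at least halved at each step has sum at most twice its first term.
 geometric-sum : ∀ (t : ℕ -> ℝ) -> (∀ i -> 0# ≤ t i) -> (∀ i -> # 2 * t (suc i) ≤ t i) -> ∀ n -> Σ n t ≤ # 2 * t 0
 geometric-sum t nn h n = x≤x+y (*≥0 (#≥0 2) (nn n)) >> go n
  where
  go : ∀ n -> Σ n t + # 2 * t n ≤ # 2 * t 0
  go zero = ≈⇒≤ (0+ _)
  go (suc n) = lin (h n) (by 3 \ s a b -> s :+ a :+ con 2 :* b :+ a := con 2 :* b :+ (s :+ con 2 :* a)) >> go n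

 module Terms (N : NormedAlgebra) where
  open Normed N
  open NormedSeries N

  -- The terms of the exponential series.
  term : ℕ -> B -> B
  term zero x = 𝟙
  term (suc k) x = ι (# (suc k) ⁻¹) ⊗ (x ⊗ term k x)

  term-cong : ∀ k {x y} -> x ≋ y -> term k x ≋ term k y
  term-cong zero p = O.refl
  term-cong (suc k) p = O.*-congˡ (O.*-cong p (term-cong k p))

  suc-term : ∀ k x -> ι (# (suc k)) ⊗ term (suc k) x ≋ x ⊗ term k x
  suc-term k x = O.sym (O.*-assoc _ _ _) ⊙ O.*-congʳ (O.sym (ι-* _ _) ⊙ ι-cong (inv (#>0 k)) ⊙ ι-1) ⊙ O.*-identityˡ _

  module _ (x y : B) where

   -- The term of degree k in the product of the two exponential series
   convolution : ℕ -> B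
   convolution k = Σᴮ (suc k) (\ i -> term i x ⊗ term (k N.∸ i) y)

   -- (k + 1) c(k + 1) = (x + y) c(k) for the Cauchy product c of the two series.
   convolution-step : ∀ k -> ι (# (suc k)) ⊗ convolution (suc k) ≋ (x ⊕ y) ⊗ convolution k
   convolution-step k = begin ι (# (suc k)) ⊗ convolution (suc k) ≈⟨ O.sym (Σᴮ-* (suc (suc k)) _ _) ⟩
    Σᴮ (suc (suc k)) (\ i -> ι (# (suc k)) ⊗ (term i x ⊗ term (suc k N.∸ i) y)) ≈⟨ Σᴮ-cong (suc (suc k)) (\ i i<k -> O.*-congʳ (ι-cong (reflexive (E.cong # (E.sym (N.m+[n∸m]≡n (N.≤-pred i<k)))) & #-+ i _) ⊙ ι-+ _ _) ⊙ byᴮ 4 \ a b c d -> (a :+ b) :* (c :* d) := a :* c :* d :+ c :* (b :* d)) ⟩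
    Σᴮ (suc (suc k)) (\ i -> ι (# i) ⊗ term i x ⊗ term (suc k N.∸ i) y ⊕ term i x ⊗ (ι (# (suc k N.∸ i)) ⊗ term (suc k N.∸ i) y)) ≈⟨ Σᴮ-+ (suc (suc k)) _ _ ⟩
    Σᴮ (suc (suc k)) (\ i -> ι (# i) ⊗ term i x ⊗ term (suc k N.∸ i) y)
    ⊕ Σᴮ (suc (suc k)) (\ i -> term i x ⊗ (ι (# (suc k N.∸ i)) ⊗ term (suc k N.∸ i) y)) ≈⟨ O.+-cong left right ⟩
    x ⊗ convolution k ⊕ y ⊗ convolution k ≈⟨ O.sym (O.distribʳ _ _ _) ⟩
    (x ⊕ y) ⊗ convolution k ∎
    where
    open ≋-Reasoning
    left = begin Σᴮ (suc (suc k)) (\ i -> ι (# i) ⊗ term i x ⊗ term (suc k N.∸ i) y) ≈⟨ Σᴮ-front (suc k) _ ⟩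
     (ι 0# ⊗ 𝟙) ⊗ term (suc k) y ⊕ Σᴮ (suc k) (\ i -> ι (# (suc i)) ⊗ term (suc i) x ⊗ term (k N.∸ i) y) ≈⟨ O.+-cong (O.*-congʳ (O.*-congʳ ι-0) ⊙ byᴮ 1 \ t -> :0 :* :1 :* t := :0)
      (Σᴮ-cong′ (suc k) (\ i -> O.*-congʳ (suc-term i x) ⊙ O.*-assoc _ _ _)) ⟩
     𝟘 ⊕ Σᴮ (suc k) (\ i -> x ⊗ (term i x ⊗ term (k N.∸ i) y)) ≈⟨ O.+-identityˡ _ ⊙ Σᴮ-* (suc k) _ _ ⟩
     x ⊗ convolution k ∎
    right = begin Σᴮ (suc k) (\ i -> term i x ⊗ (ι (# (suc k N.∸ i)) ⊗ term (suc k N.∸ i) y)) ⊕ term (suc k) x ⊗ (ι (# (k N.∸ k)) ⊗ term (k N.∸ k) y) ≈⟨ O.+-cong (Σᴮ-cong (suc k) (\ i i<k -> O.*-congˡ (O.reflexive (E.cong (\ j -> ι (# j) ⊗ term j y) (N.+-∸-assoc 1 (N.≤-pred i<k))) ⊙ suc-term (k N.∸ i) y) ⊙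
     byᴮ 3 \ a b c -> a :* (b :* c) := b :* (a :* c)))
     (O.*-congˡ (O.*-congʳ (ι-cong (reflexive (E.cong # (N.n∸n≡0 k))) ⊙ ι-0) ⊙ O.zeroˡ _) ⊙ O.zeroʳ _) ⟩
     Σᴮ (suc k) (\ i -> y ⊗ (term i x ⊗ term (k N.∸ i) y)) ⊕ 𝟘 ≈⟨ O.+-identityʳ _ ⊙ Σᴮ-* (suc k) _ _ ⟩
     y ⊗ convolution k ∎

   convolution-term : ∀ k -> convolution k ≋ term k (x ⊕ y)
   convolution-term zero = byᴮ 0 (:0 :+ :1 :* :1 := :1)
   convolution-term (suc k) = begin convolution (suc k) ≈⟨ O.sym (O.*-identityˡ _) ⟩ 𝟙 ⊗ convolution (suc k) ≈⟨ O.*-congʳ (O.sym ι-1 ⊙ ι-cong (sym (*-comm _ _ & inv (#>0 k))) ⊙ ι-* _ _) ⟩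
    (ι (# (suc k) ⁻¹) ⊗ ι (# (suc k))) ⊗ convolution (suc k) ≈⟨ O.*-assoc _ _ _ ⟩
    ι (# (suc k) ⁻¹) ⊗ (ι (# (suc k)) ⊗ convolution (suc k)) ≈⟨ O.*-congˡ (convolution-step k ⊙ O.*-congˡ (convolution-term k)) ⟩
    term (suc k) (x ⊕ y) ∎
    where open ≋-Reasoning

   partial : B -> ℕ -> B
   partial z n = Σᴮ n (\ k -> term k z)

   triangle : ∀ n -> partial (x ⊕ y) n ≋ Σᴮ n (\ i -> term i x ⊗ partial y (n N.∸ i))
   triangle zero = O.refl
   triangle (suc n) = begin partial (x ⊕ y) n ⊕ term n (x ⊕ y) ≈⟨ O.+-cong (triangle n) (O.sym (convolution-term n)) ⟩
    Σᴮ n (\ i -> term i x ⊗ partial y (n N.∸ i)) ⊕ convolution n ≈⟨ O.+-congʳ (O.sym (O.+-identityʳ _) ⊙ O.+-congˡ (O.sym (O.*-congˡ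
     (O.reflexive (E.cong (partial y) (N.n∸n≡0 n))) ⊙ O.zeroʳ _))) ⟩
    Σᴮ (suc n) (\ i -> term i x ⊗ partial y (n N.∸ i)) ⊕ convolution n ≈⟨ O.sym (Σᴮ-+ (suc n) _ _) ⟩
    Σᴮ (suc n) (\ i -> term i x ⊗ partial y (n N.∸ i) ⊕ term i x ⊗ term (n N.∸ i) y) ≈⟨ Σᴮ-cong (suc n) (\ i i<n -> O.sym (O.distribˡ _ _ _) ⊙ O.*-congˡ (O.reflexive (E.cong (partial y) (E.sym (N.+-∸-assoc 1 (N.≤-pred i<n)))))) ⟩
    Σᴮ (suc n) (\ i -> term i x ⊗ partial y (suc n N.∸ i)) ∎
    where open ≋-Reasoning

   product-defect : ∀ n -> partial x n ⊗ partial y n ⊝ partial (x ⊕ y) n ≋ Σᴮ n (\ i -> term i x ⊗ (partial y n ⊝ partial y (n N.∸ i)))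
   product-defect n = begin partial x n ⊗ partial y n ⊝ partial (x ⊕ y) n ≈⟨ O.+-cong (O.*-comm _ _ ⊙ O.sym (Σᴮ-* n _ _)) (O.-‿cong (triangle n)) ⟩
    Σᴮ n (\ i -> partial y n ⊗ term i x) ⊝ Σᴮ n (\ i -> term i x ⊗ partial y (n N.∸ i)) ≈⟨ O.sym (Σᴮ-sub n _ _) ⟩
    Σᴮ n (\ i -> partial y n ⊗ term i x ⊝ term i x ⊗ partial y (n N.∸ i)) ≈⟨ Σᴮ-cong′ n (\ i -> byᴮ 3 \ a b c -> b :* a :- a :* c := a :* (b :- c)) ⟩
    Σᴮ n (\ i -> term i x ⊗ (partial y n ⊝ partial y (n N.∸ i))) ∎
    where open ≋-Reasoning

 module Real = Terms realAlgebra
 open Real public using () renaming (term to t; triangle to triangle-ℝ; product-defect to product-defect-ℝ)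

 t≥0 : ∀ k {x} -> 0# ≤ x -> 0# ≤ t k x
 t≥0 zero h = 0≤1
 t≥0 (suc k) h = *≥0 (⁻¹≥0 (#>0 k)) (*≥0 h (t≥0 k h))

 -- Each term is at most half the previous one once its index is at least 2x.
 t-halves : ∀ k {x} -> 0# ≤ x -> # 2 * x ≤ # (suc k) -> # 2 * t (suc k) x ≤ t k x
 t-halves k {x} h p = begin # 2 * (# (suc k) ⁻¹ * (x * t k x)) ≈⟨ by 4 (\ a b c d -> a :* (b :* (c :* d)) := a :* c :* (b :* d)) ⟩
  (# 2 * x) * (# (suc k) ⁻¹ * t k x) ≤⟨ *≤ʳ _ (*≥0 (⁻¹≥0 (#>0 k)) (t≥0 k h)) p ⟩
  # (suc k) * (# (suc k) ⁻¹ * t k x) ≈⟨ sym (*-assoc _ _ _) & *ʳ (inv (#>0 k)) & 1* _ ⟩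
  t k x ∎
  where open ≤-Reasoning

 t-sum-bound : ∀ x -> 0# ≤ x -> ∃[ c ] (∀ n -> Σ n (\ k -> t k x) ≤ c)
 t-sum-bound x h = Σ m s + # 2 * s (m N.+ 0) , \ n -> Σ-length-mono (\ k -> t≥0 k h) (N.m≤n+m n m) >> Σ-split m n s ~> +-monoʳ-≤ _ (geometric-sum (\ i -> s (m N.+ i)) (\ i -> t≥0 (m N.+ i) h) halves n)
  where
  s = \ k -> t k x
  m = fst (archimedean (# 2 * x))
  halves : ∀ i -> # 2 * s (m N.+ suc i) ≤ s (m N.+ i)
  halves i = ≤-resp (*ˡ (reflexive (E.cong s (E.sym (N.+-suc m i))))) refl
   (t-halves (m N.+ i) h (<≤ (snd (archimedean (# 2 * x))) >> #-mono (N.m≤n⇒m≤1+n (N.m≤m+n m i))))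

 t-tail₂ : ∀ x -> 0# ≤ x -> x ≤ 1# -> ∀ n -> Σ n (\ i -> t (2 N.+ i) x) ≤ x * x
 t-tail₂ x h h1 n = geometric-sum (\ i -> t (2 N.+ i) x) (\ i -> t≥0 (2 N.+ i) h)
  (\ i -> t-halves (2 N.+ i) h (≤-resp refl (*1 _) (*≤ˡ (# 2) (#≥0 2) h1) >> #-mono {2} {3 N.+ i} (N.s≤s (N.s≤s N.z≤n)))) n >~ (begin
   # 2 * (½ * (x * (# 1 ⁻¹ * (x * 1#)))) ≈⟨ by 3 (\ x h o -> con 2 :* (h :* (x :* (o :* (x :* :1)))) := con 2 :* h :* o :* (x :* x)) ⟩
   (# 2 * ½) * # 1 ⁻¹ * (x * x) ≈⟨ *ʳ (*-cong 2½ (⁻¹-cong #-1 & 1⁻¹)) ⟩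
   1# * 1# * (x * x) ≈⟨ by 1 (\ x -> :1 :* :1 :* (x :* x) := x :* x) ⟩
   x * x ∎)
  where open SetoidReasoning setoid

 module Exponential (N : NormedAlgebra) where
  open Normed N
  open NormedSeries N
  open Terms N

  norm-term : ∀ k x -> ‖ term k x ‖ ≤ t k ‖ x ‖
  norm-term zero x = norm-1
  norm-term (suc k) x = norm-ι⊗₊ _ (⁻¹≥0 (#>0 k)) >> *≤ˡ _ (⁻¹≥0 (#>0 k)) (norm-*-≤ ≤-refl (norm-term k x))

  private
   series : ∀ x -> ∃ (\ l -> (\ n -> Σᴮ n (\ k -> term k x)) ⟶ᴮ l)
   series x = majorised _ (\ k -> t k ‖ x ‖) _ (\ k -> norm-term k x) (snd (t-sum-bound ‖ x ‖ (norm≥0 x)))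

  abstract
   -- The exponential function of the algebra
   Exp : B -> B
   Exp x = fst (series x)

   Exp-series : ∀ x -> (\ n -> Σᴮ n (\ k -> term k x)) ⟶ᴮ Exp x
   Exp-series x = snd (series x)

  Exp-cong : ∀ {x y} -> x ≋ y -> Exp x ≋ Exp y
  Exp-cong {x} {y} p = ⟶-unique (Exp-series x) (⟶-cong (\ n -> Σᴮ-cong′ n (\ k -> term-cong k (O.sym p))) O.refl (Exp-series y))

  -- A norm decreasing endomorphism commutes with the exponential.
  module _ (φ : B -> B) (φ-cong : ∀ {x y} -> x ≋ y -> φ x ≋ φ y) (φ-+ : ∀ x y -> φ (x ⊕ y) ≋ φ x ⊕ φ y) (φ-* : ∀ x y -> φ (x ⊗ y) ≋ φ x ⊗ φ y)
   (φ-ι : ∀ a -> φ (ι a) ≋ ι a) (φ-norm : ∀ x y -> ‖ φ x ⊝ φ y ‖ ≤ ‖ x ⊝ y ‖) where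
   private
    term-φ : ∀ k z -> term k (φ z) ≋ φ (term k z)
    term-φ zero z = O.sym (φ-cong (O.sym ι-1) ⊙ φ-ι 1# ⊙ ι-1)
    term-φ (suc k) z = O.sym (φ-* _ _ ⊙ O.*-cong (φ-ι _) (φ-* z _ ⊙ O.*-congˡ (O.sym (term-φ k z))))

    Σ-φ : ∀ n f -> φ (Σᴮ n f) ≋ Σᴮ n (\ i -> φ (f i))
    Σ-φ zero f = φ-cong (O.sym ι-0) ⊙ φ-ι 0# ⊙ ι-0
    Σ-φ (suc n) f = φ-+ _ _ ⊙ O.+-congʳ (Σ-φ n f)

   Exp-φ : ∀ z -> Exp (φ z) ≋ φ (Exp z)
   Exp-φ z = ⟶-unique (Exp-series (φ z)) (⟶-cong (\ n -> Σ-φ n _ ⊙ Σᴮ-cong′ n (\ k -> O.sym (term-φ k z))) O.refl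
    \ e he -> let (M , p) = Exp-series z e he in M , \ n le -> φ-norm _ _ >> p n le)

  Exp-0 = ⟶-unique {a = a} (⟶-subseq {a = \ n -> Σᴮ n (\ k -> term k 𝟘)} suc N.n≤1+n (Exp-series 𝟘)) (⟶-const {a = a} stationary)
   where
   a : ℕ -> B
   a n = Σᴮ (suc n) (\ k -> term k 𝟘)
   vanish : ∀ i -> term (suc i) 𝟘 ≋ 𝟘
   vanish i = O.*-congˡ (O.zeroˡ _) ⊙ O.zeroʳ _
   stationary : ∀ n -> a n ≋ 𝟙
   stationary n = Σᴮ-front n (\ k -> term k 𝟘) ⊙ O.+-congˡ (Σᴮ-zero n (\ i _ -> vanish i)) ⊙ O.+-identityʳ 𝟙

  -- The error of the product of partial sums is dominated by that of the real series of the norms,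
  -- which lies between two partial sums of the exponential series at ‖x‖ + ‖y‖.
  product-error : ∀ x y n -> let X = ‖ x ‖ ; Y = ‖ y ‖ in
   ‖ partial x y x n ⊗ partial x y y n ⊝ partial x y (x ⊕ y) n ‖ ≤ Σ (n N.+ n) (\ k -> t k (X + Y)) - Σ n (\ k -> t k (X + Y))
  product-error x y n = begin ‖ partial x y x n ⊗ partial x y y n ⊝ partial x y (x ⊕ y) n ‖ ≈⟨ norm-cong (product-defect x y n) ⟩
   ‖ Σᴮ n (\ i -> term i x ⊗ (partial x y y n ⊝ partial x y y (n N.∸ i))) ‖ ≤⟨ norm-Σ-≤ n (\ i _ -> norm-*-≤ (norm-term i x) (norm-Σ-diff (\ k -> norm-term k y) (N.m∸n≤m n i))) ⟩
   Σ n (\ i -> t i X * (S Y n - S Y (n N.∸ i))) ≈⟨ sym (product-defect-ℝ X Y n) ⟩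
   S X n * S Y n - S (X + Y) n ≤⟨ lin upper (by 3 \ p q r -> p :- q :+ r := p :+ (r :- q)) ⟩
   S (X + Y) (n N.+ n) - S (X + Y) n ∎
   where
   open ≤-Reasoning
   X = ‖ x ‖
   Y = ‖ y ‖
   hX = norm≥0 x
   hY = norm≥0 y
   S : ℝ -> ℕ -> ℝ
   S z n = Σ n (\ k -> t k z)
   upper = begin S X n * S Y n ≈⟨ *-comm _ _ & sym (Σ-* n _ _) ⟩
    Σ n (\ i -> S Y n * t i X) ≤⟨ Σ-mono n (\ i i<n -> ≤-resp (*-comm _ _) refl (*≤ˡ _ (t≥0 i hX) (Σ-length-mono (\ k -> t≥0 k hY)
     (E.subst (n N.≤_) (E.sym (N.+-∸-assoc n (N.<⇒≤ i<n))) (N.m≤m+n n _))))) ⟩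
    Σ n (\ i -> t i X * S Y (n N.+ n N.∸ i)) ≤⟨ Σ-length-mono (\ i -> *≥0 (t≥0 i hX) (Σ≥0 (n N.+ n N.∸ i) (\ k -> t≥0 k hY))) (N.m≤m+n n n) ⟩
    Σ (n N.+ n) (\ i -> t i X * S Y (n N.+ n N.∸ i)) ≈⟨ sym (triangle-ℝ X Y (n N.+ n)) ⟩
    S (X + Y) (n N.+ n) ∎

  Exp-+ : ∀ x y -> Exp (x ⊕ y) ≋ Exp x ⊗ Exp y
  Exp-+ x y = ⟶-unique (⟶-diff (⟶-* (Exp-series x) (Exp-series y)) null) (Exp-series (x ⊕ y)) ⟨∙⟩ O.refl
   where
   _⟨∙⟩_ : ∀ {a b c} -> a ≋ b -> b ≋ c -> b ≋ a
   p ⟨∙⟩ q = O.sym p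
   null : (\ n -> partial x y (x ⊕ y) n ⊝ partial x y x n ⊗ partial x y y n) ⟶ᴮ 𝟘
   null e he =
    let h = +≥0 (norm≥0 x) (norm≥0 y)
        (M , p) = monotone-cauchy (\ n -> Σ n (\ k -> t k (‖ x ‖ + ‖ y ‖))) _ (Σ-length-mono (\ k -> t≥0 k h)) (snd (t-sum-bound _ h)) e he
    in M , \ n le -> norm-cong (byᴮ 1 \ z -> z :- :0 := z) & norm-sub-sym _ _ ~> product-error x y n >> lin (Σ-length-mono (\ k -> t≥0 k h) le)
     (by 3 \ a b c -> a :- b :+ b := c :+ (a :- c)) >> p (n N.+ n) (N.≤-trans le (N.m≤m+n n n))

  -- Second order Taylor estimate.
  Exp-taylor : ∀ x -> ‖ x ‖ ≤ 1# -> ‖ Exp x ⊝ 𝟙 ⊝ x ‖ ≤ ‖ x ‖ * ‖ x ‖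
  Exp-taylor x h = norm-cong (begin Exp x ⊝ 𝟙 ⊝ x ≈⟨ byᴮ 2 (\ e x -> e :- :1 :- x := e :- (:0 :+ :1 :+ :1 :* (x :* :1))) ⟩
   Exp x ⊝ (𝟘 ⊕ 𝟙 ⊕ 𝟙 ⊗ (x ⊗ 𝟙)) ≈⟨ O.+-congˡ (O.-‿cong (O.+-congˡ (O.*-congʳ (O.sym (ι-cong (⁻¹-cong #-1 & 1⁻¹) ⊙ ι-1))))) ⟩
   Exp x ⊝ Σᴮ 2 (\ k -> term k x) ∎) ~> tail-bound 2 (Exp-series x) (\ i -> norm-term (2 N.+ i) x) (t-tail₂ ‖ x ‖ (norm≥0 x) h)
   where open ≋-Reasoning

 -- The real exponential function and logarithm

 module ℝᴮ = Normed realAlgebra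
 module Eℝ = Exponential realAlgebra

 -- Limits as in the definition of lim, and limits in the normed algebra of the reals

 to-⟶ : ∀ {a l} -> a ℝᴮ.⟶ᴮ l -> a ⟶ l
 to-⟶ h e he = let (N , p) = h (e * ½) (half>0 he) in N , \ n le -> ≤-<-trans (p n le) (half-< he)
  where
  half-< : ∀ {e} -> 0# < e -> e * ½ < e
  half-< {e} he = lin< (half>0 he) (half+half e & sym (0+ e))

 from-⟶ : ∀ {a l} -> a ⟶ l -> a ℝᴮ.⟶ᴮ l
 from-⟶ h e he = let (N , p) = h e he in N , \ n le -> <≤ (p n le)

 lim-unique : ∀ {a l} -> a ℝᴮ.⟶ᴮ l -> lim a ≈ l
 lim-unique {a} {l} h with em {∃ \ y -> a ⟶ y}
 ... | yes (m , k) = ℝᴮ.⟶-unique (from-⟶ k) h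
 ... | no q = ⊥-elim (q (l , to-⟶ h))

 the-spec : ∀ {A : Set} (d : A) (P : A -> Set) -> ∃ P -> P (the d P)
 the-spec d P h with em {∃ P}
 ... | yes (_ , p) = p
 ... | no q = ⊥-elim (q h)

 ∑-upTo : ∀ n f -> ∑ (upTo n) f ≈ Σ n f
 ∑-upTo n f = go n (\ x -> x)
  where
  go : ∀ n (g : ℕ -> ℕ) -> ∑ (applyUpTo g n) f ≈ Σ n (f ∘ g)
  go zero g = refl
  go (suc n) g = +ˡ (go n (g ∘ suc)) & sym (Σ-front n (f ∘ g))

 ≤-lim : ∀ {a l c} N -> a ℝᴮ.⟶ᴮ l -> (∀ n -> N N.≤ n -> a n ≤ c) -> l ≤ c
 ≤-lim {a} {l} {c} N h k = ≤-limit \ e he ->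
  let (M , p) = h e he ; n = N N.⊔ M in
  lin (k n (N.m≤m⊔n N M) ⊞ -≤abs _ >> p n (N.m≤n⊔m N M)) (by 4 \ a l c e -> l :+ (c :+ e) := a :+ :- (a :- l) :+ (c :+ e))

 lim-≤ : ∀ {a l c} N -> a ℝᴮ.⟶ᴮ l -> (∀ n -> N N.≤ n -> c ≤ a n) -> c ≤ l
 lim-≤ {a} {l} {c} N h k = lin (≤-lim N (ℝᴮ.⟶-neg h) (\ n le -> neg-mono (k n le))) (by 2 \ c l -> c :+ :- c := :- l :+ l)

 -- The exponential function

 exp-term : ∀ k x -> x ^ k / # (k !) ≈ t k x
 exp-term zero x = 1* _ & ⁻¹-cong #-1 & 1⁻¹
 exp-term (suc k) x = *ˡ (⁻¹-cong (#-* (suc k) (k !)) & ⁻¹-* (#>0 k) (!>0 k)) & by 4 (\ x p a b -> x :* p :* (a :* b) := a :* (x :* (p :* b))) & *ˡ (*ˡ (exp-term k x))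
  where
  !>0 : ∀ k -> 0# < # (k !)
  !>0 zero = #>0 0
  !>0 (suc k) = <-resp refl (sym (#-* (suc k) (k !))) (*>0 (#>0 k) (!>0 k))

 series-cong : ∀ x n -> Σ n (\ k -> t k x) ≈ ∑ (upTo n) (\ k -> x ^ k / # (k !))
 series-cong x n = sym (∑-upTo n _ & Σ-cong′ n (\ k -> exp-term k x))

 exp≈Exp : ∀ x -> exp x ≈ Eℝ.Exp x
 exp≈Exp x = lim-unique (ℝᴮ.⟶-cong (series-cong x) refl (Eℝ.Exp-series x))

 abstract
  exp-series : ∀ x -> (\ n -> Σ n (\ k -> t k x)) ℝᴮ.⟶ᴮ exp x
  exp-series x = ℝᴮ.⟶-cong (\ n -> refl) (sym (exp≈Exp x)) (Eℝ.Exp-series x)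

  exp-cong : ∀ {x y} -> x ≈ y -> exp x ≈ exp y
  exp-cong p = exp≈Exp _ & Eℝ.Exp-cong p & sym (exp≈Exp _)

  exp-0 : exp 0# ≈ 1#
  exp-0 = exp≈Exp _ & Eℝ.Exp-0

  exp-+ : ∀ x y -> exp (x + y) ≈ exp x * exp y
  exp-+ x y = exp≈Exp _ & Eℝ.Exp-+ x y & sym (*-cong (exp≈Exp x) (exp≈Exp y))

 -- The exponential of a scalar
 module ScalarExp (N : NormedAlgebra) where
  open Normed N
  open NormedSeries N
  open Terms N
  open Exponential N

  Exp-ι : ∀ a -> Exp (ι a) ≋ ι (exp a)
  Exp-ι a = ⟶-unique (Exp-series (ι a)) (⟶-cong (\ n -> ι-Σ n (\ k -> t k a) ⊙ Σᴮ-cong′ n (\ k -> O.sym (term-ι k))) O.refl limit)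
   where
   term-ι : ∀ k -> term k (ι a) ≋ ι (t k a)
   term-ι zero = O.sym ι-1
   term-ι (suc k) = O.sym (ι-* _ _ ⊙ O.*-congˡ (ι-* a (t k a) ⊙ O.*-congˡ (O.sym (term-ι k))))
   limit : (\ n -> ι (Σ n (\ k -> t k a))) ⟶ᴮ ι (exp a)
   limit e he = let (M , p) = exp-series a e he in M , \ n le -> norm-cong (O.sym (ι-sub _ _)) ~> norm-ι _ >> p n le

 t-≤-exp : ∀ k {x} -> 0# ≤ x -> t k x ≤ exp x
 t-≤-exp k {x} h = lim-≤ (suc k) (exp-series x) \ n le -> x≤y+x (Σ≥0 k (\ i -> t≥0 i h)) >> Σ-length-mono (\ i -> t≥0 i h) le

 1≤exp : ∀ {x} -> 0# ≤ x -> 1# ≤ exp x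
 1≤exp = t-≤-exp 0

 exp-inverse : ∀ x -> exp x * exp (- x) ≈ 1#
 exp-inverse x = sym (exp-+ x (- x)) & exp-cong (-‿inverseʳ x) & exp-0

 exp>0 : ∀ x -> 0# < exp x
 exp>0 x = ≤-resp refl (sym (exp-+ _ _) & exp-cong (half+half x)) (sq≥0 _) , \ h -> 0≉1 (sym (zeroˡ _) & *ʳ h & exp-inverse x)

 exp≥0 : ∀ x -> 0# ≤ exp x
 exp≥0 x = <≤ (exp>0 x)

 exp-neg : ∀ x -> exp (- x) ≈ exp x ⁻¹
 exp-neg x = sym (⁻¹-unique (exp-inverse x))

 -- exp x ≤ 1/(1-x) for 0 ≤ x < 1, by comparison with the geometric series
 exp-geometric : ∀ {x} -> 0# ≤ x -> x ≤ 1# -> exp x * (1# - x) ≤ 1#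
 exp-geometric {x} h h1 = ≤-lim 0 (ℝᴮ.⟶-cong (\ n -> *-comm _ _) (*-comm _ _) (ℝᴮ.⟶-scale (1# - x) (exp-series x))) \ n _ -> *≤ʳ _ (sub≥0 h1) (Σ-mono′ n (\ k -> t≤^ k)) >> lin (^≥0 n h) (+ʳ (geo n) & by 1 \ p -> :1 :- p :+ p := :0 :+ :1)
  where
  -- The inverse of the Euler factor; index 0, that is n + 1 = 1, is never a prime.
  geo : ∀ n -> Σ n (\ k -> x ^ k) * (1# - x) ≈ 1# - x ^ n
  geo zero = by 1 (\ x -> :0 :* (:1 :- x) := :1 :- :1)
  geo (suc n) = by 3 (\ s p x -> (s :+ p) :* (:1 :- x) := s :* (:1 :- x) :+ p :* (:1 :- x)) & +ʳ (geo n) & by 2 (\ p x -> :1 :- p :+ p :* (:1 :- x) := :1 :- x :* p)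
  t≤^ : ∀ k -> t k x ≤ x ^ k
  t≤^ zero = ≤-refl
  t≤^ (suc k) = *≤ʳ _ (*≥0 h (t≥0 k h)) (⁻¹-anti 0<1 (1≤# k) >~ 1⁻¹) >> 1* _ ~> *≤ˡ x h (t≤^ k)

 1+x≤exp : ∀ x -> 1# + x ≤ exp x
 1+x≤exp x = [ nonNegative , (\ h -> [ moderate h , (\ k -> lin (<≤ k) (by 1 \ x -> :1 :+ x :+ :- x := :1 :+ :0) >> exp≥0 x) ]′ (≤-or-> (- x) 1#)) ]′ (≤-total 0# x)
  where
  nonNegative : 0# ≤ x -> 1# + x ≤ exp x
  nonNegative h = lim-≤ 2 (exp-series x) \ n le -> by 1 (\ x -> :1 :+ x := :0 :+ :1 :+ :1 :* (x :* :1)) & +ˡ (*ʳ (sym (⁻¹-cong #-1 & 1⁻¹))) ~> Σ-length-mono (\ i -> t≥0 i h) le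
  moderate : x ≤ 0# -> - x ≤ 1# -> 1# + x ≤ exp x
  moderate h k = *-cancelˡ-≤ (exp (- x)) (exp>0 _) (≤-resp (*ˡ (by 1 \ x -> :1 :- :- x := :1 :+ x)) (sym (*-comm _ _ & exp-inverse x))
   (exp-geometric (lin h (by 1 \ x -> :0 :+ :0 := x :+ :- x)) k))

 exp-≤ : ∀ {x} -> x < 1# -> exp x ≤ (1# - x) ⁻¹
 exp-≤ {x} h = ≤-resp (1* _) (1* _) (≤-/ hp (*≤ˡ _ (exp≥0 x >~ sym (1* _)) (1+x≤exp (- x)) >~ *ʳ (1* _) & exp-inverse x))
  where hp = sub>0 h

 exp-mono : ∀ {x y} -> x ≤ y -> exp x ≤ exp y
 exp-mono {x} {y} h = ≤-resp (*1 _) (sym (exp-+ x (y - x)) & exp-cong (by 2 \ x y -> x :+ (y :- x) := y)) (*≤ˡ (exp x) (exp≥0 x) (1≤exp (sub≥0 h)))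

 exp-neg≤1 : ∀ {x} -> 0# ≤ x -> exp (- x) ≤ 1#
 exp-neg≤1 h = exp-mono (lin h (by 1 \ x -> :- x :+ x := :0 :+ :0)) >~ exp-0

 exp-mono-< : ∀ {x y} -> x < y -> exp x < exp y
 exp-mono-< {x} {y} h = <-resp (*1 _) (sym (exp-+ x (y - x)) & exp-cong (by 2 \ x y -> x :+ (y :- x) := y))
  (*-monoˡ-< (exp x) (exp>0 x) (<-≤-trans (lin< (sub>0 h) (by 2 \ x y -> :1 :+ (y :- x) := :0 :+ (:1 :+ (y :- x)))) (1+x≤exp _)))

 exp-cancel-≤ : ∀ {x y} -> exp x ≤ exp y -> x ≤ y
 exp-cancel-≤ h = by-contradiction \ lt -> <⇒≱ (exp-mono-< lt) h

 exp-injective : ∀ {x y} -> exp x ≈ exp y -> x ≈ y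
 exp-injective h = ≤-antisym (exp-cancel-≤ (≈⇒≤ h)) (exp-cancel-≤ (≈⇒≤ (sym h)))

 exp-#* : ∀ n x -> exp (# n * x) ≈ exp x ^ n
 exp-#* zero x = exp-cong (zeroˡ x) & exp-0
 exp-#* (suc n) x = exp-cong (by 2 \ n x -> (:1 :+ n) :* x := x :+ n :* x) & exp-+ _ _ & *ˡ (exp-#* n x)

 -- For q > 1 the number 1 - 1/q is positive and its exponential is at most q.
 exp-root : ∀ {q} -> 1# < q -> ∃[ d ] (0# < d × exp d ≤ q)
 exp-root {q} h = 1# - q ⁻¹ , sub>0 q⁻¹<1 , exp-≤ (lin< 0<q⁻¹ (by 1 \ u -> :1 :- u :+ u := :0 :+ :1)) >~ ⁻¹-cong (by 1 \ u -> :1 :- (:1 :- u) := u) & ⁻¹⁻¹ 0<q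
  where
  0<q = ≤-<-trans 0≤1 h
  0<q⁻¹ = ⁻¹>0 0<q
  q⁻¹<1 = <-resp (*1 _) (*-comm _ _ & inv 0<q) (*-monoˡ-< _ 0<q⁻¹ h)

 exp-surjective : ∀ {x} -> 0# < x -> ∃[ y ] exp y ≈ x
 exp-surjective {x} hx = s , ≤-antisym (by-contradiction not-above) (by-contradiction not-below)
  where
  P : ℝ -> Set
  P y = exp y ≤ x
  start = exp-neg _ ~> ⁻¹-anti (⁻¹>0 hx) (x≤y+x 0≤1 >> 1+x≤exp _) >~ ⁻¹⁻¹ hx
  ub : IsUpperBound P x
  ub y h = x≤y+x 0≤1 >> 1+x≤exp y >> h
  sup = complete P (_ , start) (_ , ub)
  s = fst sup
  not-below : ¬ (exp s < x)
  not-below lt = let q = x / exp s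
                     (d , hd , k) = exp-root {q} (<-resp (inv (exp>0 s)) refl (<-resp (*-comm _ _) (*-comm _ _) (*-monoˡ-< _ (⁻¹>0 (exp>0 s)) lt)))
   in <⇒≱ hd (lin (fst (snd sup) (s + d) (exp-+ s d & *-comm _ _ ~> *≤ʳ _ (exp≥0 s) k >~ /-cancel (exp>0 s)))
    (by 2 \ s d -> d :+ s := s :+ d :+ :0))
  not-above : ¬ (x < exp s)
  not-above lt = let q = exp s / x
                     (d , hd , k) = exp-root {q} (<-resp (inv hx) refl (<-resp (*-comm _ _) (*-comm _ _) (*-monoˡ-< _ (⁻¹>0 hx) lt)))
                     x≤ = *-cancelˡ-≤ (exp d) (exp>0 d) (*≤ʳ x (<≤ hx) k >> ≈⇒≤
                      (/-cancel hx & exp-cong (by 2 \ s d -> s := d :+ (s :- d)) & exp-+ _ _))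
   in <⇒≱ hd (lin (snd (snd sup) (s - d) (\ y h -> exp-cancel-≤ (h >> x≤)))
    (by 2 \ s d -> d :+ (s :- d) := s :+ :0))

 -- The logarithm

 exp-log : ∀ {x} -> 0# < x -> exp (log x) ≈ x
 exp-log h = the-spec 0# _ (exp-surjective h)

 log-exp : ∀ x -> log (exp x) ≈ x
 log-exp x = exp-injective (exp-log (exp>0 x))

 log-cong : ∀ {x y} -> 0# < x -> x ≈ y -> log x ≈ log y
 log-cong h p = exp-injective (exp-log h & p & sym (exp-log (<-resp refl p h)))

 log-1 : log 1# ≈ 0#
 log-1 = exp-injective (exp-log 0<1 & sym exp-0)

 log-* : ∀ {x y} -> 0# < x -> 0# < y -> log (x * y) ≈ log x + log y
 log-* h k = exp-injective (exp-log (*>0 h k) & sym (exp-+ _ _ & *-cong (exp-log h) (exp-log k)))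

 log-⁻¹ : ∀ {x} -> 0# < x -> log (x ⁻¹) ≈ - log x
 log-⁻¹ h = exp-injective (exp-log (⁻¹>0 h) & sym (exp-neg _ & ⁻¹-cong (exp-log h)))

 log-/ : ∀ {x y} -> 0# < x -> 0# < y -> log (x / y) ≈ log x - log y
 log-/ h k = log-* h (⁻¹>0 k) & +ˡ (log-⁻¹ k)

 log-^ : ∀ n {x} -> 0# < x -> log (x ^ n) ≈ # n * log x
 log-^ n h = exp-injective (exp-log (^>0 n h) & sym (exp-#* n _ & ^-congˡ n (exp-log h)))

 log-mono : ∀ {x y} -> 0# < x -> x ≤ y -> log x ≤ log y
 log-mono h p = exp-cancel-≤ (≤-resp (sym (exp-log h)) (sym (exp-log (<-≤-trans h p))) p)

 log-mono-< : ∀ {x y} -> 0# < x -> x < y -> log x < log y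
 log-mono-< {x} {y} h p = [ (\ q -> ⊥-elim (<⇒≱ p (≤-resp (exp-log (<-≤-trans h (<≤ p))) (exp-log h) (exp-mono q)))) , (\ q -> q) ]′ (≤-or-> (log y) (log x))

 log-≤ : ∀ {x} -> 0# < x -> log x ≤ x - 1#
 log-≤ {x} h = lin (1+x≤exp (log x) >~ exp-log h) (by 2 \ x l -> l :+ x := :1 :+ l :+ (x :- :1))

 ≤-log : ∀ {x} -> 0# < x -> 1# - x ⁻¹ ≤ log x
 ≤-log {x} h = lin (log-≤ (⁻¹>0 h)) (by 1 (\ u -> :1 :- u :+ (u :- :1) := :0) & sym (-‿inverseˡ _) & +ʳ (sym (log-⁻¹ h)))

 log≥0 : ∀ {x} -> 1# ≤ x -> 0# ≤ log x
 log≥0 h = ≤-resp log-1 refl (log-mono 0<1 h)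

 log>0 : ∀ {x} -> 1# < x -> 0# < log x
 log>0 h = <-resp log-1 refl (log-mono-< 0<1 h)

 log-≤-exp : ∀ {x y} -> 0# < x -> x ≤ exp y -> log x ≤ y
 log-≤-exp h p = exp-cancel-≤ (≤-resp (sym (exp-log h)) refl p)

 exp-≤-log : ∀ {x y} -> 0# < x -> exp y ≤ x -> y ≤ log x
 exp-≤-log h p = exp-cancel-≤ (≤-resp refl (sym (exp-log h)) p)

 -- Quadratic extensions and the complex numbers

 -- The quadratic extension N[j] with j² = c + d j, under the sum norm.
 module Quadratic (N : NormedAlgebra) (c d : ℝ) (small : ∣ c ∣ + ∣ d ∣ ≤ 1#) where
  open Normed N

  private
   Q : Set
   Q = B × B
   _≈Q_ : Q -> Q -> Set
   (a , b) ≈Q (a' , b') = (a ≋ a') × (b ≋ b')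
   _+Q_ _*Q_ : Q -> Q -> Q
   (a , b) +Q (a' , b') = a ⊕ a' , b ⊕ b'
   (a , b) *Q (a' , b') = a ⊗ a' ⊕ ι c ⊗ (b ⊗ b') , a ⊗ b' ⊕ b ⊗ a' ⊕ ι d ⊗ (b ⊗ b')
   -Q_ : Q -> Q
   -Q (a , b) = ⊖ a , ⊖ b
   normQ : Q -> ℝ
   normQ (a , b) = ‖ a ‖ + ‖ b ‖

   equivalence : IsEquivalence _≈Q_
   equivalence = record
    { refl = O.refl , O.refl
    ; sym = \ (p , q) -> O.sym p , O.sym q
    ; trans = \ (p , q) (r , s) -> p ⊙ r , q ⊙ s }

   ringQ : CommutativeRing 0ℓ 0ℓ
   ringQ = record
    { Carrier = Q ; _≈_ = _≈Q_ ; _+_ = _+Q_ ; _*_ = _*Q_ ; -_ = -Q_ ; 0# = 𝟘 , 𝟘 ; 1# = 𝟙 , 𝟘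
    ; isCommutativeRing = record
     { isRing = record
      { +-isAbelianGroup = record
       { isGroup = record
        { isMonoid = record
         { isSemigroup = record
          { isMagma = record
           { isEquivalence = equivalence
           ; ∙-cong = \ (p , q) (r , s) -> O.+-cong p r , O.+-cong q s }
          ; assoc = \ _ _ _ -> O.+-assoc _ _ _ , O.+-assoc _ _ _ }
         ; identity = (\ _ -> O.+-identityˡ _ , O.+-identityˡ _) , (\ _ -> O.+-identityʳ _ , O.+-identityʳ _) }
        ; inverse = (\ _ -> O.-‿inverseˡ _ , O.-‿inverseˡ _) , (\ _ -> O.-‿inverseʳ _ , O.-‿inverseʳ _)
        ; ⁻¹-cong = \ (p , q) -> O.-‿cong p , O.-‿cong q }
       ; comm = \ _ _ -> O.+-comm _ _ , O.+-comm _ _ }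
      ; *-cong = \ (p , q) (r , s) -> O.+-cong (O.*-cong p r) (O.*-congˡ (O.*-cong q s)) , O.+-cong (O.+-cong (O.*-cong p s) (O.*-cong q r)) (O.*-congˡ (O.*-cong q s))
      ; *-assoc = \ (x , y) (z , w) (u , v) -> byᴮ 8 (\ x y z w u v c d -> (x :* z :+ c :* (y :* w)) :* u :+ c :* ((x :* w :+ y :* z :+ d :* (y :* w)) :* v) := x :* (z :* u :+ c :* (w :* v)) :+ c :* (y :* (z :* v :+ w :* u :+ d :* (w :* v)))) ,
       byᴮ 8 (\ x y z w u v c d -> (x :* z :+ c :* (y :* w)) :* v :+ (x :* w :+ y :* z :+ d :* (y :* w)) :* u :+ d :* ((x :* w :+ y :* z :+ d :* (y :* w)) :* v) := x :* (z :* v :+ w :* u :+ d :* (w :* v)) :+ y :* (z :* u :+ c :* (w :* v)) :+ d :* (y :* (z :* v :+ w :* u :+ d :* (w :* v))))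
      ; *-identity = (\ _ -> byᴮ 3 (\ a b c -> :1 :* a :+ c :* (:0 :* b) := a) , byᴮ 3 \ a b d -> :1 :* b :+ :0 :* a :+ d :* (:0 :* b) := b) , (\ _ -> byᴮ 3 (\ a b c -> a :* :1 :+ c :* (b :* :0) := a) , byᴮ 3 \ a b d -> a :* :0 :+ b :* :1 :+ d :* (b :* :0) := b)
      ; distrib = (\ (x , y) (z , w) (u , v) -> byᴮ 7 (\ x y z w u v c -> x :* (z :+ u) :+ c :* (y :* (w :+ v)) := x :* z :+ c :* (y :* w) :+ (x :* u :+ c :* (y :* v))) , byᴮ 7 \ x y z w u v d -> x :* (w :+ v) :+ y :* (z :+ u) :+ d :* (y :* (w :+ v)) := x :* w :+ y :* z :+ d :* (y :* w) :+ (x :* v :+ y :* u :+ d :* (y :* v))) ,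
       (\ (x , y) (z , w) (u , v) -> byᴮ 7 (\ x y z w u v c -> (z :+ u) :* x :+ c :* ((w :+ v) :* y) := z :* x :+ c :* (w :* y) :+ (u :* x :+ c :* (v :* y))) , byᴮ 7 \ x y z w u v d -> (z :+ u) :* y :+ (w :+ v) :* x :+ d :* ((w :+ v) :* y) := z :* y :+ w :* x :+ d :* (w :* y) :+ (u :* y :+ v :* x :+ d :* (v :* y))) }
     ; *-comm = \ (x , y) (z , w) -> byᴮ 5 (\ x y z w c -> x :* z :+ c :* (y :* w) := z :* x :+ c :* (w :* y)) , byᴮ 5 (\ x y z w d -> x :* w :+ y :* z :+ d :* (y :* w) := z :* y :+ w :* x :+ d :* (w :* y)) } }

   normQ-* : ∀ x y -> normQ (x *Q y) ≤ normQ x * normQ y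
   normQ-* (a , b) (a' , b') = begin ‖ a ⊗ a' ⊕ ι c ⊗ (b ⊗ b') ‖ + ‖ a ⊗ b' ⊕ b ⊗ a' ⊕ ι d ⊗ (b ⊗ b') ‖ ≤⟨ norm-+-≤ (norm-* a a') (norm-ι⊗ c _ >> *≤ˡ _ (0≤abs c) (norm-* b b')) ⊞ norm-+-≤ (norm-+-≤ (norm-* a b') (norm-* b a')) (norm-ι⊗ d _ >> *≤ˡ _ (0≤abs d) (norm-* b b')) ⟩
    (A * A' + ∣ c ∣ * (D * D')) + (A * D' + D * A' + ∣ d ∣ * (D * D')) ≈⟨ by 6 (\ A A' D D' c d -> A :* A' :+ c :* (D :* D') :+ (A :* D' :+ D :* A' :+ d :* (D :* D')) := A :* A' :+ A :* D' :+ D :* A' :+ (c :+ d) :* (D :* D')) ⟩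
    (A * A' + A * D' + D * A') + (∣ c ∣ + ∣ d ∣) * (D * D') ≤⟨ ≤-refl ⊞ *≤ʳ _ (*≥0 (norm≥0 b) (norm≥0 b')) small ⟩
    (A * A' + A * D' + D * A') + 1# * (D * D') ≈⟨ by 4 (\ A A' D D' -> A :* A' :+ A :* D' :+ D :* A' :+ :1 :* (D :* D') := (A :+ D) :* (A' :+ D')) ⟩
    (A + D) * (A' + D') ∎
    where
    open ≤-Reasoning
    A = ‖ a ‖
    A' = ‖ a' ‖
    D = ‖ b ‖
    D' = ‖ b' ‖

   completeQ : ∀ (s : ℕ -> Q) -> (∀ e -> 0# < e -> ∃[ M ] (∀ n -> M N.≤ n -> normQ (s n +Q (-Q s M)) ≤ e)) -> ∃[ l ] (∀ e -> 0# < e -> ∃[ M ] (∀ n -> M N.≤ n -> normQ (s n +Q (-Q l)) ≤ e))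
   completeQ s h = (fst l₁ , fst l₂) , \ e he ->
    let (M , p) = snd l₁ (e * ½) (half>0 he) ; (M' , q) = snd l₂ (e * ½) (half>0 he) in
    M N.⊔ M' , \ n le -> ≤-resp refl (half+half e) (p n (N.m⊔n≤o⇒m≤o M M' le) ⊞ q n (N.m⊔n≤o⇒n≤o M M' le))
    where
    l₁ = cauchy-complete (\ n -> fst (s n)) \ e he -> let (M , p) = h e he in M , \ n le -> x≤x+y (norm≥0 _) >> p n le
    l₂ = cauchy-complete (\ n -> snd (s n)) \ e he -> let (M , p) = h e he in M , \ n le -> x≤y+x (norm≥0 _) >> p n le

  algebra : NormedAlgebra
  algebra = record
   { ringᴮ = ringQ
   ; ‖_‖ = normQ
   ; norm-cong = \ (p , q) -> +-cong (norm-cong p) (norm-cong q)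
   ; norm-0 = +-cong norm-0 norm-0 & 0+ 0#
   ; norm-neg = \ (a , b) -> +-cong (norm-neg a) (norm-neg b)
   ; norm-+ = \ (a , b) (a' , b') -> (norm-+ a a' ⊞ norm-+ b b') >~ by 4 (\ a b c d -> a :+ b :+ (c :+ d) := a :+ c :+ (b :+ d))
   ; norm-* = normQ-*
   ; norm≥0 = \ (a , b) -> +≥0 (norm≥0 a) (norm≥0 b)
   ; definite = \ (a , b) h -> definite a (x≤x+y (norm≥0 b) >> h) , definite b (x≤y+x (norm≥0 a) >> h)
   ; ι = \ r -> ι r , 𝟘
   ; ι-cong = \ p -> ι-cong p , O.refl
   ; ι-+ = \ a b -> ι-+ a b , O.sym (O.+-identityˡ 𝟘)
   ; ι-* = \ a b -> ι-* a b ⊙ byᴮ 3 (\ a b c -> a :* b := a :* b :+ c :* (:0 :* :0)) , byᴮ 3 (\ a b d -> :0 := a :* :0 :+ :0 :* b :+ d :* (:0 :* :0))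
   ; ι-1 = ι-1 , O.refl
   ; norm-ι = \ a -> (norm-ι a ⊞ ≈⇒≤ norm-0) >~ +0 _
   ; cauchy-complete = completeQ }

  -- Componentwise convergence
  private module A = Normed algebra

  ⟶-proj₁ : ∀ {s l} -> s A.⟶ᴮ l -> (\ n -> fst (s n)) ⟶ᴮ fst l
  ⟶-proj₁ h e he = let (M , p) = h e he in M , \ n le -> x≤x+y (norm≥0 _) >> p n le

  ⟶-proj₂ : ∀ {s l} -> s A.⟶ᴮ l -> (\ n -> snd (s n)) ⟶ᴮ snd l
  ⟶-proj₂ h e he = let (M , p) = h e he in M , \ n le -> x≤y+x (norm≥0 _) >> p n le

  Σ-proj₁ : ∀ n f -> fst (A.Σᴮ n f) ≋ Σᴮ n (\ i -> fst (f i))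
  Σ-proj₁ zero f = O.refl
  Σ-proj₁ (suc n) f = O.+-congʳ (Σ-proj₁ n f)

  Σ-proj₂ : ∀ n f -> snd (A.Σᴮ n f) ≋ Σᴮ n (\ i -> snd (f i))
  Σ-proj₂ zero f = O.refl
  Σ-proj₂ (suc n) f = O.+-congʳ (Σ-proj₂ n f)

 -- The complex numbers

 open Quadratic realAlgebra (- 1#) 0# (≈⇒≤
  (+-cong (abs-neg 1# & abs≥0 0≤1) (abs≥0 ≤-refl) & +0 1#)) public using ()
  renaming (algebra to gaussian)

 module Complex where

  abstract
   complexAlgebra : NormedAlgebra
   complexAlgebra = gaussian

  open Normed complexAlgebra public
  private
   module Eℂ = Exponential complexAlgebra
   module Sℂ = ScalarExp complexAlgebra

  -- The algebra is kept abstract: only the operations below look inside it.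
  ℂ : Set
  ℂ = B

  abstract
   -- The number a + i b
   point : ℝ -> ℝ -> ℂ
   point a b = a , b

   re im : ℂ -> ℝ
   re = fst
   im = snd

   re-cong : ∀ {x y} -> x ≋ y -> re x ≈ re y
   re-cong = fst

   re-⊕ : ∀ x y -> re (x ⊕ y) ≈ re x + re y
   re-⊕ x y = refl

   re-⊝ : ∀ x y -> re (x ⊝ y) ≈ re x - re y
   re-⊝ x y = refl

   re-𝟘 : re 𝟘 ≈ 0#
   re-𝟘 = refl

   re-𝟙 : re 𝟙 ≈ 1#
   re-𝟙 = refl

   re-ι⊗ : ∀ a x -> re (ι a ⊗ x) ≈ a * re x
   re-ι⊗ a x = by 3 (\ a x y -> a :* x :+ :- :1 :* (:0 :* y) := a :* x)

   abs-re : ∀ x -> ∣ re x ∣ ≤ ‖ x ‖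
   abs-re x = x≤x+y (0≤abs _)

   norm-point : ∀ a b -> ‖ point a b ‖ ≈ ∣ a ∣ + ∣ b ∣
   norm-point a b = refl

   point-shift : ∀ a b d -> point a b ⊕ ι d ≋ point (a + d) b
   point-shift a b d = refl , +0 b

   -- The squared modulus
   sq : ℂ -> ℝ
   sq (a , b) = a * a + b * b

   sq-cong : ∀ {z z'} -> z ≋ z' -> sq z ≈ sq z'
   sq-cong (p , q) = +-cong (*-cong p p) (*-cong q q)

   sq-𝟙 : sq 𝟙 ≈ 1#
   sq-𝟙 = by 0 (:1 :* :1 :+ :0 :* :0 := :1)

   sq-* : ∀ z z' -> sq (z ⊗ z') ≈ sq z * sq z'
   sq-* (a , b) (c , d) = by 4 (\ a b c d -> (a :* c :+ :- :1 :* (b :* d)) :* (a :* c :+ :- :1 :* (b :* d)) :+ (a :* d :+ b :* c :+ :0 :* (b :* d)) :* (a :* d :+ b :* c :+ :0 :* (b :* d)) := (a :* a :+ b :* b) :* (c :* c :+ d :* d))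

   sq≥0′ : ∀ z -> 0# ≤ sq z
   sq≥0′ (a , b) = +≥0 (sq≥0 a) (sq≥0 b)

   sq-≤ : ∀ z -> sq z ≤ ‖ z ‖ * ‖ z ‖
   sq-≤ (a , b) = lin (*≥0 (#≥0 2) (*≥0 (0≤abs a) (0≤abs b))) (+ʳ (+-cong (sym (abs-sq a)) (sym (abs-sq b))) & by 2 \ a b -> a :* a :+ b :* b :+ con 2 :* (a :* b) := :0 :+ (a :+ b) :* (a :+ b))

   norm²-≤ : ∀ z -> ‖ z ‖ * ‖ z ‖ ≤ # 2 * sq z
   norm²-≤ (a , b) = lin (sq≥0 (∣ a ∣ - ∣ b ∣)) (by 2 (\ a b -> (a :+ b) :* (a :+ b) :+ (a :- b) :* (a :- b) := con 2 :* (a :* a :+ b :* b)) & *ˡ (+-cong (abs-sq a) (abs-sq b)) & sym (0+ _))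

   sq-near-1 : ∀ z -> ‖ z ⊝ 𝟙 ‖ ≤ ½ -> ½ * ½ ≤ sq z
   sq-near-1 (a , b) h = *-mono (<≤ 0<½) ½≤a (<≤ 0<½) ½≤a >> x≤x+y (sq≥0 b)
    where
    ½≈ : 1# - ½ ≈ ½
    ½≈ = +ʳ (sym (half+half 1#) & +-cong (1* _) (1* _)) & by 1 (\ h -> h :+ h :- h := h)
    ½≤a : ½ ≤ a
    ½≤a = lin (-≤abs _ >> x≤x+y (0≤abs _) >> h) (+ʳ (sym ½≈) & by 2 \ a h -> :1 :- h :+ h := :- (a :- :1) :+ a)

   private
    conj : ℂ -> ℂ
    conj (a , b) = a , - b

    Exp-conj : ∀ z -> Eℂ.Exp (conj z) ≋ conj (Eℂ.Exp z)
    Exp-conj = Eℂ.Exp-φ conj (\ (p , q) -> p , -ᶜ q) (\ x y -> refl , by 2 \ a b -> :- (a :+ b) := :- a :+ :- b)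
     (\ x y -> by 4 (\ a b c d -> a :* c :+ :- :1 :* (b :* d) := a :* c :+ :- :1 :* (:- b :* :- d)) , by 4 \ a b c d -> :- (a :* d :+ b :* c :+ :0 :* (b :* d)) := a :* :- d :+ :- b :* c :+ :0 :* (:- b :* :- d))
     (\ a -> refl , by 0 (:- :0 := :0))
     (\ x y -> ≈⇒≤ (+ˡ (abs-cong (by 2 \ a b -> :- a :- :- b := :- (a :- b)) & abs-neg _)))

   -- A nonzero complex number is invertible.
   inverse-of-complex : ∀ z {s} -> 0# < s -> s ≤ sq z -> ∃[ y ] (z ⊗ y ≋ 𝟙 × ‖ y ‖ ≤ ‖ z ‖ / s)
   inverse-of-complex z@(a , b) {s} hs h = ι r ⊗ conj z , (by 3 (\ a b r -> a :* (r :* a :+ :- :1 :* (:0 :* :- b)) :+ :- :1 :* (b :* (r :* :- b :+ :0 :* a :+ :0 :* (:0 :* :- b))) := (a :* a :+ b :* b) :* r) & inv sq>0 ,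
    by 3 \ a b r -> a :* (r :* :- b :+ :0 :* a :+ :0 :* (:0 :* :- b)) :+ b :* (r :* a :+ :- :1 :* (:0 :* :- b)) :+ :0 :* (b :* (r :* :- b :+ :0 :* a :+ :0 :* (:0 :* :- b))) := :0) , norm-ι⊗₊ (conj z) (⁻¹≥0 sq>0) >> *ˡ (+ˡ (abs-neg b)) & *-comm _ _ ~> *≤ˡ _ (norm≥0 z) (⁻¹-anti hs h)
    where
    r : ℝ
    r = sq z ⁻¹
    sq>0 : 0# < sq z
    sq>0 = <-≤-trans hs h

   -- cis θ = exp (i θ) = cos θ + i sin θ
   cis : ℝ -> ℂ
   cis θ = Eℂ.Exp (0# , θ)

   cis-cong : ∀ {x y} -> x ≈ y -> cis x ≋ cis y
   cis-cong p = Eℂ.Exp-cong (refl , p)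

   cis-0 : cis 0# ≋ 𝟙
   cis-0 = Eℂ.Exp-0

   cis-+ : ∀ x y -> cis (x + y) ≋ cis x ⊗ cis y
   cis-+ x y = O.trans {cis (x + y)} {Eℂ.Exp ((0# , x) ⊕ (0# , y))} (Eℂ.Exp-cong (sym (0+ 0#) , refl)) (Eℂ.Exp-+ (0# , x) (0# , y))

   private
    cis-neg : ∀ x -> cis (- x) ≋ conj (cis x)
    cis-neg x = Exp-conj (0# , x)

   Exp-point : ∀ ε t u -> Eℂ.Exp (⊖ (ι u ⊗ point ε t)) ≋ ι (exp (- (ε * u))) ⊗ cis (- (t * u))
   Exp-point ε t u = O.trans {Eℂ.Exp (⊖ (ι u ⊗ point ε t))} {Eℂ.Exp (ι a ⊕ (0# , b))} (Eℂ.Exp-cong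
    (by 3 (\ e t u -> :- (u :* e :+ :- :1 :* (:0 :* t)) := :- (e :* u)) & sym (+0 a) , by 3 (\ e t u -> :- (u :* t :+ :0 :* e :+ :0 :* (:0 :* t)) := :- (t :* u)) & sym (0+ b)))
    (O.trans {Eℂ.Exp (ι a ⊕ (0# , b))} {Eℂ.Exp (ι a) ⊗ cis b} (Eℂ.Exp-+ (ι a) (0# , b)) (O.*-congʳ {cis b} {Eℂ.Exp (ι a)} (Sℂ.Exp-ι a)))
    where
    a b : ℝ
    a = - (ε * u)
    b = - (t * u)

   cos sin : ℝ -> ℝ
   cos θ = re (cis θ)
   sin θ = im (cis θ)

   cos≈re : ∀ θ -> cos θ ≈ re (cis θ)
   cos≈re θ = refl

   sq-cos-sin : ∀ θ -> cos θ * cos θ + sin θ * sin θ ≈ 1#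
   sq-cos-sin θ = by 2 (\ c s -> c :* c :+ s :* s := c :* c :+ :- :1 :* (s :* :- s)) & fst (O.trans {cis θ ⊗ conj (cis θ)} {cis θ ⊗ cis (- θ)} (O.*-congˡ {cis θ} {conj (cis θ)} (O.sym {cis (- θ)} (cis-neg θ)))
    (O.trans {cis θ ⊗ cis (- θ)} {cis (θ - θ)} (O.sym {cis (θ - θ)} (cis-+ θ (- θ))) (O.trans {cis (θ - θ)} {cis 0#} (cis-cong (-‿inverseʳ θ)) cis-0)))

   norm-cis′ : ∀ θ -> ‖ cis θ ‖ ≈ ∣ cos θ ∣ + ∣ sin θ ∣
   norm-cis′ θ = refl

   cos-taylor : ∀ x -> ∣ x ∣ ≤ 1# -> ∣ cos x - 1# ∣ + ∣ sin x - x ∣ ≤ ∣ x ∣ * ∣ x ∣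
   cos-taylor x h = ≤-resp (+-cong (abs-cong (by 1 \ c -> c :- :1 :- :0 := c :- :1)) (abs-cong (by 2 \ s x -> s :- :0 :- x := s :- x))) (*-cong eq eq) (Eℂ.Exp-taylor (0# , x) (≤-resp (sym eq) refl h))
    where eq : ‖ point 0# x ‖ ≈ ∣ x ∣
          eq = +ʳ (abs≥0 ≤-refl) & 0+ _

   cos-cong : ∀ {x y} -> x ≈ y -> cos x ≈ cos y
   cos-cong p = fst (cis-cong p)

   cos-0 : cos 0# ≈ 1#
   cos-0 = fst cis-0

   cos-neg : ∀ x -> cos (- x) ≈ cos x
   cos-neg x = fst (cis-neg x)

   sin-neg : ∀ x -> sin (- x) ≈ - sin x
   sin-neg x = snd (cis-neg x)

   cos-+ : ∀ x y -> cos (x + y) ≈ cos x * cos y - sin x * sin y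
   cos-+ x y = fst (cis-+ x y) & by 4 (\ a b c d -> a :* b :+ :- :1 :* (c :* d) := a :* b :- c :* d)

   -- One minus a multiple of cis (- θ)
   re-1- : ∀ r θ -> re (𝟙 ⊝ ι r ⊗ cis (- θ)) ≈ 1# - r * cos θ
   re-1- r θ = +ˡ (-ᶜ (re-ι⊗ r (cis (- θ)))) & +ˡ (-ᶜ (*ˡ (cos-neg θ)))

   sq-1- : ∀ r θ -> sq (𝟙 ⊝ ι r ⊗ cis (- θ)) ≈ 1# - # 2 * r * cos θ + r * r
   sq-1- r θ = begin sq (𝟙 ⊝ ι r ⊗ cis (- θ)) ≈⟨ by 3 (\ r c s -> (:1 :- (r :* c :+ :- :1 :* (:0 :* s))) :* (:1 :- (r :* c :+ :- :1 :* (:0 :* s))) :+ (:0 :- (r :* s :+ :0 :* c :+ :0 :* (:0 :* s))) :* (:0 :- (r :* s :+ :0 :* c :+ :0 :* (:0 :* s))) := :1 :- con 2 :* r :* c :+ r :* r :* (c :* c :+ s :* s)) ⟩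
    1# - # 2 * r * cos (- θ) + r * r * (cos (- θ) * cos (- θ) + sin (- θ) * sin (- θ)) ≈⟨ +-cong (+ˡ (-ᶜ (*ˡ (cos-neg θ)))) (*ˡ (sq-cos-sin (- θ)) & *1 _) ⟩
    1# - # 2 * r * cos θ + r * r ∎
    where open SetoidReasoning setoid

  sq≤1⇒abs≤1 : ∀ {x} -> x * x ≤ 1# -> ∣ x ∣ ≤ 1#
  sq≤1⇒abs≤1 {x} h = by-contradiction \ lt -> <⇒≱ (<-≤-trans lt (≤-resp (*1 _) refl (*≤ˡ _ (0≤abs x) (<≤ lt)))) (abs-sq x ~> h)

  abs-cos≤1 : ∀ θ -> ∣ cos θ ∣ ≤ 1#
  abs-cos≤1 θ = sq≤1⇒abs≤1 (x≤x+y (sq≥0 (sin θ)) >~ sq-cos-sin θ)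

  abs-sin≤1 : ∀ θ -> ∣ sin θ ∣ ≤ 1#
  abs-sin≤1 θ = sq≤1⇒abs≤1 (x≤y+x (sq≥0 (cos θ)) >~ sq-cos-sin θ)

  norm-cis : ∀ θ -> ‖ cis θ ‖ ≤ # 2
  norm-cis θ = norm-cis′ θ ~> (abs-cos≤1 θ ⊞ abs-sin≤1 θ) >~ by 0 (:1 :+ :1 := con 2)

  cos-sub : ∀ x y -> cos (x - y) ≈ cos x * cos y + sin x * sin y
  cos-sub x y = cos-+ x (- y) & +-cong (*ˡ (cos-neg y)) (-ᶜ (*ˡ (sin-neg y))) & by 4 (\ a b c d -> a :* b :- c :* :- d := a :* b :+ c :* d)

  -- Product to sum
  cos-cos : ∀ x y -> cos x * cos y ≈ (cos (x + y) + cos (x - y)) * ½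
  cos-cos x y = sym (*ʳ (+-cong (cos-+ x y) (cos-sub x y)) & by 5 (\ a b c d h -> (a :* b :- c :* d :+ (a :* b :+ c :* d)) :* h := a :* b :* (con 2 :* h)) & *ˡ 2½ & *1 _)

 -- Logarithms of integers

 -- Sequences are indexed so that the term of index n belongs to the integer n + 1.
 L : ℕ -> ℝ
 L n = log (# (suc n))

 -- The reciprocal of n + 1
 recip : ℕ -> ℝ
 recip n = # (suc n) ⁻¹

 recip>0 : ∀ n -> 0# < recip n
 recip>0 n = ⁻¹>0 (#>0 n)

 recip≥0 : ∀ n -> 0# ≤ recip n
 recip≥0 n = <≤ (recip>0 n)

 recip-mono : ∀ {m n} -> m N.≤ n -> recip n ≤ recip m
 recip-mono {m} le = ⁻¹-anti (#>0 m) (#-mono (N.s≤s le))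

 recip≤1 : ∀ n -> recip n ≤ 1#
 recip≤1 n = ⁻¹-anti 0<1 (1≤# n) >~ 1⁻¹

 suc*recip : ∀ n -> # (suc n) * recip n ≈ 1#
 suc*recip n = inv (#>0 n)

 L≥0 : ∀ n -> 0# ≤ L n
 L≥0 n = log≥0 (1≤# n)

 L-mono : ∀ {m n} -> m N.≤ n -> L m ≤ L n
 L-mono {m} le = log-mono (#>0 m) (#-mono (N.s≤s le))

 exp-L : ∀ n -> exp (L n) ≈ # (suc n)
 exp-L n = exp-log (#>0 n)

 exp-neg-L : ∀ n -> exp (- L n) ≈ recip n
 exp-neg-L n = exp-neg _ & ⁻¹-cong (exp-L n)

 L-0 : L 0 ≈ 0#
 L-0 = log-cong (#>0 0) #-1 & log-1

 L-* : ∀ {k m n} -> suc k ≡ suc m N.* suc n -> L k ≈ L m + L n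
 L-* {k} {m} {n} eq = log-cong (#>0 k) (reflexive (E.cong # eq) & #-* (suc m) (suc n)) & log-* (#>0 m) (#>0 n)

 recip-* : ∀ {k m n} -> suc k ≡ suc m N.* suc n -> recip k ≈ recip m * recip n
 recip-* {k} {m} {n} eq = ⁻¹-cong (reflexive (E.cong # eq) & #-* (suc m) (suc n)) & ⁻¹-* (#>0 m) (#>0 n)

 -- δ n = log ((n + 2)/(n + 1))
 δ : ℕ -> ℝ
 δ n = L (suc n) - L n

 δ-ratio : ∀ n -> δ n ≈ log (# (suc (suc n)) / # (suc n))
 δ-ratio n = sym (log-/ (#>0 (suc n)) (#>0 n))

 δ≤recip : ∀ n -> δ n ≤ recip n
 δ≤recip n = δ-ratio n ~> log-≤ (/>0 (#>0 (suc n)) (#>0 n)) >~ +ʳ (distribʳ _ _ _ & +-cong (1* _) (suc*recip n)) & by 1 (\ r -> r :+ :1 :- :1 := r)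

 recip≤δ : ∀ n -> recip (suc n) ≤ δ n
 recip≤δ n = (begin recip (suc n) ≈⟨ by 1 (\ r -> r := :1 :- (:1 :- r)) ⟩ 1# - (1# - recip (suc n)) ≈⟨ +ˡ (-ᶜ (+ʳ (sym (suc*recip (suc n))))) ⟩
  1# - (# (suc (suc n)) * recip (suc n) - recip (suc n)) ≈⟨ by 2 (\ f r -> :1 :- ((:1 :+ f) :* r :- r) := :1 :- f :* r) ⟩
  1# - # (suc n) * recip (suc n) ≈⟨ +ˡ (-ᶜ (*ʳ (sym (⁻¹⁻¹ (#>0 n))))) ⟩
  1# - recip n ⁻¹ * recip (suc n) ≈⟨ +ˡ (-ᶜ (*-comm _ _ & sym (⁻¹-* (#>0 (suc n)) (recip>0 n)))) ⟩
  1# - (# (suc (suc n)) / # (suc n)) ⁻¹ ∎) ~> ≤-log (/>0 (#>0 (suc n)) (#>0 n)) >~ sym (δ-ratio n)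
  where open SetoidReasoning setoid

 δ≥0 : ∀ n -> 0# ≤ δ n
 δ≥0 n = recip≥0 (suc n) >> recip≤δ n

 δ≤1 : ∀ n -> δ n ≤ 1#
 δ≤1 n = δ≤recip n >> recip≤1 n

 -- Powers of 1 + u are dominated by exponentials; the constant depends on the exponents only.
 expBound : ℕ -> ℝ -> ℝ
 expBound κ d = exp d / t κ d

 t>0 : ∀ k {x} -> 0# < x -> 0# < t k x
 t>0 zero h = 0<1
 t>0 (suc k) h = *>0 (recip>0 k) (*>0 h (t>0 k h))

 t-cong : ∀ k {x y} -> x ≈ y -> t k x ≈ t k y
 t-cong zero p = refl
 t-cong (suc k) p = *ˡ (*-cong p (t-cong k p))

 t-* : ∀ k x y -> t k (x * y) ≈ x ^ k * t k y
 t-* zero x y = sym (1* _)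
 t-* (suc k) x y = *ˡ (*ˡ (t-* k x y)) & by 5 (\ r x y p s -> r :* (x :* y :* (p :* s)) := x :* p :* (r :* (y :* s)))

 expBound>0 : ∀ κ {d} -> 0# < d -> 0# < expBound κ d
 expBound>0 κ h = />0 (exp>0 _) (t>0 κ h)

 power≤exp : ∀ κ {d u} -> 0# < d -> 0# ≤ u -> (1# + u) ^ κ ≤ expBound κ d * exp (d * u)
 power≤exp κ {d} {u} h hu = *-cancelˡ-≤ (t κ d) (t>0 κ h) (begin t κ d * (1# + u) ^ κ ≈⟨ *-comm _ _ & sym (t-* κ (1# + u) d) ⟩
  t κ ((1# + u) * d) ≤⟨ t-≤-exp κ (*≥0 (+≥0 0≤1 hu) (<≤ h)) ⟩
  exp ((1# + u) * d) ≈⟨ exp-cong (by 2 \ u d -> (:1 :+ u) :* d := d :+ d :* u) ⟩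
  exp (d + d * u) ≈⟨ exp-+ _ _ ⟩
  exp d * exp (d * u) ≈⟨ *ʳ (sym (*-comm _ _ & /-cancel (t>0 κ h))) ⟩
  (t κ d * expBound κ d) * exp (d * u) ≈⟨ *-assoc _ _ _ ⟩
  t κ d * (expBound κ d * exp (d * u)) ∎)
  where open ≤-Reasoning

 -- n ↦ (n + 1)^(-d)
 decay : ℝ -> ℕ -> ℝ
 decay d n = exp (- (d * L n))

 decay≥0 : ∀ d n -> 0# ≤ decay d n
 decay≥0 d n = exp≥0 _

 decay≤1 : ∀ {d} n -> 0# ≤ d -> decay d n ≤ 1#
 decay≤1 {d} n h = exp-neg≤1 (*≥0 h (L≥0 n))

 -- (n + 2)^(-1-d) ≤ ((n + 1)^(-d) - (n + 2)^(-d)) / d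
 decay-step : ∀ {d} n -> 0# ≤ d -> d * (recip (suc n) * decay d (suc n)) ≤ decay d n - decay d (suc n)
 decay-step {d} n h = lin (*≤ʳ _ (decay≥0 d (suc n)) (+-monoʳ-≤ 1# (*≤ˡ d h (recip≤δ n)) >> 1+x≤exp (d * δ n)) >~ sym (exp-+ _ _) & exp-cong (by 3 \ d a b -> d :* (b :- a) :+ :- (d :* b) := :- (d :* a)))
  (by 4 \ d r x y -> d :* (r :* y) :+ x := (:1 :+ d :* r) :* y :+ (x :- y))

 decay-sum : ∀ {d} -> 0# < d -> ∀ m n -> Σ n (\ i -> recip (suc m N.+ i) * decay d (suc m N.+ i)) ≤ decay d m / d
 decay-sum {d} h m n = ≤-/ h (begin Σ n (\ i -> f i) * d ≈⟨ *-comm _ _ & sym (Σ-* n d f) ⟩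
  Σ n (\ i -> d * f i) ≤⟨ Σ-mono′ n (\ i -> decay-step (m N.+ i) (<≤ h)) ⟩
  Σ n (\ i -> decay d (m N.+ i) - decay d (suc (m N.+ i))) ≈⟨ Σ-cong′ n (\ i -> +ˡ (-ᶜ (reflexive (E.cong (decay d) (E.sym (N.+-suc m i)))))) ⟩
  Σ n (\ i -> decay d (m N.+ i) - decay d (m N.+ suc i)) ≈⟨ Σ-telescope n (\ i -> decay d (m N.+ i)) ⟩
  decay d (m N.+ 0) - decay d (m N.+ n) ≤⟨ lin (decay≥0 d (m N.+ n)) (by 2 \ a b -> a :- b :+ b := :0 :+ a) ⟩
  decay d (m N.+ 0) ≡⟨ E.cong (decay d) (N.+-identityʳ m) ⟩
  decay d m ∎)
  where open ≤-Reasoning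
        f : ℕ -> ℝ
        f i = recip (suc m N.+ i) * decay d (suc m N.+ i)

 -- Sums of (i + 1)^(-1-d)
 decay-total : ∀ {d} -> 0# < d -> ∀ n -> Σ n (\ i -> recip i * decay d i) ≤ 1# + d ⁻¹
 decay-total {d} h zero = +≥0 0≤1 (⁻¹≥0 h)
 decay-total {d} h (suc n) = Σ-front n _ ~> (first ⊞ decay-sum h 0 n >> *≤ʳ _ (⁻¹≥0 h) (decay≤1 0 (<≤ h)) >~ 1* _)
  where first : recip 0 * decay d 0 ≤ 1#
        first = *-mono (recip≥0 0) (recip≤1 0) (decay≥0 d 0) (decay≤1 0 (<≤ h)) >~ 1* _

 -- L n tends to infinity.
 L-unbounded : ∀ x -> ∃[ N ] (∀ n -> N N.≤ n -> x ≤ L n)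
 L-unbounded x = let (N , h) = archimedean (exp x) in N , \ n le ->
  exp-≤-log (#>0 n) (<≤ h >> #-mono (N.m≤n⇒m≤1+n le))

 decay-null : ∀ {d} -> 0# < d -> ∀ e -> 0# < e -> ∃[ N ] (∀ n -> N N.≤ n -> decay d n ≤ e)
 decay-null {d} h e he = let (N , p) = L-unbounded ((d * e) ⁻¹) in N , \ n le ->
  let x = d * L n
      e⁻¹≤x = sym (1* _) & *ʳ (sym (inv h)) & *-assoc _ _ _ & *ˡ (sym (⁻¹-* h he)) ~> *≤ˡ d (<≤ h) (p n le)
  in exp-neg x ~> ⁻¹-anti (⁻¹>0 he) (e⁻¹≤x >> x≤y+x 0≤1 >> 1+x≤exp x) >~ ⁻¹⁻¹ he

 -- Harmonic sums
 harmonic≤ : ∀ n -> Σ (suc n) recip ≤ 1# + L n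
 harmonic≤ zero = lin (L≥0 0 ⊞ recip≤1 0) (by 2 \ l r -> :0 :+ r :+ (l :+ :1) := :0 :+ r :+ (:1 :+ l))
 harmonic≤ (suc n) = (harmonic≤ n ⊞ recip≤δ n) >~ by 2 (\ a b -> :1 :+ a :+ (b :- a) := :1 :+ b)

 -- Characters and their zeta functions

 -- A character E of the additive reals with values in N, behaving like u ↦ exp (- w u):
 -- it has decay rate ε up to a power of u, and D controls its behaviour near 0.
 record Character (N : NormedAlgebra) (ε D C : ℝ) (κ : ℕ) : Set where
  open Normed N
  field
   -- Multiplicative in u, with derivative - w at 0
   E : ℝ -> B
   w : B
   E-cong : ∀ {u v} -> u ≈ v -> E u ≋ E v
   E-0 : E 0# ≋ 𝟙
   E-+ : ∀ u v -> E (u + v) ≋ E u ⊗ E v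
   E-bound : ∀ {u} -> 0# ≤ u -> ‖ E u ‖ ≤ C * ((1# + u) ^ κ * exp (- (ε * u)))
   w-bound : ‖ w ‖ ≤ D
   E-first-order : ∀ {u} -> 0# ≤ u -> u ≤ 1# -> ‖ 𝟙 ⊝ E u ⊝ ι u ⊗ w ‖ ≤ D * (u * u)

 -- The divided difference ring N[j] with j² = d j, for 0 ≤ d ≤ 1; dual numbers for d = 0.
 module Divided (N : NormedAlgebra) (d : ℝ) (0≤d : 0# ≤ d) (d≤1 : d ≤ 1#) where
  open Quadratic N 0# d (+-cong (abs≥0 ≤-refl) (abs≥0 0≤d) & 0+ d ~> d≤1) public

 -- A function g with 1 + d g(u) multiplicative, normalised by g(u) = - u + O(u²).
 record Increment (d : ℝ) : Set where
  field
   g : ℝ -> ℝ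
   g-cong : ∀ {u v} -> u ≈ v -> g u ≈ g v
   g-+ : ∀ u v -> g (u + v) ≈ g u + g v + d * (g u * g v)
   g-0 : g 0# ≈ 0#
   g-bound : ∀ {u} -> 0# ≤ u -> ∣ g u ∣ ≤ u
   g-first-order : ∀ {u} -> 0# ≤ u -> u ≤ 1# -> ∣ g u + u ∣ ≤ u * u

 linearIncrement : Increment 0#
 linearIncrement = record
  { g = \ u -> - u
  ; g-cong = -ᶜ
  ; g-+ = \ u v -> by 2 (\ u v -> :- (u :+ v) := :- u :+ :- v :+ :0 :* (:- u :* :- v))
  ; g-0 = by 0 (:- :0 := :0)
  ; g-bound = \ {u} h -> ≈⇒≤ (abs-neg u & abs≥0 h)
  ; g-first-order = \ {u} _ _ -> abs-cong (-‿inverseˡ u) & abs≥0 ≤-refl ~> sq≥0 u }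

 -- The character u ↦ E(u) (1 + g(u) j) of N[j].
 module Extend {N : NormedAlgebra} {ε D C : ℝ} {κ : ℕ} (χ : Character N ε D C κ) (0≤ε : 0# ≤ ε) (0≤C : 0# ≤ C)
  (d : ℝ) (0≤d : 0# ≤ d) (d≤1 : d ≤ 1#) (inc : Increment d) where
  open Normed N
  open Character χ
  open Increment inc
  private
   module Q = NormedAlgebra (Divided.algebra N d 0≤d d≤1)
   0≤D = norm≥0 w >> w-bound

   E-near-0 : ∀ {u} -> 0# ≤ u -> u ≤ 1# -> ‖ E u ‖ ≤ C * # 2 ^ κ
   E-near-0 {u} h h1 = E-bound h >> *≤ˡ C 0≤C (*-mono (^≥0 κ (+≥0 0≤1 h)) (^-mono κ (+≥0 0≤1 h) (lin h1 (by 1 \ u -> :1 :+ u :+ :1 := u :+ con 2)))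
    (exp≥0 _) (exp-neg≤1 (*≥0 0≤ε h)) >~ *1 _)

   E-1 : ∀ {u} -> 0# ≤ u -> u ≤ 1# -> ‖ E u ⊝ 𝟙 ‖ ≤ # 2 * D * u
   E-1 {u} h h1 = begin ‖ E u ⊝ 𝟙 ‖ ≈⟨ norm-cong (byᴮ 2 \ e x -> e :- :1 := :- (:1 :- e :- x :+ x)) & norm-neg _ ⟩ ‖ 𝟙 ⊝ E u ⊝ ι u ⊗ w ⊕ ι u ⊗ w ‖ ≤⟨ norm-+-≤ (E-first-order h h1) (norm-ι⊗₊ w h >> *≤ˡ u h w-bound) ⟩
    D * (u * u) + u * D ≤⟨ lin (*≥0 (*≥0 0≤D h) (sub≥0 h1)) (by 2 \ D u -> D :* (u :* u) :+ u :* D :+ D :* u :* (:1 :- u) := :0 :+ con 2 :* D :* u) ⟩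
    # 2 * D * u ∎
    where open ≤-Reasoning

  extend : Character (Divided.algebra N d 0≤d d≤1) ε (# 3 * D + C * # 2 ^ κ + 1#) C (suc κ)
  extend = record
   { E = \ u -> E u , ι (g u) ⊗ E u
   ; w = w , 𝟙
   ; E-cong = \ p -> E-cong p , O.*-cong (ι-cong (g-cong p)) (E-cong p)
   ; E-0 = E-0 , O.*-congʳ (ι-cong g-0 ⊙ ι-0) ⊙ O.zeroˡ _
   ; E-+ = \ u v -> E-+ u v ⊙ byᴮ 4 (\ a b x y -> a :* b := a :* b :+ :0 :* (x :* a :* (y :* b))) ⊙ O.+-congˡ (O.*-congʳ (O.sym ι-0)) , O.*-cong (ι-cong (g-+ u v) ⊙ ι-+ _ _ ⊙ O.+-cong (ι-+ _ _) (ι-* _ _ ⊙ O.*-congˡ (ι-* _ _))) (E-+ u v) ⊙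
    byᴮ 5 (\ a b x y d -> (x :+ y :+ d :* (x :* y)) :* (a :* b) := a :* (y :* b) :+ x :* a :* b :+ d :* (x :* a :* (y :* b)))
   ; E-bound = \ {u} h -> let e = exp (- (ε * u)) ; p = (1# + u) ^ κ in begin
    ‖ E u ‖ + ‖ ι (g u) ⊗ E u ‖ ≤⟨ ≤-refl ⊞ norm-ι⊗ (g u) (E u) >> *≤ʳ _ (norm≥0 _) (g-bound h) ⟩
    ‖ E u ‖ + u * ‖ E u ‖ ≈⟨ by 2 (\ x u -> x :+ u :* x := (:1 :+ u) :* x) ⟩
    (1# + u) * ‖ E u ‖ ≤⟨ *≤ˡ _ (+≥0 0≤1 h) (E-bound h) ⟩
    (1# + u) * (C * (p * e)) ≈⟨ by 4 (\ x c p e -> x :* (c :* (p :* e)) := c :* (x :* p :* e)) ⟩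
    C * ((1# + u) * p * e) ∎
   ; w-bound = (w-bound ⊞ norm-1) >> lin (+≥0 (*≥0 (#≥0 2) 0≤D) C2) (by 2 \ D c -> D :+ :1 :+ (con 2 :* D :+ c) := :0 :+ (con 3 :* D :+ c :+ :1))
   ; E-first-order = \ {u} h h1 -> begin ‖ 𝟙 ⊝ E u ⊝ (ι u ⊗ w ⊕ ι 0# ⊗ (𝟘 ⊗ 𝟙)) ‖ + ‖ 𝟘 ⊝ ι (g u) ⊗ E u ⊝ (ι u ⊗ 𝟙 ⊕ 𝟘 ⊗ w ⊕ ι d ⊗ (𝟘 ⊗ 𝟙)) ‖ ≈⟨ +-cong (norm-cong (byᴮ 3 \ e x z -> :1 :- e :- (x :+ z :* (:0 :* :1)) := :1 :- e :- x))
    (norm-cong (byᴮ 5 (\ e g u d w -> :0 :- g :* e :- (u :* :1 :+ :0 :* w :+ d :* (:0 :* :1)) := u :* (e :- :1) :- (g :+ u) :* e) ⊙ O.+-congˡ (O.-‿cong (O.*-congʳ (O.sym (ι-+ _ _)))))) ⟩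
    ‖ 𝟙 ⊝ E u ⊝ ι u ⊗ w ‖ + ‖ ι u ⊗ (E u ⊝ 𝟙) ⊝ ι (g u + u) ⊗ E u ‖ ≤⟨ E-first-order h h1 ⊞ norm-sub _ _ >> (norm-ι⊗₊ _ h >> *≤ˡ u h (E-1 h h1) ⊞ norm-ι⊗ _ _ >> *-mono (0≤abs _) (g-first-order h h1) (norm≥0 _) (E-near-0 h h1)) ⟩
    D * (u * u) + (u * (# 2 * D * u) + u * u * (C * # 2 ^ κ)) ≤⟨ lin (sq≥0 u) (by 3 \ D u c -> D :* (u :* u) :+ (u :* (con 2 :* D :* u) :+ u :* u :* c) :+ u :* u := :0 :+ (con 3 :* D :+ c :+ :1) :* (u :* u)) ⟩
    (# 3 * D + C * # 2 ^ κ + 1#) * (u * u) ∎ }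
   where
   open ≤-Reasoning
   C2 = *≥0 0≤C (^≥0 κ (#≥0 2))

 -- The series of the E(log n)/n.
 module Zeta {N : NormedAlgebra} {ε D C : ℝ} {κ : ℕ} (χ : Character N ε D C κ)
  (0<ε : 0# < ε) (0≤C : 0# ≤ C) where
  open Normed N
  open NormedSeries N
  open Character χ

  0≤D = norm≥0 w >> w-bound

  z : ℕ -> B
  z n = ι (recip n) ⊗ E (L n)

  z-* : ∀ {k m n} -> suc k ≡ suc m N.* suc n -> z k ≋ z m ⊗ z n
  z-* {k} {m} {n} eq = O.*-cong (ι-cong (recip-* {k} {m} {n} eq) ⊙ ι-* _ _) (E-cong (L-* {k} {m} {n} eq) ⊙ E-+ _ _) ⊙ byᴮ 4 (\ a b c d -> a :* b :* (c :* d) := a :* c :* (b :* d))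

  z-0 = O.*-cong (ι-cong (⁻¹-cong #-1 & 1⁻¹) ⊙ ι-1) (E-cong L-0 ⊙ E-0) ⊙ O.*-identityˡ 𝟙

  E-L-bound : ∀ {d} -> 0# < d -> ∀ n -> ‖ E (L n) ‖ ≤ C * expBound κ d * (exp (d * L n) * exp (- (ε * L n)))
  E-L-bound h n = E-bound (L≥0 n) >> *≤ˡ C 0≤C (*≤ʳ _ (exp≥0 _) (power≤exp κ h (L≥0 n))) >~ by 4 (\ c a b e -> c :* (a :* b :* e) := c :* a :* (b :* e))

  0<ε/2 = half>0 0<ε

  -- ‖E(log n)‖ is at most a constant times n^(-ε/2).
  E-decay : ∀ n -> ‖ E (L n) ‖ ≤ C * expBound κ (ε * ½) * decay (ε * ½) n
  E-decay n = E-L-bound 0<ε/2 n >~ *ˡ (sym (exp-+ _ _) & exp-cong (+ˡ (-ᶜ (*ʳ (sym (half+half ε)))) & by 2 \ e l -> e :* l :- (e :+ e) :* l := :- (e :* l)))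

  C′ : ℝ
  C′ = C * expBound κ (ε * ½)

  0≤C′ = *≥0 0≤C (<≤ (expBound>0 κ 0<ε/2))

  majorant : ℕ -> ℝ
  majorant n = C′ * (recip n * decay (ε * ½) n)

  norm-z-E : ∀ n -> ‖ z n ‖ ≤ recip n * ‖ E (L n) ‖
  norm-z-E n = norm-ι⊗₊ _ (recip≥0 n)

  norm-z : ∀ n -> ‖ z n ‖ ≤ majorant n
  norm-z n = norm-z-E n >> *≤ˡ _ (recip≥0 n) (E-decay n) >~ by 3 (\ r c d -> r :* (c :* d) := c :* (r :* d))

  majorant-sum : ∀ n -> Σ n majorant ≤ C′ * (1# + (ε * ½) ⁻¹)
  majorant-sum n = Σ-* n C′ _ ~> *≤ˡ C′ 0≤C′ (decay-total 0<ε/2 n)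

  majorant≥0 : ∀ n -> 0# ≤ majorant n
  majorant≥0 n = *≥0 0≤C′ (*≥0 (recip≥0 n) (decay≥0 _ n))

  abstract
   -- The sum of the series
   Z : B
   Z = fst (majorised z majorant _ norm-z majorant-sum)

   Z-series : (\ n -> Σᴮ n z) ⟶ᴮ Z
   Z-series = snd (majorised z majorant _ norm-z majorant-sum)

  E-null : (\ n -> E (L n)) ⟶ᴮ 𝟘
  E-null e he = let (M , p) = decay-null 0<ε/2 (e / (C′ + 1#)) (/>0 he hc) in M , \ n le ->
   norm-cong (byᴮ 1 \ x -> x :- :0 := x) ~> E-decay n >> *-mono 0≤C′ (x≤x+y 0≤1) (decay≥0 _ n) (p n le) >~ *-comm _ _ & /-cancel hc
   where hc = +≥> 0≤C′ 0<1

  -- w z(n) is E(log n) - E(log (n + 1)) up to an error a(n) of order n^(-2).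
  a : ℕ -> B
  a n = w ⊗ z n ⊝ (E (L n) ⊝ E (L (suc n)))

  a≋ : ∀ n -> a n ≋ z n ⊗ (w ⊝ ι (# (suc n)) ⊗ (𝟙 ⊝ E (δ n)))
  a≋ n = begin w ⊗ z n ⊝ (E (L n) ⊝ E (L (suc n))) ≈⟨ O.+-congˡ (O.-‿cong (O.+-congˡ (O.-‿cong (E-cong (by 2 \ a b -> b := a :+ (b :- a)) ⊙ E-+ (L n) (δ n))))) ⟩
   w ⊗ (r ⊗ e) ⊝ (e ⊝ e ⊗ E (δ n)) ≈⟨ byᴮ 4 (\ w r e d -> w :* (r :* e) :- (e :- e :* d) := w :* (r :* e) :- :1 :* (e :* (:1 :- d))) ⟩
   w ⊗ (r ⊗ e) ⊝ 𝟙 ⊗ (e ⊗ (𝟙 ⊝ E (δ n))) ≈⟨ O.+-congˡ (O.-‿cong (O.*-congʳ (O.sym (O.sym (ι-* _ _) ⊙ ι-cong (suc*recip n) ⊙ ι-1)))) ⟩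
   w ⊗ (r ⊗ e) ⊝ ι (# (suc n)) ⊗ r ⊗ (e ⊗ (𝟙 ⊝ E (δ n))) ≈⟨ byᴮ 5 (\ w r e d n -> w :* (r :* e) :- n :* r :* (e :* (:1 :- d)) := r :* e :* (w :- n :* (:1 :- d))) ⟩
   z n ⊗ (w ⊝ ι (# (suc n)) ⊗ (𝟙 ⊝ E (δ n))) ∎
   where
   open ≋-Reasoning
   r = ι (recip n)
   e = E (L n)

  a-factor : ∀ n -> ‖ w ⊝ ι (# (suc n)) ⊗ (𝟙 ⊝ E (δ n)) ‖ ≤ # 2 * D * recip n
  a-factor n = begin ‖ w ⊝ ι s ⊗ (𝟙 ⊝ E d) ‖ ≈⟨ norm-cong (byᴮ 4 (\ w s e d -> w :- s :* (:1 :- e) := (:1 :- s :* d) :* w :- s :* (:1 :- e :- d :* w)) ⊙ O.+-congʳ (O.*-congʳ (O.sym (ι-sub _ _ ⊙ O.+-cong ι-1 (O.-‿cong (ι-* _ _)))))) ⟩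
   ‖ ι (1# - s * d) ⊗ w ⊝ ι s ⊗ (𝟙 ⊝ E d ⊝ ι d ⊗ w) ‖ ≤⟨ norm-sub _ _ >> (norm-ι⊗₊ _ (sub≥0 sd≤1) >> *-mono (sub≥0 sd≤1) 1-sd (norm≥0 w) w-bound ⊞ norm-ι⊗₊ _ (#≥0 (suc n)) >> *≤ˡ s (#≥0 (suc n)) (E-first-order (δ≥0 n) (δ≤1 n) >> *≤ˡ D 0≤D (*-mono (δ≥0 n) (δ≤recip n) (δ≥0 n) (δ≤recip n)))) ⟩
   recip n * D + s * (D * (recip n * recip n)) ≈⟨ by 3 (\ r D s -> r :* D :+ s :* (D :* (r :* r)) := r :* D :+ s :* r :* (D :* r)) & +ˡ (*ʳ (suc*recip n)) ⟩
   recip n * D + 1# * (D * recip n) ≈⟨ by 2 (\ r D -> r :* D :+ :1 :* (D :* r) := con 2 :* D :* r) ⟩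
   # 2 * D * recip n ∎
   where
   open ≤-Reasoning
   s = # (suc n)
   d = δ n
   sd≤1 = *≤ˡ s (#≥0 (suc n)) (δ≤recip n) >~ suc*recip n
   1-sd = lin (*≤ˡ s (#≥0 (suc n)) (recip≤δ n)) (by 3 (\ s d r -> :1 :- s :* d :+ s :* d := s :* r :+ (:1 :- s :* r)) & refl) >> +ʳ (sym (suc*recip (suc n))) & by 2 (\ s r -> (:1 :+ s) :* r :- s :* r := r) ~> recip-mono (N.n≤1+n n)

  A : ℝ
  A = expBound κ ½

  a-majorant : ℕ -> ℝ
  a-majorant n = # 2 * D * (C * A) * (recip n * decay ½ n)

  norm-a : ∀ n -> ‖ a n ‖ ≤ a-majorant n
  norm-a n = begin ‖ a n ‖ ≈⟨ norm-cong (a≋ n) ⟩ ‖ z n ⊗ _ ‖ ≤⟨ norm-*-≤ (norm-z-E n >> *≤ˡ _ (recip≥0 n) bound) (a-factor n) ⟩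
   (recip n * (C * A * exp (½ * L n))) * (# 2 * D * recip n) ≈⟨ by 5 (\ r c e D s -> r :* (c :* e) :* (con 2 :* D :* s) := con 2 :* D :* c :* (r :* (e :* s))) ⟩
   # 2 * D * (C * A) * (recip n * (exp (½ * L n) * recip n)) ≈⟨ *ˡ (*ˡ (*ˡ (sym (exp-neg-L n)) & sym (exp-+ _ _) & exp-cong
    (+ˡ (-ᶜ (sym (half+half (L n)))) & by 2 \ h l -> h :* l :- (l :* h :+ l :* h) := :- (h :* l)))) ⟩
   a-majorant n ∎
   where
   open ≤-Reasoning
   bound = E-L-bound 0<½ n >> *≤ˡ _ (*≥0 0≤C (<≤ (expBound>0 κ 0<½))) (*≤ˡ _ (exp≥0 _) (decay≤1 n (<≤ 0<ε)) >~ *1 _)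

  0≤DCA = *≥0 (*≥0 (#≥0 2) 0≤D) (*≥0 0≤C (<≤ (expBound>0 κ 0<½)))

  ½⁻¹ = ⁻¹⁻¹ (#>0 1)

  a-sum : ∀ n -> Σ n a-majorant ≤ # 2 * D * (C * A) * # 3
  a-sum n = Σ-* n _ _ ~> *≤ˡ _ 0≤DCA (decay-total 0<½ n >~ +ˡ ½⁻¹)

  a-tail-sum : ∀ m n -> Σ n (\ i -> a-majorant (suc m N.+ i)) ≤ # 2 * D * (C * A) * (decay ½ m * # 2)
  a-tail-sum m n = Σ-* n _ _ ~> *≤ˡ _ 0≤DCA (decay-sum 0<½ m n >~ *ˡ ½⁻¹)

  Σ-a : ∀ n -> Σᴮ n a ≋ w ⊗ Σᴮ n z ⊝ (𝟙 ⊝ E (L n))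
  Σ-a n = Σᴮ-sub n _ _ ⊙ O.+-cong (Σᴮ-* n w z) (O.-‿cong (Σᴮ-telescope n (\ i -> E (L i)) ⊙ O.+-congʳ (E-cong L-0 ⊙ E-0)))

  a-series : (\ n -> Σᴮ n a) ⟶ᴮ w ⊗ Z ⊝ 𝟙
  a-series = ⟶-cong (\ n -> O.sym (Σ-a n)) (byᴮ 1 \ x -> x :- (:1 :- :0) := x :- :1)
   (⟶-sub (⟶-scale w Z-series) (⟶-sub (⟶-const {a = \ _ -> 𝟙} (\ _ -> O.refl)) E-null))

  wZ-bound = norm-cong (byᴮ 1 \ x -> x := x :- :0) ~> tail-bound 0 a-series norm-a a-sum

  -- The tail of the series times w.
  wZ-tail : ∀ m -> ‖ w ⊗ (Z ⊝ Σᴮ (suc m) z) ⊝ E (L (suc m)) ‖ ≤ # 2 * D * (C * A) * (decay ½ m * # 2)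
  wZ-tail m = norm-cong (byᴮ 4 (\ w Z s e -> w :* (Z :- s) :- e := w :* Z :- :1 :- (w :* s :- (:1 :- e))) ⊙ O.+-congˡ (O.-‿cong (O.sym (Σ-a (suc m))))) ~> tail-bound (suc m) a-series (\ i -> norm-a (suc m N.+ i)) (a-tail-sum m)

  -- If w has an inverse of norm at most V, then Z is bounded by a power of a bound R for log m
  -- as soon as m is large compared with D.
  Z-bound : ∀ {winv V R d} m -> 0# ≤ V -> w ⊗ winv ≋ 𝟙 -> ‖ winv ‖ ≤ V -> 0# ≤ R -> L (suc m) ≤ R -> D ≤ d * exp (½ * L m) -> ‖ Z ‖ ≤ (1# + R) ^ suc κ * (C + V * (C + # 4 * d * (C * A)))
  Z-bound {winv} {V} {R} {d} m 0≤V w-inv winv-bound 0≤R L≤R D≤ = begin ‖ Z ‖ ≈⟨ norm-cong (byᴮ 2 (\ Z s -> Z := s :+ :1 :* (Z :- s)) ⊙ O.+-congˡ (O.*-congʳ (O.sym w-inv) ⊙ byᴮ 4 \ w v t e -> w :* v :* t := v :* (w :* t :- e :+ e))) ⟩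
   ‖ Σᴮ (suc m) z ⊕ winv ⊗ (w ⊗ (Z ⊝ Σᴮ (suc m) z) ⊝ E (L (suc m)) ⊕ E (L (suc m))) ‖ ≤⟨ norm-+-≤ head (norm-*-≤ winv-bound (norm-+-≤ (wZ-tail m >> tail) (E≤ {suc m} L≤R))) ⟩
   C * P * (1# + R) + V * (# 4 * d * (C * A) + C * P) ≤⟨ lin (+≥0 (*≥0 (*≥0 0≤V 0≤dCA) (sub≥0 (1≤^ (suc κ) 1≤1+R)))
    (*≥0 (*≥0 0≤V 0≤C) (*≥0 0≤R (^≥0 κ 0≤1+R))))
    (by 5 \ C P R V x -> C :* P :* (:1 :+ R) :+ V :* (x :+ C :* P) :+ (V :* x :* ((:1 :+ R) :* P :- :1) :+ V :* C :* (R :* P)) := :0 :+ (:1 :+ R) :* P :* (C :+ V :* (C :+ x))) ⟩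
   (1# + R) * P * (C + V * (C + # 4 * d * (C * A))) ∎
   where
   open ≤-Reasoning
   P = (1# + R) ^ κ
   0≤1+R = +≥0 0≤1 0≤R
   1≤1+R = x≤x+y 0≤R
   0≤CA = *≥0 0≤C (<≤ (expBound>0 κ 0<½))
   0≤d = *-cancelˡ-≤ _ (exp>0 (½ * L m)) (≤-resp (sym (zeroʳ _)) (*-comm d _) (0≤D >> D≤))
   0≤dCA = *≥0 (*≥0 (#≥0 4) 0≤d) 0≤CA
   E≤ : ∀ {n} -> L n ≤ R -> ‖ E (L n) ‖ ≤ C * P
   E≤ {n} h = E-bound (L≥0 n) >> *≤ˡ C 0≤C (*-mono (^≥0 κ (+≥0 0≤1 (L≥0 n))) (^-mono κ (+≥0 0≤1 (L≥0 n)) (+-monoʳ-≤ 1# h)) (exp≥0 _) (decay≤1 n (<≤ 0<ε)) >~ *1 _)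
   head = norm-Σ-≤ (suc m) (\ i i<m -> norm-z-E i >> *≤ˡ _ (recip≥0 i) (E≤ {i} (L-mono {i} {suc m} (N.≤-trans (N.≤-pred i<m) (N.n≤1+n m)) >> L≤R))) >> Σ-cong′ (suc m) (\ i -> *-comm _ _) & Σ-* (suc m) _ _ ~> *≤ˡ _ (*≥0 0≤C (^≥0 κ 0≤1+R)) (harmonic≤ m >> +-monoʳ-≤ 1# (L-mono {m} {suc m} (N.n≤1+n m) >> L≤R))
   tail = *≤ʳ _ (*≥0 (decay≥0 ½ m) (#≥0 2)) (*≤ʳ _ 0≤CA (*≤ˡ (# 2) (#≥0 2) D≤)) >~ by 4 (\ d e c x -> con 2 :* (d :* e) :* c :* (x :* con 2) := con 4 :* d :* c :* (e :* x)) & *ˡ (sym (exp-+ _ _) & exp-cong (-‿inverseʳ _) & exp-0) & *1 _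

 -- Euler products

 module Euler {N : NormedAlgebra} {ε D C : ℝ} {κ : ℕ} (χ : Character N ε D C κ)
  (0<ε : 0# < ε) (0≤C : 0# ≤ C) where
  open Normed N
  open NormedSeries N
  open Character χ
  open Zeta χ 0<ε 0≤C

  select : Bool -> B -> B
  select b x = if b then x else 𝟘

  -- The product of 1 - E(log p)/p over the primes p ≤ n.
  P : ℕ -> B
  P zero = 𝟙
  P (suc n) = P n ⊗ (if isPrime (suc n) then 𝟙 ⊝ z n else 𝟙)

  private
   -- The terms z n with n + 1 free of prime factors up to i
   sifted : ℕ -> ℕ -> B
   sifted n i = select (sieve n i) (z i)

   norm-sifted : ∀ n i -> ‖ sifted n i ‖ ≤ majorant i
   norm-sifted n i = go (sieve n i)
    where go : ∀ b -> ‖ select b (z i) ‖ ≤ majorant i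
          go true = norm-z i
          go false = norm-0 ~> majorant≥0 i

   select-cong : ∀ {a b x} -> a ≡ b -> select a x ≋ select b x
   select-cong ok = O.refl

   module PrimeStep (q : ℕ) (prime : isPrime (suc q) ≡ true) where
    p = suc q
    g : ℕ -> B
    g i = sifted q i ⊝ sifted p i

    g-vanish : ∀ i -> ¬ (p ∣ suc i) -> g i ≋ 𝟘
    g-vanish i d = O.+-congˡ (O.-‿cong (select-cong (sieve-∤ q i d))) ⊙ O.-‿inverseʳ _

    z-select : ∀ b {i j} -> suc i ≡ suc j N.* p -> select b (z i) ≋ z q ⊗ select b (z j)
    z-select true {i} {j} eq = z-* {i} {q} {j} (E.trans eq (N.*-comm (suc j) p))
    z-select false eq = O.sym (O.zeroʳ _)

    g-multiple : ∀ i j -> suc i ≡ suc j N.* p -> g i ≋ z q ⊗ sifted q j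
    g-multiple i j eq = begin sifted q i ⊝ sifted p i ≈⟨ O.+-cong (select-cong (sieve-* q (isPrime⇒Prime prime) (N.n<1+n q) eq))
     (O.-‿cong (select-cong (sieve-∣ q i prime (E.subst (p ∣_) (E.sym eq) (n∣m*n (suc j)))))) ⟩
     select (sieve q j) (z i) ⊝ 𝟘 ≈⟨ byᴮ 1 (\ x -> x :- :0 := x) ⟩
     select (sieve q j) (z i) ≈⟨ z-select (sieve q j) {i} {j} eq ⟩
     z q ⊗ sifted q j ∎
     where open ≋-Reasoning

    block : ∀ j -> Σᴮ p (\ i -> g (j N.* p N.+ i)) ≋ z q ⊗ sifted q j
    block j = O.+-cong (Σᴮ-zero q (\ i i<q -> g-vanish (j N.* p N.+ i) (\ d -> N.<⇒≱ i<q (N.≤-pred (∣⇒≤ (∣m+n∣m⇒∣n {m = j N.* p} (E.subst (p ∣_) (E.sym (N.+-suc (j N.* p) i)) d) (n∣m*n j)))))))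
     (g-multiple (j N.* p N.+ q) j (E.trans (E.sym (N.+-suc (j N.* p) q)) (N.+-comm (j N.* p) p))) ⊙ O.+-identityˡ _

    blocks : ∀ n -> Σᴮ (n N.* p) g ≋ z q ⊗ Σᴮ n (sifted q)
    blocks zero = O.sym (O.zeroʳ _)
    blocks (suc n) = O.reflexive (E.cong (\ k -> Σᴮ k g) (N.+-comm p (n N.* p))) ⊙ Σᴮ-split (n N.* p) p g ⊙ O.+-cong (blocks n) (block n) ⊙ O.sym (O.distribˡ _ _ _)

    sifted-step : ∀ n -> Σᴮ (n N.* p) (sifted p) ≋ Σᴮ (n N.* p) (sifted q) ⊝ z q ⊗ Σᴮ n (sifted q)
    sifted-step n = byᴮ 2 (\ a b -> b := a :- (a :- b)) ⊙ O.+-congˡ (O.-‿cong (O.sym (Σᴮ-sub (n N.* p) (sifted q) (sifted p)) ⊙ blocks n))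

    limit : ∀ {l} -> (\ n -> Σᴮ n (sifted q)) ⟶ᴮ l -> (\ n -> Σᴮ n (sifted p)) ⟶ᴮ l ⊗ (𝟙 ⊝ z q)
    limit {l} h = ⟶-cong {a = \ n -> Σᴮ n (sifted p)} (\ n -> O.refl)
     (⟶-unique {a = \ n -> Σᴮ (n N.* p) (sifted p)} (⟶-subseq {a = \ n -> Σᴮ n (sifted p)} (N._* p) (\ n -> N.m≤m*n n p) (snd converges))
      (⟶-cong {a = \ n -> Σᴮ (n N.* p) (sifted q) ⊝ z q ⊗ Σᴮ n (sifted q)} (\ n -> O.sym (sifted-step n)) (byᴮ 2 \ l z -> l :- z :* l := l :* (:1 :- z))
       (⟶-sub (⟶-subseq {a = \ n -> Σᴮ n (sifted q)} (N._* p) (\ n -> N.m≤m*n n p) h) (⟶-scale (z q) h))))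
     (snd converges)
     where converges = majorised (sifted p) majorant _ (norm-sifted p) majorant-sum

  -- Sieve of Eratosthenes: multiplying Z by P(n) removes the multiples of the primes up to n.
  sifted-sum : ∀ n -> (\ m -> Σᴮ m (\ i -> select (sieve n i) (z i))) ⟶ᴮ P n ⊗ Z
  sifted-sum zero = ⟶-cong (\ _ -> O.refl) (O.sym (O.*-identityˡ Z)) Z-series
  sifted-sum (suc n) = by-cases₀ (isPrime (suc n)) (\ e -> ⟶-cong (\ _ -> O.refl) (byᴮ 3 (\ p x y -> p :* x :* y := p :* y :* x) ⊙ O.*-congʳ (O.*-congˡ (O.reflexive (E.cong (\ b -> if b then 𝟙 ⊝ z n else 𝟙) (E.sym e)))))
   (PrimeStep.limit n e (sifted-sum n)))
   (\ e -> ⟶-cong (\ m -> Σᴮ-cong′ m (\ i -> select-cong (E.sym (sieve-composite n i e))))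
    (O.*-congʳ (O.sym (O.*-identityʳ _) ⊙ O.*-congˡ (O.reflexive (E.cong (\ b -> if b then 𝟙 ⊝ z n else 𝟙) (E.sym e)))))
    (sifted-sum n))

  euler-product : (\ n -> P n ⊗ Z) ⟶ᴮ 𝟙
  euler-product e he =
   let (M , small) = monotone-cauchy (\ n -> Σ n majorant) _ (\ le -> Σ-length-mono majorant≥0 le) majorant-sum e he
   in suc M , \ where
    zero ()
    (suc n) le -> norm-cong (O.+-congˡ (O.-‿cong (O.sym (initial n)))) ~> (tail-bound (suc n) (sifted-sum (suc n)) (\ i -> norm-sifted (suc n) (suc n N.+ i)) \ k -> lin (small (suc n N.+ k) (N.≤-trans (N.n≤1+n M) (N.≤-trans le (N.m≤m+n (suc n) k))) ⊞ Σ-length-mono majorant≥0 (N.≤-trans (N.n≤1+n M) le) >> ≤-refl)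
     (+ˡ (+ˡ refl) & by 3 (\ t y x -> t :+ (x :+ y) := t :+ y :+ x) & +ʳ (+-comm _ _ & sym (Σ-split (suc n) k majorant)) & by 3 \ a e m -> a :+ e := a :- m :+ m :+ e))
   where
   initial : ∀ n -> Σᴮ (suc n) (sifted (suc n)) ≋ 𝟙
   initial n = Σᴮ-front n _ ⊙ O.+-cong (select-cong (sieve-1 (suc n)) ⊙ z-0)
    (Σᴮ-zero n (\ i i<n -> select-cong (sieve-small (suc n) i (N.s≤s i<n)))) ⊙ O.+-identityʳ 𝟙

 -- The complex character

 module Nonvanishing where

  open Complex
  private module Eℂ = Exponential complexAlgebra

  record Inverse (N : NormedAlgebra) (x : NormedAlgebra.B N) (V : ℝ) : Set where
   open NormedAlgebra N using () renaming (B to B′; _⊗_ to _⊗′_; _≋_ to _≋′_; 𝟙 to 𝟙′; ‖_‖ to ‖_‖′)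
   field
    inverse-of : B′
    isInverse : x ⊗′ inverse-of ≋′ 𝟙′
    bound : ‖ inverse-of ‖′ ≤ V

  inverse-weaken : ∀ {N x V V'} -> V ≤ V' -> Inverse N x V -> Inverse N x V'
  inverse-weaken h i = record { inverse-of = inverse-of ; isInverse = isInverse ; bound = bound >> h }
   where open Inverse i

  complex-inverse : ∀ z {s} -> 0# < s -> s ≤ sq z -> Inverse complexAlgebra z (‖ z ‖ / s)
  complex-inverse z hs h = record { inverse-of = fst r ; isInverse = fst (snd r) ; bound = snd (snd r) }
   where r = inverse-of-complex z hs h

  -- The character u ↦ exp (- (ε + i t) u)
  size : ℝ -> ℝ -> ℝ
  size ε t = ε + ∣ t ∣

  -- The constant in the first order estimate of the character
  D₀ : ℝ -> ℝ -> ℝ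
  D₀ ε t = # 4 * (size ε t + size ε t * size ε t)

  private
   V≥0 : ∀ {ε} t -> 0# < ε -> 0# ≤ size ε t
   V≥0 t h = +≥0 (<≤ h) (0≤abs t)

  module _ (ε t : ℝ) (0<ε : 0# < ε) where
   private
    V = size ε t
    0≤V = V≥0 t 0<ε
    E₀ : ℝ -> ℂ
    E₀ u = ι (exp (- (ε * u))) ⊗ cis (- (t * u))
    norm-E₀ : ∀ u -> ‖ E₀ u ‖ ≤ exp (- (ε * u)) * # 2
    norm-E₀ u = norm-ι⊗₊ (cis (- (t * u))) (exp≥0 _) >> *≤ˡ _ (exp≥0 _) (norm-cis _)

    norm-w₁ = norm-point ε t & +ʳ (abs≥0 (<≤ 0<ε))

    norm-w : ∀ {u} -> 0# ≤ u -> ‖ ι u ⊗ point ε t ‖ ≤ u * V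
    norm-w h = norm-ι⊗₊ _ h >~ *ˡ norm-w₁

    V≤D = lin (+≥0 (*≥0 (#≥0 3) 0≤V) (*≥0 (#≥0 4) (*≥0 0≤V 0≤V))) (by 1 \ v -> v :+ (con 3 :* v :+ con 4 :* (v :* v)) := :0 :+ con 4 :* (v :+ v :* v))

    4V²≤D : # 4 * (V * V) ≤ D₀ ε t
    4V²≤D = *≤ˡ _ (#≥0 4) (x≤y+x 0≤V)

    first-order : ∀ {u} -> 0# ≤ u -> u ≤ 1# -> ‖ 𝟙 ⊝ E₀ u ⊝ ι u ⊗ point ε t ‖ ≤ D₀ ε t * (u * u)
    first-order {u} h h1 = [ small-case , large-case ]′ (≤-or-> (u * V) 1#)
     where
     open ≤-Reasoning
     x = ι u ⊗ point ε t
     -x≤ = norm-neg x ~> norm-w h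
     E≤2 = norm-E₀ u >> *≤ʳ _ (#≥0 2) (exp-neg≤1 (*≥0 (<≤ 0<ε) h)) >~ 1* _
     small-case : u * V ≤ 1# -> ‖ 𝟙 ⊝ E₀ u ⊝ x ‖ ≤ D₀ ε t * (u * u)
     small-case small = begin ‖ 𝟙 ⊝ E₀ u ⊝ x ‖ ≈⟨ norm-cong (byᴮ 3 \ e x o -> o :- e :- x := :- (e :- o :- :- x)) & norm-neg (E₀ u ⊝ 𝟙 ⊝ ⊖ x) ⟩
      ‖ E₀ u ⊝ 𝟙 ⊝ (⊖ x) ‖ ≈⟨ norm-cong (O.+-congʳ (O.+-congʳ (O.sym (Exp-point ε t u)))) ⟩
      ‖ Eℂ.Exp (⊖ x) ⊝ 𝟙 ⊝ (⊖ x) ‖ ≤⟨ Eℂ.Exp-taylor (⊖ x) (norm-neg x ~> norm-w h >> small) ⟩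
      ‖ ⊖ x ‖ * ‖ ⊖ x ‖ ≤⟨ *-mono (norm≥0 (⊖ x)) -x≤ (norm≥0 (⊖ x)) -x≤ ⟩
      (u * V) * (u * V) ≈⟨ by 2 (\ u v -> u :* v :* (u :* v) := v :* v :* (u :* u)) ⟩
      (V * V) * (u * u) ≤⟨ *≤ʳ _ (sq≥0 u) (lin (*≥0 (#≥0 3) (sq≥0 V)) (by 1 \ v -> v :* v :+ con 3 :* (v :* v) := :0 :+ con 4 :* (v :* v)) >> 4V²≤D) ⟩
      D₀ ε t * (u * u) ∎
     large-case : 1# < u * V -> ‖ 𝟙 ⊝ E₀ u ⊝ x ‖ ≤ D₀ ε t * (u * u)
     large-case large = begin ‖ 𝟙 ⊝ E₀ u ⊝ x ‖ ≤⟨ norm-sub (𝟙 ⊝ E₀ u) x >> (norm-sub 𝟙 (E₀ u) >> (norm-1 ⊞ E≤2) ⊞ norm-w h) ⟩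
      (1# + # 2) + u * V ≤⟨ lin (*≥0 (+≥0 (*≥0 (#≥0 4) (*≥0 h 0≤V)) (#≥0 3)) (sub≥0 (<≤ large)))
       (by 1 \ y -> :1 :+ con 2 :+ y :+ (con 4 :* y :+ con 3) :* (y :- :1) := :0 :+ con 4 :* (y :* y)) ⟩
      # 4 * (u * V * (u * V)) ≈⟨ by 2 (\ u v -> con 4 :* (u :* v :* (u :* v)) := con 4 :* (v :* v) :* (u :* u)) ⟩
      # 4 * (V * V) * (u * u) ≤⟨ *≤ʳ _ (sq≥0 u) 4V²≤D ⟩
      D₀ ε t * (u * u) ∎

   complexCharacter : Character complexAlgebra ε (D₀ ε t) (# 2) 0
   complexCharacter = record
    { E = E₀
    ; w = point ε t
    ; E-cong = \ p -> O.*-cong (ι-cong (exp-cong (-ᶜ (*ˡ p)))) (cis-cong (-ᶜ (*ˡ p)))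
    ; E-0 = O.*-cong (ι-cong (exp-cong (by 1 \ e -> :- (e :* :0) := :0) & exp-0) ⊙ ι-1)
     (cis-cong (by 1 \ e -> :- (e :* :0) := :0) ⊙ cis-0) ⊙ O.*-identityˡ 𝟙
    ; E-+ = \ u v -> O.*-cong (ι-cong (exp-cong (by 3 \ e u v -> :- (e :* (u :+ v)) := :- (e :* u) :+ :- (e :* v)) & exp-+ _ _) ⊙ ι-* _ _)
     (cis-cong (by 3 \ e u v -> :- (e :* (u :+ v)) := :- (e :* u) :+ :- (e :* v)) ⊙ cis-+ _ _) ⊙ byᴮ 4 (\ a b c d -> a :* b :* (c :* d) := a :* c :* (b :* d))
    ; E-bound = \ {u} h -> norm-E₀ u >~ by 1 (\ e -> e :* con 2 := con 2 :* (:1 :* e))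
    ; w-bound = norm-w₁ ~> V≤D
    ; E-first-order = first-order }

  -- The inequality behind the nonvanishing of the zeta function, for one Euler factor
  module _ (x c : ℝ) (0≤x : 0# ≤ x) where
   private
    A = (1# - x) * (1# - x)
    F = 1# - # 2 * x * c + x * x
    G = 1# - # 2 * x * (# 2 * (c * c) - 1#) + x * x

   mertens-factor : 0# ≤ F -> 0# ≤ G -> A ^ 3 * F ^ 4 * G ≤ (1# + x * x) ^ 8
   mertens-factor hF hG = *-cancelˡ-≤ (# 8 ^ 8) (^>0 8 (#>0 7)) (begin # 8 ^ 8 * (A ^ 3 * F ^ 4 * G) ≈⟨ by 3 (\ a f g -> con 8 :^ 8 :* (a :^ 3 :* f :^ 4 :* g) := con 16 :^ 4 :* f :^ 4 :* (con 4 :^ 4 :* (a :^ 3 :* g))) ⟩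
    # 16 ^ 4 * F ^ 4 * (# 4 ^ 4 * (A ^ 3 * G)) ≤⟨ *≤ˡ _ (*≥0 (^≥0 4 (#≥0 16)) (^≥0 4 hF)) step ⟩
    # 16 ^ 4 * F ^ 4 * (# 3 * A + G) ^ 4 ≈⟨ by 2 (\ f g -> con 16 :^ 4 :* f :^ 4 :* g :^ 4 := (con 16 :* f :* g) :^ 4) ⟩
    (# 16 * F * (# 3 * A + G)) ^ 4 ≤⟨ ^-mono 4 (*≥0 (*≥0 (#≥0 16) hF) h3AG)
     (lin (sq≥0 (# 4 * F - (# 3 * A + G))) (by 2 \ f s -> con 16 :* f :* s :+ (con 4 :* f :- s) :* (con 4 :* f :- s) := :0 :+ (con 4 :* f :+ s) :^ 2)) ⟩
    ((# 4 * F + (# 3 * A + G)) ^ 2) ^ 4 ≤⟨ ^-mono 4 (^≥0 2 hS) (^-mono 2 hS (lin (*≥0 (*≥0 (#≥0 4) 0≤x) (sq≥0 (1# + c)))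
     (by 2 \ x c -> con 4 :* (:1 :- con 2 :* x :* c :+ x :* x) :+ (con 3 :* ((:1 :- x) :* (:1 :- x)) :+ (:1 :- con 2 :* x :* (con 2 :* (c :* c) :- :1) :+ x :* x))
      :+ con 4 :* x :* ((:1 :+ c) :* (:1 :+ c)) := :0 :+ con 8 :* (:1 :+ x :* x)))) ⟩
    ((# 8 * (1# + x * x)) ^ 2) ^ 4 ≈⟨ by 1 (\ y -> ((con 8 :* y) :^ 2) :^ 4 := con 8 :^ 8 :* y :^ 8) ⟩
    # 8 ^ 8 * (1# + x * x) ^ 8 ∎)
    where
    open ≤-Reasoning
    hA = sq≥0 (1# - x)
    h3AG = +≥0 (*≥0 (#≥0 3) hA) hG
    hS = +≥0 (*≥0 (#≥0 4) hF) h3AG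
    step = begin # 4 ^ 4 * (A ^ 3 * G) ≈⟨ by 2 (\ a g -> con 4 :^ 4 :* (a :^ 3 :* g) := con 8 :^ 2 :* (a :* a) :* (con 4 :* a :* g)) ⟩
     # 8 ^ 2 * (A * A) * (# 4 * A * G) ≤⟨ *≤ˡ _ (*≥0 (^≥0 2 (#≥0 8)) (sq≥0 A)) (lin (sq≥0 (A - G)) (by 2 \ a g -> con 4 :* a :* g :+ (a :- g) :* (a :- g) := :0 :+ (a :+ g) :* (a :+ g))) ⟩
     # 8 ^ 2 * (A * A) * ((A + G) * (A + G)) ≈⟨ by 2 (\ a g -> con 8 :^ 2 :* (a :* a) :* ((a :+ g) :* (a :+ g)) := (con 8 :* (a :* (a :+ g))) :^ 2) ⟩
     (# 8 * (A * (A + G))) ^ 2 ≤⟨ ^-mono 2 (*≥0 (#≥0 8) (*≥0 hA (+≥0 hA hG)))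
      (lin (sq≥0 (# 2 * A - (A + G))) (by 2 \ a g -> con 8 :* (a :* (a :+ g)) :+ (con 2 :* a :- (a :+ g)) :* (con 2 :* a :- (a :+ g)) := :0 :+ (con 3 :* a :+ g) :^ 2)) ⟩
     ((# 3 * A + G) ^ 2) ^ 2 ≈⟨ by 1 (\ y -> (y :^ 2) :^ 2 := y :^ 4) ⟩
     (# 3 * A + G) ^ 4 ∎

 open Nonvanishing

 -- A lower bound for the zeta function

 module ZetaLowerBound where

  open Complex
  open NormedSeries complexAlgebra

  0≤2 : 0# ≤ # 2
  0≤2 = #≥0 2

  -- ζ (1 + ε + i t)
  module ζ (ε t : ℝ) (0<ε : 0# < ε) where
   χ = complexCharacter ε t 0<ε
   open Zeta χ 0<ε 0≤2 public
   open Euler χ 0<ε 0≤2 public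

   -- The modulus of z n
   r : ℕ -> ℝ
   r n = recip n * exp (- (ε * L n))

   Z-crude = norm-cong (byᴮ 1 \ x -> x := x :- :0) ~> tail-bound {g = \ n -> # 2 * (recip n * decay ε n)} 0 Z-series (\ n -> norm-z-E n >> *≤ˡ _ (recip≥0 n) (Character.E-bound χ (L≥0 n)) >~ by 2 \ r e -> r :* (con 2 :* (:1 :* e)) := con 2 :* (r :* e))
    (\ n -> Σ-* n (# 2) _ ~> *≤ˡ (# 2) 0≤2 (decay-total 0<ε n))

   z-polar : ∀ n -> z n ≋ ι (r n) ⊗ cis (- (t * L n))
   z-polar n = O.sym (O.*-assoc _ _ _) ⊙ O.*-congʳ (O.sym (ι-* _ _))

   sq-factor : ∀ n -> sq (𝟙 ⊝ z n) ≈ 1# - # 2 * r n * cos (t * L n) + r n * r n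
   sq-factor n = sq-cong (O.+-congˡ (O.-‿cong (z-polar n))) & sq-1- (r n) (t * L n)

   sq-P-suc : ∀ n -> sq (P (suc n)) ≈ sq (P n) * (if isPrime (suc n) then sq (𝟙 ⊝ z n) else 1#)
   sq-P-suc n = sq-* (P n) _ & *ˡ (branch (isPrime (suc n)))
    where
    branch : ∀ b -> sq (if b then 𝟙 ⊝ z n else 𝟙) ≈ (if b then sq (𝟙 ⊝ z n) else 1#)
    branch true = refl
    branch false = sq-𝟙

   -- Eventually the Euler product times Z is close to 1.
   quarter : ∃[ N ] (∀ n -> N N.≤ n -> ½ * ½ ≤ sq (P n) * sq Z)
   quarter = let (N , h) = euler-product ½ 0<½ in N , \ n le -> sq-near-1 _ (h n le) >~ sq-* (P n) Z

  module ThreeFourOne (ε t : ℝ) (0<ε : 0# < ε) where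
   private
    module ζ₀ = ζ ε 0# 0<ε
    module ζ₁ = ζ ε t 0<ε
    module ζ₂ = ζ ε (# 2 * t) 0<ε
    r = ζ₁.r

    factor : ∀ n -> sq (𝟙 ⊝ ζ₀.z n) ^ 3 * sq (𝟙 ⊝ ζ₁.z n) ^ 4 * sq (𝟙 ⊝ ζ₂.z n) ≤ exp (# 8 * (r n * r n))
    factor n = begin sq (𝟙 ⊝ ζ₀.z n) ^ 3 * sq (𝟙 ⊝ ζ₁.z n) ^ 4 * sq (𝟙 ⊝ ζ₂.z n) ≈⟨ *-cong (*-cong (^-congˡ 3 eq₀) (^-congˡ 4 eq₁)) eq₂ ⟩
     ((1# - r n) * (1# - r n)) ^ 3 * (1# - # 2 * r n * c + r n * r n) ^ 4 * (1# - # 2 * r n * (# 2 * (c * c) - 1#) + r n * r n) ≤⟨ mertens-factor (r n) c (*≥0 (recip≥0 n) (exp≥0 _)) (≤-resp refl eq₁ (sq≥0′ (𝟙 ⊝ ζ₁.z n))) (≤-resp refl eq₂ (sq≥0′ (𝟙 ⊝ ζ₂.z n))) ⟩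
     (1# + r n * r n) ^ 8 ≤⟨ ^-mono 8 (+≥0 0≤1 (sq≥0 (r n))) (1+x≤exp _) ⟩
     exp (r n * r n) ^ 8 ≈⟨ sym (exp-#* 8 _) ⟩
     exp (# 8 * (r n * r n)) ∎
     where
     open ≤-Reasoning
     c = cos (t * L n)
     eq₀ = ζ₀.sq-factor n & +ʳ (+ˡ (-ᶜ (*ˡ (cos-cong (zeroˡ _) & cos-0)))) & by 1 (\ r -> :1 :- con 2 :* r :* :1 :+ r :* r := (:1 :- r) :* (:1 :- r))
     eq₁ = ζ₁.sq-factor n
     double = cos-cong (by 2 \ t l -> con 2 :* t :* l := t :* l :+ t :* l) & cos-+ _ _ & by 2 (\ c s -> c :* c :- s :* s := con 2 :* (c :* c) :- (c :* c :+ s :* s)) & +ˡ (-ᶜ (sq-cos-sin (t * L n)))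
     eq₂ = ζ₂.sq-factor n & +ʳ (+ˡ (-ᶜ (*ˡ double)))

    product : ∀ n -> sq (ζ₀.P n) ^ 3 * sq (ζ₁.P n) ^ 4 * sq (ζ₂.P n) ≤ exp (Σ n (\ i -> # 8 * (r i * r i)))
    product zero = ≈⇒≤ (*-cong (*-cong (^-congˡ 3 sq-𝟙) (^-congˡ 4 sq-𝟙)) sq-𝟙 & by 0 (:1 :^ 3 :* :1 :^ 4 :* :1 := :1) & sym exp-0)
    product (suc n) = *-cong (*-cong (^-congˡ 3 (ζ₀.sq-P-suc n)) (^-congˡ 4 (ζ₁.sq-P-suc n))) (ζ₂.sq-P-suc n) ~> branch (sq≥0′ (ζ₀.P n)) (sq≥0′ (ζ₁.P n)) (sq≥0′ (ζ₂.P n)) (product n) (isPrime (suc n))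
     where
     x₀ = sq (𝟙 ⊝ ζ₀.z n)
     x₁ = sq (𝟙 ⊝ ζ₁.z n)
     x₂ = sq (𝟙 ⊝ ζ₂.z n)
     branch : ∀ {a b c e} -> 0# ≤ a -> 0# ≤ b -> 0# ≤ c -> a ^ 3 * b ^ 4 * c ≤ exp e -> ∀ p -> (a * (if p then x₀ else 1#)) ^ 3 * (b * (if p then x₁ else 1#)) ^ 4 * (c * (if p then x₂ else 1#)) ≤ exp (e + # 8 * (r n * r n))
     branch {a} {b} {c} {e} ha hb hc h p = begin (a * f x₀) ^ 3 * (b * f x₁) ^ 4 * (c * f x₂) ≈⟨ by 6 (\ a b c d e f -> (a :* b) :^ 3 :* (c :* d) :^ 4 :* (e :* f) := a :^ 3 :* c :^ 4 :* e :* (b :^ 3 :* d :^ 4 :* f)) ⟩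
      (a ^ 3 * b ^ 4 * c) * (f x₀ ^ 3 * f x₁ ^ 4 * f x₂) ≤⟨ *-mono (*≥0 (*≥0 (^≥0 3 ha) (^≥0 4 hb)) hc) h (*≥0 (*≥0 (^≥0 3 (f≥0 p (sq≥0′ _))) (^≥0 4 (f≥0 p (sq≥0′ _)))) (f≥0 p (sq≥0′ _))) (f≤ p) ⟩
      exp e * exp (# 8 * (r n * r n)) ≈⟨ sym (exp-+ _ _) ⟩
      exp (e + # 8 * (r n * r n)) ∎
      where
      open ≤-Reasoning
      f : ℝ -> ℝ
      f x = if p then x else 1#
      f≥0 : ∀ p {x} -> 0# ≤ x -> 0# ≤ (if p then x else 1#)
      f≥0 true h = h
      f≥0 false h = 0≤1
      f≤ : ∀ p -> (if p then x₀ else 1#) ^ 3 * (if p then x₁ else 1#) ^ 4 * (if p then x₂ else 1#) ≤ exp (# 8 * (r n * r n))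
      f≤ true = factor n
      f≤ false = by 0 (:1 :^ 3 :* :1 :^ 4 :* :1 := :1) ~> 1≤exp (*≥0 (#≥0 8) (sq≥0 (r n)))

    exponent : ∀ n -> Σ n (\ i -> # 8 * (r i * r i)) ≤ # 16
    exponent n = Σ-* n (# 8) _ ~> *≤ˡ (# 8) (#≥0 8)
     (Σ-mono′ n (\ i -> *-mono (r≥0 i) (r≤ i) (r≥0 i) (r≤ i) >~ *ˡ (sym (exp-neg-L i) & exp-cong (-ᶜ (sym (1* _))))) >> decay-total 0<1 n) >~ *ˡ (+ˡ 1⁻¹) & by 0 (con 8 :* (:1 :+ :1) := con 16)
     where
     r≥0 : ∀ i -> 0# ≤ r i
     r≥0 i = *≥0 (recip≥0 i) (exp≥0 _)
     r≤ : ∀ i -> r i ≤ recip i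
     r≤ i = *≤ˡ _ (recip≥0 i) (decay≤1 i (<≤ 0<ε)) >~ *1 _

   three-four-one = begin (½ * ½) ^ 8 ≈⟨ by 1 (\ x -> x :^ 8 := x :^ 3 :* x :^ 4 :* x) ⟩ (½ * ½) ^ 3 * (½ * ½) ^ 4 * (½ * ½) ≤⟨ *-mono (*≥0 (^≥0 3 q) (^≥0 4 q)) (*-mono (^≥0 3 q) (^-mono 3 q (h₀ n n₀)) (^≥0 4 q) (^-mono 4 q (h₁ n n₁))) q (h₂ n n₂) ⟩
    (sq (ζ₀.P n) * sq ζ₀.Z) ^ 3 * (sq (ζ₁.P n) * sq ζ₁.Z) ^ 4 * (sq (ζ₂.P n) * sq ζ₂.Z) ≈⟨ by 6 (\ a b c d e f -> (a :* b) :^ 3 :* (c :* d) :^ 4 :* (e :* f) := a :^ 3 :* c :^ 4 :* e :* (b :^ 3 :* d :^ 4 :* f)) ⟩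
    (sq (ζ₀.P n) ^ 3 * sq (ζ₁.P n) ^ 4 * sq (ζ₂.P n)) * (sq ζ₀.Z ^ 3 * sq ζ₁.Z ^ 4 * sq ζ₂.Z) ≤⟨ *≤ʳ _ (*≥0 (*≥0 (^≥0 3 (sq≥0′ ζ₀.Z)) (^≥0 4 (sq≥0′ ζ₁.Z))) (sq≥0′ ζ₂.Z)) (product n >> exp-mono (exponent n)) ⟩
    exp (# 16) * (sq ζ₀.Z ^ 3 * sq ζ₁.Z ^ 4 * sq ζ₂.Z) ∎
    where
    open ≤-Reasoning
    q = *≥0 (<≤ 0<½) (<≤ 0<½)
    N₀ = fst ζ₀.quarter ; h₀ = snd ζ₀.quarter
    N₁ = fst ζ₁.quarter ; h₁ = snd ζ₁.quarter
    N₂ = fst ζ₂.quarter ; h₂ = snd ζ₂.quarter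
    n = N₀ N.+ (N₁ N.+ N₂)
    n₀ = N.m≤m+n N₀ _
    n₁ = N.≤-trans (N.m≤m+n N₁ N₂) (N.m≤n+m _ N₀)
    n₂ = N.≤-trans (N.m≤n+m N₂ N₁) (N.m≤n+m _ N₀)

 open ZetaLowerBound

 -- Divided differences and the inverse of the zeta function

 module DividedLemmas (N : NormedAlgebra) (d : ℝ) (0≤d : 0# ≤ d) (d≤1 : d ≤ 1#) where
  private
   module Δ = Divided N d 0≤d d≤1
   module ΔN = Normed Δ.algebra
  open Normed N

  swap-right : ∀ a b c -> a ⊗ b ⊗ c ≋ a ⊗ c ⊗ b
  swap-right a b c = byᴮ 3 (\ a b c -> a :* b :* c := a :* c :* b)

  -- The inverse of w + j, where j² = d j
  shifted-inverse : ∀ w v v' -> w ⊗ v ≋ 𝟙 -> (w ⊕ ι d) ⊗ v' ≋ 𝟙 -> ((w , 𝟙) ΔN.⊗ (v , ⊖ (v ⊗ v'))) ΔN.≋ ΔN.𝟙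
  shifted-inverse w v v' h h' = O.+-congˡ (O.*-congʳ ι-0 ⊙ O.zeroˡ _) ⊙ O.+-identityʳ _ ⊙ h , byᴮ 4 (\ w y z d -> w :* :- (y :* z) :+ :1 :* y :+ d :* (:1 :* :- (y :* z)) := y :* (:1 :- (w :+ d) :* z)) ⊙ O.*-congˡ (O.+-congˡ (O.-‿cong h') ⊙ O.-‿inverseʳ 𝟙) ⊙ O.zeroʳ v

  module Difference {ε ε' D D' C κ} (χ : Character N ε D C κ) (χ' : Character N ε' D' C κ)
   (0<ε : 0# < ε) (0<ε' : 0# < ε') (0≤C : 0# ≤ C) (inc : Increment d)
   (eq : ∀ u -> Character.E χ' u ≋ Character.E χ u ⊗ ι (1# + d * Increment.g inc u)) where
   module Z₁ = Zeta χ 0<ε 0≤C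
   module Z₂ = Zeta χ' 0<ε' 0≤C
   module ZΔ = Zeta (Extend.extend χ (<≤ 0<ε) 0≤C d 0≤d d≤1 inc) 0<ε 0≤C
   open Increment inc using (g)
   open Character χ using (E)

   private
    J : ℕ -> B
    J n = snd (ZΔ.z n)
    J-series : (\ n -> Σᴮ n J) ⟶ᴮ snd ZΔ.Z
    J-series = ⟶-cong {a = \ n -> snd (ΔN.Σᴮ n ZΔ.z)} (\ n -> Δ.Σ-proj₂ n ZΔ.z) O.refl (Δ.⟶-proj₂ {s = \ n -> ΔN.Σᴮ n ZΔ.z} ZΔ.Z-series)
    shift : ∀ n -> Z₂.z n ≋ Z₁.z n ⊕ ι d ⊗ J n
    shift n = O.*-congˡ (eq (L n) ⊙ O.*-congˡ (ι-+ 1# (d * g (L n)) ⊙ O.+-cong ι-1 (ι-* d (g (L n))))) ⊙ byᴮ 4 (\ r e d g -> r :* (e :* (:1 :+ d :* g)) := r :* e :+ d :* (r :* (g :* e) :+ :0 :* e :+ d :* (:0 :* (g :* e))))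
    sums : ∀ n -> Σᴮ n Z₂.z ≋ Σᴮ n Z₁.z ⊕ ι d ⊗ Σᴮ n J
    sums n = Σᴮ-cong′ n shift ⊙ Σᴮ-+ n Z₁.z (\ i -> ι d ⊗ J i) ⊙ O.+-congˡ (Σᴮ-* n (ι d) J)

   difference : Z₂.Z ≋ Z₁.Z ⊕ ι d ⊗ snd ZΔ.Z
   difference = ⟶-unique {a = \ n -> Σᴮ n Z₂.z} Z₂.Z-series (⟶-cong {a = \ n -> Σᴮ n Z₁.z ⊕ ι d ⊗ Σᴮ n J} (\ n -> O.sym (sums n)) O.refl
    (⟶-+ Z₁.Z-series (⟶-scale {a = \ n -> Σᴮ n J} (ι d) J-series)))

   norm-difference : ‖ Z₂.Z ‖ ≤ ‖ Z₁.Z ‖ + d * ΔN.‖ ZΔ.Z ‖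
   norm-difference = norm-cong difference ~> norm-+-≤ ≤-refl (norm-ι⊗₊ _ 0≤d >> *≤ˡ d 0≤d (x≤y+x (norm≥0 _)))

 module ZetaInverse where

  open Complex

  -- g(u) = (exp (- d u) - 1)/d
  expIncrement : ∀ d -> 0# < d -> d ≤ 1# -> Increment d
  expIncrement d hd d≤1 = record
   { g = g
   ; g-cong = \ p -> *ʳ (+ʳ (exp-cong (-ᶜ (*ˡ p))))
   ; g-+ = \ u v -> *ʳ (+ʳ (exp-cong (by 3 \ d u v -> :- (d :* (u :+ v)) := :- (d :* u) :+ :- (d :* v)) & exp-+ _ _)) & by 3 (\ x y i -> (x :* y :- :1) :* i := (x :- :1) :* i :+ (y :- :1) :* i :+ (x :- :1) :* i :* (y :- :1)) &
    +ˡ (sym (1* _) & *ʳ (sym (inv hd)) & by 4 \ d i x y -> d :* i :* (x :* i :* y) := d :* (x :* i :* (y :* i)))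
   ; g-0 = *ʳ (+ʳ (exp-cong (by 1 \ d -> :- (d :* :0) := :0) & exp-0) & -‿inverseʳ 1#) & zeroˡ _
   ; g-bound = \ {u} h -> abs-≤ (g≤0 h >> h) (lin (-u≤g u) (by 2 \ u g -> :- g :+ g := :- u :+ u))
   ; g-first-order = \ {u} h h1 -> abs-≤ (second h h1) (lin (-u≤g u) (by 2 \ u g -> :- (g :+ u) :+ g := :- u :+ :0) >> sq≥0 u) }
   where
   g : ℝ -> ℝ
   g u = (exp (- (d * u)) - 1#) / d
   g≤0 : ∀ {u} -> 0# ≤ u -> g u ≤ 0#
   g≤0 {u} h = /-≤ hd (lin (exp-neg≤1 (*≥0 (<≤ hd) h)) (by 2 \ e d -> e :- :1 :+ :1 := e :+ :0 :* d))
   -u≤g : ∀ u -> - u ≤ g u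
   -u≤g u = ≤-/ hd (lin (1+x≤exp (- (d * u))) (by 3 \ u d e -> :- u :* d :+ e := :1 :+ :- (d :* u) :+ (e :- :1)))
   second : ∀ {u} -> 0# ≤ u -> u ≤ 1# -> g u + u ≤ u * u
   second {u} h h1 = ≤-/ hd (distribʳ _ _ _ & +ʳ (/-cancel hd) ~> poly) >> (/-≤ hd ≤-refl)
    where
    x = d * u
    hx = *≥0 (<≤ hd) h
    e≤ : exp (- x) ≤ 1# - x + x * x
    e≤ = exp-neg x ~> ⁻¹-anti (+>≥ 0<1 hx) (1+x≤exp x) >> sym (1* _) ~> (/-≤ (+>≥ 0<1 hx) (lin (*≥0 hx (*≥0 hx hx))
     (by 1 \ x -> :1 :+ x :* (x :* x) := :0 :+ (:1 :- x :+ x :* x) :* (:1 :+ x))))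
    poly : exp (- x) - 1# + u * d ≤ u * u * d
    poly = lin (e≤ ⊞ *≥0 (*≥0 (<≤ hd) (sub≥0 d≤1)) (*≥0 h h))
     (by 3 \ e u d -> e :- :1 :+ u :* d :+ (:1 :- d :* u :+ d :* u :* (d :* u) :+ d :* (:1 :- d) :* (u :* u)) := e :+ :0 :+ u :* u :* d)

  -- Inverse of a complex number bounded away from zero
  complex-inverse′ : ∀ z {y} -> 0# < y -> y ≤ ‖ z ‖ -> Inverse complexAlgebra z (# 2 / y)
  complex-inverse′ z {y} hy h = inverse-weaken (≈⇒≤ eq) (complex-inverse z (*>0 hn (half>0 hy)) sq≥)
   where
   hn = <-≤-trans hy h
   sq≥ : ‖ z ‖ * (y * ½) ≤ sq z
   sq≥ = *-cancelˡ-≤ (# 2) (#>0 1) (by 3 (\ n y h -> con 2 :* (n :* (y :* h)) := n :* y :* (con 2 :* h)) & *ˡ 2½ & *1 _ ~> *≤ˡ _ (norm≥0 z) h >> norm²-≤ z)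
   eq : ‖ z ‖ / (‖ z ‖ * (y * ½)) ≈ # 2 / y
   eq = *ˡ (⁻¹-* hn (half>0 hy) & *ˡ (⁻¹-* hy 0<½)) & by 4 (\ n i y h -> n :* (i :* (y :* h)) := n :* i :* (h :* y)) & *-cong (inv hn) (*ʳ (⁻¹⁻¹ (#>0 1))) & 1* _

  t≤size : ∀ {ε t y} -> 0# < ε -> y ≤ ∣ t ∣ -> y ≤ ‖ point ε t ‖
  t≤size {ε} {t} h hy = hy >> x≤y+x (0≤abs ε) >~ sym (norm-point ε t)

  D₀-bound : ∀ {ε t W} -> 0# < ε -> 1# ≤ W -> size ε t ≤ W -> D₀ ε t ≤ # 8 * (W * W)
  D₀-bound {ε} {t} {W} hε hW h = *≤ˡ _ (#≥0 4) (h >> sym (1* W) ~> *≤ʳ W (0≤1 >> hW) hW ⊞ *-mono hs h hs h) >~ by 1 (\ w -> con 4 :* (w :+ w) := con 8 :* w)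
   where hs = +≥0 (<≤ hε) (0≤abs t)

  -- For |t| ≥ t₀ the inverse of ζ (1 + ε + i t) is polynomially bounded in log |t|, uniformly in ε.
  module _ (t₀ : ℝ) (0<t₀ : 0# < t₀) where
   private
    a = # 2 / t₀
    0≤a : 0# ≤ a
    0≤a = /≥0 0≤2 0<t₀
    k₁ = # 2 + a * (# 2 + # 4 * # 8 * (# 2 * expBound 0 ½))
    k₂ = # 2 + (a + a * a) * (# 2 + # 4 * # 27 * (# 2 * expBound 1 ½))
    k = k₁ + k₂
    c₀ = (½ * ½) ^ 8 / exp (# 16)
    Q = # 4 ^ 6 * # 2 ^ 8
    0<c₀ : 0# < c₀
    0<c₀ = />0 (^>0 8 (*>0 0<½ 0<½)) (exp>0 _)
    c₀≤1 : c₀ ≤ 1#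
    c₀≤1 = /-≤ (exp>0 _) (^≤1 8 (<≤ (*>0 0<½ 0<½)) (*-mono (<≤ 0<½) ½≤1 (<≤ 0<½) ½≤1 >~ 1* 1#) >> 1≤exp (#≥0 16) >~ sym (1* _))
    1≤Q : 1# ≤ Q
    1≤Q = sym (1* 1#) ~> *-mono 0≤1 (1≤^ 6 (1≤# 3)) 0≤1 (1≤^ 8 (1≤# 1))
    0<Q = <-≤-trans 0<1 1≤Q
    c₁ = c₀ * (# 2 * Q) ⁻¹
    0<2Q = *>0 (#>0 1) 0<Q
    0<c₁ : 0# < c₁
    0<c₁ = *>0 0<c₀ (⁻¹>0 0<2Q)
    1≤2Q : 1# ≤ # 2 * Q
    1≤2Q = sym (1* 1#) ~> *-mono 0≤1 (1≤# 1) 0≤1 1≤Q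
    c₁≤c₀ : c₁ ≤ c₀
    c₁≤c₀ = /-≤ 0<2Q (sym (*1 c₀) ~> *≤ˡ c₀ (<≤ 0<c₀) 1≤2Q)
    c₁≤1 = c₁≤c₀ >> c₀≤1

    Qc₁² : Q * (c₁ * c₁) < c₀
    Qc₁² = ≤-<-trans (by 3 (\ q c i -> q :* (c :* i :* (c :* i)) := c :* (q :* i) :* (c :* i)) & refl ~> *≤ˡ _ (*≥0 (<≤ 0<c₀) (<≤ (*>0 0<Q (⁻¹>0 0<2Q)))) c₁≤1 >~ *1 _ & *ˡ (*ˡ (⁻¹-* (#>0 1) 0<Q) & by 3 (\ q h i -> q :* (h :* i) := h :* (q :* i)) & *ˡ (inv 0<Q) & *1 _))
     (lin< (half>0 0<c₀) (half+half c₀ & sym (0+ c₀)))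

    1≤k : 1# ≤ k
    1≤k = 1≤# 1 >> x≤x+y (*≥0 0≤a (+≥0 0≤2 (*≥0 (*≥0 (#≥0 4) (#≥0 8)) (*≥0 0≤2 (<≤ (expBound>0 0 0<½)))))) >> x≤x+y 0≤k₂
     where 0≤k₂ : 0# ≤ k₂
           0≤k₂ = +≥0 0≤2 (*≥0 (+≥0 0≤a (*≥0 0≤a 0≤a)) (+≥0 0≤2 (*≥0 (*≥0 (#≥0 4) (#≥0 27)) (*≥0 0≤2 (<≤ (expBound>0 1 0<½))))))
    k₂≥0 : 0# ≤ k₂
    k₂≥0 = +≥0 0≤2 (*≥0 (+≥0 0≤a (*≥0 0≤a 0≤a)) (+≥0 0≤2 (*≥0 (*≥0 (#≥0 4) (#≥0 27)) (*≥0 0≤2 (<≤ (expBound>0 1 0<½))))))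
    k₁≥0 : 0# ≤ k₁
    k₁≥0 = +≥0 0≤2 (*≥0 0≤a (+≥0 0≤2 (*≥0 (*≥0 (#≥0 4) (#≥0 8)) (*≥0 0≤2 (<≤ (expBound>0 0 0<½))))))

   k≥0 : 0# ≤ k
   k≥0 = +≥0 k₁≥0 k₂≥0

   inverseConstant≥0 : 0# ≤ # 2 * k ^ 4 * c₁ ⁻¹
   inverseConstant≥0 = *≥0 (*≥0 0≤2 (^≥0 4 k≥0)) (⁻¹≥0 0<c₁)

   inverseConstant : ℝ
   inverseConstant = # 2 * k ^ 4 * c₁ ⁻¹

   module _ (ε t W R : ℝ) (m : ℕ) (0<ε : 0# < ε) (t₀≤t : t₀ ≤ ∣ t ∣) (1≤W : 1# ≤ W) (W-bound : ε + 1# + # 2 * ∣ t ∣ ≤ W)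
    (W-m : W * W ≤ exp (½ * L m)) (m-R : L (suc m) ≤ R) where
    private
     0≤R = L≥0 (suc m) >> m-R
     1≤1+R : 1# ≤ 1# + R
     1≤1+R = x≤x+y 0≤R
     G = (1# + R) ^ 2 * k
     1≤G : 1# ≤ G
     1≤G = sym (1* 1#) ~> *-mono 0≤1 (1≤^ 2 1≤1+R) 0≤1 1≤k
     0<G = <-≤-trans 0<1 1≤G
     d = c₁ / G ^ 5
     0<d : 0# < d
     0<d = />0 0<c₁ (^>0 5 0<G)
     d≤1 : d ≤ 1#
     d≤1 = /-≤ (^>0 5 0<G) (c₁≤1 >> 1≤^ 5 1≤G >~ sym (1* _))
     ε′ = ε + d
     0<ε′ : 0# < ε′
     0<ε′ = +>≥ 0<ε (<≤ 0<d)
     module ζ₁ = ζ ε t 0<ε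
     module ζ₁′ = ζ ε′ t 0<ε′
     module ζ₂ = ζ ε′ (# 2 * t) 0<ε′
     module ζ₀ = ζ ε′ 0# 0<ε′
     module Δ = Divided complexAlgebra d (<≤ 0<d) d≤1
     module ΔN = NormedAlgebra Δ.algebra
     open Increment (expIncrement d 0<d d≤1) using (g)

     abs-2t : ∣ # 2 * t ∣ ≈ # 2 * ∣ t ∣
     abs-2t = abs-* (# 2) t & *ʳ (abs≥0 0≤2)
     size₂ : size ε′ (# 2 * t) ≤ W
     size₂ = (+-monoʳ-≤ ε d≤1 ⊞ ≈⇒≤ abs-2t) >> W-bound
     size₁ : size ε t ≤ W
     size₁ = lin (0≤1 ⊞ 0≤abs t) (by 2 \ e t -> e :+ t :+ (:1 :+ t) := :0 :+ :0 :+ (e :+ :1 :+ con 2 :* t)) >> W-bound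

     w⁻¹ = complex-inverse′ (point ε t) 0<t₀ (t≤size 0<ε t₀≤t)
     w′⁻¹ = complex-inverse′ (point ε′ t) 0<t₀ (t≤size 0<ε′ t₀≤t)
     w₂⁻¹ = complex-inverse′ (point ε′ (# 2 * t)) 0<t₀ (t≤size 0<ε′ (t₀≤t >> x≤x+y (0≤abs t) >~ by 1 (\ x -> x :+ x := con 2 :* x) & sym abs-2t))
     module I = Inverse w⁻¹
     module I′ = Inverse w′⁻¹
     module I₂ = Inverse w₂⁻¹

     ζ₂-bound : ‖ ζ₂.Z ‖ ≤ G
     ζ₂-bound = ζ₂.Z-bound {d = # 8} m 0≤a I₂.isInverse I₂.bound 0≤R m-R (D₀-bound 0<ε′ 1≤W size₂ >> *≤ˡ _ (#≥0 8) W-m) >> *-mono (^≥0 1 (0≤1 >> 1≤1+R)) (^-exp-mono {m = 1} {n = 2} 1≤1+R (N.s≤s N.z≤n)) k₁≥0 (x≤x+y k₂≥0)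

     -- The inverse of w + j in the divided difference ring.
     wΔ⁻¹ : Δ.algebra .NormedAlgebra.B
     wΔ⁻¹ = I.inverse-of , ⊖ (I.inverse-of ⊗ I′.inverse-of)
     wΔ-inverse : ((point ε t , 𝟙) ΔN.⊗ wΔ⁻¹) ΔN.≋ ΔN.𝟙
     wΔ-inverse = DividedLemmas.shifted-inverse complexAlgebra d (<≤ 0<d) d≤1 (point ε t) I.inverse-of I′.inverse-of I.isInverse
      (O.*-congʳ (point-shift ε t d) ⊙ I′.isInverse)
     wΔ-bound : ΔN.‖ wΔ⁻¹ ‖ ≤ a + a * a
     wΔ-bound = I.bound ⊞ norm-neg (I.inverse-of ⊗ I′.inverse-of) ~> norm-*-≤ I.bound I′.bound

     E-shift : ∀ u -> Character.E ζ₁′.χ u ≋ Character.E ζ₁.χ u ⊗ ι (1# + d * g u)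
     E-shift u = O.*-congʳ (ι-cong eq ⊙ ι-* _ _) ⊙ DividedLemmas.swap-right complexAlgebra d (<≤ 0<d) d≤1 _ _ _
      where
      eq : exp (- (ε′ * u)) ≈ exp (- (ε * u)) * (1# + d * g u)
      eq = exp-cong (by 3 \ e d l -> :- ((e :+ d) :* l) := :- (e :* l) :+ :- (d :* l)) & exp-+ _ _ & *ˡ
       (by 1 (\ x -> x := :1 :+ (x :- :1)) & +ˡ (sym (*-comm _ _ & /-cancel 0<d)))

     module DD = DividedLemmas.Difference complexAlgebra d (<≤ 0<d) d≤1 ζ₁.χ ζ₁′.χ 0<ε 0<ε′ 0≤2 (expIncrement d 0<d d≤1) E-shift

     ζΔ-bound : ΔN.‖ DD.ZΔ.Z ‖ ≤ G
     ζΔ-bound = DD.ZΔ.Z-bound {d = # 27} m (+≥0 0≤a (*≥0 0≤a 0≤a)) wΔ-inverse wΔ-bound 0≤R m-R D≤ >> *≤ˡ _ (^≥0 2 (0≤1 >> 1≤1+R)) (x≤y+x k₁≥0)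
      where
      D≤ : # 3 * D₀ ε t + # 2 * # 2 ^ 0 + 1# ≤ # 27 * exp (½ * L m)
      D≤ = lin (*≤ˡ (# 3) (#≥0 3) (D₀-bound 0<ε 1≤W size₁) ⊞ *≤ˡ (# 3) (#≥0 3) (sym (1* 1#) ~> *-mono 0≤1 1≤W 0≤1 1≤W))
       (by 2 \ D w -> con 3 :* D :+ con 2 :* con 2 :^ 0 :+ :1 :+ (con 3 :* (con 8 :* w) :+ con 3 :* w) := con 3 :* D :+ con 3 :* :1 :+ con 27 :* w) >> *≤ˡ _ (#≥0 27) W-m

     y = d * G
     0<y : 0# < y
     0<y = *>0 0<d 0<G

     lower : y ≤ ‖ ζ₁.Z ‖
     lower = by-contradiction \ lt -> <⇒≱ Qc₁² (chain lt)
      where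
      chain : ‖ ζ₁.Z ‖ < y -> c₀ ≤ Q * (c₁ * c₁)
      chain lt = /-≤ (exp>0 _) (ThreeFourOne.three-four-one ε′ t 0<ε′ >> *≤ˡ _ (exp≥0 _) bound >~ *-comm _ _)
       where
       open ≤-Reasoning
       i = d ⁻¹
       0≤i : 0# ≤ i
       0≤i = ⁻¹≥0 0<d
       1≤i : 1# ≤ i
       1≤i = sym 1⁻¹ ~> ⁻¹-anti 0<d d≤1
       n₀ : ‖ ζ₀.Z ‖ ≤ # 4 * i
       n₀ = ζ₀.Z-crude >> *≤ˡ _ 0≤2 (1≤i ⊞ ⁻¹-anti 0<d (x≤y+x (<≤ 0<ε))) >~ by 1 (\ i -> con 2 :* (i :+ i) := con 4 :* i)
       n₁ : ‖ ζ₁′.Z ‖ ≤ # 2 * y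
       n₁ = DD.norm-difference >> (<≤ lt ⊞ *≤ˡ d (<≤ 0<d) ζΔ-bound) >~ by 1 (\ y -> y :+ y := con 2 :* y)
       sq-bound : ∀ {z b} -> ‖ z ‖ ≤ b -> sq z ≤ b * b
       sq-bound {z} h = sq-≤ z >> *-mono (norm≥0 z) h (norm≥0 z) h
       q₀ = sq≥0′ ζ₀.Z
       q₁ = sq≥0′ ζ₁′.Z
       bound : sq ζ₀.Z ^ 3 * sq ζ₁′.Z ^ 4 * sq ζ₂.Z ≤ Q * (c₁ * c₁)
       bound = begin sq ζ₀.Z ^ 3 * sq ζ₁′.Z ^ 4 * sq ζ₂.Z ≤⟨ *-mono (*≥0 (^≥0 3 q₀) (^≥0 4 q₁)) (*-mono (^≥0 3 q₀) (^-mono 3 q₀ (sq-bound n₀)) (^≥0 4 q₁) (^-mono 4 q₁ (sq-bound n₁))) (sq≥0′ ζ₂.Z) (sq-bound ζ₂-bound) ⟩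
        (# 4 * i * (# 4 * i)) ^ 3 * (# 2 * y * (# 2 * y)) ^ 4 * (G * G) ≈⟨ by 3 (\ i d G -> (con 4 :* i :* (con 4 :* i)) :^ 3 :* (con 2 :* (d :* G) :* (con 2 :* (d :* G))) :^ 4 :* (G :* G) := con 4 :^ 6 :* con 2 :^ 8 :* ((d :* i) :^ 6 :* (d :* G :^ 5 :* (d :* G :^ 5)))) ⟩
        Q * ((d * i) ^ 6 * (d * G ^ 5 * (d * G ^ 5))) ≈⟨ *ˡ (*-cong (^-congˡ 6 (inv 0<d) & 1^ 6) (*-cong (/-cancel (^>0 5 0<G)) (/-cancel (^>0 5 0<G))) & 1* _) ⟩
        Q * (c₁ * c₁) ∎

    zeta-inverse : Inverse complexAlgebra ζ₁.Z (inverseConstant * (1# + R) ^ 8)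
    zeta-inverse = inverse-weaken (≈⇒≤ eq) (complex-inverse′ ζ₁.Z 0<y lower)
     where
     y≈ : y ≈ c₁ / G ^ 4
     y≈ = ≈-/ (^>0 4 0<G) (by 2 (\ d G -> d :* G :* G :^ 4 := d :* G :^ 5) & /-cancel (^>0 5 0<G))
     eq : # 2 / y ≈ inverseConstant * (1# + R) ^ 8
     eq = /-cong refl y≈ & *ˡ (⁻¹-* 0<c₁ (⁻¹>0 (^>0 4 0<G)) & *ˡ (⁻¹⁻¹ (^>0 4 0<G))) & by 3 (\ i r k -> con 2 :* (i :* (r :^ 2 :* k) :^ 4) := con 2 :* k :^ 4 :* i :* r :^ 8)

 open ZetaInverse

 -- Logarithmic derivatives

 -- Dual numbers over N
 module Dual (N : NormedAlgebra) = Divided N 0# ≤-refl 0≤1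

 -- An element of the dual numbers is invertible as soon as its first component is.
 module _ (N : NormedAlgebra) where
  open Normed N
  private
   module D = Dual N
   module DN = NormedAlgebra D.algebra

  lift-inverse : ∀ {a b a' V b̄} -> a ≋ a' -> Inverse N a V -> ‖ b ‖ ≤ b̄ -> Inverse D.algebra (a' , b) (V + V * V * b̄)
  lift-inverse {a} {b} {a'} {V} {b̄} eq i hb = record
   { inverse-of = y , ⊖ (y ⊗ y ⊗ b)
   ; isInverse = O.+-congˡ zeroˡ′ ⊙ O.+-identityʳ _ ⊙ ay , O.+-congˡ zeroˡ′ ⊙ byᴮ 3 (\ a b y -> a :* :- (y :* y :* b) :+ b :* y :+ :0 := (:1 :- a :* y) :* (y :* b)) ⊙ O.*-congʳ (O.+-congˡ (O.-‿cong ay) ⊙ O.-‿inverseʳ 𝟙) ⊙ O.zeroˡ _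
   ; bound = I.bound ⊞ norm-neg _ ~> norm-*-≤ (norm-*-≤ I.bound I.bound) hb }
   where
   module I = Inverse i
   y = I.inverse-of
   ay = O.*-congʳ (O.sym eq) ⊙ I.isInverse
   zeroˡ′ : ∀ {x} -> ι 0# ⊗ x ≋ 𝟘
   zeroˡ′ = O.*-congʳ ι-0 ⊙ O.zeroˡ _

 module LogDerivative {N : NormedAlgebra} {ε D C : ℝ} {κ : ℕ} (χ : Character N ε D C κ)
  (0<ε : 0# < ε) (0≤C : 0# ≤ C) where
  open Normed N
  open NormedSeries N
  open Character χ
  open Zeta χ 0<ε 0≤C
  open Euler χ 0<ε 0≤C
  module D = Dual N
  module DN = Normed D.algebra

  -- The character of the dual numbers whose second component is the derivative with respect to w.
  χ′ = Extend.extend χ (<≤ 0<ε) 0≤C 0# ≤-refl 0≤1 linearIncrement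

  module Z′ = Zeta χ′ 0<ε 0≤C
  module E′ = Euler χ′ 0<ε 0≤C

  -- The derivative of Z with respect to w
  DZ : B
  DZ = snd Z′.Z

  ι0⊗ : ∀ {x} -> ι 0# ⊗ x ≋ 𝟘
  ι0⊗ = O.*-congʳ ι-0 ⊙ O.zeroˡ _

  z′-first : ∀ n -> fst (Z′.z n) ≋ z n
  z′-first n = O.+-congˡ ι0⊗ ⊙ O.+-identityʳ _

  z′-second : ∀ n -> snd (Z′.z n) ≋ ⊖ (ι (L n) ⊗ z n)
  z′-second n = O.+-cong (O.+-congˡ (O.zeroˡ _) ⊙ O.+-identityʳ _) ι0⊗ ⊙ O.+-identityʳ _ ⊙ O.*-congˡ (O.*-congʳ (ι-neg (L n))) ⊙ byᴮ 3 (\ r l e -> r :* (:- l :* e) := :- (l :* (r :* e)))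

  Z′-first = ⟶-unique {a = \ n -> Σᴮ n z}
   (⟶-cong {a = \ n -> fst (DN.Σᴮ n Z′.z)} (\ n -> D.Σ-proj₁ n Z′.z ⊙ Σᴮ-cong′ n z′-first) O.refl (D.⟶-proj₁ {s = \ n -> DN.Σᴮ n Z′.z} Z′.Z-series))
   Z-series

  -- ‖log n · z(n)‖
  norm-Lz : ∀ n -> ‖ ι (L n) ⊗ z n ‖ ≤ Z′.majorant n
  norm-Lz n = sym (norm-neg _) & norm-cong (O.sym (z′-second n)) ~> x≤y+x (norm≥0 _) >> Z′.norm-z n

  -- Inverses of the Euler factors
  module WithFactorInverses {V : ℝ} (0≤V : 0# ≤ V) (factor : ∀ i -> Inverse N (𝟙 ⊝ z (suc i)) V) where

   geo : ℕ -> B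
   geo zero = 𝟘
   geo (suc i) = Inverse.inverse-of (factor i)

   norm-geo : ∀ i -> ‖ geo i ‖ ≤ V
   norm-geo zero = norm-0 ~> 0≤V
   norm-geo (suc i) = Inverse.bound (factor i)

   geo-inverse : ∀ i -> isPrime (suc i) ≡ true -> (𝟙 ⊝ z i) ⊗ geo i ≋ 𝟙
   geo-inverse zero ()
   geo-inverse (suc i) _ = Inverse.isInverse (factor i)

   -- Terms of the logarithmic derivative, and of its part over the primes themselves.
   full-term prime-term : ℕ -> B
   full-term i = select (isPrime (suc i)) (ι (L i) ⊗ z i ⊗ geo i)
   prime-term i = select (isPrime (suc i)) (ι (L i) ⊗ z i)

   select-bound : ∀ b {x c} -> 0# ≤ c -> ‖ x ‖ ≤ c -> ‖ select b x ‖ ≤ c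
   select-bound true hc h = h
   select-bound false hc h = norm-0 ~> hc

   private
    full-majorant : ∀ i -> ‖ full-term i ‖ ≤ V * Z′.majorant i
    full-majorant i = select-bound (isPrime (suc i)) (*≥0 0≤V (Z′.majorant≥0 i)) (norm-*-≤ (norm-Lz i) (norm-geo i) >~ *-comm _ _)
    prime-majorant : ∀ i -> ‖ prime-term i ‖ ≤ Z′.majorant i
    prime-majorant i = select-bound (isPrime (suc i)) (Z′.majorant≥0 i) (norm-Lz i)

   abstract
    Λ Λ₁ : B
    Λ = fst (majorised full-term (\ i -> V * Z′.majorant i) _ full-majorant (\ n -> Σ-* n V _ ~> *≤ˡ V 0≤V (Z′.majorant-sum n)))
    Λ₁ = fst (majorised prime-term Z′.majorant _ prime-majorant Z′.majorant-sum)

    Λ-series : (\ n -> Σᴮ n full-term) ⟶ᴮ Λ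
    Λ-series = snd (majorised full-term (\ i -> V * Z′.majorant i) _ full-majorant (\ n -> Σ-* n V _ ~> *≤ˡ V 0≤V (Z′.majorant-sum n)))

    Λ₁-series : (\ n -> Σᴮ n prime-term) ⟶ᴮ Λ₁
    Λ₁-series = snd (majorised prime-term Z′.majorant _ prime-majorant Z′.majorant-sum)

   P′-first : ∀ n -> fst (E′.P n) ≋ P n
   P′-first zero = O.refl
   P′-first (suc n) = O.+-congˡ ι0⊗ ⊙ O.+-identityʳ _ ⊙ O.*-cong (P′-first n) (step (isPrime (suc n)))
    where
    step : ∀ b -> fst (if b then DN.𝟙 DN.⊝ Z′.z n else DN.𝟙) ≋ (if b then 𝟙 ⊝ z n else 𝟙)
    step true = O.+-congˡ (O.-‿cong (z′-first n))
    step false = O.refl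

   -- The derivative of the Euler product is the product times the sum of the logarithmic derivatives.
   P′-second : ∀ n -> snd (E′.P n) ≋ P n ⊗ Σᴮ n full-term
   P′-second zero = byᴮ 0 (:0 := :1 :* :0)
   P′-second (suc n) = by-cases₀ (isPrime (suc n)) (\ e -> step true e (geo-inverse n e)) (\ e -> step false e O.refl)
    where
    open ≋-Reasoning
    x = ι (L n) ⊗ z n ⊗ geo n
    key : ∀ b -> (if b then (𝟙 ⊝ z n) ⊗ geo n ≋ 𝟙 else 𝟙 ≋ 𝟙) -> ∀ p s -> p ⊗ s ⊗ fst (if b then DN.𝟙 DN.⊝ Z′.z n else DN.𝟙) ⊕ p ⊗ snd (if b then DN.𝟙 DN.⊝ Z′.z n else DN.𝟙) ≋ p ⊗ (if b then 𝟙 ⊝ z n else 𝟙) ⊗ (s ⊕ select b x)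
    key false _ p s = byᴮ 2 (\ p s -> p :* s :* :1 :+ p :* :0 := p :* :1 :* (s :+ :0))
    key true h p s = begin p ⊗ s ⊗ (𝟙 ⊝ fst (Z′.z n)) ⊕ p ⊗ (𝟘 ⊝ snd (Z′.z n)) ≈⟨ O.+-cong (O.*-congˡ (O.+-congˡ (O.-‿cong (z′-first n)))) (O.*-congˡ (O.+-congˡ (O.-‿cong (z′-second n)))) ⟩
     p ⊗ s ⊗ (𝟙 ⊝ z n) ⊕ p ⊗ (𝟘 ⊝ ⊖ (ι (L n) ⊗ z n)) ≈⟨ byᴮ 4 (\ p s z y -> p :* s :* (:1 :- z) :+ p :* (:0 :- :- y) := p :* s :* (:1 :- z) :+ p :* (:1 :* y)) ⟩
     p ⊗ s ⊗ (𝟙 ⊝ z n) ⊕ p ⊗ (𝟙 ⊗ (ι (L n) ⊗ z n)) ≈⟨ O.+-congˡ (O.*-congˡ (O.*-congʳ (O.sym h))) ⟩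
     p ⊗ s ⊗ (𝟙 ⊝ z n) ⊕ p ⊗ ((𝟙 ⊝ z n) ⊗ geo n ⊗ (ι (L n) ⊗ z n)) ≈⟨ byᴮ 5 (\ p s z g y -> p :* s :* (:1 :- z) :+ p :* ((:1 :- z) :* g :* y) := p :* (:1 :- z) :* (s :+ y :* g)) ⟩
     p ⊗ (𝟙 ⊝ z n) ⊗ (s ⊕ x) ∎
    step : ∀ b -> isPrime (suc n) ≡ b -> (if b then (𝟙 ⊝ z n) ⊗ geo n ≋ 𝟙 else 𝟙 ≋ 𝟙) -> (fst (E′.P n) ⊗ snd (if isPrime (suc n) then DN.𝟙 DN.⊝ Z′.z n else DN.𝟙)
     ⊕ snd (E′.P n) ⊗ fst (if isPrime (suc n) then DN.𝟙 DN.⊝ Z′.z n else DN.𝟙))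
     ⊕ ι 0# ⊗ (snd (E′.P n) ⊗ snd (if isPrime (suc n) then DN.𝟙 DN.⊝ Z′.z n else DN.𝟙)) ≋ P n ⊗ (if isPrime (suc n) then 𝟙 ⊝ z n else 𝟙) ⊗ (Σᴮ n full-term ⊕ select (isPrime (suc n)) x)
    step b ok h = begin _ ≈⟨ O.+-congˡ ι0⊗ ⊙ O.+-identityʳ _ ⊙ O.+-comm _ _ ⟩ _ ≈⟨ O.+-cong (O.*-congʳ (P′-second n)) (O.*-congʳ (P′-first n)) ⟩
     _ ≈⟨ key b h (P n) (Σᴮ n full-term) ⟩
     _ ∎

   -- The logarithmic derivative of the Euler product is that of Z.
   Λ-Z = O.sym (O.*-identityˡ _) ⊙ ⟶-unique {a = \ n -> P n ⊗ Z ⊗ (DZ ⊕ Σᴮ n full-term ⊗ Z)}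
    (⟶-* {a = \ n -> P n ⊗ Z} euler-product (⟶-+ (⟶-const {a = \ _ -> DZ} (\ _ -> O.refl)) (⟶-cong (\ n -> O.*-comm _ _) (O.*-comm _ _) (⟶-scale Z Λ-series))))
    (⟶-cong {a = \ n -> Z ⊗ snd (E′.P n DN.⊗ Z′.Z)} (\ n -> begin
     Z ⊗ (fst (E′.P n) ⊗ DZ ⊕ snd (E′.P n) ⊗ fst Z′.Z ⊕ ι 0# ⊗ (snd (E′.P n) ⊗ DZ)) ≈⟨ O.*-congˡ (O.+-congˡ ι0⊗ ⊙ O.+-identityʳ _ ⊙ O.+-cong (O.*-congʳ (P′-first n)) (O.*-cong (P′-second n) Z′-first)) ⟩
     Z ⊗ (P n ⊗ DZ ⊕ P n ⊗ Σᴮ n full-term ⊗ Z) ≈⟨ byᴮ 4 (\ z p d s -> z :* (p :* d :+ p :* s :* z) := p :* z :* (d :+ s :* z)) ⟩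
     P n ⊗ Z ⊗ (DZ ⊕ Σᴮ n full-term ⊗ Z) ∎)
     (O.zeroʳ Z) (⟶-scale {a = \ n -> snd (E′.P n DN.⊗ Z′.Z)} Z (D.⟶-proj₂ {s = \ n -> E′.P n DN.⊗ Z′.Z} E′.euler-product))) ⊙ O.refl
    where open ≋-Reasoning

   Λ≋ : ∀ {y} -> Z ⊗ y ≋ 𝟙 -> Λ ≋ ⊖ (DZ ⊗ y)
   Λ≋ {y} h = begin Λ ≈⟨ O.sym (O.*-identityʳ Λ) ⊙ O.*-congˡ (O.sym h) ⟩
    Λ ⊗ (Z ⊗ y) ≈⟨ byᴮ 4 (\ l z y d -> l :* (z :* y) := (d :+ l :* z) :* y :- d :* y) ⟩
    (DZ ⊕ Λ ⊗ Z) ⊗ y ⊝ DZ ⊗ y ≈⟨ O.+-congʳ (O.*-congʳ Λ-Z ⊙ O.zeroˡ y) ⟩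
    𝟘 ⊝ DZ ⊗ y ≈⟨ O.+-identityˡ _ ⟩
    ⊖ (DZ ⊗ y) ∎
    where open ≋-Reasoning

   -- The higher prime powers contribute a bounded amount.
   powerBound : ℝ
   powerBound = V * (C * C) * expBound (suc (κ N.+ κ)) ½ * # 3

   prime-powers = norm-cong (byᴮ 1 \ x -> x := x :- :0) ~> tail-bound 0 difference-series difference
    (\ n -> Σ-* n c _ ~> *≤ˡ c 0≤c (decay-total 0<½ n >~ +ˡ ½⁻¹))
    where
    open ≤-Reasoning
    A′ = expBound (suc (κ N.+ κ)) ½
    c = V * (C * C) * A′
    0≤c = *≥0 (*≥0 0≤V (*≥0 0≤C 0≤C)) (<≤ (expBound>0 (suc (κ N.+ κ)) 0<½))
    difference-series : (\ n -> Σᴮ n (\ i -> full-term i ⊝ prime-term i)) ⟶ᴮ Λ ⊝ Λ₁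
    difference-series = ⟶-cong {a = \ n -> Σᴮ n full-term ⊝ Σᴮ n prime-term} (\ n -> O.sym (Σᴮ-sub n full-term prime-term)) O.refl (⟶-sub Λ-series Λ₁-series)
    norm-z≤ : ∀ n -> ‖ z n ‖ ≤ recip n * (C * (1# + L n) ^ κ)
    norm-z≤ n = norm-z-E n >> *≤ˡ _ (recip≥0 n) (E-bound (L≥0 n) >> *≤ˡ C 0≤C (*≤ˡ _ (^≥0 κ (+≥0 0≤1 (L≥0 n))) (decay≤1 n (<≤ 0<ε)) >~ *1 _))
    term-bound : ∀ n -> ‖ ι (L n) ⊗ z n ⊗ (z n ⊗ geo n) ‖ ≤ c * (recip n * decay ½ n)
    term-bound n = begin ‖ ι (L n) ⊗ z n ⊗ (z n ⊗ geo n) ‖ ≤⟨ norm-*-≤ (norm-ι⊗₊ _ (L≥0 n) >> *-mono (L≥0 n) (x≤y+x 0≤1) (norm≥0 _) (norm-z≤ n)) (norm-*-≤ (norm-z≤ n) (norm-geo n)) ⟩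
     ((1# + L n) * (recip n * (C * (1# + L n) ^ κ))) * (recip n * (C * (1# + L n) ^ κ) * V) ≈⟨ by 5 (\ x r C p V -> x :* (r :* (C :* p)) :* (r :* (C :* p) :* V) := V :* (C :* C) :* (r :* r :* (x :* (p :* p)))) ⟩
     V * (C * C) * (recip n * recip n * ((1# + L n) * ((1# + L n) ^ κ * (1# + L n) ^ κ))) ≈⟨ *ˡ (*ˡ (*ˡ (sym (^-homo-* (1# + L n) κ κ)))) ⟩
     V * (C * C) * (recip n * recip n * (1# + L n) ^ suc (κ N.+ κ)) ≤⟨ *≤ˡ _ (*≥0 0≤V (*≥0 0≤C 0≤C)) (*≤ˡ _ (sq≥0 _) (power≤exp (suc (κ N.+ κ)) 0<½ (L≥0 n))) ⟩
     V * (C * C) * (recip n * recip n * (A′ * exp (½ * L n))) ≈⟨ by 5 (\ V C r A e -> V :* (C :* C) :* (r :* r :* (A :* e)) := V :* (C :* C) :* A :* (r :* (e :* r))) ⟩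
     c * (recip n * (exp (½ * L n) * recip n)) ≈⟨ *ˡ (*ˡ (*ˡ (sym (exp-neg-L n)) & sym (exp-+ _ _) & exp-cong
      (+ˡ (-ᶜ (sym (half+half (L n)))) & by 2 \ h l -> h :* l :- (l :* h :+ l :* h) := :- (h :* l)))) ⟩
     c * (recip n * decay ½ n) ∎
    difference : ∀ i -> ‖ full-term i ⊝ prime-term i ‖ ≤ c * (recip i * decay ½ i)
    difference i = go (isPrime (suc i)) (geo-inverse i)
     where
     go : ∀ b -> (b ≡ true -> (𝟙 ⊝ z i) ⊗ geo i ≋ 𝟙) -> ‖ select b (ι (L i) ⊗ z i ⊗ geo i) ⊝ select b (ι (L i) ⊗ z i) ‖ ≤ c * (recip i * decay ½ i)
     go false _ = norm-cong (O.-‿inverseʳ 𝟘) & norm-0 ~> *≥0 0≤c (*≥0 (recip≥0 i) (decay≥0 ½ i))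
     go true h = norm-cong (byᴮ 3 (\ y g z -> y :* g :- y := y :* (z :* g) :+ y :* ((:1 :- z) :* g :- :1)) ⊙ O.+-congˡ (O.*-congˡ (O.+-congʳ (h ok) ⊙ O.-‿inverseʳ 𝟙) ⊙ O.zeroʳ _) ⊙ O.+-identityʳ _) ~> term-bound i

 -- Iterated dual numbers

 open Complex using (complexAlgebra; point)

 -- Iterated dual numbers over the complex numbers: an element of level k carries derivatives up to order k.
 Level : ℕ -> NormedAlgebra
 Level zero = complexAlgebra
 Level (suc k) = Dual.algebra (Level k)

 -- Constants depending on the level only

 Aᶜ : ℕ -> ℝ
 Aᶜ k = expBound k ½

 Aᶜ≥0 : ∀ k -> 0# ≤ Aᶜ k
 Aᶜ≥0 k = <≤ (expBound>0 k 0<½)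

 -- Constants for the k-th derivative: dᶜ bounds the first order estimate relative to its
 -- value at level 0, and factorᶜ the inverse of the Euler factors.
 dᶜ factorᶜ : ℕ -> ℝ
 dᶜ zero = # 8
 dᶜ (suc k) = # 3 * dᶜ k + # 2 * # 2 ^ k + 1#
 factorᶜ zero = # 4
 factorᶜ (suc k) = factorᶜ k + factorᶜ k * factorᶜ k * (# 2 * Aᶜ (suc k))

 -- Bound for the inverse of w at level k, given one at level 0
 wᶜ : ℕ -> ℝ -> ℝ
 wᶜ zero a = a
 wᶜ (suc k) a = wᶜ k a + wᶜ k a * wᶜ k a * 1#

 dᶜ≥0 : ∀ k -> 0# ≤ dᶜ k
 dᶜ≥0 zero = #≥0 8
 dᶜ≥0 (suc k) = +≥0 (+≥0 (*≥0 (#≥0 3) (dᶜ≥0 k)) (*≥0 0≤2 (^≥0 k 0≤2))) 0≤1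

 factorᶜ≥0 : ∀ k -> 0# ≤ factorᶜ k
 factorᶜ≥0 zero = #≥0 4
 factorᶜ≥0 (suc k) = +≥0 (factorᶜ≥0 k) (*≥0 (*≥0 (factorᶜ≥0 k) (factorᶜ≥0 k)) (*≥0 0≤2 (Aᶜ≥0 (suc k))))

 wᶜ≥0 : ∀ k {a} -> 0# ≤ a -> 0# ≤ wᶜ k a
 wᶜ≥0 zero h = h
 wᶜ≥0 (suc k) h = +≥0 (wᶜ≥0 k h) (*≥0 (*≥0 (wᶜ≥0 k h) (wᶜ≥0 k h)) 0≤1)

 inverse-unique : ∀ N -> let open NormedAlgebra N in ∀ {x y y'} -> x ⊗ y ≋ 𝟙 -> x ⊗ y' ≋ 𝟙 -> y ≋ y'
 inverse-unique N {x} {y} {y'} h h' = O.sym (O.*-identityʳ y) ⊙ O.*-congˡ (O.sym h') ⊙ byᴮ 3 (\ x y z -> y :* (x :* z) := x :* y :* z) ⊙ O.*-congʳ h ⊙ O.*-identityˡ y'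
  where open Normed N

 -- The first component of the extended character's z, and a uniform bound for log n · z(n).
 module LevelStep {N : NormedAlgebra} {ε D C : ℝ} {κ : ℕ} (χ : Character N ε D C κ) (0<ε : 0# < ε) (0≤C : 0# ≤ C) where
  open Normed N
  open Character χ
  open Zeta χ 0<ε 0≤C
  open LogDerivative χ 0<ε 0≤C

  norm-Lz-uniform : ∀ n -> ‖ ι (L n) ⊗ z n ‖ ≤ C * Aᶜ (suc κ)
  norm-Lz-uniform n = begin ‖ ι (L n) ⊗ z n ‖ ≤⟨ norm-ι⊗₊ _ (L≥0 n) >> *-mono (L≥0 n) (x≤y+x 0≤1) (norm≥0 _) (norm-z-E n >> *≤ˡ _ (recip≥0 n) (E-bound (L≥0 n) >> *≤ˡ C 0≤C (*≤ˡ _ (^≥0 κ (+≥0 0≤1 (L≥0 n))) (decay≤1 n (<≤ 0<ε)) >~ *1 _))) ⟩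
   (1# + L n) * (recip n * (C * (1# + L n) ^ κ)) ≈⟨ by 4 (\ x r C p -> x :* (r :* (C :* p)) := C :* (r :* (x :* p))) ⟩
   C * (recip n * (1# + L n) ^ suc κ) ≤⟨ *≤ˡ C 0≤C (*≤ˡ _ (recip≥0 n) (power≤exp (suc κ) 0<½ (L≥0 n))) ⟩
   C * (recip n * (Aᶜ (suc κ) * exp (½ * L n))) ≤⟨ *≤ˡ C 0≤C (*≤ˡ _ (recip≥0 n) (*≤ˡ _ (Aᶜ≥0 (suc κ)) (exp-mono (*≤ʳ _ (L≥0 n) ½≤1 >~ 1* _)))) ⟩
   C * (recip n * (Aᶜ (suc κ) * exp (L n))) ≈⟨ *ˡ (*ˡ (*ˡ (exp-L n)) & by 3 (\ r a s -> r :* (a :* s) := a :* (s :* r)) & *ˡ (suc*recip n) & *1 _) ⟩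
   C * Aᶜ (suc κ) ∎
   where open ≤-Reasoning

  lift-factor : ∀ {V} n -> Inverse N (𝟙 ⊝ z n) V -> Inverse D.algebra (DN.𝟙 DN.⊝ Z′.z n) (V + V * V * (C * Aᶜ (suc κ)))
  lift-factor n i = lift-inverse N (O.+-congˡ (O.-‿cong (O.sym (z′-first n)))) i
   (norm-cong (O.+-identityˡ _ ⊙ O.-‿cong (z′-second n) ⊙ byᴮ 1 \ x -> :- (:- x) := x) ~> norm-Lz-uniform n)

  lift-w : ∀ {V} -> Inverse N w V -> Inverse D.algebra (w , 𝟙) (V + V * V * 1#)
  lift-w i = lift-inverse N O.refl i norm-1

  lift-Z : ∀ {V b} -> Inverse N Z V -> DN.‖ Z′.Z ‖ ≤ b -> Inverse D.algebra Z′.Z (V + V * V * b)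
  lift-Z i h = lift-inverse N (O.sym Z′-first) i (x≤y+x (norm≥0 _) >> h)

  -- The second component of w Z is its derivative.
  D[wZ] : B
  D[wZ] = snd ((w , 𝟙) DN.⊗ Z′.Z)

  norm-D[wZ] : ‖ D[wZ] ‖ ≤ DN.‖ ((w , 𝟙) DN.⊗ Z′.Z) DN.⊝ DN.𝟙 ‖
  norm-D[wZ] = norm-cong (byᴮ 1 \ x -> x := x :- :0) ~> x≤y+x (norm≥0 _)

  lift-wZ : ∀ {V b} -> Inverse N (w ⊗ Z) V -> ‖ D[wZ] ‖ ≤ b -> Inverse D.algebra ((w , 𝟙) DN.⊗ Z′.Z) (V + V * V * b)
  lift-wZ i h = lift-inverse N (O.sym (O.+-congˡ ι0⊗ ⊙ O.+-identityʳ _ ⊙ O.*-congˡ Z′-first)) i h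

  module WithFactors {Vf : ℝ} (0≤Vf : 0# ≤ Vf) (factor : ∀ i -> Inverse N (𝟙 ⊝ z (suc i)) Vf) where
   open WithFactorInverses 0≤Vf factor

   -- The logarithmic derivative of Z, compared with 1/w, through an inverse of Z ...
   by-Z : ∀ {v V b Vw} -> w ⊗ v ≋ 𝟙 -> ‖ v ‖ ≤ Vw -> Inverse N Z V -> DN.‖ Z′.Z ‖ ≤ b -> ‖ Λ₁ ⊝ v ‖ ≤ powerBound + (b * V + Vw)
   by-Z {v} {V} {b} wv hv i hb = begin ‖ Λ₁ ⊝ v ‖ ≈⟨ norm-cong (byᴮ 3 \ l l₁ v -> l₁ :- v := :- (l :- l₁) :+ (l :- v)) ⟩
    ‖ (⊖ (Λ ⊝ Λ₁)) ⊕ (Λ ⊝ v) ‖ ≤⟨ norm-+-≤ (norm-neg _ ~> prime-powers) (norm-sub Λ v >> (norm-cong (Λ≋ I.isInverse) & norm-neg _ ~> norm-*-≤ (x≤y+x (norm≥0 _) >> hb) I.bound ⊞ hv)) ⟩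
    powerBound + (b * V + _) ∎
    where open ≤-Reasoning
          module I = Inverse i

   -- ... or through an inverse of w Z.
   by-wZ : ∀ {v V b} -> w ⊗ v ≋ 𝟙 -> Inverse N (w ⊗ Z) V -> ‖ D[wZ] ‖ ≤ b -> ‖ Λ₁ ⊝ v ‖ ≤ powerBound + b * V
   by-wZ {v} {V} {b} wv i hb = begin ‖ Λ₁ ⊝ v ‖ ≈⟨ norm-cong (byᴮ 3 \ l l₁ v -> l₁ :- v := :- (l :- l₁) :+ (l :- v)) ⟩
    ‖ (⊖ (Λ ⊝ Λ₁)) ⊕ (Λ ⊝ v) ‖ ≤⟨ norm-+-≤ (norm-neg _ ~> prime-powers) (norm-cong eq & norm-neg _ ~> norm-*-≤ hb I.bound) ⟩
    powerBound + b * V ∎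
    where
    open ≤-Reasoning
    module I = Inverse i
    y = I.inverse-of
    eq : Λ ⊝ v ≋ ⊖ (D[wZ] ⊗ y)
    eq = O.+-cong (Λ≋ (byᴮ 3 (\ w z y -> z :* (w :* y) := w :* z :* y) ⊙ I.isInverse))
     (O.-‿cong (inverse-unique N wv (O.sym (O.*-assoc w Z y) ⊙ I.isInverse))) ⊙ byᴮ 4 (\ d w z y -> :- (d :* (w :* y)) :- z :* y := :- ((w :* d :+ :1 :* z :+ :0) :* y)) ⊙ O.-‿cong (O.*-congʳ (O.+-cong (O.+-congˡ (O.*-congˡ (O.sym Z′-first))) (O.sym ι0⊗)))

 module Tower (ε t : ℝ) (0<ε : 0# < ε) where

  -- The first order constant of the character at level k
  Dₖ : ℕ -> ℝ
  Dₖ zero = D₀ ε t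
  Dₖ (suc k) = # 3 * Dₖ k + # 2 * # 2 ^ k + 1#

  χ : ∀ k -> Character (Level k) ε (Dₖ k) (# 2) k
  χ zero = complexCharacter ε t 0<ε
  χ (suc k) = Extend.extend (χ k) (<≤ 0<ε) 0≤2 0# ≤-refl 0≤1 linearIncrement

  module Zₖ (k : ℕ) = Zeta (χ k) 0<ε 0≤2
  module LS (k : ℕ) = LevelStep (χ k) 0<ε 0≤2

  factor : ∀ k i -> Inverse (Level k) (NormedAlgebra._⊝_ (Level k) (NormedAlgebra.𝟙 (Level k)) (Zₖ.z k (suc i))) (factorᶜ k)
  factor zero i = inverse-weaken (≈⇒≤ (*ˡ (⁻¹⁻¹ (#>0 1)) & by 0 (con 2 :* con 2 := con 4)))
   (complex-inverse′ _ 0<½ (half≤ >> ≤abs _ >> abs-re _ >~ norm-cong (O.+-congˡ (O.-‿cong (O.sym (Zε.z-polar n))))))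
   where
   n = suc i
   module Zε = ζ ε t 0<ε
   open Complex using (cos; abs-cos≤1; abs-re; re; re-1-; norm-cong; module O; cis; _⊝_; _⊗_; ι; 𝟙)
   c = cos (t * L n)
   r≥0 = *≥0 (recip≥0 n) (exp≥0 (- (ε * L n)))
   half≤ : ½ ≤ re (𝟙 ⊝ ι (Zε.r n) ⊗ cis (- (t * L n)))
   half≤ = lin (*-mono r≥0 (*≤ˡ _ (recip≥0 n) (decay≤1 n (<≤ 0<ε)) >~ *1 _) (0≤abs c) (abs-cos≤1 _) ⊞ *≤ˡ _ r≥0 (≤abs c) ⊞ recip-mono {1} {n} (N.s≤s N.z≤n))
    (by 5 (\ h r c a s -> h :+ (s :* :1 :+ (r :* a :+ h)) := r :* a :+ (r :* c :+ s) :+ (h :+ h :- r :* c)) & +ˡ (+ʳ ½+½≈1)) >~ sym (re-1- (Zε.r n) (t * L n))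
  factor (suc k) i = LS.lift-factor k (suc i) (factor k i)

  module WF (k : ℕ) = LS.WithFactors k (factorᶜ≥0 k) (factor k)
  module LD (k : ℕ) = LogDerivative.WithFactorInverses (χ k) 0<ε 0≤2 (factorᶜ≥0 k) (factor k)

  -- The sum of log p · E(log p)/p over the primes.
  primeSum : ∀ k -> NormedAlgebra.B (Level k)
  primeSum k = LD.Λ₁ k

  w-inverse : ∀ k {a} -> Inverse complexAlgebra (point ε t) a -> Inverse (Level k) (Character.w (χ k)) (wᶜ k a)
  w-inverse zero i = i
  w-inverse (suc k) i = LS.lift-w k (w-inverse k i)

  Dₖ≤ : ∀ k {x} -> 1# ≤ x -> D₀ ε t ≤ # 8 * x -> Dₖ k ≤ dᶜ k * x
  Dₖ≤ zero h p = p
  Dₖ≤ (suc k) {x} h p = lin (*≤ˡ (# 3) (#≥0 3) (Dₖ≤ k h p) ⊞ *≤ˡ (# 2 * # 2 ^ k + 1#) (+≥0 (*≥0 0≤2 (^≥0 k 0≤2)) 0≤1) h)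
   (by 4 \ D d x q -> con 3 :* D :+ q :+ :1 :+ (con 3 :* (d :* x) :+ (q :+ :1) :* x) := con 3 :* D :+ (q :+ :1) :* :1 :+ (con 3 :* d :+ q :+ :1) :* x)

 -- Sums over primes against characters

 open Complex using (complexAlgebra; point; re-𝟙; abs-re)

 -- Below t₀ the pole at s = 1 dominates.
 t₀ : ℝ
 t₀ = (# 384 * Aᶜ 0) ⁻¹

 0<384A : 0# < # 384 * Aᶜ 0
 0<384A = *>0 (#>0 383) (expBound>0 0 0<½)

 0<t₀ : 0# < t₀
 0<t₀ = ⁻¹>0 0<384A

 1≤A : 1# ≤ Aᶜ 0
 1≤A = 1≤exp (<≤ 0<½) >~ sym (*ˡ 1⁻¹ & *1 _)

 2t₀≤1 : # 2 * t₀ ≤ 1#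
 2t₀≤1 = *≤ʳ _ (<≤ 0<t₀) (#-mono {2} {384} (N.s≤s (N.s≤s N.z≤n)) >> sym (*1 _) ~> *≤ˡ _ (#≥0 384) 1≤A) >~ inv 0<384A

 192At₀ : # 192 * Aᶜ 0 * t₀ ≈ ½
 192At₀ = *-cancelˡ (# 2) (pos⇒≉0 (#>0 1)) (by 2 (\ pole t -> con 2 :* (con 192 :* pole :* t) := con 384 :* pole :* t) & inv 0<384A & sym 2½)

 pole : ℝ
 pole = # 2 / t₀
 0≤pole : 0# ≤ pole
 0≤pole = /≥0 0≤2 0<t₀

 -- Constants for the k-th derivative of: w Z - 1 and 1 / (w Z) near the pole, and Z, the higher
 -- prime powers, 1 / Z away from it, and the final bound for the sum over primes
 wZᶜ finvᶜ Zᶜ powerᶜ Zinvᶜ primeᶜ : ℕ -> ℝ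
 wZᶜ k = # 2 * dᶜ (suc k) * (# 2 * Aᶜ (suc k)) * # 3
 finvᶜ zero = # 4
 finvᶜ (suc k) = finvᶜ k + finvᶜ k * finvᶜ k * wZᶜ k
 Zᶜ k = # 2 + wᶜ k pole * (# 2 + # 4 * dᶜ k * (# 2 * Aᶜ k))
 powerᶜ k = factorᶜ k * (# 2 * # 2) * expBound (suc (k N.+ k)) ½ * # 3
 Zinvᶜ zero = inverseConstant t₀ 0<t₀
 Zinvᶜ (suc k) = Zinvᶜ k + Zinvᶜ k * Zinvᶜ k * Zᶜ (suc k)
 primeᶜ k = powerᶜ k + (Zᶜ (suc k) * Zinvᶜ k + wᶜ k pole) + wZᶜ k * finvᶜ k

 -- The corresponding exponents of the logarithm of the height
 Zinvᵉ primeᵉ : ℕ -> ℕ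
 Zinvᵉ zero = 8
 Zinvᵉ (suc k) = Zinvᵉ k N.+ Zinvᵉ k N.+ suc (suc k)
 primeᵉ k = suc (suc k) N.+ Zinvᵉ k

 wZᶜ≥0 : ∀ k -> 0# ≤ wZᶜ k
 wZᶜ≥0 k = *≥0 (*≥0 (*≥0 0≤2 (dᶜ≥0 (suc k))) (*≥0 0≤2 (Aᶜ≥0 (suc k)))) (#≥0 3)
 finvᶜ≥0 : ∀ k -> 0# ≤ finvᶜ k
 finvᶜ≥0 zero = #≥0 4
 finvᶜ≥0 (suc k) = +≥0 (finvᶜ≥0 k) (*≥0 (*≥0 (finvᶜ≥0 k) (finvᶜ≥0 k)) (wZᶜ≥0 k))
 Zᶜ≥0 : ∀ k -> 0# ≤ Zᶜ k
 Zᶜ≥0 k = +≥0 0≤2 (*≥0 (wᶜ≥0 k 0≤pole) (+≥0 0≤2 (*≥0 (*≥0 (#≥0 4) (dᶜ≥0 k)) (*≥0 0≤2 (Aᶜ≥0 k)))))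
 powerᶜ≥0 : ∀ k -> 0# ≤ powerᶜ k
 powerᶜ≥0 k = *≥0 (*≥0 (*≥0 (factorᶜ≥0 k) (*≥0 0≤2 0≤2)) (<≤ (expBound>0 (suc (k N.+ k)) 0<½))) (#≥0 3)

 Zinvᶜ≥0 : ∀ k -> 0# ≤ Zinvᶜ k
 Zinvᶜ≥0 zero = inverseConstant≥0 t₀ 0<t₀
 Zinvᶜ≥0 (suc k) = +≥0 (Zinvᶜ≥0 k) (*≥0 (*≥0 (Zinvᶜ≥0 k) (Zinvᶜ≥0 k)) (Zᶜ≥0 (suc k)))

 module _ (ε t : ℝ) (0<ε : 0# < ε) where
  open Tower ε t 0<ε
  private module C0 = ζ ε t 0<ε

  module Near (ε≤t₀ : ε ≤ t₀) (t≤t₀ : ∣ t ∣ ≤ t₀) where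
   private
    V = size ε t
    0≤V : 0# ≤ V
    0≤V = +≥0 (<≤ 0<ε) (0≤abs t)
    V≤2t₀ : V ≤ # 2 * t₀
    V≤2t₀ = (ε≤t₀ ⊞ t≤t₀) >~ by 1 (\ t -> t :+ t := con 2 :* t)
    D₀≤8V : D₀ ε t ≤ # 8 * V
    D₀≤8V = *≤ˡ (# 4) (#≥0 4) (+-monoʳ-≤ V (*≤ˡ V 0≤V (V≤2t₀ >> 2t₀≤1))) >~ by 1 (\ v -> con 4 :* (v :+ v :* :1) := con 8 :* v)
    D₀≤8 : D₀ ε t ≤ # 8 * 1#
    D₀≤8 = D₀≤8V >> *≤ˡ _ (#≥0 8) (V≤2t₀ >> 2t₀≤1)

   wZ-near : ∀ k -> NormedAlgebra.‖_‖ (Level k) (NormedAlgebra._⊝_ (Level k) (NormedAlgebra._⊗_ (Level k) (Character.w (χ k)) (Zₖ.Z k)) (NormedAlgebra.𝟙 (Level k))) ≤ # 2 * dᶜ k * (# 2 * Aᶜ k) * # 3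
   wZ-near k = Zₖ.wZ-bound k >> *≤ʳ _ (#≥0 3) (*≤ʳ _ (*≥0 0≤2 (Aᶜ≥0 k)) (*≤ˡ _ 0≤2 (Dₖ≤ k ≤-refl D₀≤8 >~ *1 _)))

   D[wZ]-near : ∀ k -> NormedAlgebra.‖_‖ (Level k) (LS.D[wZ] k) ≤ wZᶜ k
   D[wZ]-near k = LS.norm-D[wZ] k >> wZ-near (suc k)

   wZ-inverse : ∀ k -> Inverse (Level k) (NormedAlgebra._⊗_ (Level k) (Character.w (χ k)) (Zₖ.Z k)) (finvᶜ k)
   wZ-inverse zero = inverse-weaken (≈⇒≤ (*ˡ (⁻¹⁻¹ (#>0 1)) & by 0 (con 2 :* con 2 := con 4))) (complex-inverse′ _ 0<½ half≤)
    where
    open Normed complexAlgebra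
    wZ = point ε t ⊗ Zₖ.Z 0
    near-1 : ‖ wZ ⊝ 𝟙 ‖ ≤ ½
    near-1 = Zₖ.wZ-bound 0 >> *≤ʳ _ (#≥0 3) (*≤ʳ _ (*≥0 0≤2 (Aᶜ≥0 0)) (*≤ˡ _ 0≤2 (D₀≤8V >> *≤ˡ _ (#≥0 8) V≤2t₀))) >~ by 2 (\ t pole -> con 2 :* (con 8 :* (con 2 :* t)) :* (con 2 :* pole) :* con 3 := con 192 :* pole :* t) & 192At₀
    half≤ : ½ ≤ ‖ wZ ‖
    half≤ = lin (sym re-𝟙 ~> ≤abs _ >> abs-re 𝟙 >> norm-≤-+ 𝟙 wZ ⊞ norm-sub-sym 𝟙 wZ ~> near-1)
     (by 3 (\ h n d -> h :+ (n :+ d :+ h) := h :+ h :+ d :+ n) & +ʳ (+ʳ ½+½≈1))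
   wZ-inverse (suc k) = LS.lift-wZ k (wZ-inverse k) (D[wZ]-near k)

  module Far (W R : ℝ) (m : ℕ) (t₀≤t : t₀ ≤ ∣ t ∣) (1≤W : 1# ≤ W) (W-bound : ε + 1# + # 2 * ∣ t ∣ ≤ W)
   (W-m : W * W ≤ exp (½ * L m)) (m-R : L (suc m) ≤ R) where
   X = 1# + R
   0≤R : 0# ≤ R
   0≤R = L≥0 (suc m) >> m-R
   1≤X : 1# ≤ X
   1≤X = x≤x+y 0≤R
   0≤X = 0≤1 >> 1≤X

   w⁻¹ : ∀ k -> Inverse (Level k) (Character.w (χ k)) (wᶜ k pole)
   w⁻¹ k = w-inverse k (complex-inverse′ (point ε t) 0<t₀ (t≤size 0<ε t₀≤t))

   private
    size≤ : size ε t ≤ W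
    size≤ = lin (0≤1 ⊞ 0≤abs t) (by 2 \ e t -> e :+ t :+ (:1 :+ t) := :0 :+ :0 :+ (e :+ :1 :+ con 2 :* t)) >> W-bound

   Z-far : ∀ k -> NormedAlgebra.‖_‖ (Level k) (Zₖ.Z k) ≤ X ^ suc k * Zᶜ k
   Z-far k = Zₖ.Z-bound k {d = dᶜ k} m (wᶜ≥0 k 0≤pole) (Inverse.isInverse (w⁻¹ k)) (Inverse.bound (w⁻¹ k)) 0≤R m-R
    (Dₖ≤ k (sym (1* 1#) ~> *-mono 0≤1 1≤W 0≤1 1≤W) (D₀-bound 0<ε 1≤W size≤) >> *≤ˡ _ (dᶜ≥0 k) W-m)

   Z-inverse : ∀ k -> Inverse (Level k) (Zₖ.Z k) (Zinvᶜ k * X ^ Zinvᵉ k)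
   Z-inverse zero = zeta-inverse t₀ 0<t₀ ε t W R m 0<ε t₀≤t 1≤W W-bound W-m m-R
   Z-inverse (suc k) = inverse-weaken weaken (LS.lift-Z k (Z-inverse k) (Z-far (suc k)))
    where
    open ≤-Reasoning
    c = Zinvᵉ k
    K = Zinvᶜ k
    weaken : K * X ^ c + K * X ^ c * (K * X ^ c) * (X ^ suc (suc k) * Zᶜ (suc k)) ≤ Zinvᶜ (suc k) * X ^ Zinvᵉ (suc k)
    weaken = begin K * X ^ c + K * X ^ c * (K * X ^ c) * (X ^ suc (suc k) * Zᶜ (suc k)) ≤⟨ *≤ˡ K (Zinvᶜ≥0 k) (^-exp-mono 1≤X (N.≤-trans (N.m≤m+n c c) (N.m≤m+n (c N.+ c) (suc (suc k)))))
     ⊞ ≈⇒≤ (by 4 (\ K p q z -> K :* p :* (K :* p) :* (q :* z) := K :* K :* z :* (p :* p :* q)) & *ˡ (sym (^-homo-* X (c N.+ c) (suc (suc k)) & *ʳ (^-homo-* X c c)))) ⟩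
     K * X ^ (c N.+ c N.+ suc (suc k)) + K * K * Zᶜ (suc k) * X ^ (c N.+ c N.+ suc (suc k)) ≈⟨ sym (distribʳ _ _ _) ⟩
     Zinvᶜ (suc k) * X ^ Zinvᵉ (suc k) ∎

  -- The sum of log p · E(log p)/p over the primes is 1/w up to pole power of log |t|, uniformly in ε.
  primeSum-bound : ∀ k (W R : ℝ) (m : ℕ) -> ε ≤ t₀ -> 1# ≤ W -> ε + 1# + # 2 * ∣ t ∣ ≤ W -> W * W ≤ exp (½ * L m) -> L (suc m) ≤ R ->
   let open NormedAlgebra (Level k) in ∀ {v} -> Character.w (χ k) ⊗ v ≋ 𝟙 ->
   ‖ primeSum k ⊝ v ‖ ≤ primeᶜ k * (1# + R) ^ primeᵉ k
  primeSum-bound k W R m ε≤t₀ 1≤W W-bound W-m m-R {v} wv = split (≤-total ∣ t ∣ t₀)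
   where
   open NormedAlgebra (Level k)
   open ≤-Reasoning
   X = 1# + R
   0≤R = L≥0 (suc m) >> m-R
   1≤X : 1# ≤ X
   1≤X = x≤x+y 0≤R
   split : ∣ t ∣ ≤ t₀ ⊎ t₀ ≤ ∣ t ∣ -> ‖ primeSum k ⊝ v ‖ ≤ primeᶜ k * X ^ primeᵉ k
   split (inj₁ t≤t₀) = begin ‖ primeSum k ⊝ v ‖ ≤⟨ WF.by-wZ k wv (Nr.wZ-inverse k) (Nr.D[wZ]-near k) ⟩
    powerᶜ k + wZᶜ k * finvᶜ k ≤⟨ lin (+≥0 (*≥0 (Zᶜ≥0 (suc k)) (Zinvᶜ≥0 k)) (wᶜ≥0 k 0≤pole))
     (by 4 \ p f z w -> p :+ f :+ (z :+ w) := :0 :+ (p :+ (z :+ w) :+ f)) ⟩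
    primeᶜ k ≈⟨ sym (*1 _) ⟩
    primeᶜ k * 1# ≤⟨ *≤ˡ _ primeᶜ≥0 (1≤^ (primeᵉ k) 1≤X) ⟩
    primeᶜ k * X ^ primeᵉ k ∎
    where
    module Nr = Near ε≤t₀ t≤t₀
    primeᶜ≥0 : 0# ≤ primeᶜ k
    primeᶜ≥0 = +≥0 (+≥0 (powerᶜ≥0 k) (+≥0 (*≥0 (Zᶜ≥0 (suc k)) (Zinvᶜ≥0 k)) (wᶜ≥0 k 0≤pole))) (*≥0 (wZᶜ≥0 k) (finvᶜ≥0 k))
   split (inj₂ t₀≤t) = begin ‖ primeSum k ⊝ v ‖ ≤⟨ WF.by-Z k wv (norm-cong (inverse-unique (Level k) wv (Inverse.isInverse (F.w⁻¹ k))) ~> Inverse.bound (F.w⁻¹ k)) (F.Z-inverse k) (F.Z-far (suc k)) ⟩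
    powerᶜ k + (X ^ suc (suc k) * Zᶜ (suc k) * (Zinvᶜ k * X ^ Zinvᵉ k) + wᶜ k pole) ≈⟨ +ˡ (+ʳ (by 4 (\ x z i y -> x :* z :* (i :* y) := z :* i :* (x :* y)) & *ˡ (sym (^-homo-* X (suc (suc k)) (Zinvᵉ k))))) ⟩
    powerᶜ k + (Zᶜ (suc k) * Zinvᶜ k * Y + wᶜ k pole) ≤⟨ lin (*≤ˡ (powerᶜ k + wᶜ k pole) (+≥0 (powerᶜ≥0 k) (wᶜ≥0 k 0≤pole)) (1≤^ (primeᵉ k) 1≤X) ⊞ *≥0 (*≥0 (wZᶜ≥0 k) (finvᶜ≥0 k)) (0≤1 >> 1≤^ (primeᵉ k) 1≤X))
     (by 5 \ p z y w f -> p :+ (z :* y :+ w) :+ ((p :+ w) :* y :+ f :* y) := (p :+ w) :* :1 :+ :0 :+ (p :+ (z :+ w) :+ f) :* y) ⟩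
    primeᶜ k * X ^ primeᵉ k ∎
    where
    module F = Far W R m t₀≤t 1≤W W-bound W-m m-R
    Y = X ^ primeᵉ k

 -- Riemann sums on a grid

 -- The measure giving mass η to each positive multiple of η has Laplace transform close to 1/w.
 module Grid {N : NormedAlgebra} {ε D C : ℝ} {κ : ℕ} (χ : Character N ε D C κ) (0<ε : 0# < ε) (0≤C : 0# ≤ C)
  (η : ℝ) (0<η : 0# < η) (η≤1 : η ≤ 1#) where
  open Normed N
  open Character χ

  q : B
  q = E η

  -- A difference quotient approximating w.
  ŵ : B
  ŵ = ι (η ⁻¹) ⊗ (𝟙 ⊝ q)

  -- The grid points and the terms of the Riemann sum for 1 / w
  node : ℕ -> ℝ
  node j = # (suc j) * η

  grid-term : ℕ -> B
  grid-term j = ι η ⊗ E (node j)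

  private
   0≤D = norm≥0 w >> w-bound
   0≤η = <≤ 0<η

  ŵ-w = begin ‖ w ⊝ ι (η ⁻¹) ⊗ (𝟙 ⊝ q) ‖ ≈⟨ norm-cong (O.+-congʳ (O.sym (O.*-identityˡ w) ⊙ O.*-congʳ (O.sym (O.sym (ι-* _ _) ⊙ ι-cong (*-comm _ _ & inv 0<η) ⊙ ι-1))) ⊙ byᴮ 4 \ i e w q -> i :* e :* w :- i :* (:1 :- q) := :- (i :* (:1 :- q :- e :* w))) ⟩
   ‖ ⊖ (ι (η ⁻¹) ⊗ (𝟙 ⊝ q ⊝ ι η ⊗ w)) ‖ ≤⟨ norm-neg _ ~> norm-ι⊗₊ _ (⁻¹≥0 0<η) >> *≤ˡ _ (⁻¹≥0 0<η) (E-first-order 0≤η η≤1) ⟩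
   η ⁻¹ * (D * (η * η)) ≈⟨ by 3 (\ i d e -> i :* (d :* (e :* e)) := e :* i :* (d :* e)) & *ʳ (inv 0<η) & 1* _ ⟩
   D * η ∎
   where open ≤-Reasoning

  q-1 = begin ‖ q ⊝ 𝟙 ‖ ≈⟨ norm-cong (byᴮ 2 \ q x -> q :- :1 := :- (:1 :- q :- x :+ x)) & norm-neg _ ⟩
   ‖ (𝟙 ⊝ q ⊝ ι η ⊗ w) ⊕ ι η ⊗ w ‖ ≤⟨ norm-+-≤ (E-first-order 0≤η η≤1) (norm-ι⊗₊ w 0≤η >> *≤ˡ η 0≤η w-bound) ⟩
   D * (η * η) + η * D ≤⟨ lin (*≥0 (*≥0 0≤D 0≤η) (sub≥0 η≤1)) (by 2 \ d e -> d :* (e :* e) :+ e :* d :+ d :* e :* (:1 :- e) := :0 :+ con 2 :* d :* e) ⟩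
   # 2 * D * η ∎
   where open ≤-Reasoning

  E-node-step : ∀ u -> E (u + η) ≋ E u ⊗ q
  E-node-step u = E-+ u η

  -- E vanishes at infinity.
  E-node-null : (\ J -> E (node J)) ⟶ᴮ 𝟘
  E-node-null e he = let (M , h) = archimedean (x / η) in M , \ J le -> begin
   ‖ E (node J) ⊝ 𝟘 ‖ ≈⟨ norm-cong (byᴮ 1 \ x -> x :- :0 := x) ⟩
   ‖ E (node J) ‖ ≤⟨ E-bound (0≤node J) ⟩
   C * ((1# + node J) ^ κ * exp (- (ε * node J))) ≤⟨ *≤ˡ C 0≤C (*≤ʳ _ (exp≥0 _) (power≤exp κ 0<ε/2 (0≤node J))) ⟩
   C * (A′ * exp (ε * ½ * node J) * exp (- (ε * node J))) ≈⟨ by 4 (\ c a x y -> c :* (a :* x :* y) := c :* a :* (x :* y)) & *ˡ (sym (exp-+ _ _) & exp-cong (+ˡ (-ᶜ (*ʳ (sym (half+half ε)))) & by 2 \ e l -> e :* l :- (e :+ e) :* l := :- (e :* l)) & exp-neg _) ⟩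
   C * A′ * exp (ε * ½ * node J) ⁻¹ ≤⟨ *≤ˡ _ 0≤CA (⁻¹-anti (<-≤-trans 0<1 (x≤x+y (*≥0 (<≤ 0<ε/2) (0≤node J)))) (1+x≤exp _)) ⟩
   C * A′ * (1# + ε * ½ * node J) ⁻¹ ≤⟨ /-≤ (+>≥ 0<1 (*≥0 (<≤ 0<ε/2) (0≤node J))) (x≤y+x 0≤1 >> sym (*ˡ (/-cancel 0<ε/2) & *-comm _ _ & /-cancel he) ~> *≤ˡ e (<≤ he) (*≤ʳ _ (<≤ 0<ε/2) (sym (/-cancel 0<η) ~> *≤ʳ η 0≤η (<≤ h >> #-mono (N.m≤n⇒m≤1+n le))) >> *-comm _ _ ~> x≤y+x 0≤1)) ⟩
   e ∎
   where
   open ≤-Reasoning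
   0<ε/2 = half>0 0<ε
   A′ = expBound κ (ε * ½)
   0≤CA = *≥0 0≤C (<≤ (expBound>0 κ 0<ε/2))
   x = (1# + C * A′) / e / (ε * ½)
   0≤node : ∀ J -> 0# ≤ node J
   0≤node J = *≥0 (#≥0 (suc J)) 0≤η

  module _ {V : ℝ} (i : Inverse N ŵ V) where
   private
    module I = Inverse i
    u = I.inverse-of

   partial-sums : ∀ J -> Σᴮ J grid-term ≋ (q ⊝ E (node J)) ⊗ u
   partial-sums zero = O.sym (O.*-congʳ (O.+-congˡ (O.-‿cong (E-cong (*ʳ #-1 & 1* η))) ⊙ O.-‿inverseʳ q) ⊙ O.zeroˡ u)
   partial-sums (suc J) = begin Σᴮ J grid-term ⊕ ι η ⊗ e ≈⟨ O.+-cong (partial-sums J) (O.sym (O.*-identityʳ _) ⊙ O.*-congˡ (O.sym I.isInverse)) ⟩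
    (q ⊝ e) ⊗ u ⊕ ι η ⊗ e ⊗ (ι (η ⁻¹) ⊗ (𝟙 ⊝ q) ⊗ u) ≈⟨ byᴮ 5 (\ q e u n i -> (q :- e) :* u :+ n :* e :* (i :* (:1 :- q) :* u) := (q :- e) :* u :+ n :* i :* (e :* (:1 :- q) :* u)) ⟩
    (q ⊝ e) ⊗ u ⊕ ι η ⊗ ι (η ⁻¹) ⊗ (e ⊗ (𝟙 ⊝ q) ⊗ u) ≈⟨ O.+-congˡ (O.*-congʳ (O.sym (ι-* _ _) ⊙ ι-cong (inv 0<η) ⊙ ι-1)) ⟩
    (q ⊝ e) ⊗ u ⊕ 𝟙 ⊗ (e ⊗ (𝟙 ⊝ q) ⊗ u) ≈⟨ byᴮ 3 (\ q e u -> (q :- e) :* u :+ :1 :* (e :* (:1 :- q) :* u) := (q :- e :* q) :* u) ⟩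
    (q ⊝ e ⊗ q) ⊗ u ≈⟨ O.*-congʳ (O.+-congˡ (O.-‿cong (O.sym (E-cong (by 2 \ n h -> (:1 :+ n) :* h := n :* h :+ h) ⊙ E-node-step (node J))))) ⟩
    (q ⊝ E (node (suc J))) ⊗ u ∎
    where
    open ≋-Reasoning
    e = E (node J)

   grid-limit : (\ J -> Σᴮ J grid-term) ⟶ᴮ q ⊗ u
   grid-limit = ⟶-cong {a = \ J -> u ⊗ (q ⊝ E (node J))} (\ J -> O.*-comm _ _ ⊙ O.sym (partial-sums J))
    (byᴮ 2 \ u q -> u :* (q :- :0) := q :* u) (⟶-scale u (⟶-sub (⟶-const {a = \ _ -> q} (\ _ -> O.refl)) E-node-null))

   grid-bound : ∀ {v V'} -> w ⊗ v ≋ 𝟙 -> ‖ v ‖ ≤ V' -> ‖ q ⊗ u ⊝ v ‖ ≤ (# 2 * D * D + D) * η * (V * V')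
   grid-bound {v} {V'} wv hv = begin ‖ q ⊗ u ⊝ v ‖ ≈⟨ norm-cong (byᴮ 3 (\ q u v -> q :* u :- v := q :* u :* :1 :- v :* :1) ⊙ O.+-cong (O.*-congˡ (O.sym wv)) (O.-‿cong (O.*-congˡ (O.sym I.isInverse))) ⊙ byᴮ 5 \ q u v w x -> q :* u :* (w :* v) :- v :* (x :* u) := ((q :- :1) :* w :+ (w :- x)) :* (u :* v)) ⟩
    ‖ ((q ⊝ 𝟙) ⊗ w ⊕ (w ⊝ ŵ)) ⊗ (u ⊗ v) ‖ ≤⟨ norm-*-≤ (norm-+-≤ (norm-*-≤ q-1 w-bound) ŵ-w) (norm-*-≤ I.bound hv) ⟩
    (# 2 * D * η * D + D * η) * (V * V') ≈⟨ *ʳ (by 2 \ d e -> con 2 :* d :* e :* d :+ d :* e := (con 2 :* d :* d :+ d) :* e) ⟩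
    (# 2 * D * D + D) * η * (V * V') ∎
    where open ≤-Reasoning

  -- Passing to dual numbers
  private
   module DN = Normed (Dual.algebra N)
  χ′ = Extend.extend χ (<≤ 0<ε) 0≤C 0# ≤-refl 0≤1 linearIncrement

  lift-ŵ : ∀ {V} -> Inverse N ŵ V -> Inverse (Dual.algebra N) (DN.ι (η ⁻¹) DN.⊗ (DN.𝟙 DN.⊝ Character.E χ′ η)) (V + V * V * (C * # 2 ^ κ))
  lift-ŵ i = lift-inverse N (O.sym (O.+-congˡ (O.*-congʳ ι-0 ⊙ O.zeroˡ _) ⊙ O.+-identityʳ _)) i (norm-cong second ~> E-near)
   where
   second = O.+-congʳ (O.+-congʳ (O.*-congˡ (O.+-congˡ (O.-‿cong (O.*-congʳ (ι-neg η)))))) ⊙ byᴮ 5 (\ i n q o x -> i :* (:0 :- :- n :* q) :+ :0 :* (:1 :- q) :+ o :* (:0 :* x) := n :* i :* q) ⊙ O.*-congʳ (O.sym (ι-* _ _) ⊙ ι-cong (inv 0<η) ⊙ ι-1) ⊙ O.*-identityˡ q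
   E-near = E-bound 0≤η >> *≤ˡ C 0≤C (*-mono (^≥0 κ (+≥0 0≤1 0≤η)) (^-mono κ (+≥0 0≤1 0≤η) (lin η≤1 (by 1 \ u -> :1 :+ u :+ :1 := u :+ con 2)))
    (exp≥0 _) (exp-neg≤1 (*≥0 (<≤ 0<ε) 0≤η)) >~ *1 _)

 -- Top coefficients

 open Complex using (complexAlgebra)

 module ℂ = Normed complexAlgebra

 -- Coefficient of the highest order derivative, up to sign
 topᶜ : ∀ k -> NormedAlgebra.B (Level k) -> ℂ.B
 topᶜ zero x = x
 topᶜ (suc k) (a , b) = ℂ.⊖ topᶜ k b

 top-cong : ∀ k {x y} -> NormedAlgebra._≋_ (Level k) x y -> topᶜ k x ℂ.≋ topᶜ k y
 top-cong zero p = p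
 top-cong (suc k) (p , q) = ℂ.O.-‿cong (top-cong k q)

 top-norm : ∀ k x -> ℂ.‖ topᶜ k x ‖ ≤ NormedAlgebra.‖_‖ (Level k) x
 top-norm zero x = ≤-refl
 top-norm (suc k) (a , b) = ℂ.norm-neg (topᶜ k b) ~> top-norm k b >> x≤y+x (NormedAlgebra.norm≥0 (Level k) a)

 top-⊕ : ∀ k x y -> topᶜ k (NormedAlgebra._⊕_ (Level k) x y) ℂ.≋ topᶜ k x ℂ.⊕ topᶜ k y
 top-⊕ zero x y = ℂ.O.refl
 top-⊕ (suc k) (a , b) (c , d) = ℂ.O.trans (ℂ.O.-‿cong (top-⊕ k b d)) (ℂ.byᴮ 2 \ x y -> :- (x :+ y) := :- x :+ :- y)

 top-⊖ : ∀ k x -> topᶜ k (NormedAlgebra.⊖_ (Level k) x) ℂ.≋ ℂ.⊖ topᶜ k x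
 top-⊖ zero x = ℂ.O.refl
 top-⊖ (suc k) (a , b) = ℂ.O.-‿cong (top-⊖ k b)

 top-𝟘 : ∀ k -> topᶜ k (NormedAlgebra.𝟘 (Level k)) ℂ.≋ ℂ.𝟘
 top-𝟘 zero = ℂ.O.refl
 top-𝟘 (suc k) = ℂ.O.trans (ℂ.O.-‿cong (top-𝟘 k)) (ℂ.byᴮ 0 (:- :0 := :0))

 top-ι : ∀ k r x -> topᶜ k (NormedAlgebra._⊗_ (Level k) (NormedAlgebra.ι (Level k) r) x) ℂ.≋ ℂ.ι r ℂ.⊗ topᶜ k x
 top-ι zero r x = ℂ.O.refl
 top-ι (suc k) r (a , b) = ℂ.O.trans (ℂ.O.-‿cong (ℂ.O.trans (top-cong k second) (top-ι k r b))) (ℂ.byᴮ 2 \ r x -> :- (r :* x) := r :* :- x)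
  where
  open Normed (Level k)
  y = ι r ⊗ b ⊕ 𝟘 ⊗ a ⊕ ι 0# ⊗ (𝟘 ⊗ b)
  second : y ≋ ι r ⊗ b
  second = byᴮ 4 (\ r a b o -> r :* b :+ :0 :* a :+ o :* (:0 :* b) := r :* b)

 top-Σ : ∀ k n f -> topᶜ k (Normed.Σᴮ (Level k) n f) ℂ.≋ ℂ.Σᴮ n (\ i -> topᶜ k (f i))
 top-Σ k zero f = top-𝟘 k
 top-Σ k (suc n) f = ℂ.O.trans (top-⊕ k (Normed.Σᴮ (Level k) n f) (f n)) (ℂ.O.+-congʳ (top-Σ k n f))

 -- Primes carry the mass log p / p at log p, and multiples of η the mass η.
 primeMass : ℕ -> ℝ
 primeMass i = if isPrime (suc i) then L i * recip i else 0#

 gridPoint : ℝ -> ℕ -> ℝ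
 gridPoint η j = # (suc j) * η

 module _ (ε t : ℝ) (0<ε : 0# < ε) where
  open Tower ε t 0<ε
  private
   E₀ : ℝ -> ℂ.B
   E₀ = Character.E (complexCharacter ε t 0<ε)

  top-E : ∀ k u -> topᶜ k (Character.E (χ k) u) ℂ.≋ ℂ.ι (u ^ k) ℂ.⊗ E₀ u
  top-E zero u = ℂ.O.sym (ℂ.O.trans (ℂ.O.*-congʳ ℂ.ι-1) (ℂ.O.*-identityˡ (E₀ u)))
  top-E (suc k) u = begin ℂ.⊖ topᶜ k (NormedAlgebra._⊗_ (Level k) (NormedAlgebra.ι (Level k) (- u)) (Character.E (χ k) u)) ≈⟨ ℂ.O.-‿cong (top-ι k (- u) (Character.E (χ k) u)) ⟩
   ℂ.⊖ (ℂ.ι (- u) ℂ.⊗ topᶜ k (Character.E (χ k) u)) ≈⟨ ℂ.O.-‿cong (ℂ.O.*-cong (ℂ.ι-neg u) (top-E k u)) ⟩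
   ℂ.⊖ ((ℂ.⊖ ℂ.ι u) ℂ.⊗ (ℂ.ι (u ^ k) ℂ.⊗ E₀ u)) ≈⟨ ℂ.byᴮ 3 (\ u p e -> :- (:- u :* (p :* e)) := u :* p :* e) ⟩
   (ℂ.ι u ℂ.⊗ ℂ.ι (u ^ k)) ℂ.⊗ E₀ u ≈⟨ ℂ.O.*-congʳ (ℂ.O.sym (ℂ.ι-* u (u ^ k))) ⟩
   ℂ.ι (u ^ suc k) ℂ.⊗ E₀ u ∎
   where open ℂ.≋-Reasoning

  module _ (k : ℕ) (η : ℝ) (0<η : 0# < η) (η≤1 : η ≤ 1#) where
   private
    module 𝔸 = Normed (Level k)
    module G = Grid (χ k) 0<ε 0≤2 η 0<η η≤1

    prime-part : ℕ -> ℂ.B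
    prime-part i = ℂ.ι (primeMass i * L i ^ k) ℂ.⊗ E₀ (L i)
    grid-part : ℕ -> ℂ.B
    grid-part j = ℂ.ι (η * gridPoint η j ^ k) ℂ.⊗ E₀ (gridPoint η j)

    top-prime-term : ∀ i -> topᶜ k (LD.prime-term k i) ℂ.≋ prime-part i
    top-prime-term i = go (isPrime (suc i))
     where
     x = 𝔸._⊗_ (𝔸.ι (L i)) (Zₖ.z k i)
     go : ∀ b -> topᶜ k (if b then x else 𝔸.𝟘) ℂ.≋ ℂ.ι ((if b then L i * recip i else 0#) * L i ^ k) ℂ.⊗ E₀ (L i)
     go false = ℂ.O.trans (top-𝟘 k) (ℂ.O.sym (ℂ.O.trans (ℂ.O.*-congʳ (ℂ.O.trans (ℂ.ι-cong (zeroˡ _)) ℂ.ι-0)) (ℂ.O.zeroˡ (E₀ (L i)))))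
     go true = begin topᶜ k x ≈⟨ top-ι k (L i) (Zₖ.z k i) ⟩ ℂ.ι (L i) ℂ.⊗ topᶜ k (Zₖ.z k i) ≈⟨ ℂ.O.*-congˡ (ℂ.O.trans (top-ι k (recip i) (Character.E (χ k) (L i))) (ℂ.O.*-congˡ (top-E k (L i)))) ⟩
      ℂ.ι (L i) ℂ.⊗ (ℂ.ι (recip i) ℂ.⊗ (ℂ.ι (L i ^ k) ℂ.⊗ E₀ (L i))) ≈⟨ ℂ.byᴮ 4 (\ a b c d -> a :* (b :* (c :* d)) := a :* b :* c :* d) ⟩
      ((ℂ.ι (L i) ℂ.⊗ ℂ.ι (recip i)) ℂ.⊗ ℂ.ι (L i ^ k)) ℂ.⊗ E₀ (L i) ≈⟨ ℂ.O.*-congʳ (ℂ.O.sym (ℂ.O.trans (ℂ.ι-* (L i * recip i) (L i ^ k)) (ℂ.O.*-congʳ (ℂ.ι-* (L i) (recip i))))) ⟩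
      ℂ.ι (L i * recip i * L i ^ k) ℂ.⊗ E₀ (L i) ∎
      where open ℂ.≋-Reasoning

    top-grid-term : ∀ j -> topᶜ k (G.grid-term j) ℂ.≋ grid-part j
    top-grid-term j = begin topᶜ k (G.grid-term j) ≈⟨ top-ι k η (Character.E (χ k) p) ⟩
     ℂ.ι η ℂ.⊗ topᶜ k (Character.E (χ k) p) ≈⟨ ℂ.O.*-congˡ (top-E k p) ⟩
     ℂ.ι η ℂ.⊗ (ℂ.ι (p ^ k) ℂ.⊗ E₀ p) ≈⟨ ℂ.O.sym (ℂ.O.*-assoc (ℂ.ι η) (ℂ.ι (p ^ k)) (E₀ p)) ⟩
     (ℂ.ι η ℂ.⊗ ℂ.ι (p ^ k)) ℂ.⊗ E₀ p ≈⟨ ℂ.O.*-congʳ (ℂ.O.sym (ℂ.ι-* η (p ^ k))) ⟩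
     grid-part j ∎
     where
     open ℂ.≋-Reasoning
     p = gridPoint η j

   -- If the two transforms are eventually close then so are their k-th derivatives.
   top-difference : ∀ {c} v V' {V} -> 𝔸._≋_ (𝔸._⊗_ (Character.w (χ k)) v) 𝔸.𝟙 -> 𝔸.‖_‖ v ≤ V' -> Inverse (Level k) G.ŵ V -> (# 2 * Dₖ k * Dₖ k + Dₖ k) * η * (V * V') ≤ 1# -> 𝔸.‖_‖ (𝔸._⊝_ (primeSum k) v) ≤ c -> ∃[ M ] (∀ n -> M N.≤ n -> ℂ.‖ ℂ.Σᴮ n prime-part ℂ.⊝ ℂ.Σᴮ n grid-part ‖ ≤ c + # 2)
   top-difference {c} v V' wv hv i small hc =
    let (M , h) = limit 1# 0<1 in M , \ n le -> ℂ.norm-cong (ℂ.O.sym (top-S n)) ~> top-norm k (S n) >>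
     norm-≤-+ (S n) l >> (l-bound ⊞ h n le) >~ by 1 (\ c -> c :+ :1 :+ :1 := c :+ con 2)
    where
    open Normed (Level k)
    l = primeSum k ⊝ Character.E (χ k) η ⊗ Inverse.inverse-of i
    S : ℕ -> B
    S n = Σᴮ n (LD.prime-term k) ⊝ Σᴮ n G.grid-term
    limit : S ⟶ᴮ l
    limit = ⟶-sub (LD.Λ₁-series k) (G.grid-limit i)
    l-bound : ‖ l ‖ ≤ c + 1#
    l-bound = norm-cong (byᴮ 3 \ a b v -> a :- b := a :- v :- (b :- v)) ~> norm-sub _ _ >> (hc ⊞ G.grid-bound i wv hv >> small)
    top-S : ∀ n -> topᶜ k (S n) ℂ.≋ ℂ.Σᴮ n prime-part ℂ.⊝ ℂ.Σᴮ n grid-part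
    top-S n = ℂ.O.trans (top-⊕ k (Σᴮ n (LD.prime-term k)) (⊖ Σᴮ n G.grid-term)) (ℂ.O.+-cong
     (ℂ.O.trans (top-Σ k n (LD.prime-term k)) (ℂ.Σᴮ-cong′ n top-prime-term))
     (ℂ.O.trans (top-⊖ k (Σᴮ n G.grid-term)) (ℂ.O.-‿cong (ℂ.O.trans (top-Σ k n G.grid-term) (ℂ.Σᴮ-cong′ n top-grid-term)))))

 -- Kernels

 open Complex using (complexAlgebra; point; norm-point; re; re-cong; re-𝟘; re-⊕; re-⊝; re-ι⊗; abs-re; cos; cos≈re; cos-cong; cos-neg; cos-cos; cis; cis-0; cis-+; norm-cis)

 -- Sums over the primes and over the grid of mesh η, truncated after n terms
 α : ℕ -> (ℝ -> ℝ) -> ℝ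
 α n f = Σ n (\ i -> primeMass i * f (L i))

 β : ℝ -> ℕ -> (ℝ -> ℝ) -> ℝ
 β η n f = Σ n (\ j -> η * f (gridPoint η j))

 primeMass≥0 : ∀ i -> 0# ≤ primeMass i
 primeMass≥0 i = go (isPrime (suc i))
  where go : ∀ b -> 0# ≤ (if b then L i * recip i else 0#)
        go true = *≥0 (L≥0 i) (recip≥0 i)
        go false = ≤-refl

 -- A complex sum and its rotated real part
 module _ (ε t v : ℝ) (0<ε : 0# < ε) where

  -- The test function u^k exp (- ε u) cos (t (u - v))
  wave : ℕ -> ℝ -> ℝ
  wave k u = u ^ k * exp (- (ε * u)) * cos (t * (u - v))

  private
   E₀ = Character.E (complexCharacter ε t 0<ε)

   rotate : ℂ.B -> ℝ
   rotate x = re (cis (t * v) ℂ.⊗ x)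

   rotate-term : ∀ k c u -> rotate (ℂ.ι (c * u ^ k) ℂ.⊗ E₀ u) ≈ c * wave k u
   rotate-term k c u = begin rotate (ℂ.ι (c * u ^ k) ℂ.⊗ E₀ u) ≈⟨ re-cong (ℂ.O.trans (ℂ.byᴮ 4 \ r p e s -> r :* (p :* (e :* s)) := p :* e :* (r :* s))
    (ℂ.O.*-cong (ℂ.O.sym (ℂ.ι-* _ _)) (ℂ.O.sym (cis-+ _ _)))) ⟩
    re (ℂ.ι (c * u ^ k * e) ℂ.⊗ cis (t * v + - (t * u))) ≈⟨ re-ι⊗ _ _ & *ˡ (sym (cos≈re _)) ⟩
    c * u ^ k * e * cos (t * v + - (t * u)) ≈⟨ *ˡ (sym (cos-neg _) & cos-cong (by 3 \ t u v -> :- (t :* v :+ :- (t :* u)) := t :* (u :- v))) ⟩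
    c * u ^ k * e * cos (t * (u - v)) ≈⟨ by 4 (\ c p e s -> c :* p :* e :* s := c :* (p :* e :* s)) ⟩
    c * wave k u ∎
    where open SetoidReasoning setoid
          e = exp (- (ε * u))

   rotate-Σ : ∀ n (f : ℕ -> ℂ.B) (g : ℕ -> ℝ) -> (∀ i -> rotate (f i) ≈ g i) -> rotate (ℂ.Σᴮ n f) ≈ Σ n g
   rotate-Σ zero f g h = re-cong (ℂ.O.zeroʳ _) & re-𝟘
   rotate-Σ (suc n) f g h = re-cong (ℂ.O.distribˡ _ _ _) & re-⊕ _ _ & +-cong (rotate-Σ n f g h) (h n)

  wave-difference : ∀ k η n -> let S = ℂ.Σᴮ n (\ i -> ℂ.ι (primeMass i * L i ^ k) ℂ.⊗ E₀ (L i)) ℂ.⊝ ℂ.Σᴮ n (\ j -> ℂ.ι (η * gridPoint η j ^ k) ℂ.⊗ E₀ (gridPoint η j)) in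
   ∣ α n (wave k) - β η n (wave k) ∣ ≤ # 2 * ℂ.‖ S ‖
  wave-difference k η n = begin ∣ α n (wave k) - β η n (wave k) ∣ ≈⟨ abs-cong (sym (re-cong (ℂ.byᴮ 3 \ r x y -> r :* (x :- y) := r :* x :- r :* y) & re-⊝ _ _ & +-cong (rotate-Σ n _ _ (\ i -> rotate-term k (primeMass i) (L i))) (-ᶜ (rotate-Σ n _ _ (\ j -> rotate-term k η (gridPoint η j)))))) ⟩
   ∣ rotate (S₁ ℂ.⊝ S₂) ∣ ≤⟨ abs-re _ ⟩
   ℂ.‖ cis (t * v) ℂ.⊗ (S₁ ℂ.⊝ S₂) ‖ ≤⟨ ℂ.norm-*-≤ (norm-cis (t * v)) ≤-refl ⟩
   # 2 * ℂ.‖ S₁ ℂ.⊝ S₂ ‖ ∎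
   where
   open ≤-Reasoning
   S₁ = ℂ.Σᴮ n (\ i -> ℂ.ι (primeMass i * L i ^ k) ℂ.⊗ E₀ (L i))
   S₂ = ℂ.Σᴮ n (\ j -> ℂ.ι (η * gridPoint η j ^ k) ℂ.⊗ E₀ (gridPoint η j))

 -- Bound for the inverse of the difference quotient at level k
 gridᶜ : ℕ -> ℝ -> ℝ
 gridᶜ zero b = b
 gridᶜ (suc k) b = gridᶜ k b + gridᶜ k b * gridᶜ k b * (# 2 * # 2 ^ k)

 gridᶜ≥0 : ∀ k {b} -> 0# ≤ b -> 0# ≤ gridᶜ k b
 gridᶜ≥0 zero h = h
 gridᶜ≥0 (suc k) h = +≥0 (gridᶜ≥0 k h) (*≥0 (*≥0 (gridᶜ≥0 k h) (gridᶜ≥0 k h)) (*≥0 0≤2 (^≥0 k 0≤2)))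

 -- Agreement of the two sums up to b once sufficiently many terms are taken
 Agree : ℝ -> ℝ -> (ℝ -> ℝ) -> Set
 Agree η b f = ∃[ M ] (∀ n -> M N.≤ n -> ∣ α n f - β η n f ∣ ≤ b)

 module Kernel (k : ℕ) (ε W R T : ℝ) (m : ℕ) (0<ε : 0# < ε) (ε≤t₀ : ε ≤ t₀) (1≤W : 1# ≤ W) (0≤T : 0# ≤ T)
  (W-bound : ε + 1# + # 2 * T ≤ W) (W-m : W * W ≤ exp (½ * L m)) (m-R : L (suc m) ≤ R) where
  private
   Db = dᶜ k * (W * W)
   b = # 2 / (ε * ½)
   V = gridᶜ k b
   V' = wᶜ k (# 2 / ε)
   Q = (# 2 * Db * Db + Db) * (V * V') + # 8 * (W * W) / (ε * ½) + 1#
   0<ε/2 = half>0 0<ε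
   0≤W = 0≤1 >> 1≤W
   0≤WW = *≥0 0≤W 0≤W
   0≤Db = *≥0 (dᶜ≥0 k) 0≤WW
   0≤V = gridᶜ≥0 k (/≥0 0≤2 0<ε/2)
   0≤V' = wᶜ≥0 k (/≥0 0≤2 0<ε)
   0≤Q₁ = *≥0 (+≥0 (*≥0 (*≥0 0≤2 0≤Db) 0≤Db) 0≤Db) (*≥0 0≤V 0≤V')
   0≤Q₂ = /≥0 (*≥0 (#≥0 8) 0≤WW) 0<ε/2
   0<Q : 0# < Q
   0<Q = +≥> (+≥0 0≤Q₁ 0≤Q₂) 0<1

  -- A mesh for which the grid is a good approximation
  mesh : ℝ
  mesh = Q ⁻¹

  mesh>0 : 0# < mesh
  mesh>0 = ⁻¹>0 0<Q

  -- Bound for the discrepancy between primes and grid against one wave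
  kernelBound : ℝ
  kernelBound = # 2 * (primeᶜ k * (1# + R) ^ primeᵉ k + # 2)

  module _ (η : ℝ) (0<η : 0# < η) (η≤ : η ≤ mesh) where
   private
    Qη≤1 : Q * η ≤ 1#
    Qη≤1 = *≤ˡ Q (<≤ 0<Q) η≤ >~ inv 0<Q
    part : ∀ {x} -> 0# ≤ x -> x ≤ Q -> x * η ≤ 1#
    part hx h = *≤ʳ η (<≤ 0<η) h >> Qη≤1
    η≤1 : η ≤ 1#
    η≤1 = sym (1* η) ~> part 0≤1 (x≤y+x (+≥0 0≤Q₁ 0≤Q₂))

    module AtFrequency (t : ℝ) (t≤T : ∣ t ∣ ≤ T) where
     open Tower ε t 0<ε
     size≤W : size ε t ≤ W
     size≤W = lin (t≤T ⊞ 0≤T ⊞ 0≤1) (by 3 \ e t T -> e :+ t :+ (T :+ (T :+ :1)) := t :+ (:0 :+ :0) :+ (e :+ :1 :+ con 2 :* T)) >> W-bound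
     D₀≤ : D₀ ε t ≤ # 8 * (W * W)
     D₀≤ = D₀-bound 0<ε 1≤W size≤W
     module G k = Grid (χ k) 0<ε 0≤2 η 0<η η≤1
     ε≤w : ε ≤ ℂ.‖ point ε t ‖
     ε≤w = ≤abs ε >> x≤x+y (0≤abs t) >~ sym (norm-point ε t)
     ŵ-inverse : ∀ k -> Inverse (Level k) (G.ŵ k) (gridᶜ k b)
     ŵ-inverse zero = complex-inverse′ (G.ŵ 0) 0<ε/2 (lin (ε≤w >> ℂ.norm-≤-+ (point ε t) (G.ŵ 0) ⊞ G.ŵ-w 0 >> Dη≤)
      (by 3 (\ h y z -> h :+ (y :+ z :+ h) := h :+ h :+ z :+ y) & +ʳ (+ʳ (half+half ε))))
      where
      Dη≤ : D₀ ε t * η ≤ ε * ½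
      Dη≤ = *≤ʳ η (<≤ 0<η) D₀≤ >> *ʳ (sym (/-cancel 0<ε/2)) & by 3 (\ a b c -> a :* b :* c := b :* (a :* c)) ~> *≤ˡ _ (<≤ 0<ε/2) (part 0≤Q₂ (x≤y+x 0≤Q₁ >> x≤x+y 0≤1)) >~ *1 _
     ŵ-inverse (suc k) = G.lift-ŵ k (ŵ-inverse k)

     w⁻¹ = w-inverse k (complex-inverse′ (point ε t) 0<ε ε≤w)
     D≤Db : Dₖ k ≤ Db
     D≤Db = Dₖ≤ k (sym (1* 1#) ~> *-mono 0≤1 1≤W 0≤1 1≤W) D₀≤
     0≤Dk : 0# ≤ Dₖ k
     0≤Dk = Zₖ.0≤D k
     small : (# 2 * Dₖ k * Dₖ k + Dₖ k) * η * (V * V') ≤ 1#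
     small = *≤ʳ _ (*≥0 0≤V 0≤V') (*≤ʳ η (<≤ 0<η) (*-mono (*≥0 0≤2 0≤Dk) (*≤ˡ _ 0≤2 D≤Db) 0≤Dk D≤Db ⊞ D≤Db)) >> by 4 (\ d e a c -> d :* e :* (a :* c) := d :* (a :* c) :* e) ~> part 0≤Q₁ (x≤x+y 0≤Q₂ >> x≤x+y 0≤1)

     agree : ∀ v -> Agree η kernelBound (wave ε t v 0<ε k)
     agree v = let (M , h) = top-difference ε t 0<ε k η 0<η η≤1 (Inverse.inverse-of w⁻¹) V' (Inverse.isInverse w⁻¹) (Inverse.bound w⁻¹) (ŵ-inverse k) small
                    (primeSum-bound ε t 0<ε k W R m ε≤t₀ 1≤W (+-monoʳ-≤ _ (*≤ˡ _ 0≤2 t≤T) >> W-bound) W-m m-R (Inverse.isInverse w⁻¹))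
      in M , \ n le -> wave-difference ε t v 0<ε k η n >> *≤ˡ _ 0≤2 (h n le)

   average : ∀ {c f g h} -> (∀ u -> h u ≈ (f u + g u) * ½) -> Agree η c f -> Agree η c g -> Agree η c h
   average {c} {f} {g} {h} eq (M , p) (M' , q) = M N.⊔ M' , \ n le -> abs-cong (difference n) & abs-* _ _ & *ˡ (abs≥0 (<≤ 0<½)) ~> *≤ʳ ½ (<≤ 0<½) (abs-+ _ _ >> (p n (N.m⊔n≤o⇒m≤o M M' le) ⊞ q n (N.m⊔n≤o⇒n≤o M M' le))) >~ distribʳ _ _ _ & half+half c
    where
    linear : ∀ n (x : ℕ -> ℝ) (y : ℕ -> ℝ) -> Σ n (\ i -> x i * h (y i)) ≈ (Σ n (\ i -> x i * f (y i)) + Σ n (\ i -> x i * g (y i))) * ½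
    linear n x y = Σ-cong′ n (\ i -> *ˡ (eq (y i)) & by 4 \ x f g h -> x :* ((f :+ g) :* h) := h :* (x :* f :+ x :* g)) & Σ-* n ½ _ & *ˡ (Σ-+ n _ _) & *-comm _ _
    difference : ∀ n -> α n h - β η n h ≈ (α n f - β η n f + (α n g - β η n g)) * ½
    difference n = +-cong (linear n primeMass L) (-ᶜ (linear n (\ _ -> η) (gridPoint η))) & by 5 (\ a b c d h -> (a :+ b) :* h :- (c :+ d) :* h := (a :- c :+ (b :- d)) :* h)

   -- The kernel cos^N is an average of the waves of frequencies up to N h.
   kernel-agree : ∀ N h v -> 0# ≤ h -> ∀ t -> ∣ t ∣ + # N * h ≤ T -> Agree η kernelBound (\ u -> u ^ k * exp (- (ε * u)) * cos (h * (u - v)) ^ N * cos (t * (u - v)))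
   kernel-agree zero h v 0≤h t t≤ = average {f = wave ε t v 0<ε k} {g = wave ε t v 0<ε k} (\ u -> sym (half-sum (wave ε t v 0<ε k u) & one (u ^ k) (exp (- (ε * u))) (cos (t * (u - v))))) first first
    where
    one : ∀ p e c -> p * e * c ≈ p * e * 1# * c
    one p e c = by 3 (\ p e c -> p :* e :* c := p :* e :* :1 :* c)
    half-sum : ∀ x -> (x + x) * ½ ≈ x
    half-sum x = distribʳ _ _ _ & half+half x
    first = AtFrequency.agree t (x≤x+y (≈⇒≤ (sym (zeroˡ h))) >> ≤-refl >> t≤) v
   kernel-agree (suc N) h v 0≤h t t≤ = average step (kernel-agree N h v 0≤h (t + h) ((abs-+ t h ⊞ ≤-refl) >> shifted))
    (kernel-agree N h v 0≤h (t - h) ((abs-+ t (- h) >> +-monoʳ-≤ _ (≈⇒≤ (abs-neg h)) ⊞ ≤-refl) >> shifted))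
    where
    shifted : ∣ t ∣ + ∣ h ∣ + # N * h ≤ T
    shifted = +ʳ (+ˡ (abs≥0 0≤h)) & by 3 (\ t h n -> t :+ h :+ n :* h := t :+ (:1 :+ n) :* h) ~> t≤
    step : ∀ u -> u ^ k * exp (- (ε * u)) * cos (h * (u - v)) ^ suc N * cos (t * (u - v)) ≈ (u ^ k * exp (- (ε * u)) * cos (h * (u - v)) ^ N * cos ((t + h) * (u - v)) + u ^ k * exp (- (ε * u)) * cos (h * (u - v)) ^ N * cos ((t - h) * (u - v))) * ½
    step u = by 5 (\ p e c d s -> p :* e :* (c :* d) :* s := p :* e :* d :* (s :* c)) & *ˡ (cos-cos (t * (u - v)) (h * (u - v))) & *ˡ (*ʳ (+-cong (cos-cong (by 3 \ t h x -> t :* x :+ h :* x := (t :+ h) :* x)) (cos-cong (by 3 \ t h x -> t :* x :- h :* x := (t :- h) :* x)))) &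
     by 4 (\ p a b h -> p :* ((a :+ b) :* h) := (p :* a :+ p :* b) :* h)

 -- Powers of the cosine

 open ≤-Reasoning hiding (start; stop)

 module CosinePowers where

  open Complex

  cos-lipschitz : ∀ x y -> ∣ x - y ∣ ≤ 1# -> ∣ cos x - cos y ∣ ≤ # 4 * ∣ x - y ∣
  cos-lipschitz x y h = begin ∣ cos x - cos y ∣ ≈⟨ abs-cong (+ʳ (cos-cong (by 2 \ x y -> x := y :+ (x :- y)) & cos-+ y d) & by 4 \ a b s u -> a :* b :- s :* u :- a := a :* (b :- :1) :- s :* u) ⟩
   ∣ cos y * (cos d - 1#) - sin y * sin d ∣ ≤⟨ abs-+ _ _ >> (≤1* (abs-cos≤1 y) ⊞ abs-neg _ ~> ≤1* (abs-sin≤1 y)) ⟩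
   ∣ cos d - 1# ∣ + ∣ sin d ∣ ≤⟨ ≤-refl ⊞ abs-cong (by 2 \ s d -> s := s :- d :+ d) ~> abs-+ (sin d - d) d ⟩
   ∣ cos d - 1# ∣ + (∣ sin d - d ∣ + ∣ d ∣) ≤⟨ lin (cos-taylor d h ⊞ *≥0 (0≤abs d) (+≥0 (sub≥0 h) (#≥0 2)))
    (by 3 \ a b d -> a :+ (b :+ d) :+ (d :* d :+ d :* (:1 :- d :+ con 2)) := a :+ b :+ :0 :+ con 4 :* d) ⟩
   # 4 * ∣ d ∣ ∎
   where
   d = x - y
   ≤1* : ∀ {a b} -> ∣ a ∣ ≤ 1# -> ∣ a * b ∣ ≤ ∣ b ∣
   ≤1* h = abs-* _ _ ~> *≤ʳ _ (0≤abs _) h >~ 1* _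

  1-x²≤cos : ∀ x -> ∣ x ∣ ≤ 1# -> 1# - x * x ≤ cos x
  1-x²≤cos x h = lin (-≤abs _ >> x≤x+y (0≤abs (sin x - x)) >> cos-taylor x h)
   (+ˡ (abs-sq x) & by 2 \ x c -> :1 :- x :* x :+ x :* x := :- (c :- :1) :+ c)

  -- By the double angle formula
  cos≤ : ∀ x -> ∣ x ∣ ≤ 1# -> # 8 * cos x ≤ # 8 - x * x
  cos≤ x h = begin # 8 * cos x ≈⟨ *ˡ double ⟩
   # 8 * (1# - # 2 * (sin y * sin y)) ≤⟨ lin (*≤ˡ (# 16) (#≥0 16) sin²) (by 2 (\ s q -> con 8 :* (:1 :- con 2 :* s) :+ con 16 :* s := con 16 :* q :+ (con 8 :- con 16 :* q)) & +ˡ (+ˡ (-ᶜ quarter))) ⟩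
   # 8 - x * x ∎
   where
   y = x * ½
   y≤½ : ∣ y ∣ ≤ ½
   y≤½ = abs-* x ½ & *ˡ (abs≥0 (<≤ 0<½)) ~> *≤ʳ ½ (<≤ 0<½) h >~ 1* ½
   double : cos x ≈ 1# - # 2 * (sin y * sin y)
   double = cos-cong (sym (half+half x)) & cos-+ y y & by 2 (\ c s -> c :* c :- s :* s := c :* c :+ s :* s :- con 2 :* (s :* s)) & +ʳ (sq-cos-sin y)
   sin-lower : ∣ y ∣ * ½ ≤ ∣ sin y ∣
   sin-lower = lin (abs-cong (by 2 \ y s -> y := s :+ :- (s :- y)) ~> abs-+ (sin y) (- (sin y - y)) ⊞ abs-neg _ ~> x≤y+x (0≤abs (cos y - 1#)) >> cos-taylor y (y≤½ >> ½≤1) >> *≤ˡ _ (0≤abs y) y≤½)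
    (by 4 (\ a h s e -> a :* h :+ (s :+ e :+ a :* h) := a :* h :+ a :* h :+ (e :+ s)) & +ʳ (half+half ∣ y ∣) & sym (+-assoc _ _ _))
   sin² : y * (y * ½ * ½) ≤ sin y * sin y
   sin² = by 2 (\ y h -> y :* (y :* h :* h) := y :* y :* (h :* h)) & *ʳ (sym (abs-sq y)) & by 2 (\ a h -> a :* a :* (h :* h) := a :* h :* (a :* h)) ~> *-mono 0≤ sin-lower 0≤ sin-lower >~ abs-sq (sin y)
    where 0≤ = *≥0 (0≤abs y) (<≤ 0<½)
   quarter : # 16 * (y * (y * ½ * ½)) ≈ x * x
   quarter = by 2 (\ x h -> con 16 :* (x :* h :* (x :* h :* h :* h)) := x :* x :* (con 2 :* h) :^ 4) & *ˡ (^-congˡ 4 2½ & 1^ 4) & *1 _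

  abs-^≤1 : ∀ n {x} -> ∣ x ∣ ≤ 1# -> ∣ x ^ n ∣ ≤ 1#
  abs-^≤1 zero h = ≈⇒≤ (abs≥0 0≤1)
  abs-^≤1 (suc n) h = abs-* _ _ ~> *-mono (0≤abs _) h (0≤abs _) (abs-^≤1 n h) >~ 1* 1#

  ^-lipschitz : ∀ n {x y} -> ∣ x ∣ ≤ 1# -> ∣ y ∣ ≤ 1# -> ∣ x ^ n - y ^ n ∣ ≤ # n * ∣ x - y ∣
  ^-lipschitz zero {x} {y} hx hy = ≈⇒≤ (abs-cong (-‿inverseʳ 1#) & abs≥0 ≤-refl & sym (zeroˡ _))
  ^-lipschitz (suc n) {x} {y} hx hy = begin
   ∣ x * x ^ n - y * y ^ n ∣ ≈⟨ abs-cong (by 4 \ x p y q -> x :* p :- y :* q := (x :- y) :* p :+ y :* (p :- q)) ⟩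
   ∣ (x - y) * x ^ n + y * (x ^ n - y ^ n) ∣ ≤⟨ abs-+ _ _ ⟩
   ∣ (x - y) * x ^ n ∣ + ∣ y * (x ^ n - y ^ n) ∣ ≤⟨ (abs-* _ _ ~> *≤ˡ _ (0≤abs _) (abs-^≤1 n hx)) ⊞ (abs-* _ _ ~> *-mono (0≤abs y) hy (0≤abs _) (^-lipschitz n hx hy)) ⟩
   ∣ x - y ∣ * 1# + 1# * (# n * ∣ x - y ∣) ≈⟨ by 2 (\ d n -> d :* :1 :+ :1 :* (n :* d) := (:1 :+ n) :* d) ⟩
   # (suc n) * ∣ x - y ∣ ∎

  -- The kernel cos (h y) ^ 2N, concentrated near 0
  module CosinePower (h : ℝ) (0<h : 0# < h) (N : ℕ) where

   K : ℝ -> ℝ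
   K y = cos (h * y) ^ (N N.+ N)

   K-cong : ∀ {x y} -> x ≈ y -> K x ≈ K y
   K-cong p = ^-congˡ (N N.+ N) (cos-cong (*ˡ p))

   K-square : ∀ y -> K y ≈ (cos (h * y) * cos (h * y)) ^ N
   K-square y = ^-homo-* _ N N & sym (^-distrib-* _ _ N)

   K≥0 : ∀ y -> 0# ≤ K y
   K≥0 y = ≤-resp refl (sym (K-square y)) (^≥0 N (sq≥0 _))

   K≤1 : ∀ y -> K y ≤ 1#
   K≤1 y = ≤abs _ >> abs-^≤1 (N N.+ N) (abs-cos≤1 (h * y))

   K-neg : ∀ y -> K (- y) ≈ K y
   K-neg y = ^-congˡ (N N.+ N) (cos-cong (by 2 \ h y -> h :* :- y := :- (h :* y)) & cos-neg (h * y))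

   private
    abs-h : ∀ y -> ∣ h * y ∣ ≈ h * ∣ y ∣
    abs-h y = abs-* h y & *ʳ (abs≥0 (<≤ 0<h))

   K-lipschitz : ∀ x y -> h * ∣ x - y ∣ ≤ 1# -> ∣ K x - K y ∣ ≤ # (N N.+ N) * (# 4 * (h * ∣ x - y ∣))
   K-lipschitz x y small = ^-lipschitz (N N.+ N) (abs-cos≤1 (h * x)) (abs-cos≤1 (h * y)) >> *≤ˡ _ (#≥0 (N N.+ N)) (cos-lipschitz (h * x) (h * y) (eq ~> small) >~ *ˡ eq)
    where eq : ∣ h * x - h * y ∣ ≈ h * ∣ x - y ∣
          eq = abs-cong (by 3 \ h x y -> h :* x :- h :* y := h :* (x :- y)) & abs-h (x - y)

   K-core : ∀ y -> h * ∣ y ∣ ≤ 1# -> # 4 * # N * (h * y * (h * y)) ≤ 1# -> ½ ≤ K y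
   K-core y small core = begin ½ ≤⟨ lin (*≤ˡ ½ (<≤ 0<½) core) (+ˡ (*1 ½) & ½+½≈1 & sym (by 3 (\ h n x -> h :* (con 4 :* n :* x) :+ (:1 :+ (n :+ n) :* :- x) := :1 :+ (con 2 :* h :* (con 2 :* n :* x) :- con 2 :* n :* x)) & +ˡ (+ʳ (*ʳ 2½ & 1* _) & -‿inverseʳ _) & +0 1#)) ⟩
    1# + (# N + # N) * - X ≈⟨ +ˡ (*ʳ (sym (#-+ N N))) ⟩
    1# + # (N N.+ N) * - X ≤⟨ bernoulli (N N.+ N) (neg-mono X≤1) ⟩
    (1# - X) ^ (N N.+ N) ≤⟨ ^-mono (N N.+ N) (sub≥0 X≤1) (1-x²≤cos (h * y) (abs-h y ~> small)) ⟩
    K y ∎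
    where
    X = h * y * (h * y)
    X≤1 : X ≤ 1#
    X≤1 = sym (abs-sq (h * y)) ~> *-mono (0≤abs _) s (0≤abs _) s >~ 1* 1#
     where s = abs-h y ~> small

   -- N (h y)² K y ≤ 8 in the first period.
   K-tail : ∀ y -> h * ∣ y ∣ ≤ 1# -> # N * (h * y * (h * y)) * K y ≤ # 8
   K-tail y small = *-cancelˡ-≤ (# 8 ^ N) (^>0 N (#>0 7)) (begin # 8 ^ N * (# N * X * K y) ≤⟨ lin (*≥0 (#≥0 8) (*≥0 (^≥0 N (#≥0 8)) (K≥0 y))) (by 4 \ e n X K -> e :* (n :* X :* K) :+ con 8 :* (e :* K) := :0 :+ (con 8 :* (e :* K) :* :1 :+ e :* (n :* X :* K))) ⟩
    # 8 * (# 8 ^ N * K y) * 1# + # 8 ^ N * (# N * X * K y)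
     ≈⟨ by 4 (\ e n X K -> con 8 :* (e :* K) :* :1 :+ e :* (n :* X :* K) := con 8 :* (e :* K) :* :1 :+ e :* K :* (n :* X)) & refl & +ˡ (sym (*1 _) & *ˡ (sym (inv (#>0 7))) & by 4 \ a n x i -> a :* (n :* x) :* (con 8 :* i) := con 8 :* a :* (n :* (x :* i))) & sym (distribˡ _ _ _) ⟩
    # 8 * (# 8 ^ N * K y) * (1# + # N * (X * # 8 ⁻¹)) ≤⟨ *-mono (*≥0 (#≥0 8) (*≥0 (^≥0 N (#≥0 8)) (K≥0 y))) (*≤ˡ _ (#≥0 8) K≤) (+≥0 0≤1 (*≥0 (#≥0 N) X/8≥0)) (bernoulli N (lin 0≤1 (by 0 (:- :1 :+ :1 := :0 :+ :0)) >> X/8≥0)) ⟩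
    # 8 * (# 8 - X) ^ N * (1# + X * # 8 ⁻¹) ^ N ≈⟨ *-assoc _ _ _ & *ˡ (sym (^-distrib-* _ _ N)) ⟩
    # 8 * ((# 8 - X) * (1# + X * # 8 ⁻¹)) ^ N ≤⟨ *≤ˡ _ (#≥0 8) (^-mono N (*≥0 X≤8 (+≥0 0≤1 X/8≥0)) prod) ⟩
    # 8 * # 8 ^ N ≈⟨ *-comm _ _ ⟩
    # 8 ^ N * # 8 ∎)
    where
    X = h * y * (h * y)
    c = cos (h * y)
    s = abs-h y ~> small
    X≤1 : X ≤ 1#
    X≤1 = sym (abs-sq (h * y)) ~> *-mono (0≤abs _) s (0≤abs _) s >~ 1* 1#
    X/8≥0 = *≥0 (sq≥0 (h * y)) (⁻¹≥0 (#>0 7))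
    X≤8 : 0# ≤ # 8 - X
    X≤8 = sub≥0 (X≤1 >> 1≤# 7)
    c≥0 : 0# ≤ c
    c≥0 = sub≥0 X≤1 >> 1-x²≤cos (h * y) s
    c²≤ : # 8 * (c * c) ≤ # 8 - X
    c²≤ = *≤ˡ _ (#≥0 8) (*≤ˡ c c≥0 (≤abs c >> abs-cos≤1 _)) >> *ˡ (*1 c) ~> cos≤ (h * y) s
    K≤ : # 8 ^ N * K y ≤ (# 8 - X) ^ N
    K≤ = *ˡ (K-square y) & sym (^-distrib-* _ _ N) ~> ^-mono N (*≥0 (#≥0 8) (sq≥0 c)) c²≤
    prod : (# 8 - X) * (1# + X * # 8 ⁻¹) ≤ # 8
    prod = lin (*≥0 (sq≥0 X) (⁻¹≥0 (#>0 7)))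
     (by 2 (\ X i -> (con 8 :- X) :* (:1 :+ X :* i) :+ X :* X :* i := con 8 :- X :+ X :* (con 8 :* i)) & +ˡ (*ˡ (inv (#>0 7)) & *1 X) & by 1 \ X -> con 8 :- X :+ X := :0 :+ con 8)

 open CosinePowers

 -- Windows and smoothing

 -- A sum of nonnegative terms over a range is at least the sum over a subrange ...
 sub-sum : ∀ {f} A I c w -> (∀ i -> 0# ≤ f i) -> A N.≤ c -> c N.+ w N.≤ A N.+ I -> Σ w (\ e -> f (c N.+ e)) ≤ Σ I (\ r -> f (A N.+ r))
 sub-sum {f} A I c w h A≤c cw≤ = begin
  Σ w (\ e -> f (c N.+ e)) ≈⟨ Σ-cong′ w (\ e -> reflexive (E.cong f (E.trans (E.cong (N._+ e) (E.sym (N.m+[n∸m]≡n A≤c))) (N.+-assoc A p e)))) ⟩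
  Σ w (\ e -> f (A N.+ (p N.+ e))) ≤⟨ x≤y+x (Σ≥0 p (\ r -> h (A N.+ r))) ⟩
  Σ p (\ r -> f (A N.+ r)) + Σ w (\ e -> f (A N.+ (p N.+ e))) ≈⟨ sym (Σ-split p w (\ r -> f (A N.+ r))) ⟩
  Σ (p N.+ w) (\ r -> f (A N.+ r)) ≤⟨ Σ-length-mono (\ r -> h (A N.+ r)) pw≤I ⟩
  Σ I (\ r -> f (A N.+ r)) ∎
  where
  p = c N.∸ A
  pw≤I = N.+-cancelˡ-≤ A _ _ (E.subst (N._≤ A N.+ I) (E.trans (E.cong (N._+ w) (E.sym (N.m+[n∸m]≡n A≤c))) (N.+-assoc A p w)) cw≤)

 -- ... and at most the sum over a range outside which the terms vanish.
 support-sum : ∀ {f} A I c w -> (∀ i -> 0# ≤ f i) -> (∀ i -> i N.< c -> f i ≈ 0#) -> (∀ i -> c N.+ w N.≤ i -> f i ≈ 0#) -> Σ I (\ r -> f (A N.+ r)) ≤ Σ w (\ e -> f (c N.+ e))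
 support-sum {f} A I c w h below above = begin Σ I (\ r -> f (A N.+ r)) ≤⟨ x≤y+x (Σ≥0 A h) ⟩ Σ A f + Σ I (\ r -> f (A N.+ r)) ≈⟨ sym (Σ-split A I f) ⟩
  Σ (A N.+ I) f ≤⟨ Σ-length-mono h (N.m≤n+m (A N.+ I) (c N.+ w)) ⟩
  Σ (c N.+ w N.+ (A N.+ I)) f ≈⟨ Σ-split (c N.+ w) (A N.+ I) f ⟩
  Σ (c N.+ w) f + Σ (A N.+ I) (\ r -> f (c N.+ w N.+ r)) ≈⟨ +-cong (Σ-split c w f & +ʳ (Σ-zero c below)) (Σ-zero (A N.+ I) (\ r _ -> above _ (N.m≤m+n (c N.+ w) r))) ⟩
  0# + Σ w (\ e -> f (c N.+ e)) + 0# ≈⟨ by 1 (\ x -> :0 :+ x :+ :0 := x) ⟩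
  Σ w (\ e -> f (c N.+ e)) ∎

 -- If f is small off a set of indices and at most g there, its sum is at most that of g.
 split-sum : ∀ {f g rest : ℕ -> ℝ} n c w -> (∀ i -> 0# ≤ g i) -> (∀ i -> 0# ≤ rest i) -> (∀ i -> c N.≤ i -> i N.< c N.+ w -> f i ≤ g i + rest i) -> (∀ i -> i N.< c ⊎ c N.+ w N.≤ i -> f i ≤ rest i) -> Σ n f ≤ Σ w (\ e -> g (c N.+ e)) + Σ n rest
 split-sum {f} {g} {rest} n c w g≥0 rest≥0 within off = begin Σ n f ≤⟨ Σ-mono′ n (\ i -> term i (side i)) ⟩
  Σ n (\ i -> pick i (side i) + rest i) ≈⟨ Σ-+ n _ _ ⟩
  Σ n (\ i -> pick i (side i)) + Σ n rest ≤⟨ support-sum {\ i -> pick i (side i)} 0 n c w (\ i -> pick≥0 i (side i)) (\ i lt -> pick-off i (inj₁ lt) (side i)) (\ i le -> pick-off i (inj₂ le) (side i)) ⊞ ≤-refl ⟩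
  Σ w (\ e -> pick (c N.+ e) (side (c N.+ e))) + Σ n rest ≤⟨ Σ-mono′ w (\ e -> pick≤ (c N.+ e) (side (c N.+ e))) ⊞ ≤-refl ⟩
  Σ w (\ e -> g (c N.+ e)) + Σ n rest ∎
  where
  Side : ℕ -> Set
  Side i = (c N.≤ i × i N.< c N.+ w) ⊎ (i N.< c ⊎ c N.+ w N.≤ i)
  side : ∀ i -> Side i
  side i with N.≤-<-connex c i | N.≤-<-connex (c N.+ w) i
  ... | inj₂ p | _ = inj₂ (inj₁ p)
  ... | inj₁ _ | inj₁ q = inj₂ (inj₂ q)
  ... | inj₁ p | inj₂ q = inj₁ (p , q)
  pick : ∀ i -> Side i -> ℝ
  pick i (inj₁ _) = g i
  pick i (inj₂ _) = 0#
  pick≥0 : ∀ i s -> 0# ≤ pick i s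
  pick≥0 i (inj₁ _) = g≥0 i
  pick≥0 i (inj₂ _) = ≤-refl
  pick≤ : ∀ i s -> pick i s ≤ g i
  pick≤ i (inj₁ _) = ≤-refl
  pick≤ i (inj₂ _) = g≥0 i
  pick-off : ∀ i -> i N.< c ⊎ c N.+ w N.≤ i -> ∀ s -> pick i s ≈ 0#
  pick-off i (inj₁ lt) (inj₁ (p , _)) = ⊥-elim (N.<⇒≱ lt p)
  pick-off i (inj₂ le) (inj₁ (_ , q)) = ⊥-elim (N.<⇒≱ q le)
  pick-off i _ (inj₂ _) = refl
  term : ∀ i s -> f i ≤ pick i s + rest i
  term i (inj₁ (p , q)) = within i p q
  term i (inj₂ o) = off i o >~ sym (0+ _)

 -- Every real number at least η lies in a cell [(j + 1) η, (j + 2) η).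
 cell : ∀ {η u} -> 0# < η -> η ≤ u -> ∃[ j ] (# (suc j) * η ≤ u × u < # (suc (suc j)) * η)
 cell {η} {u} hη h = search (fst (archimedean (u / η))) (<-resp (/-cancel hη) refl (*-monoʳ-< (snd (archimedean (u / η)))))
  where
  *-monoʳ-< : ∀ {x y} -> x < y -> x * η < y * η
  *-monoʳ-< p = <-resp (*-comm _ _) (*-comm _ _) (*-monoˡ-< η hη p)
  search : ∀ n -> u < # n * η -> ∃[ j ] (# (suc j) * η ≤ u × u < # (suc (suc j)) * η)
  search zero lt = ⊥-elim (<⇒≱ lt (zeroˡ η ~> <≤ hη >> h))
  search (suc zero) lt = ⊥-elim (<⇒≱ lt (*ʳ #-1 & 1* η ~> h))
  search (suc (suc n)) lt = [ (\ p -> n , p , lt) , (\ p -> search (suc n) p) ]′ (≤-or-> (# (suc n) * η) u)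

 -- Cells are ordered as the numbers in them.
 cell-mono : ∀ {η u u' j j'} -> 0# < η -> # (suc j) * η ≤ u -> u ≤ u' -> u' < # (suc (suc j')) * η -> j N.≤ j'
 cell-mono {η} {j = j} {j'} hη h p h' = N.≤-pred (N.≤-pred (#-cancel-< (cancel (≤-<-trans h (≤-<-trans p h')))))
  where
  cancel : # (suc j) * η < # (suc (suc j')) * η -> # (suc j) < # (suc (suc j'))
  cancel lt with ≤-or-> (# (suc (suc j'))) (# (suc j))
  ... | inj₁ q = ⊥-elim (<⇒≱ lt (*≤ʳ η (<≤ hη) q))
  ... | inj₂ q = q

 -- Setting: weights of exponent k and scale S, and the kernel of frequency h and exponent 2N on the grid of mesh η;
 -- neighbours up to m steps away are near, and τ bounds the contribution of the others.
 module Smooth (k N m : ℕ) (S h η τ : ℝ) (1≤S : 1# ≤ S) (0<h : 0# < h) (0<η : 0# < η)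
  (hη≤1 : h * η ≤ 1#) (Δ≤1 : # (suc m) * η ≤ 1#) (0≤τ : 0# ≤ τ) where
  open CosinePower h 0<h N public

  0<S = <-≤-trans 0<1 1≤S

  ε : ℝ
  ε = S ⁻¹

  ε≤1 = ⁻¹-anti 0<1 1≤S >~ 1⁻¹

  0≤ε = ⁻¹≥0 0<S

  -- The centres of the kernels
  v : ℕ -> ℝ
  v i = # (suc i) * η

  v>0 : ∀ i -> 0# < v i
  v>0 i = *>0 (#>0 i) 0<η

  -- The normalising factor
  weight : ℝ -> ℝ
  weight u = u ^ suc k * exp (- (ε * u))

  weight>0 : ∀ {u} -> 0# < u -> 0# < weight u
  weight>0 h = *>0 (^>0 (suc k) h) (exp>0 _)

  -- The weighted kernel centred at v i, normalised so that it is about K(u - v i)/u near v i.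
  F : ℕ -> ℝ -> ℝ
  F i u = u ^ k * exp (- (ε * u)) * K (u - v i) * weight (v i) ⁻¹

  F≥0 : ∀ i {u} -> 0# ≤ u -> 0# ≤ F i u
  F≥0 i hu = *≥0 (*≥0 (*≥0 (^≥0 k hu) (exp≥0 _)) (K≥0 _)) (⁻¹≥0 (weight>0 (v>0 i)))

  uF : ∀ i u -> u * F i u ≈ weight u / weight (v i) * K (u - v i)
  uF i u = by 5 (\ u p e K w -> u :* (p :* e :* K :* w) := u :* p :* e :* w :* K)

  -- A number exceeding the logarithm of the ratio of the weights of two close points
  x : ℝ
  x = # (suc k) * (# 4 * (# (suc m) * η)) + # 2 * (# (suc m) * η)

  private
   Δ′ = # (suc m) * η
   0≤Δ′ = *≥0 (#≥0 (suc m)) (<≤ 0<η)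

  weight-ratio : ∀ {u u'} -> S * ½ ≤ u' -> 0# < u -> ∣ u - u' ∣ ≤ Δ′ -> weight u / weight u' ≤ exp x
  weight-ratio {u} {u'} hu' hu close = /-≤ (weight>0 0<u') (begin u ^ suc k * exp (- (ε * u)) ≤⟨ *-mono (^≥0 (suc k) (<≤ hu)) (^-mono (suc k) (<≤ hu) u≤) (exp≥0 _) (exp-mono e≤) ⟩
   (exp (# 4 * Δ′) * u') ^ suc k * exp (# 2 * Δ′ + - (ε * u')) ≈⟨ *-cong (^-distrib-* _ _ (suc k) & *ʳ (sym (exp-#* (suc k) _))) (exp-+ _ _) & by 4 (\ a b c d -> a :* b :* (c :* d) := a :* c :* (b :* d)) & *ʳ (sym (exp-+ _ _)) ⟩
   exp x * weight u' ∎)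
   where
   0<u' = <-≤-trans (half>0 0<S) hu'
   u≤ = lin (≤abs (u - u') >> close ⊞ *≤ˡ Δ′ 0≤Δ′ (sym 2½ ~> *≤ˡ _ (#≥0 2) (sym (1* ½) ~> *≤ʳ ½ (<≤ 0<½) 1≤S) >> *≤ˡ _ (#≥0 2) hu') ⊞ *≥0 (#≥0 2) (*≥0 0≤Δ′ (<≤ 0<u')))
    (by 3 \ u u' d -> u :+ (d :+ (d :* (con 2 :* u') :+ con 2 :* (d :* u'))) := u :- u' :+ (d :* :1 :+ :0) :+ (:1 :+ con 4 :* d) :* u') >> *≤ʳ u' (<≤ 0<u') (1+x≤exp _)
   e≤ = lin (*-mono 0≤ε ε≤1 (0≤abs (u - u')) close ⊞ *≤ˡ ε 0≤ε (-≤abs (u - u')) ⊞ 0≤Δ′)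
    (by 6 (\ e u u' d a D -> :- (e :* u) :+ (:1 :* D :+ (e :* a :+ D)) := e :* a :+ (e :* :- (u :- u') :+ :0) :+ (con 2 :* D :+ :- (e :* u'))) {_} {ε} {u} {u'} {Δ′} {∣ u - u' ∣} {Δ′} & refl)

  F-upper : ∀ i {u} -> S * ½ ≤ v i -> 0# < u -> ∣ u - v i ∣ ≤ Δ′ -> u * F i u ≤ exp x * K (u - v i)
  F-upper i hv hu close = uF i _ ~> *≤ʳ _ (K≥0 _) (weight-ratio hv hu close)

  F-lower : ∀ i {u} -> S * ½ ≤ u -> ∣ u - v i ∣ ≤ Δ′ -> exp (- x) * K (u - v i) ≤ u * F i u
  F-lower i {u} hu close = *≤ʳ _ (K≥0 _) ratio >~ sym (uF i u)
   where
   0<u = <-≤-trans (half>0 0<S) hu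
   a = weight u
   b = weight (v i)
   ratio = ≤-/ (weight>0 (v>0 i)) (*≤ˡ _ (exp≥0 _) (sym (/-cancel (weight>0 0<u)) ~> *≤ʳ a (<≤ (weight>0 0<u))
    (weight-ratio hu (v>0 i) (abs-sub (v i) u ~> close))) >~ sym (*-assoc _ _ _) & *ʳ (*-comm _ _ & exp-inverse x) & 1* a)

  -- Values of the kernel at grid distances
  Kd : ℕ -> ℝ
  Kd d = K (# d * η)

  -- How much the kernel can vary over one cell
  lip : ℝ
  lip = # (N N.+ N) * (# 4 * (h * η))

  lip≥0 = *≥0 (#≥0 (N N.+ N)) (*≥0 (#≥0 4) (*≥0 (<≤ 0<h) (<≤ 0<η)))

  -- The cell between two consecutive centres
  InCell : ℕ -> ℝ -> Set
  InCell j u = v j ≤ u × u < v (suc j)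

  distance : ∀ i j -> ∃[ s ] (∣ s ∣ ≈ # N.∣ j - i ∣ * η × v j - v i ≈ s)
  distance i j with N.≤-total i j
  ... | inj₁ le = # N.∣ j - i ∣ * η , abs≥0 (*≥0 (#≥0 N.∣ j - i ∣) (<≤ 0<η)) , +ʳ (*ʳ (reflexive (E.cong (\ n -> # (suc n)) (E.trans (E.sym (N.m+[n∸m]≡n le)) (E.cong (i N.+_) (E.sym (N.m≤n⇒∣n-m∣≡n∸m le))))) & +ˡ (#-+ i _))) & by 3 (\ i d h -> (:1 :+ (i :+ d)) :* h :- (:1 :+ i) :* h := d :* h)
  ... | inj₂ le = - (# N.∣ j - i ∣ * η) , abs-neg _ & abs≥0 (*≥0 (#≥0 N.∣ j - i ∣) (<≤ 0<η)) , +ˡ (-ᶜ (*ʳ (reflexive (E.cong (\ n -> # (suc n)) (E.trans (E.sym (N.m+[n∸m]≡n le)) (E.cong (j N.+_) (E.sym (N.m≤n⇒∣m-n∣≡n∸m le))))) & +ˡ (#-+ j _)))) & by 3 (\ j d h -> (:1 :+ j) :* h :- (:1 :+ (j :+ d)) :* h := :- (d :* h))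

  in-cell : ∀ {j u} -> InCell j u -> ∣ u - v j ∣ ≤ η
  in-cell {j} {u} (p , q) = abs-≤ (lin (<≤ q) (by 3 \ u j h -> u :- (:1 :+ j) :* h :+ (:1 :+ (:1 :+ j)) :* h := u :+ h))
   (lin p (by 2 \ u v -> :- (u :- v) :+ u := v :+ :0) >> <≤ 0<η)

  near-distance : ∀ {j u} i -> InCell j u -> ∣ u - v i ∣ ≤ # (suc N.∣ j - i ∣) * η
  near-distance {j} {u} i c = let (s , e , eq) = distance i j in begin
   ∣ u - v i ∣ ≈⟨ abs-cong (by 3 \ u v j -> u :- v := u :- j :+ (j :- v)) ⟩
   ∣ (u - v j) + (v j - v i) ∣ ≤⟨ abs-+ _ _ ⟩
   ∣ u - v j ∣ + ∣ v j - v i ∣ ≤⟨ in-cell {j} c ⊞ ≈⇒≤ (abs-cong eq & e) ⟩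
   η + # N.∣ j - i ∣ * η ≈⟨ by 2 (\ d h -> h :+ d :* h := (:1 :+ d) :* h) ⟩
   # (suc N.∣ j - i ∣) * η ∎

  far-distance : ∀ {j u} i -> InCell j u -> # N.∣ j - i ∣ * η ≤ ∣ u - v i ∣ + η
  far-distance {j} {u} i c = let (s , e , eq) = distance i j in begin
   # N.∣ j - i ∣ * η ≈⟨ sym (abs-cong eq & e) ⟩
   ∣ v j - v i ∣ ≈⟨ abs-cong (by 3 \ u v j -> j :- v := u :- v :+ (j :- u)) ⟩
   ∣ u - v i + (v j - u) ∣ ≤⟨ abs-+ _ _ >> +-monoʳ-≤ _ (abs-sub (v j) u ~> in-cell {j} c) ⟩
   ∣ u - v i ∣ + η ∎

  K-near : ∀ {j u} i -> InCell j u -> ∣ K (u - v i) - Kd N.∣ j - i ∣ ∣ ≤ lip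
  K-near {j} {u} i c = let (s , e , eq) = distance i j in abs-cong (+ˡ (-ᶜ (sym (even s e)))) ~>
   K-lipschitz (u - v i) s (*≤ˡ h (<≤ 0<h) (d≤ s eq) >> hη≤1) >> *≤ˡ _ (#≥0 (N N.+ N)) (*≤ˡ _ (#≥0 4) (*≤ˡ h (<≤ 0<h) (d≤ s eq)))
   where
   d≤ : ∀ s -> v j - v i ≈ s -> ∣ (u - v i) - s ∣ ≤ η
   d≤ s eq = abs-cong (+ˡ (-ᶜ (sym eq)) & by 3 \ u v j -> u :- v :- (j :- v) := u :- j) ~> in-cell {j} c
   even : ∀ s -> ∣ s ∣ ≈ # N.∣ j - i ∣ * η -> K s ≈ Kd N.∣ j - i ∣
   even s e with abs-cases s
   ... | inj₁ (_ , p) = K-cong (sym p & e)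
   ... | inj₂ (_ , p) = sym (K-neg s) & K-cong (sym p & e)

 -- Comparing primes with the grid

 -- 1/p if i + 1 is a prime p, and 0 otherwise
 1/p : ℕ -> ℝ
 1/p i = if isPrime (suc i) then recip i else 0#

 primeRecip≥0 : ∀ i -> 0# ≤ 1/p i
 primeRecip≥0 i = go (isPrime (suc i))
  where go : ∀ b -> 0# ≤ (if b then recip i else 0#)
        go true = recip≥0 i
        go false = ≤-refl

 primeMass-L : ∀ i -> primeMass i ≈ 1/p i * L i
 primeMass-L i = go (isPrime (suc i))
  where go : ∀ b -> (if b then L i * recip i else 0#) ≈ (if b then recip i else 0#) * L i
        go true = *-comm _ _
        go false = sym (zeroˡ _)

 -- Harmonic sums over a range
 recip-sum-≤ : ∀ b w -> Σ w (\ e -> recip (suc b N.+ e)) ≤ L (b N.+ w) - L b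
 recip-sum-≤ b zero = ≈⇒≤ (sym (-‿inverseʳ (L b)) & +ʳ (reflexive (E.cong L (E.sym (N.+-identityʳ b)))))
 recip-sum-≤ b (suc w) = (recip-sum-≤ b w ⊞ recip≤δ (b N.+ w)) >> by 3 (\ x y z -> x :- y :+ (z :- x) := z :- y) ~> ≈⇒≤ (+ʳ (reflexive (E.cong L (E.sym (N.+-suc b w)))))

 ≤-recip-sum : ∀ b w -> L (b N.+ w) - L b ≤ Σ w (\ e -> recip (b N.+ e))
 ≤-recip-sum b zero = ≈⇒≤ (+ʳ (reflexive (E.cong L (N.+-identityʳ b))) & -‿inverseʳ (L b))
 ≤-recip-sum b (suc w) = +ʳ (reflexive (E.cong L (N.+-suc b w))) & by 3 (\ x y z -> z :- y := x :- y :+ (z :- x)) ~> (≤-recip-sum b w ⊞ δ≤recip (b N.+ w))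

 agree-cong : ∀ {η b f g} -> (∀ u -> f u ≈ g u) -> Agree η b f -> Agree η b g
 agree-cong eq (M , h) = M , \ n le -> abs-cong (+-cong (Σ-cong′ n (\ i -> *ˡ (sym (eq (L i))))) (-ᶜ (Σ-cong′ n (\ j -> *ˡ (sym (eq _)))))) ~> h n le

 agree-Σ : ∀ {η b} I (c : ℕ -> ℝ) (f : ℕ -> ℝ -> ℝ) -> (∀ r -> 0# ≤ c r) -> (∀ r -> Agree η b (f r)) -> Agree η (Σ I (\ r -> c r * b)) (\ u -> Σ I (\ r -> f r u * c r))
 agree-Σ {η} {b} zero c f hc h = 0 , \ n _ -> ≈⇒≤ (abs-cong (+-cong (Σ-zero n (\ i _ -> zeroʳ _)) (-ᶜ (Σ-zero n (\ j _ -> zeroʳ _))) & -‿inverseʳ 0#) & abs≥0 ≤-refl)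
 agree-Σ {η} {b} (suc I) c f hc h = let (M , p) = agree-Σ {η} {b} I c f hc h ; (M' , q) = h I in M N.⊔ M' , \ n le ->
  abs-cong (split n) ~> abs-+ _ _ >> (p n (N.m⊔n≤o⇒m≤o M M' le) ⊞ abs-* _ _ & *ʳ (abs≥0 (hc I)) ~> *≤ˡ _ (hc I) (q n (N.m⊔n≤o⇒n≤o M M' le)))
  where
  linear : ∀ n (x : ℕ -> ℝ) (y : ℕ -> ℝ) -> Σ n (\ i -> x i * (Σ I (\ r -> f r (y i) * c r) + f I (y i) * c I)) ≈ Σ n (\ i -> x i * Σ I (\ r -> f r (y i) * c r)) + c I * Σ n (\ i -> x i * f I (y i))
  linear n x y = Σ-cong′ n (\ i -> by 4 \ x s f c -> x :* (s :+ f :* c) := x :* s :+ c :* (x :* f)) & Σ-+ n _ _ & +ˡ (Σ-* n (c I) _)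
  split : ∀ n -> α n (\ u -> Σ (suc I) (\ r -> f r u * c r)) - β η n (\ u -> Σ (suc I) (\ r -> f r u * c r)) ≈ α n (\ u -> Σ I (\ r -> f r u * c r)) - β η n (\ u -> Σ I (\ r -> f r u * c r)) + c I * (α n (f I) - β η n (f I))
  split n = +-cong (linear n primeMass L) (-ᶜ (linear n (\ _ -> η) (gridPoint η))) & by 5 (\ a b d e c -> a :+ c :* b :- (d :+ c :* e) := a :- d :+ c :* (b :- e))

 ∣-∣≤ : ∀ m e -> e N.< m N.+ suc m -> N.∣ m - e ∣ N.≤ m
 ∣-∣≤ m e lt with N.≤-total m e
 ... | inj₁ le = E.subst (N._≤ m) (E.sym (N.m≤n⇒∣m-n∣≡n∸m le)) (N.m≤n+o⇒m∸n≤o e m (N.≤-pred (E.subst (suc e N.≤_) (N.+-suc m m) lt)))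
 ... | inj₂ le = E.subst (N._≤ m) (E.sym (N.m≤n⇒∣n-m∣≡n∸m le)) (N.m∸n≤m m e)

 module Compare (k N m : ℕ) (S h η τ kb Mα Mβ : ℝ) (1≤S : 1# ≤ S) (0<h : 0# < h) (0<η : 0# < η)
  (hη≤1 : h * η ≤ 1#) (Δ≤1 : # (suc m) * η ≤ 1#) (0≤τ : 0# ≤ τ) where
  open Smooth k N m S h η τ 1≤S 0<h 0<η hη≤1 Δ≤1 0≤τ

  -- A window consists of m centres on either side of a middle one.
  width : ℕ
  width = m N.+ suc m

  -- The mass U of the kernel on a window, and bounds for u times the sum of the F i over it
  U slack G⁺ G⁻ : ℝ
  U = Σ width (\ e -> Kd N.∣ m - e ∣)
  slack = # width * lip
  G⁺ = exp x * (U + slack)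
  G⁻ = exp (- x) * (U - slack)

  -- Bound for one F i at distance more than m cells
  tail : ℝ -> ℝ
  tail u = τ * exp (- (ε * ½ * u))

  tail≥0 : ∀ u -> 0# ≤ tail u
  tail≥0 u = *≥0 0≤τ (exp≥0 _)

  0≤slack = *≥0 (#≥0 width) lip≥0

  0≤G⁺ : 0# ≤ G⁺
  0≤G⁺ = *≥0 (exp≥0 x) (+≥0 (Σ≥0 width (\ e -> K≥0 _)) 0≤slack)

  -- The sum of the kernels centred at v A, …, v (A + I - 1)
  Ψ : ℕ -> ℕ -> ℝ -> ℝ
  Ψ A I u = Σ I (\ r -> F (A N.+ r) u)

  Ψ≥0 : ∀ A I {u} -> 0# ≤ u -> 0# ≤ Ψ A I u
  Ψ≥0 A I hu = Σ≥0 I (\ r -> F≥0 (A N.+ r) hu)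

  module Bounds (far : ∀ i {u} -> 0# < u -> S * ½ ≤ v i -> v i ≤ # 4 * S -> # m * η ≤ ∣ u - v i ∣ -> F i u ≤ tail u)
   (agree : ∀ w -> Agree η kb (\ u -> u ^ k * exp (- (ε * u)) * K (u - w)))
   (α-mass : ∀ n -> α n (\ u -> exp (- (ε * ½ * u))) ≤ Mα) (β-mass : ∀ n -> β η n (\ u -> exp (- (ε * ½ * u))) ≤ Mβ) where

   inside : ∀ {A I u} c -> InCell (c N.+ m) u -> S * ½ ≤ u -> A N.≤ c -> c N.+ width N.≤ A N.+ I -> G⁻ ≤ u * Ψ A I u
   inside {A} {I} {u} c cell hu A≤c c≤ = begin exp (- x) * (U - slack) ≈⟨ *ˡ (sym (Σ-sub width _ _ & +ˡ (-ᶜ (const-sum width lip)))) ⟩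
    exp (- x) * Σ width (\ e -> Kd N.∣ m - e ∣ - lip) ≈⟨ sym (Σ-* width _ _) ⟩
    Σ width (\ e -> exp (- x) * (Kd N.∣ m - e ∣ - lip)) ≤⟨ Σ-mono width term ⟩
    Σ width (\ e -> u * F (c N.+ e) u) ≤⟨ sub-sum {\ i -> u * F i u} A I c width (\ i -> *≥0 0≤u (F≥0 i 0≤u)) A≤c c≤ ⟩
    Σ I (\ r -> u * F (A N.+ r) u) ≈⟨ Σ-* I u _ ⟩
    u * Ψ A I u ∎
    where
    0≤u = <≤ (half>0 0<S) >> hu
    term : ∀ e -> e N.< width -> exp (- x) * (Kd N.∣ m - e ∣ - lip) ≤ u * F (c N.+ e) u
    term e lt = *≤ˡ _ (exp≥0 _) (lin (-≤abs _ >> K-near {c N.+ m} (c N.+ e) cell)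
     (+ʳ (+ʳ (K-cong (*ʳ (reflexive (E.cong # (E.sym (N.∣m+n-m+o∣≡∣n-o∣ c m e))))))) & by 3 \ d l K -> d :- l :+ l := :- (K :- d) :+ K)) >> F-lower (c N.+ e) hu (near-distance {c N.+ m} (c N.+ e) cell >> *≤ʳ η (<≤ 0<η) (#-mono {n = suc m} (N.s≤s (E.subst (N._≤ m) (E.sym (N.∣m+n-m+o∣≡∣n-o∣ c m e)) (∣-∣≤ m e lt)))))

   -- The centres lie within a bounded ratio of the scale S.
   Admissible : ℕ -> ℕ -> Set
   Admissible A I = ∀ r -> r N.< I -> S * ½ ≤ v (A N.+ r) × v (A N.+ r) ≤ # 4 * S

   far-term : ∀ {j u} i -> InCell j u -> S * ½ ≤ v i -> v i ≤ # 4 * S -> m N.< N.∣ j - i ∣ -> F i u ≤ tail u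
   far-term {j} {u} i cell lo hi lt = far i (<-≤-trans (v>0 j) (fst cell)) lo hi
    (lin (*≤ʳ η (<≤ 0<η) (#-mono lt) >> far-distance {j} i cell) (by 3 \ m h d -> m :* h :+ (d :+ h) := (:1 :+ m) :* h :+ d))

   upper : ∀ {A I u} c -> InCell (c N.+ m) u -> Admissible A I -> u * Ψ A I u ≤ G⁺ + u * (# I * tail u)
   upper {A} {I} {u} c cell adm = begin u * Ψ A I u ≈⟨ sym (Σ-* I u _) ⟩ Σ I (\ r -> u * F (A N.+ r) u) ≤⟨ Σ-mono I (\ r lt -> term (A N.+ r) (fst (adm r lt)) (snd (adm r lt))) ⟩
    Σ I (\ r -> w (A N.+ r) + u * tail u) ≈⟨ Σ-+ I _ _ & +ˡ (const-sum I _ & by 3 \ i u t -> i :* (u :* t) := u :* (i :* t)) ⟩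
    Σ I (\ r -> w (A N.+ r)) + u * (# I * tail u) ≤⟨ support-sum {w} A I c width w≥0 below above ⊞ ≤-refl ⟩
    Σ width (\ e -> w (c N.+ e)) + u * (# I * tail u) ≤⟨ (Σ-mono′ width w-centre ⊞ ≤-refl) >~ +ʳ (Σ-* width _ _ & *ˡ (Σ-+ width _ _ & +ˡ (const-sum width lip))) ⟩
    G⁺ + u * (# I * tail u) ∎
    where
    0<u = <-≤-trans (v>0 (c N.+ m)) (fst cell)
    d : ℕ -> ℕ
    d i = N.∣ c N.+ m - i ∣
    peak : ℕ -> ℝ
    peak i = exp x * (Kd (d i) + lip)
    0≤peak : ∀ i -> 0# ≤ peak i
    0≤peak i = *≥0 (exp≥0 x) (+≥0 (K≥0 _) lip≥0)
    pick : ∀ i -> d i N.≤ m ⊎ m N.< d i -> ℝ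
    pick i (inj₁ _) = peak i
    pick i (inj₂ _) = 0#
    side : ∀ i -> d i N.≤ m ⊎ m N.< d i
    side i = N.≤-<-connex (d i) m
    w : ℕ -> ℝ
    w i = pick i (side i)
    w≥0 : ∀ i -> 0# ≤ w i
    w≥0 i = go (side i)
     where go : ∀ s -> 0# ≤ pick i s
           go (inj₁ _) = 0≤peak i
           go (inj₂ _) = ≤-refl
    w-far : ∀ i -> m N.< d i -> w i ≈ 0#
    w-far i lt = go (side i)
     where go : ∀ s -> pick i s ≈ 0#
           go (inj₁ p) = ⊥-elim (N.<⇒≱ lt p)
           go (inj₂ _) = refl
    w-peak : ∀ i -> w i ≤ peak i
    w-peak i = go (side i)
     where go : ∀ s -> pick i s ≤ peak i
           go (inj₁ _) = ≤-refl
           go (inj₂ _) = 0≤peak i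
    w-centre : ∀ e -> w (c N.+ e) ≤ exp x * (Kd N.∣ m - e ∣ + lip)
    w-centre e = w-peak (c N.+ e) >~ *ˡ (+ʳ (K-cong (*ʳ (reflexive (E.cong # (N.∣m+n-m+o∣≡∣n-o∣ c m e))))))
    below : ∀ i -> i N.< c -> w i ≈ 0#
    below i lt = w-far i (E.subst (m N.<_) (E.sym (N.m≤n⇒∣n-m∣≡n∸m (N.≤-trans (N.<⇒≤ lt) (N.m≤m+n c m)))) (N.m+n≤o⇒m≤o∸n (suc m) (E.subst (suc m N.+ i N.≤_) (N.+-comm m c) (E.subst (N._≤ m N.+ c) (N.+-suc m i) (N.+-monoʳ-≤ m lt)))))
    above : ∀ i -> c N.+ width N.≤ i -> w i ≈ 0#
    above i le = w-far i (E.subst (m N.<_) (E.sym (N.m≤n⇒∣m-n∣≡n∸m (N.≤-trans (N.+-monoʳ-≤ c (N.m≤m+n m (suc m))) le)))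
     (N.m+n≤o⇒m≤o∸n (suc m) (E.subst (N._≤ i) (E.trans (E.sym (N.+-assoc c m (suc m))) (N.+-comm (c N.+ m) (suc m))) le)))
    term : ∀ i -> S * ½ ≤ v i -> v i ≤ # 4 * S -> u * F i u ≤ w i + u * tail u
    term i lo hi = go (side i)
     where
     go : ∀ s -> u * F i u ≤ pick i s + u * tail u
     go (inj₁ p) = F-upper i lo 0<u (near-distance {c N.+ m} i cell >> *≤ʳ η (<≤ 0<η) (#-mono {n = suc m} (N.s≤s p))) >> *≤ˡ _ (exp≥0 x) (lin (≤abs _ >> K-near {c N.+ m} i cell) (by 3 \ K d l -> K :+ l := K :- d :+ (d :+ l))) >> x≤x+y (*≥0 (<≤ 0<u) (tail≥0 u))
     go (inj₂ p) = *≤ˡ u (<≤ 0<u) (far-term {c N.+ m} i cell lo hi p) >~ sym (0+ _)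

   outside : ∀ {A I j u} -> InCell j u -> Admissible A I -> (j N.+ m N.< A ⊎ A N.+ I N.+ m N.≤ j) -> Ψ A I u ≤ # I * tail u
   outside {A} {I} {j} {u} cell adm out = Σ-mono I (\ r lt -> far-term {j} (A N.+ r) cell (fst (adm r lt)) (snd (adm r lt)) (apart r lt out)) >~ const-sum I (tail u)
    where
    apart : ∀ r -> r N.< I -> (j N.+ m N.< A ⊎ A N.+ I N.+ m N.≤ j) -> m N.< N.∣ j - A N.+ r ∣
    apart r lt (inj₁ p) = E.subst (m N.<_) (E.sym (N.m≤n⇒∣m-n∣≡n∸m (N.≤-trans (N.≤-trans (N.m≤m+n j m) (N.<⇒≤ p)) (N.m≤m+n A r))))
     (N.m+n≤o⇒m≤o∸n (suc m) (N.≤-trans (E.subst (N._≤ A) (E.cong suc (N.+-comm j m)) p) (N.m≤m+n A r)))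
    apart r lt (inj₂ p) = E.subst (m N.<_) (E.sym (N.m≤n⇒∣n-m∣≡n∸m (N.≤-trans (N.+-monoʳ-≤ A (N.<⇒≤ lt)) (N.≤-trans (N.m≤m+n (A N.+ I) m) p))))
     (N.m+n≤o⇒m≤o∸n (suc m) (N.≤-trans (E.subst (N._≤ A N.+ I N.+ m) (E.trans (E.cong (N._+ m) (N.+-suc A r)) (E.cong suc (N.+-comm (A N.+ r) m))) (N.+-monoˡ-≤ m (N.+-monoʳ-≤ A lt))) p))

   -- The sums of Ψ over the primes and over the grid agree up to an error.
   error : ℕ -> ℕ -> ℝ
   error A I = Σ I (\ r -> weight (v (A N.+ r)) ⁻¹ * kb)

   Ψ-agree : ∀ A I -> Agree η (error A I) (Ψ A I)
   Ψ-agree A I = agree-Σ I (\ r -> weight (v (A N.+ r)) ⁻¹) (\ r u -> u ^ k * exp (- (ε * u)) * K (u - v (A N.+ r)))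
    (\ r -> ⁻¹≥0 (weight>0 (v>0 (A N.+ r)))) (\ r -> agree (v (A N.+ r)))

   η-recip : ∀ j -> η ≈ recip j * v j
   η-recip j = sym (sym (*-assoc _ _ _) & *ʳ (*-comm _ _ & suc*recip j) & 1* η)

   agree-≤ : ∀ A I n -> ∣ α n (Ψ A I) - β η n (Ψ A I) ∣ ≤ error A I -> α n (Ψ A I) ≤ β η n (Ψ A I) + error A I × β η n (Ψ A I) ≤ α n (Ψ A I) + error A I
   agree-≤ A I n h = lin (≤abs _ >> h) (by 3 \ a b e -> a :+ e := a :- b :+ (b :+ e)) , lin (-≤abs _ >> h) (by 3 \ a b e -> b :+ e := :- (a :- b) :+ (a :+ e))

   module _ {X Y ja jb : ℕ} (X≤Y : X N.≤ Y) (S≤LX : S ≤ L X) (cell-X : InCell ja (L X)) (cell-Y : InCell jb (L Y)) where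

    private
     η≤1 = sym (1* η) ~> *≤ʳ η (<≤ 0<η) (1≤# m) >> Δ≤1

     sum-p : ℝ
     sum-p = Σ (Y N.∸ X) (\ r -> 1/p (suc X N.+ r))

     S½≤S = x≤x+y (<≤ (half>0 0<S)) >~ half+half S

     X<⇒ : ∀ {i} -> X N.≤ i -> S ≤ L i
     X<⇒ le = S≤LX >> L-mono le

     suc-Y = E.cong suc (N.m+[n∸m]≡n X≤Y)

     -- The cell of log (i + 1) for X < i ≤ Y
     cell-between : ∀ {i} -> X N.≤ i -> i N.≤ Y -> ∃[ j ] (InCell j (L i) × ja N.≤ j × j N.≤ jb)
     cell-between {i} X≤i i≤Y = let (j , c) = cell 0<η (η≤1 >> 1≤S >> X<⇒ X≤i) in
      j , c , cell-mono {j = ja} {j' = j} 0<η (fst cell-X) (L-mono X≤i) (snd c) , cell-mono {j = j} {j' = jb} 0<η (fst c) (L-mono i≤Y) (snd cell-Y)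

    prime-sum-upper : ∀ {b′ A I w} -> ja ≡ suc b′ N.+ m N.+ m -> A ≡ suc b′ N.+ m -> m N.≤ suc b′ -> A N.+ I ≡ suc (jb N.+ m) -> suc b′ N.+ w ≡ suc (jb N.+ m N.+ m) -> Admissible A I -> G⁻ * sum-p ≤ G⁺ * (L (jb N.+ m N.+ m) - L b′) + # I * (τ * Mβ) + error A I
    prime-sum-upper {b′} {A} {I} {w} ja≡ A≡ m≤b AI≡ w≡ adm = begin G⁻ * sum-p ≈⟨ sym (Σ-* (Y N.∸ X) G⁻ _) ⟩
     Σ (Y N.∸ X) (\ r -> G⁻ * 1/p (suc X N.+ r)) ≤⟨ Σ-mono (Y N.∸ X) (\ r lt -> lower (suc X N.+ r) (N.m≤n⇒m≤1+n (N.m≤m+n X r)) (N.≤-pred (E.subst (suc X N.+ r N.<_) suc-Y (N.+-monoʳ-< (suc X) lt)))) ⟩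
     Σ (Y N.∸ X) (\ r -> f (suc X N.+ r)) ≤⟨ sub-sum {f} 0 n (suc X) (Y N.∸ X) f≥0 N.z≤n (E.subst (N._≤ n) (E.sym suc-Y) (N.m≤n⊔m M₀ (suc Y))) ⟩
     α n (Ψ A I) ≤⟨ fst (agree-≤ A I n (agrees n (N.m≤m⊔n M₀ (suc Y)))) ⟩
     β η n (Ψ A I) + error A I ≤⟨ grid ⊞ ≤-refl ⟩
     G⁺ * (L (jb N.+ m N.+ m) - L b′) + # I * (τ * Mβ) + error A I ∎
     where
     M₀ = fst (Ψ-agree A I)
     agrees = snd (Ψ-agree A I)
     n = M₀ N.⊔ suc Y
     b = suc b′
     f : ℕ -> ℝ
     f i = primeMass i * Ψ A I (L i)
     f≥0 : ∀ i -> 0# ≤ f i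
     f≥0 i = *≥0 (primeMass≥0 i) (Ψ≥0 A I (L≥0 i))
     lower : ∀ i -> X N.≤ i -> i N.≤ Y -> G⁻ * 1/p i ≤ f i
     lower i X≤i i≤Y = let (j , c , ja≤j , j≤jb) = cell-between X≤i i≤Y
                           A+m≤j = N.≤-trans (N.≤-reflexive (E.trans (E.cong (N._+ m) A≡) (E.sym ja≡))) ja≤j
                           c≡ = N.m∸n+n≡m {j} {m} (N.≤-trans (N.m≤n+m m A) A+m≤j) in
      *-comm _ _ ~> *≤ˡ _ (primeRecip≥0 i)
       (inside {A} {I} (j N.∸ m) (E.subst (\ k -> InCell k (L i)) (E.sym c≡) c) (S½≤S >> X<⇒ X≤i) (N.m+n≤o⇒m≤o∸n A A+m≤j)
        (N.≤-trans (N.≤-reflexive (E.trans (E.sym (N.+-assoc (j N.∸ m) m (suc m))) (E.trans (E.cong (N._+ suc m) c≡) (N.+-suc j m)))) (E.subst (suc (j N.+ m) N.≤_) (E.sym AI≡) (N.s≤s (N.+-monoˡ-≤ m j≤jb))))) >~ sym (*-assoc _ _ _) & *ʳ (sym (primeMass-L i))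
     rest : ℕ -> ℝ
     rest j = η * (# I * tail (v j))
     rest≥0 : ∀ j -> 0# ≤ rest j
     rest≥0 j = *≥0 (<≤ 0<η) (*≥0 (#≥0 I) (tail≥0 (v j)))
     own : ∀ j -> InCell j (v j)
     own j = ≤-refl , lin< 0<η (by 2 \ j h -> (:1 :+ j) :* h :+ h := :0 :+ (:1 :+ (:1 :+ j)) :* h)
     within : ∀ j -> b N.≤ j -> j N.< b N.+ w -> η * Ψ A I (v j) ≤ G⁺ * recip j + rest j
     within j b≤j lt = let c≡ = N.m∸n+n≡m {j} {m} (N.≤-trans m≤b b≤j) in begin
      η * Ψ A I (v j) ≈⟨ *ʳ (η-recip j) & *-assoc _ _ _ ⟩
      recip j * (v j * Ψ A I (v j)) ≤⟨ *≤ˡ _ (recip≥0 j) (upper {A} {I} (j N.∸ m) (E.subst (\ k -> InCell k (v j)) (E.sym c≡) (own j)) adm) ⟩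
      recip j * (G⁺ + v j * (# I * tail (v j))) ≈⟨ by 4 (\ r g v t -> r :* (g :+ v :* t) := g :* r :+ r :* v :* t) ⟩
      G⁺ * recip j + recip j * v j * (# I * tail (v j)) ≈⟨ +ˡ (*ʳ (sym (η-recip j))) ⟩
      G⁺ * recip j + rest j ∎
     off : ∀ j -> j N.< b ⊎ b N.+ w N.≤ j -> η * Ψ A I (v j) ≤ rest j
     off j (inj₁ lt) = *≤ˡ η (<≤ 0<η) (outside {A} {I} {j} (own j) adm (inj₁ (E.subst (j N.+ m N.<_) (E.sym A≡) (N.+-monoˡ-< m lt))))
     off j (inj₂ le) = *≤ˡ η (<≤ 0<η) (outside {A} {I} {j} (own j) adm (inj₂ (E.subst (N._≤ j) (E.trans w≡ (E.cong (N._+ m) (E.sym AI≡))) le)))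
     grid = begin β η n (Ψ A I) ≤⟨ split-sum {g = \ j -> G⁺ * recip j} {rest = rest} n b w (\ j -> *≥0 0≤G⁺ (recip≥0 j)) rest≥0 within off ⟩
      Σ w (\ e -> G⁺ * recip (b N.+ e)) + Σ n rest ≤⟨ Σ-* w G⁺ _ ~> *≤ˡ _ 0≤G⁺ (recip-sum-≤ b′ w >~ +ʳ (reflexive (E.cong L (N.suc-injective w≡)))) ⊞ Σ-cong′ n (\ j -> by 4 \ h i t e -> h :* (i :* (t :* e)) := i :* t :* (h :* e)) & Σ-* n _ _ ~> *≤ˡ _ (*≥0 (#≥0 I) 0≤τ) (β-mass n) ⟩
      G⁺ * (L (jb N.+ m N.+ m) - L b′) + # I * τ * Mβ ≈⟨ +ˡ (*-assoc _ _ _) ⟩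
      G⁺ * (L (jb N.+ m N.+ m) - L b′) + # I * (τ * Mβ) ∎

    prime-sum-lower : ∀ {A I w} -> η ≤ ½ -> m N.≤ ja -> 0# ≤ G⁻ -> A ≡ suc (ja N.+ m) -> A N.+ I N.+ m ≡ jb -> A N.+ m N.+ w N.+ m ≡ A N.+ I -> Admissible A I -> G⁻ * (L (A N.+ m N.+ w) - L (A N.+ m)) ≤ G⁺ * sum-p + # I * (τ * Mα) + error A I
    prime-sum-lower {A} {I} {w} η≤½ m≤ja 0≤G⁻ A≡ AI≡ w≡ adm = begin G⁻ * (L (A N.+ m N.+ w) - L (A N.+ m)) ≤⟨ *≤ˡ _ 0≤G⁻ (≤-recip-sum (A N.+ m) w) ⟩
     G⁻ * Σ w (\ e -> recip (A N.+ m N.+ e)) ≈⟨ sym (Σ-* w G⁻ _) ⟩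
     Σ w (\ e -> G⁻ * recip (A N.+ m N.+ e)) ≤⟨ Σ-mono w (\ e lt -> lower e lt) ⟩
     Σ w (\ e -> g (A N.+ m N.+ e)) ≤⟨ sub-sum {g} 0 n (A N.+ m) w g≥0 N.z≤n (N.m≤n⊔m M₀ (A N.+ m N.+ w)) ⟩
     β η n (Ψ A I) ≤⟨ snd (agree-≤ A I n (agrees n (N.m≤m⊔n M₀ (A N.+ m N.+ w)))) ⟩
     α n (Ψ A I) + error A I ≤⟨ primes ⊞ ≤-refl ⟩
     G⁺ * sum-p + # I * (τ * Mα) + error A I ∎
     where
     M₀ = fst (Ψ-agree A I)
     agrees = snd (Ψ-agree A I)
     n = M₀ N.⊔ (A N.+ m N.+ w)
     g : ℕ -> ℝ
     g j = η * Ψ A I (v j)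
     g≥0 : ∀ j -> 0# ≤ g j
     g≥0 j = *≥0 (<≤ 0<η) (Ψ≥0 A I (<≤ (v>0 j)))
     own : ∀ j -> InCell j (v j)
     own j = ≤-refl , lin< 0<η (by 2 \ j h -> (:1 :+ j) :* h :+ h := :0 :+ (:1 :+ (:1 :+ j)) :* h)
     lower : ∀ e -> e N.< w -> G⁻ * recip (A N.+ m N.+ e) ≤ g (A N.+ m N.+ e)
     lower e lt = begin G⁻ * recip j ≈⟨ *-comm _ _ ⟩
      recip j * G⁻ ≤⟨ *≤ˡ _ (recip≥0 j) (inside {A} {I} (A N.+ e) (E.subst (\ k -> InCell k (v j)) j≡ (own j)) v-lower (N.m≤m+n A e) fits) ⟩
      recip j * (v j * Ψ A I (v j)) ≈⟨ sym (*-assoc _ _ _) & *ʳ (sym (η-recip j)) ⟩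
      g j ∎
      where
      j = A N.+ m N.+ e
      j≡ = E.trans (N.+-assoc A m e) (E.trans (E.cong (A N.+_) (N.+-comm m e)) (E.sym (N.+-assoc A e m)))
      fits = E.subst₂ N._≤_ (E.trans (N.+-suc j m) (E.trans (E.cong (\ k -> suc (k N.+ m)) j≡) (E.sym (E.trans (E.cong (A N.+ e N.+_) (N.+-suc m m)) (E.trans (N.+-suc (A N.+ e) (m N.+ m)) (E.cong suc (E.sym (N.+-assoc (A N.+ e) m m))))))))
       w≡ (E.subst (N._≤ A N.+ m N.+ w N.+ m) (E.sym (N.+-suc j m)) (N.+-monoˡ-≤ m (E.subst (N._≤ A N.+ m N.+ w) (N.+-suc (A N.+ m) e) (N.+-monoʳ-≤ (A N.+ m) lt))))
      m+e<I = N.+-cancelˡ-≤ A _ _ (N.≤-trans (N.≤-reflexive (E.trans (N.+-suc A (m N.+ e)) (E.cong suc (E.sym (N.+-assoc A m e)))))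
       (N.≤-trans (E.subst (N._≤ A N.+ m N.+ w) (N.+-suc (A N.+ m) e) (N.+-monoʳ-≤ (A N.+ m) lt)) (N.≤-trans (N.m≤m+n (A N.+ m N.+ w) m) (N.≤-reflexive w≡))))
      v-lower = E.subst (\ k -> S * ½ ≤ v k) (E.sym (N.+-assoc A m e)) (fst (adm (m N.+ e) m+e<I))
     rest : ℕ -> ℝ
     rest i = primeMass i * (# I * tail (L i))
     rest≥0 : ∀ i -> 0# ≤ rest i
     rest≥0 i = *≥0 (primeMass≥0 i) (*≥0 (#≥0 I) (tail≥0 (L i)))
     within : ∀ i -> suc X N.≤ i -> i N.< suc X N.+ (Y N.∸ X) -> primeMass i * Ψ A I (L i) ≤ G⁺ * 1/p i + rest i
     within i X<i lt = let (j , c , ja≤j , j≤jb) = cell-between {i} (N.<⇒≤ X<i) (N.≤-pred (E.subst (i N.<_) suc-Y lt))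
                           c≡ = N.m∸n+n≡m {j} {m} (N.≤-trans m≤ja ja≤j) in begin
      primeMass i * Ψ A I (L i) ≈⟨ *ʳ (primeMass-L i) & *-assoc _ _ _ ⟩
      1/p i * (L i * Ψ A I (L i)) ≤⟨ *≤ˡ _ (primeRecip≥0 i) (upper {A} {I} (j N.∸ m) (E.subst (\ k -> InCell k (L i)) (E.sym c≡) c) adm) ⟩
      1/p i * (G⁺ + L i * (# I * tail (L i))) ≈⟨ by 4 (\ r g v t -> r :* (g :+ v :* t) := g :* r :+ r :* v :* t) ⟩
      G⁺ * 1/p i + 1/p i * L i * (# I * tail (L i)) ≈⟨ +ˡ (*ʳ (sym (primeMass-L i))) ⟩
      G⁺ * 1/p i + rest i ∎
     half≤L : ∀ i -> ½ ≤ L (suc i)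
     half≤L i = recip≤δ 0 >> +ˡ (-ᶜ L-0) & by 1 (\ x -> x :- :0 := x) ~> L-mono {1} {suc i} (N.s≤s N.z≤n)
     cell-of : ∀ i -> ∃[ j ] InCell j (L (suc i))
     cell-of i = cell 0<η (η≤½ >> half≤L i)
     off : ∀ i -> i N.< suc X ⊎ suc X N.+ (Y N.∸ X) N.≤ i -> primeMass i * Ψ A I (L i) ≤ rest i
     off zero _ = ≈⇒≤ (zeroˡ _ & sym (zeroˡ _))
     off (suc i) (inj₁ lt) = let (j , c) = cell-of i in *≤ˡ _ (primeMass≥0 (suc i)) (outside {A} {I} {j} c adm (inj₁ (E.subst (suc (j N.+ m) N.≤_) (E.sym A≡)
      (N.s≤s (N.+-monoˡ-≤ m (cell-mono {j = j} {j' = ja} 0<η (fst c) (L-mono (N.≤-pred lt)) (snd cell-X)))))))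
     off (suc i) (inj₂ le) = let (j , c) = cell-of i in *≤ˡ _ (primeMass≥0 (suc i)) (outside {A} {I} {j} c adm (inj₂ (E.subst (N._≤ j) (E.sym AI≡)
      (cell-mono {j = jb} {j' = j} 0<η (fst cell-Y) (L-mono (N.<⇒≤ (E.subst (N._≤ suc i) suc-Y le))) (snd c)))))
     primes = begin
      α n (Ψ A I) ≤⟨ split-sum {g = \ i -> G⁺ * 1/p i} {rest = rest} n (suc X) (Y N.∸ X) (\ i -> *≥0 0≤G⁺ (primeRecip≥0 i)) rest≥0 within off ⟩
      Σ (Y N.∸ X) (\ r -> G⁺ * 1/p (suc X N.+ r)) + Σ n rest ≤⟨ ≈⇒≤ (Σ-* (Y N.∸ X) G⁺ _) ⊞ Σ-cong′ n (\ j -> by 4 \ h i t e -> h :* (i :* (t :* e)) := i :* t :* (h :* e)) & Σ-* n _ _ ~> *≤ˡ _ (*≥0 (#≥0 I) 0≤τ) (α-mass n) ⟩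
      G⁺ * sum-p + # I * τ * Mα ≈⟨ +ˡ (*-assoc _ _ _) ⟩
      G⁺ * sum-p + # I * (τ * Mα) ∎

 -- Estimates at one scale

 -- The logarithm has slope at most 2 on [1/2, ∞).
 log-shift : ∀ {y d} -> ½ ≤ y -> 0# ≤ d -> log (y + d) ≤ log y + # 2 * d
 log-shift {y} {d} h hd = log-≤-exp (+>≥ 0<y hd) (begin
  y + d ≤⟨ lin (*≤ʳ d hd (sym 2½ ~> *≤ˡ _ (#≥0 2) h)) (by 2 \ y d -> y :+ d :+ con 2 :* y :* d := :1 :* d :+ y :* (:1 :+ con 2 :* d)) ⟩
  y * (1# + # 2 * d) ≤⟨ *≤ˡ y (<≤ 0<y) (1+x≤exp _) ⟩
  y * exp (# 2 * d) ≈⟨ sym (exp-+ _ _ & *ʳ (exp-log 0<y)) ⟩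
  exp (log y + # 2 * d) ∎)
  where
   0<y = <-≤-trans 0<½ h

 power-cancel : ∀ {S ε} -> S * ε ≈ 1# -> ∀ a b -> S ^ a * ε ^ (a N.+ b) ≈ ε ^ b
 power-cancel {S} {ε} e a b = *ˡ (^-homo-* ε a b) & sym (*-assoc _ _ _) & *ʳ (sym (^-distrib-* S ε a) & ^-congˡ a e & 1^ a) & 1* _

 #-^ : ∀ n k -> # (n N.^ k) ≈ # n ^ k
 #-^ n zero = #-1
 #-^ n (suc k) = #-* n (n N.^ k) & *ˡ (#-^ n k)

 -- Bounds for the exponential of a small number
 exp-upper : ∀ {x θ} -> x ≤ θ -> 0# ≤ θ -> θ ≤ ½ -> exp x ≤ 1# + # 2 * θ
 exp-upper {x} {θ} h h0 h½ = exp-mono h >> exp-≤ θ<1 >> ≤-resp (1* _) refl (/-≤ 0<1-θ (lin (*≥0 h0 (sub≥0 (*≤ˡ _ (#≥0 2) h½ >~ 2½)))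
  (by 1 \ t -> :1 :+ t :* (:1 :- con 2 :* t) := :0 :+ (:1 :+ con 2 :* t) :* (:1 :- t))))
  where
  θ<1 = ≤-<-trans h½ (lin< 0<½ (+ʳ (sym (1* ½)) & +ˡ (sym (1* ½)) & half+half 1# & sym (0+ _)))
  0<1-θ = sub>0 θ<1

 -- Removing the weights from an approximate inequality between two sums
 module _ {θ x U λ' E : ℝ} (0≤θ : 0# ≤ θ) (θ≤ : # 8 * θ ≤ 1#) (x≤θ : x ≤ θ) (slack : λ' ≤ θ * U) (0<U : 0# < U) where
  private
   0≤U = <≤ 0<U
   θ≤½ = *-cancelˡ-≤ (# 2) (#>0 1) (*≤ʳ θ 0≤θ (#-mono {2} {8} (N.s≤s (N.s≤s N.z≤n))) >> θ≤ >~ sym 2½)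
   1-2θ≥ = lin (θ≤ ⊞ *≥0 (#≥0 4) 0≤θ) (by 1 \ t -> :1 :+ (:1 :+ con 4 :* t) := con 8 :* t :+ :0 :+ con 2 :* (:1 :- con 2 :* t))
   lowerG = begin
    (1# - # 2 * θ) * U ≤⟨ lin (*≥0 (sq≥0 θ) 0≤U) (by 2 \ t U -> (:1 :- con 2 :* t) :* U :+ t :* t :* U := :0 :+ (:1 :- t) :* ((:1 :- t) :* U)) ⟩
    (1# - θ) * ((1# - θ) * U) ≤⟨ *-mono 0≤1-θ (lin x≤θ (by 2 \ x t -> :1 :- t :+ t := x :+ (:1 :+ :- x)) >> 1+x≤exp (- x))
     (*≥0 0≤1-θ 0≤U) (lin slack (by 3 \ t U l -> (:1 :- t) :* U :+ t :* U := l :+ (U :- l))) ⟩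
    exp (- x) * (U - λ') ∎
    where
     0≤1-θ = sub≥0 (θ≤½ >> ½≤1)
   upperG = begin exp x * (U + λ') ≤⟨ *≤ˡ _ (exp≥0 x) (lin slack (by 3 \ t U l -> U :+ l :+ t :* U := l :+ (:1 :+ t) :* U)) ⟩
    exp x * ((1# + θ) * U) ≤⟨ *≤ʳ _ (*≥0 (+≥0 0≤1 0≤θ) 0≤U) (exp-upper x≤θ 0≤θ θ≤½) ⟩
    (1# + # 2 * θ) * ((1# + θ) * U) ≤⟨ lin (*≤ʳ U 0≤U (*≤ˡ θ 0≤θ (*≤ˡ _ (#≥0 2) θ≤½ >~ 2½))) (by 2 \ t U -> (:1 :+ con 2 :* t) :* ((:1 :+ t) :* U) :+ t :* :1 :* U := t :* (con 2 :* t) :* U :+ (:1 :+ con 4 :* t) :* U) ⟩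
    (1# + # 4 * θ) * U ∎

  -- If G⁻ y ≤ G⁺ z + E U then (1 - 2θ) y ≤ (1 + 4θ) z + E.
  unweight : ∀ {y z} -> 0# ≤ y -> 0# ≤ z -> exp (- x) * (U - λ') * y ≤ exp x * (U + λ') * z + E * U -> (1# - # 2 * θ) * y ≤ (1# + # 4 * θ) * z + E
  unweight {y} {z} hy hz h = *-cancelˡ-≤ U 0<U (begin U * ((1# - # 2 * θ) * y) ≈⟨ by 3 (\ U t y -> U :* (t :* y) := t :* U :* y) ⟩
   (1# - # 2 * θ) * U * y ≤⟨ *≤ʳ y hy lowerG ⟩
   exp (- x) * (U - λ') * y ≤⟨ h ⟩
   exp x * (U + λ') * z + E * U ≤⟨ *≤ʳ z hz upperG ⊞ ≤-refl ⟩
   (1# + # 4 * θ) * U * z + E * U ≈⟨ by 4 (\ t U z E -> t :* U :* z :+ E :* U := U :* (t :* z :+ E)) ⟩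
   U * ((1# + # 4 * θ) * z + E) ∎)

  combine-upper : ∀ {y z} -> 0# ≤ E -> 0# ≤ y -> 0# ≤ z -> z ≤ # 4 -> exp (- x) * (U - λ') * y ≤ exp x * (U + λ') * z + E * U -> y ≤ z + (# 40 * θ + # 2 * E)
  combine-upper {y} {z} hE hy hz hz4 h = begin y ≤⟨ lin (*≤ˡ (# 2 * θ * y) (*≥0 (*≥0 (#≥0 2) 0≤θ) hy) 1-2θ≥)
   (by 2 \ y t -> y :+ con 2 :* t :* y :* (con 2 :* (:1 :- con 2 :* t)) := con 2 :* t :* y :* :1 :+ (:1 :+ con 4 :* t) :* ((:1 :- con 2 :* t) :* y)) ⟩
   (1# + # 4 * θ) * ((1# - # 2 * θ) * y) ≤⟨ *≤ˡ _ (+≥0 0≤1 (*≥0 (#≥0 4) 0≤θ)) (unweight hy hz h) ⟩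
   (1# + # 4 * θ) * ((1# + # 4 * θ) * z + E) ≤⟨ lin (*≤ˡ (# 10 * θ) (*≥0 (#≥0 10) 0≤θ) hz4 ⊞ *≤ˡ (# 2 * (θ * z)) (*≥0 (#≥0 2) (*≥0 0≤θ hz)) θ≤ ⊞ *≤ʳ E hE (*≤ʳ θ 0≤θ (#-mono {4} {8} (N.s≤s (N.s≤s (N.s≤s (N.s≤s N.z≤n))))) >> θ≤))
    (by 3 \ z t E -> (:1 :+ con 4 :* t) :* ((:1 :+ con 4 :* t) :* z :+ E) :+ (con 10 :* t :* con 4 :+ (con 2 :* (t :* z) :* :1 :+ :1 :* E)) := con 10 :* t :* z :+ (con 2 :* (t :* z) :* (con 8 :* t) :+ con 4 :* t :* E) :+ (z :+ (con 40 :* t :+ con 2 :* E))) ⟩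
   z + (# 40 * θ + # 2 * E) ∎

  combine-lower : ∀ {y z} -> 0# ≤ E -> 0# ≤ y -> 0# ≤ z -> y ≤ # 4 -> exp (- x) * (U - λ') * y ≤ exp x * (U + λ') * z + E * U -> y ≤ z + (# 40 * θ + # 2 * E)
  combine-lower {y} {z} hE hy hz hy4 h = [ (\ y≤z -> y≤z >> x≤x+y (+≥0 (*≥0 (#≥0 40) 0≤θ) (*≥0 (#≥0 2) hE))) , (\ z<y -> lin (unweight hy hz h ⊞ *≤ˡ (# 4 * θ) (*≥0 (#≥0 4) 0≤θ) (<≤ z<y >> hy4) ⊞ *≤ˡ (# 2 * θ) (*≥0 (#≥0 2) 0≤θ) hy4 ⊞ *≥0 (#≥0 16) 0≤θ ⊞ hE)
   (by 4 \ y z t E -> y :+ ((:1 :+ con 4 :* t) :* z :+ E :+ (con 4 :* t :* con 4 :+ (con 2 :* t :* con 4 :+ (con 16 :* t :+ E)))) := (:1 :- con 2 :* t) :* y :+ (con 4 :* t :* z :+ (con 2 :* t :* y :+ (:0 :+ :0))) :+ (z :+ (con 40 :* t :+ con 2 :* E)))) ]′ (≤-or-> y z)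

 -- Total mass of the weights exp(-u/2S) on either side
 module Masses {S ε : ℝ} (0<S : 0# < S) (1≤S : 1# ≤ S) (Sε : S * ε ≈ 1#) (0<ε : 0# < ε) where

  -- Bound for both transforms of exp (- ε u / 2)
  massBound : ℝ
  massBound = # 20 * (S * S)

  private
   d = ε * ½ * ½
   0<d = half>0 (half>0 0<ε)
   d⁻¹ = ⁻¹-unique (by 3 (\ e h S -> e :* h :* h :* (con 4 :* S) := S :* e :* (con 2 :* h :* (con 2 :* h))) & *-cong Sε (*-cong 2½ 2½ & 1* 1#) & 1* 1#)
   term : ∀ {M} -> 0# ≤ M -> ∀ i -> M ≤ L i -> M * exp (- (ε * ½ * L i)) ≤ # 4 * S * decay d i
   term {M} hM i le = begin
    M * exp (- (ε * ½ * L i)) ≤⟨ *≤ʳ _ (exp≥0 _) (le >> sym (*ʳ (*ˡ (sym d⁻¹) & inv 0<d) & 1* _) ~> ≈⇒≤ (*ʳ (*-comm _ _) & *-assoc _ _ _)) ⟩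
    # 4 * S * (d * L i) * exp (- (ε * ½ * L i)) ≤⟨ *≤ʳ _ (exp≥0 _) (*≤ˡ _ (*≥0 (#≥0 4) (<≤ 0<S)) (x≤y+x 0≤1 >> 1+x≤exp _)) ⟩
    # 4 * S * exp (d * L i) * exp (- (ε * ½ * L i)) ≈⟨ *-assoc _ _ _ & *ˡ (sym (exp-+ _ _) & exp-cong
     (+ˡ (-ᶜ (*ʳ (sym (half+half (ε * ½))))) & by 2 \ d l -> d :* l :+ :- ((d :+ d) :* l) := :- (d :* l))) ⟩
    # 4 * S * decay d i ∎

  α-mass : ∀ n -> α n (\ u -> exp (- (ε * ½ * u))) ≤ massBound
  α-mass n = begin
   α n (\ u -> exp (- (ε * ½ * u))) ≤⟨ Σ-mono′ n (\ i -> go (isPrime (suc i)) i >~ by 3 \ r s d -> r :* (con 4 :* s :* d) := con 4 :* s :* (r :* d)) ⟩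
   Σ n (\ i -> # 4 * S * (recip i * decay d i)) ≈⟨ Σ-* n _ _ ⟩
   # 4 * S * Σ n (\ i -> recip i * decay d i) ≤⟨ *≤ˡ _ (*≥0 (#≥0 4) (<≤ 0<S)) (decay-total 0<d n >> (1≤S ⊞ ≈⇒≤ d⁻¹)) ⟩
   # 4 * S * (S + # 4 * S) ≈⟨ by 1 (\ S -> con 4 :* S :* (S :+ con 4 :* S) := con 20 :* (S :* S)) ⟩
   massBound ∎
   where
   go : ∀ b i -> (if b then L i * recip i else 0#) * exp (- (ε * ½ * L i)) ≤ recip i * (# 4 * S * decay d i)
   go true i = by 3 (\ l r e -> l :* r :* e := r :* (l :* e)) ~> *≤ˡ _ (recip≥0 i) (term (L≥0 i) i ≤-refl)
   go false i = zeroˡ _ ~> *≥0 (recip≥0 i) (*≥0 (*≥0 (#≥0 4) (<≤ 0<S)) (decay≥0 d i))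

  β-mass : ∀ {η} -> 0# < η -> ∀ n -> β η n (\ u -> exp (- (ε * ½ * u))) ≤ massBound
  β-mass {η} 0<η n = *-cancelˡ-≤ c 0<c (begin c * β η n (\ u -> exp (- (c * u))) ≈⟨ sym (Σ-* n c _) ⟩
   Σ n (\ j -> c * (η * exp (- (c * gridPoint η j)))) ≤⟨ Σ-mono′ n step ⟩
   Σ n (\ j -> f j - f (suc j)) ≈⟨ Σ-telescope n f ⟩
   f 0 - f n ≤⟨ lin (exp≥0 _) (by 2 \ a b -> a :- b :+ b := :0 :+ a) ⟩
   f 0 ≈⟨ exp-cong (-ᶜ (*ˡ (zeroˡ η) & zeroʳ c) & by 0 (:- :0 := :0)) & exp-0 ⟩
   1# ≈⟨ sym (by 3 (\ e h S -> e :* h :* (con 2 :* S) := S :* e :* (con 2 :* h)) & *-cong Sε 2½ & 1* 1#) ⟩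
   c * (# 2 * S) ∎) >> *-mono (#≥0 2) (#-mono {2} {20} (N.s≤s (N.s≤s N.z≤n))) (<≤ 0<S) (sym (1* S) ~> *≤ʳ S (<≤ 0<S) 1≤S) >> ≤-refl
   where
   c = ε * ½
   0<c = half>0 0<ε
   f : ℕ -> ℝ
   f j = exp (- (c * (# j * η)))
   step : ∀ j -> c * (η * exp (- (c * gridPoint η j))) ≤ f j - f (suc j)
   step j = lin (*≤ʳ _ (exp≥0 (- (c * gridPoint η j))) (1+x≤exp (c * η)) >~ sym (exp-+ _ _) & exp-cong
    (by 3 \ c h j -> c :* h :+ :- (c :* ((:1 :+ j) :* h)) := :- (c :* (j :* h))))
    (by 4 \ c h e f -> c :* (h :* e) :+ f := (:1 :+ c :* h) :* e :+ (f :- e))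

 -- Parameters and short sums

 -- Exponents used for a saving of ℓ powers of the scale
 ν k D eN c₁ : ℕ -> ℕ
 ν ℓ = 7 N.+ (ℓ N.+ ℓ N.+ (ℓ N.+ ℓ))
 k ℓ = 1 N.+ (ν ℓ N.+ (ℓ N.+ ℓ))
 D ℓ = 3 N.+ (ν ℓ N.+ (ℓ N.+ ℓ))
 eN ℓ = 4 N.+ (ℓ N.+ ℓ) N.+ D ℓ
 c₁ ℓ = 8 N.* (4 N.* k ℓ N.+ 40)

 eN≡ν+ν : ∀ ℓ -> eN ℓ ≡ ν ℓ N.+ ν ℓ
 eN≡ν+ν ℓ = S.solve 1 (\ l -> let v = S.con 7 S.:+ (l S.:+ l S.:+ (l S.:+ l)) in
  S.con 4 S.:+ (l S.:+ l) S.:+ (S.con 3 S.:+ (v S.:+ (l S.:+ l))) S.:= v S.:+ v) ok ℓ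
  where module S = +-*-Solver

 -- The parameters at scale σ; m₁ is a large number still to be chosen.
 module Scale (ℓ σ m₁ : ℕ) (4≤S : # 4 ≤ # σ) (0<m₁ : 1 N.≤ m₁) where

  -- Scale S, accuracy Θ = S^(- ℓ), half width Δ of the windows, frequency step h, mesh η
  S ε Θ θ Δ h η : ℝ
  S = # σ
  ε = S ⁻¹
  Θ = ε ^ ℓ
  θ = Θ * # 8 ⁻¹
  Δ = Θ * # (c₁ ℓ) ⁻¹
  h = ε * ε

  -- The kernel is cos^(2 N); a window has m cells on each side, that is m η = Δ.
  N P m : ℕ
  N = σ N.^ eN ℓ
  P = σ N.^ ν ℓ
  m = P N.* m₁

  η = Δ * recip m

  1≤S = 1≤# 3 >> 4≤S
  0<S = <-≤-trans 0<1 1≤S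
  Sε = inv 0<S
  εS = *-comm _ _ & Sε
  0<ε = ⁻¹>0 0<S
  ε≤1 = ⁻¹-anti 0<1 1≤S >~ 1⁻¹
  0<Θ = ^>0 ℓ 0<ε
  Θ≤1 = ^≤1 ℓ (<≤ 0<ε) ε≤1
  0<h = *>0 0<ε 0<ε
  h≤1 = *-mono (<≤ 0<ε) ε≤1 (<≤ 0<ε) ε≤1 >~ 1* 1#
  8θ : # 8 * θ ≈ Θ
  8θ = *-comm _ _ & /-cancel (#>0 7)
  0<θ = />0 0<Θ (#>0 7)
  8θ≤1 = 8θ ~> Θ≤1
  c₁>0 = #>0 (N.pred (c₁ ℓ))
  c₁Δ : # (c₁ ℓ) * Δ ≈ Θ
  c₁Δ = *-comm _ _ & /-cancel c₁>0
  0<Δ = />0 0<Θ c₁>0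
  kΔ = *-cancelˡ (# 8) (pos⇒≉0 (#>0 7)) (sym (*-assoc _ _ _) & *ʳ (sym eq) & c₁Δ & sym 8θ)
   where
   eq = #-* 8 (4 N.* k ℓ N.+ 40) & *ˡ (#-+ (4 N.* k ℓ) 40 & +ʳ (#-* 4 (k ℓ)))
  40Δ≤θ = *≤ʳ Δ (<≤ 0<Δ) (x≤y+x (*≥0 (#≥0 4) (#≥0 (k ℓ)))) >~ kΔ
  320Δ≤1 = *ʳ (#-* 8 40) & *-assoc _ _ _ ~> *≤ˡ _ (#≥0 8) 40Δ≤θ >> 8θ≤1
  2Δ≤½ = *-cancelˡ-≤ (# 160) (#>0 159) (sym (*-assoc _ _ _) & *ʳ (sym (#-* 160 2)) ~> 320Δ≤1 >> sym 2½ ~> *≤ʳ ½ (<≤ 0<½) (#-mono {2} {160} (N.s≤s (N.s≤s N.z≤n))) >> ≤-refl)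
  Δ≤½ = lin (<≤ 0<Δ) (by 1 \ d -> d :+ d := :0 :+ con 2 :* d) >> 2Δ≤½
  Δ≤1 = Δ≤½ >> ½≤1

  suc-m-η = by 3 (\ a b c -> a :* (b :* c) := b :* (a :* c)) & *ˡ (suc*recip m) & *1 Δ
  0<η = *>0 0<Δ (recip>0 m)
  η≤Δ = sym (1* η) ~> *≤ʳ η (<≤ 0<η) (1≤# m) >~ suc-m-η
  mη≤Δ = *≤ʳ η (<≤ 0<η) (#-mono (N.n≤1+n m)) >~ suc-m-η
  hη≤1 = *-mono (<≤ 0<h) h≤1 (<≤ 0<η) (η≤Δ >> Δ≤1) >~ 1* 1#

  1≤σ : 1 N.≤ σ
  1≤σ = #-cancel-≤ (#-1 ~> 1≤S)
  1≤P = N.^-monoʳ-≤ σ {{N.>-nonZero 1≤σ}} {0} {ν ℓ} N.z≤n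
  m₁≤m = N.≤-trans (N.≤-reflexive (E.sym (N.*-identityˡ m₁))) (N.*-monoˡ-≤ m₁ 1≤P)
  1≤m = N.≤-trans 0<m₁ m₁≤m
  P≈ = #-^ σ (ν ℓ)
  N≈ = #-^ σ (eN ℓ)
  N≈PP = N≈ & reflexive (E.cong (S ^_) (eN≡ν+ν ℓ)) & ^-homo-* S (ν ℓ) (ν ℓ) & sym (*-cong P≈ P≈)
  m≈ = #-* P m₁

  -- At most half of Δ is lost by passing from m + 1 to m steps.
  Δ≤2mη = sym suc-m-η ~> *≤ʳ η (<≤ 0<η) (#-mono {suc m} {m N.+ m} (N.+-monoˡ-≤ m 1≤m) >~ #-+ m m) >~ by 2 (\ m h -> (m :+ m) :* h := con 2 :* (m :* h))

  module _ (τ : ℝ) (0≤τ : 0# ≤ τ) (kb M′ : ℝ) where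
   private
    Δ′≤1 = suc-m-η ~> Δ≤1
   module Cm = Compare (k ℓ) N m S h η τ kb M′ M′ 1≤S 0<h 0<η hη≤1 Δ′≤1 0≤τ
   module Sm = Smooth (k ℓ) N m S h η τ 1≤S 0<h 0<η hη≤1 Δ′≤1 0≤τ

   x≤θ = +-cong (*ˡ (*ˡ suc-m-η)) (*ˡ suc-m-η) & refl ~> lin (*≥0 (#≥0 34) (<≤ 0<Δ)) (by 2 \ k d -> (:1 :+ k) :* (con 4 :* d) :+ con 2 :* d :+ con 34 :* d := :0 :+ (con 4 :* k :+ con 40) :* d) >~ kΔ

   core : ∀ d -> d N.≤ m₁ -> ½ ≤ Sm.Kd d
   core d le = Sm.K-core y small (begin
    # 4 * # N * (h * y * (h * y)) ≈⟨ *ʳ (*ˡ N≈PP) & by 3 (\ p h y -> con 4 :* (p :* p) :* (h :* y :* (h :* y)) := h :* h :* (con 2 :* (p :* y) :* (con 2 :* (p :* y)))) ⟩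
    (h * h) * (# 2 * (# P * y) * (# 2 * (# P * y))) ≤⟨ *-mono (sq≥0 h) (*-mono (<≤ 0<h) h≤1 (<≤ 0<h) h≤1) (sq≥0 _) (*-mono 0≤2Py 2Py≤1 0≤2Py 2Py≤1) ⟩
    1# * 1# * (1# * 1#) ≈⟨ by 0 (:1 :* :1 :* (:1 :* :1) := :1) ⟩
    1# ∎)
    where
    y = # d * η
    0≤y = *≥0 (#≥0 d) (<≤ 0<η)
    0≤2Py = *≥0 (#≥0 2) (*≥0 (#≥0 P) 0≤y)
    2Py≤1 = *≤ˡ _ (#≥0 2) (sym (*-assoc _ _ _) ~> *≤ʳ η (<≤ 0<η) (*≤ˡ _ (#≥0 P) (#-mono le) >~ sym m≈) >> mη≤Δ) >> 2Δ≤½ >> ½≤1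
    small = *-mono (<≤ 0<h) h≤1 (0≤abs y) (abs≥0 0≤y ~> *≤ʳ η (<≤ 0<η) (#-mono (N.≤-trans le m₁≤m)) >> mη≤Δ >> Δ≤1) >~ 1* 1#

   U-lower = sym (const-sum m₁ ½) ~> Σ-mono m₁ (\ d lt -> core d (N.<⇒≤ lt) >~ reflexive (E.cong Sm.Kd (E.sym (N.∣m-m+n∣≡n m d)))) >> sub-sum {\ e -> Sm.Kd N.∣ m - e ∣} 0 Cm.width m m₁ (\ e -> Sm.K≥0 _) N.z≤n (N.+-monoʳ-≤ m (N.m≤n⇒m≤1+n m₁≤m))

   U>0 = <-≤-trans (half>0 (<-≤-trans 0<1 (sym #-1 ~> #-mono 0<m₁))) U-lower

   slack≤ : N N.≤ m₁ -> Cm.slack ≤ θ * Cm.U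
   slack≤ N≤m₁ = begin # (m N.+ suc m) * (# (N N.+ N) * (# 4 * (h * η))) ≈⟨ *-cong (#-+ m (suc m)) (*ʳ (#-+ N N)) ⟩
    (# m + # (suc m)) * ((# N + # N) * (# 4 * (h * η))) ≈⟨ by 4 (\ m n h e -> (m :+ (:1 :+ m)) :* ((n :+ n) :* (con 4 :* (h :* e))) := con 8 :* n :* h :* (m :* e :+ (:1 :+ m) :* e)) ⟩
    # 8 * # N * h * (# m * η + # (suc m) * η) ≤⟨ *-mono (*≥0 (*≥0 (#≥0 8) (#≥0 N)) (<≤ 0<h)) (*-mono (*≥0 (#≥0 8) (#≥0 N)) (*≤ˡ _ (#≥0 8) (#-mono N≤m₁)) (<≤ 0<h) h≤1)
     (+≥0 (*≥0 (#≥0 m) (<≤ 0<η)) (*≥0 (#≥0 (suc m)) (<≤ 0<η))) (mη≤Δ ⊞ ≈⇒≤ suc-m-η) ⟩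
    # 8 * # m₁ * 1# * (Δ + Δ) ≈⟨ *ˡ (sym (*1 _) & *ˡ (sym 2½)) & by 3 (\ m d i -> con 8 :* m :* :1 :* ((d :+ d) :* (con 2 :* i)) := con 32 :* d :* (m :* i)) ⟩
    # 32 * Δ * (# m₁ * ½) ≤⟨ *-mono (*≥0 (#≥0 32) (<≤ 0<Δ)) (lin (*≥0 (#≥0 8) (<≤ 0<Δ)) (by 1 \ d -> con 32 :* d :+ con 8 :* d := :0 :+ con 40 :* d) >> 40Δ≤θ) (*≥0 (#≥0 m₁) (<≤ 0<½)) U-lower ⟩
    θ * Cm.U ∎

   -- The number of windows compared with U
   count≤ : ∀ {I} -> # I * η ≤ # 4 * S -> # I ≤ # 16 * # (c₁ ℓ) * S ^ (1 N.+ (ν ℓ N.+ ℓ)) * Cm.U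
   count≤ {I} h = begin # I ≈⟨ sym (*ˡ eq & *1 _) ⟩ # I * (# (c₁ ℓ) * S ^ ℓ * Δ) ≤⟨ *≤ˡ _ (#≥0 I) (*≤ˡ _ 0≤cS Δ≤2mη) ⟩
    # I * (# (c₁ ℓ) * S ^ ℓ * (# 2 * (# m * η))) ≈⟨ *ˡ (*ˡ (*ˡ (*ʳ m≈))) & by 6 (\ i c s p m h -> i :* (c :* s :* (con 2 :* (p :* m :* h))) := con 2 :* c :* s :* p :* m :* (i :* h)) ⟩
    # 2 * # (c₁ ℓ) * S ^ ℓ * # P * # m₁ * (# I * η) ≤⟨ *≤ˡ _ (*≥0 (*≥0 (*≥0 (*≥0 (#≥0 2) (<≤ c₁>0)) (^≥0 ℓ (<≤ 0<S))) (#≥0 P)) (#≥0 m₁)) h ⟩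
    # 2 * # (c₁ ℓ) * S ^ ℓ * # P * # m₁ * (# 4 * S) ≈⟨ sym (*1 _) & *ˡ (sym 2½) & *ʳ (*ʳ (*ʳ (*ˡ P≈))) & by 6 (\ c s p m i S -> con 2 :* c :* s :* p :* m :* (con 4 :* S) :* (con 2 :* i) := con 16 :* c :* (S :* (p :* s)) :* (m :* i)) & *ʳ (*ˡ (*ˡ (sym (^-homo-* S (ν ℓ) ℓ)))) ⟩
    # 16 * # (c₁ ℓ) * S ^ (1 N.+ (ν ℓ N.+ ℓ)) * (# m₁ * ½) ≤⟨ *≤ˡ _ (*≥0 (*≥0 (#≥0 16) (<≤ c₁>0)) (^≥0 (1 N.+ (ν ℓ N.+ ℓ)) (<≤ 0<S))) U-lower ⟩
    # 16 * # (c₁ ℓ) * S ^ (1 N.+ (ν ℓ N.+ ℓ)) * Cm.U ∎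
    where
    0≤cS = *≥0 (<≤ c₁>0) (^≥0 ℓ (<≤ 0<S))
    eq = by 3 (\ c s d -> c :* s :* d := s :* (c :* d)) & *ˡ c₁Δ & sym (^-distrib-* S ε ℓ) & ^-congˡ ℓ Sε & 1^ ℓ

 -- Terms far from the centre

 -- Constants depending on ℓ only
 ¼ : ℝ
 ¼ = ½ * ½

 0<¼ : 0# < ¼
 0<¼ = half>0 0<½

 -- Constants for the inverse weight, the kernel away from its centre, and their product
 Cw Cf Cτ : ℕ -> ℝ
 Cw ℓ = # 2 ^ suc (k ℓ) * exp (# 4)
 Cf ℓ = # 32 * (# (c₁ ℓ) * # (c₁ ℓ)) + expBound (D ℓ) ¼
 Cτ ℓ = expBound (k ℓ) ¼ * (Cw ℓ * Cf ℓ)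

 0≤Cw : ∀ ℓ -> 0# ≤ Cw ℓ
 0≤Cw ℓ = *≥0 (^≥0 (suc (k ℓ)) (#≥0 2)) (exp≥0 _)

 0≤Cf : ∀ ℓ -> 0# ≤ Cf ℓ
 0≤Cf ℓ = +≥0 (*≥0 (#≥0 32) (sq≥0 _)) (<≤ (expBound>0 (D ℓ) 0<¼))

 0≤Cτ : ∀ ℓ -> 0# ≤ Cτ ℓ
 0≤Cτ ℓ = *≥0 (<≤ (expBound>0 (k ℓ) 0<¼)) (*≥0 (0≤Cw ℓ) (0≤Cf ℓ))

 module FarScale (ℓ σ m₁ : ℕ) (4≤S : # 4 ≤ # σ) (0<m₁ : 1 N.≤ m₁) where
  open Scale ℓ σ m₁ 4≤S 0<m₁

  τ : ℝ
  τ = Cτ ℓ * ε ^ D ℓ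

  0≤τ : 0# ≤ τ
  0≤τ = *≥0 (0≤Cτ ℓ) (^≥0 (D ℓ) (<≤ 0<ε))

  open CosinePower h 0<h N using (K; K≥0; K≤1; K-tail)

  weight-inverse : ∀ w {v} -> S * ½ ≤ v -> v ≤ # 4 * S -> (v ^ suc w * exp (- (ε * v))) ⁻¹ ≤ # 2 ^ suc w * exp (# 4) * ε ^ suc w
  weight-inverse w {v} lo hi = ⁻¹-anti (*>0 (^>0 (suc w) (half>0 0<S)) (exp>0 _))
   (*-mono (^≥0 (suc w) (<≤ (half>0 0<S))) (^-mono (suc w) (<≤ (half>0 0<S)) lo) (exp≥0 _)
    (exp-mono (neg-mono (*≤ˡ ε (<≤ 0<ε) hi >~ by 2 (\ e s -> e :* (con 4 :* s) := con 4 :* (e :* s)) & *ˡ εS & *1 _)))) >~ ⁻¹-unique (by 5 (\ a e t f z -> a :* e :* (t :* f :* z) := a :* (t :* z) :* (f :* e)) &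
    *-cong (*ˡ (sym (^-distrib-* _ _ (suc w))) & sym (^-distrib-* _ _ (suc w)) & ^-congˡ (suc w) (by 4 (\ s h t e -> s :* h :* (t :* e) := s :* e :* (t :* h)) & *-cong Sε 2½ & 1* 1#) & 1^ (suc w))
     (exp-inverse (# 4)) & 1* 1#)

  -- Where the kernel is past its peak but within the first period ...
  tail-near : ∀ {y} -> Δ ≤ # 2 * ∣ y ∣ -> h * ∣ y ∣ ≤ 1# -> K y ≤ # 32 * (# (c₁ ℓ) * # (c₁ ℓ)) * ε ^ D ℓ
  tail-near {y} hy small = sym (by 3 (\ k s e -> k :* s :* e := s :* e :* k) & *ʳ SE & 1* _) ~> *≤ʳ _ (^≥0 (D ℓ) (<≤ 0<ε)) (begin
   K y * S ^ D ℓ ≈⟨ *ˡ (sym (power-cancel εS (4 N.+ (ℓ N.+ ℓ)) (D ℓ))) ⟩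
   K y * (ε ^ (4 N.+ (ℓ N.+ ℓ)) * S ^ eN ℓ) ≈⟨ *ˡ (*-cong (^-homo-* ε 4 (ℓ N.+ ℓ) & *-cong refl (^-homo-* ε ℓ ℓ & *-cong (sym c₁Δ) (sym c₁Δ))) (sym N≈)) ⟩
   K y * (ε ^ 4 * (# (c₁ ℓ) * Δ * (# (c₁ ℓ) * Δ)) * # N) ≈⟨ by 5 (\ K e c d n -> K :* (e :^ 4 :* (c :* d :* (c :* d)) :* n) := c :* c :* (e :* e :* (e :* e)) :* n :* K :* (d :* d)) ⟩
   (# (c₁ ℓ) * # (c₁ ℓ) * (h * h) * # N * K y) * (Δ * Δ) ≤⟨ *≤ˡ _ (*≥0 (*≥0 (*≥0 (sq≥0 _) (sq≥0 h)) (#≥0 N)) (K≥0 y)) (*-mono (<≤ 0<Δ) hy (<≤ 0<Δ) hy >~ by 1 (\ a -> con 2 :* a :* (con 2 :* a) := con 4 :* (a :* a)) & *ˡ (sym (abs-* y y) & abs≥0 (sq≥0 y))) ⟩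
   (# (c₁ ℓ) * # (c₁ ℓ) * (h * h) * # N * K y) * (# 4 * (y * y)) ≈⟨ by 5 (\ c h n K y -> c :* c :* (h :* h) :* n :* K :* (con 4 :* (y :* y)) := con 4 :* (c :* c) :* (n :* (h :* y :* (h :* y)) :* K)) ⟩
   # 4 * (# (c₁ ℓ) * # (c₁ ℓ)) * (# N * (h * y * (h * y)) * K y) ≤⟨ *≤ˡ _ (*≥0 (#≥0 4) (sq≥0 _)) (K-tail y small) ⟩
   # 4 * (# (c₁ ℓ) * # (c₁ ℓ)) * # 8 ≈⟨ by 1 (\ c -> con 4 :* c :* con 8 := con 32 :* c) ⟩
   # 32 * (# (c₁ ℓ) * # (c₁ ℓ)) ∎)
   where
   SE : S ^ D ℓ * ε ^ D ℓ ≈ 1#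
   SE = sym (^-distrib-* S ε (D ℓ)) & ^-congˡ (D ℓ) Sε & 1^ (D ℓ)

  -- ... and beyond the first period the exponential factor is small.
  tail-far : ∀ {u} -> S ≤ ε * u -> exp (- (¼ * (ε * u))) ≤ expBound (D ℓ) ¼ * ε ^ D ℓ
  tail-far {u} hu = exp-mono (neg-mono (*≤ˡ ¼ (<≤ 0<¼) hu)) >> (begin exp (- (¼ * S)) ≈⟨ sym (*ˡ SE & *1 _) ⟩
   exp (- (¼ * S)) * (S ^ D ℓ * ε ^ D ℓ) ≤⟨ *≤ˡ _ (exp≥0 _) (*≤ʳ _ (^≥0 (D ℓ) (<≤ 0<ε)) (^-mono (D ℓ) (<≤ 0<S) (x≤y+x 0≤1) >> power≤exp (D ℓ) 0<¼ (<≤ 0<S))) ⟩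
   exp (- (¼ * S)) * (expBound (D ℓ) ¼ * exp (¼ * S) * ε ^ D ℓ) ≈⟨ by 4 (\ a b c d -> a :* (b :* c :* d) := c :* a :* (b :* d)) & *ʳ (exp-inverse (¼ * S)) & 1* _ ⟩
   expBound (D ℓ) ¼ * ε ^ D ℓ ∎)
   where
   SE : S ^ D ℓ * ε ^ D ℓ ≈ 1#
   SE = sym (^-distrib-* S ε (D ℓ)) & ^-congˡ (D ℓ) Sε & 1^ (D ℓ)

  away : ∀ {u v} -> 0# < u -> 0# ≤ v -> v ≤ # 4 * S -> # m * η ≤ ∣ u - v ∣ -> exp (- (¼ * (ε * u))) * K (u - v) ≤ Cf ℓ * ε ^ D ℓ
  away {u} {v} 0<u 0≤v hi dist = [ (\ small -> *≤ʳ _ (K≥0 _) e≤1 >> 1* _ ~> tail-near (Δ≤2mη >> *≤ˡ _ (#≥0 2) dist) small >> *≤ʳ _ (^≥0 (D ℓ) (<≤ 0<ε)) (x≤x+y (<≤ (expBound>0 (D ℓ) 0<¼)))) , (\ big -> *≤ˡ _ (exp≥0 _) (K≤1 _) >> *1 _ ~> tail-far (beyond big) >> *≤ʳ _ (^≥0 (D ℓ) (<≤ 0<ε)) (x≤y+x (*≥0 (#≥0 32) (sq≥0 _)))) ]′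
   (≤-or-> (h * ∣ u - v ∣) 1#)
   where
   0≤εu = *≥0 (<≤ 0<ε) (<≤ 0<u)
   e≤1 : exp (- (¼ * (ε * u))) ≤ 1#
   e≤1 = exp-neg≤1 (*≥0 (<≤ 0<¼) 0≤εu)
   beyond : 1# < h * ∣ u - v ∣ -> S ≤ ε * u
   beyond big = sym (sym (*-assoc _ _ _) & *ʳ εS & 1* S) ~> *≤ˡ ε (<≤ 0<ε)
    ([ (\ { (_ , e) -> large e >> lin 0≤v (by 2 \ u v -> u :- v :+ v := :0 :+ u) }) , (\ { (_ , e) -> ⊥-elim (not-below e) }) ]′ (abs-cases (u - v)))
    where
    SS = S * S
    0<SS = *>0 0<S 0<S
    hSS : SS * h ≈ 1#
    hSS = by 2 (\ s e -> s :* s :* (e :* e) := s :* e :* (s :* e)) & *-cong Sε Sε & 1* 1#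
    large< : SS < ∣ u - v ∣
    large< = <-resp (*1 SS) (sym (*-assoc _ _ _) & *ʳ hSS & 1* _) (*-monoˡ-< SS 0<SS big)
    large : ∀ {z} -> ∣ u - v ∣ ≈ z -> SS ≤ z
    large e = <≤ large< >~ e
    4S≤ : # 4 * S ≤ SS
    4S≤ = *≤ʳ S (<≤ 0<S) 4≤S
    not-below : ¬ (∣ u - v ∣ ≈ - (u - v))
    not-below e = <⇒≱ 0<u (lin (large e ⊞ hi ⊞ 4S≤) (by 4 \ u v s f -> u :+ (:- (u :- v) :+ (f :+ s)) := s :+ (v :+ f) :+ :0))

  -- The contribution of a distant window
  far-bound : ∀ {u v} -> 0# < u -> S * ½ ≤ v -> v ≤ # 4 * S -> # m * η ≤ ∣ u - v ∣ -> u ^ k ℓ * exp (- (ε * u)) * K (u - v) * (v ^ suc (k ℓ) * exp (- (ε * v))) ⁻¹ ≤ τ * exp (- (ε * ½ * u))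
  far-bound {u} {v} 0<u lo hi dist = begin u ^ k ℓ * exp (- (ε * u)) * K (u - v) * W⁻¹ ≈⟨ *ʳ (*ʳ (*-cong power split-exp)) ⟩
   S ^ k ℓ * (ε * u) ^ k ℓ * (e₂ * (exp (- (¼ * (ε * u))) * exp (- (¼ * (ε * u))))) * K (u - v) * W⁻¹ ≈⟨ by 6 (\ s p e q K w -> s :* p :* (e :* (q :* q)) :* K :* w := p :* q :* (q :* K :* (s :* w)) :* e) ⟩
   (ε * u) ^ k ℓ * exp (- (¼ * (ε * u))) * (exp (- (¼ * (ε * u))) * K (u - v) * (S ^ k ℓ * W⁻¹)) * e₂ ≤⟨ *≤ʳ e₂ (exp≥0 _) (*-mono (*≥0 (^≥0 (k ℓ) 0≤εu) (exp≥0 _)) poly (*≥0 (*≥0 (exp≥0 _) (K≥0 _)) (*≥0 0≤Sk 0≤W⁻¹))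
    (*-mono (*≥0 (exp≥0 _) (K≥0 _)) (away 0<u 0≤v hi dist) (*≥0 0≤Sk 0≤W⁻¹) (*≤ˡ _ 0≤Sk (weight-inverse (k ℓ) lo hi)))) ⟩
   B * (Cf ℓ * ε ^ D ℓ * (S ^ k ℓ * (Cw ℓ * ε ^ suc (k ℓ)))) * e₂ ≈⟨ *ʳ (by 7 \ B c e s w x y -> B :* (c :* e :* (s :* (w :* (x :* y)))) := B :* (w :* c) :* e :* (x :* (s :* y))) ⟩
   B * (Cw ℓ * Cf ℓ) * ε ^ D ℓ * (ε * (S ^ k ℓ * ε ^ k ℓ)) * e₂ ≤⟨ *≤ʳ e₂ (exp≥0 _) (*≤ˡ _ 0≤τ (*ˡ (sym (^-distrib-* S ε (k ℓ)) & ^-congˡ (k ℓ) Sε & 1^ (k ℓ)) & *1 ε ~> ε≤1) >~ *1 _) ⟩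
   τ * e₂ ∎
   where
   0≤v = <≤ (half>0 0<S) >> lo
   0≤εu = *≥0 (<≤ 0<ε) (<≤ 0<u)
   e₂ = exp (- (ε * ½ * u))
   B = expBound (k ℓ) ¼
   W⁻¹ = (v ^ suc (k ℓ) * exp (- (ε * v))) ⁻¹
   0≤W⁻¹ = ⁻¹≥0 (*>0 (^>0 (suc (k ℓ)) (<-≤-trans (half>0 0<S) lo)) (exp>0 (- (ε * v))))
   0≤Sk = ^≥0 (k ℓ) (<≤ 0<S)
   power : u ^ k ℓ ≈ S ^ k ℓ * (ε * u) ^ k ℓ
   power = ^-congˡ (k ℓ) (sym (sym (*-assoc _ _ _) & *ʳ Sε & 1* u)) & ^-distrib-* S (ε * u) (k ℓ)
   split-exp : exp (- (ε * u)) ≈ e₂ * (exp (- (¼ * (ε * u))) * exp (- (¼ * (ε * u))))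
   split-exp = exp-cong (-ᶜ (sym (half+half (ε * u)) & +-cong (*-assoc _ _ _ & *ˡ (*-comm u ½) & sym (*-assoc _ _ _)) (sym (half+half (ε * u * ½)) & by 2 \ e h -> e :* h :* h :+ e :* h :* h := h :* h :* e :+ h :* h :* e)) & by 2 \ a b -> :- (a :+ (b :+ b)) := :- a :+ (:- b :+ :- b)) & exp-+ _ _ & *ˡ (exp-+ _ _)
   poly : (ε * u) ^ k ℓ * exp (- (¼ * (ε * u))) ≤ B
   poly = *≤ʳ _ (exp≥0 _) (^-mono (k ℓ) 0≤εu (x≤y+x 0≤1) >> power≤exp (k ℓ) 0<¼ 0≤εu) >~ *-assoc _ _ _ & *ˡ (exp-inverse (¼ * (ε * u))) & *1 B

 -- Sums over a window

 excess : ∀ {a b} -> a N.≤ b -> ∃[ o ] b ≡ a N.+ o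
 excess {a} {b} le = b N.∸ a , E.sym (N.m+[n∸m]≡n le)

 start-index : ∀ {m j} -> 1 N.≤ m -> m N.+ m N.+ m N.≤ j -> ∃[ b ] (j ≡ suc b N.+ m N.+ m × m N.≤ suc b)
 start-index {suc m} {j} _ le = let (o , eq) = excess le in m N.+ o ,
  E.trans eq (S.solve 2 (\ m o -> let s = S.con 1 S.:+ m in s S.:+ s S.:+ s S.:+ o S.:= S.con 1 S.:+ (m S.:+ o) S.:+ s S.:+ s) ok m o) , N.s≤s (N.m≤m+n m o)
  where module S = +-*-Solver

 -- Sum of 1/p over X + 1 < p ≤ Y + 1
 primesBetween : ℕ -> ℕ -> ℝ
 primesBetween X Y = Σ (Y N.∸ X) (\ r -> 1/p (suc X N.+ r))

 primesBetween≥0 : ∀ X Y -> 0# ≤ primesBetween X Y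
 primesBetween≥0 X Y = Σ≥0 (Y N.∸ X) (\ r -> primeRecip≥0 (suc X N.+ r))

 -- Constant of the error term for a window
 errorᶜ : ℕ -> ℝ -> ℝ
 errorᶜ ℓ C = # 16 * # (c₁ ℓ) * (Cτ ℓ * # 20 + Cw ℓ * C)

 errorᶜ≥0 : ∀ ℓ {C} -> 0# ≤ C -> 0# ≤ errorᶜ ℓ C
 errorᶜ≥0 ℓ 0≤C = *≥0 (*≥0 (#≥0 16) (#≥0 (c₁ ℓ))) (+≥0 (*≥0 (0≤Cτ ℓ) (#≥0 20)) (*≥0 (0≤Cw ℓ) 0≤C))

 -- Primes and grid agree up to kb when tested against every translate of the kernel.
 KernelAgree : ∀ ℓ σ m₁ -> # 4 ≤ # σ -> 1 N.≤ m₁ -> ℝ -> Set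
 KernelAgree ℓ σ m₁ 4≤S 0<m₁ kb = ∀ w -> Agree η kb (\ u -> u ^ k ℓ * exp (- (ε * u)) * CosinePower.K h 0<h N (u - w))
  where open Scale ℓ σ m₁ 4≤S 0<m₁

 module Window (ℓ σ m₁ : ℕ) (4≤S : # 4 ≤ # σ) (0<m₁ : 1 N.≤ m₁) (N≤m₁ : σ N.^ eN ℓ N.≤ m₁)
  (C kb : ℝ) (0≤C : 0# ≤ C) (0≤kb : 0# ≤ kb) (kb≤ : kb ≤ C * # σ)
  (agree : KernelAgree ℓ σ m₁ 4≤S 0<m₁ kb) where
  open Scale ℓ σ m₁ 4≤S 0<m₁
  open FarScale ℓ σ m₁ 4≤S 0<m₁ using (τ; 0≤τ; weight-inverse; far-bound)
  open Masses 0<S 1≤S Sε 0<ε using (massBound; α-mass; β-mass)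

  private
   module Cmp = Cm τ 0≤τ kb massBound
   module Smt = Sm τ 0≤τ kb massBound
   open Smt using (v; v>0; InCell)
   module Bnd = Cmp.Bounds (\ i hu lo hi dist -> far-bound hu lo hi dist) agree α-mass (β-mass 0<η)
   open Bnd using (Admissible; error)

   E : ℝ
   E = errorᶜ ℓ C * Θ
   0≤E = *≥0 (errorᶜ≥0 ℓ 0≤C) (<≤ 0<Θ)

   v-mono : ∀ {i j} -> i N.≤ j -> v i ≤ v j
   v-mono le = *≤ʳ η (<≤ 0<η) (#-mono (N.s≤s le))

   -- η times the number of windows is at most 4 S.
   length≤ : ∀ A I -> Admissible A I -> # I * η ≤ # 4 * S
   length≤ A zero adm = zeroˡ η ~> *≥0 (#≥0 4) (<≤ 0<S)
   length≤ A (suc I) adm = v-mono {I} {A N.+ I} (N.m≤n+m I A) >> snd (adm I (N.n<1+n I))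

   error≤ : ∀ A I -> Admissible A I -> error A I ≤ # I * (Cw ℓ * ε ^ suc (k ℓ) * (C * S))
   error≤ A I adm = Σ-mono I (\ r lt -> *-mono (⁻¹≥0 (Smt.weight>0 (v>0 (A N.+ r)))) (weight-inverse (k ℓ) (fst (adm r lt)) (snd (adm r lt))) 0≤kb kb≤) >~ const-sum I _

   total-error : ∀ A I -> Admissible A I -> # I * (τ * massBound) + error A I ≤ E * Cmp.U
   total-error A I adm = begin # I * (τ * massBound) + error A I ≤⟨ ≤-refl ⊞ error≤ A I adm ⟩
    # I * (τ * massBound) + # I * (Cw ℓ * ε ^ suc (k ℓ) * (C * S)) ≈⟨ sym (distribˡ _ _ _) ⟩
    # I * (τ * massBound + Cw ℓ * ε ^ suc (k ℓ) * (C * S)) ≤⟨ *≤ʳ _ (+≥0 (*≥0 0≤τ (*≥0 (#≥0 20) (sq≥0 S))) (*≥0 (*≥0 (0≤Cw ℓ) (^≥0 (suc (k ℓ)) (<≤ 0<ε))) (*≥0 0≤C (<≤ 0<S))))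
     (count≤ τ 0≤τ kb massBound {I} (length≤ A I adm)) ⟩
    # 16 * # (c₁ ℓ) * Sᵖ * Cmp.U * (τ * massBound + Cw ℓ * ε ^ suc (k ℓ) * (C * S)) ≈⟨ by 10 (\ a c p U t e S w f C -> a :* c :* p :* U :* (t :* e :* (con 20 :* (S :* S)) :+ w :* f :* (C :* S))
     := a :* c :* (t :* con 20 :* (S :* (S :* p) :* e) :+ w :* C :* (S :* p :* f)) :* U) {_} {# 16} {# (c₁ ℓ)} {Sᵖ} {Cmp.U} {Cτ ℓ} {ε ^ D ℓ} {S} {Cw ℓ} {ε ^ suc (k ℓ)} {C} ⟩
    # 16 * # (c₁ ℓ) * (Cτ ℓ * # 20 * (S * (S * Sᵖ) * ε ^ D ℓ) + Cw ℓ * C * (S * Sᵖ * ε ^ suc (k ℓ))) * Cmp.U ≈⟨ *ʳ (*ˡ (+-cong (*ˡ p₁) (*ˡ p₂)) & by 4 \ a x y t -> a :* (x :* t :+ y :* t) := a :* (x :+ y) :* t) ⟩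
    E * Cmp.U ∎
    where
    Sᵖ = S ^ (1 N.+ (ν ℓ N.+ ℓ))
    a₁ = 3 N.+ (ν ℓ N.+ ℓ)
    a₂ = 2 N.+ (ν ℓ N.+ ℓ)
    p₁ = *ˡ (reflexive (E.cong (\ n -> ε ^ (3 N.+ n)) (E.sym (N.+-assoc (ν ℓ) ℓ ℓ)))) & power-cancel Sε a₁ ℓ
    p₂ = *ˡ (reflexive (E.cong (\ n -> ε ^ (2 N.+ n)) (E.sym (N.+-assoc (ν ℓ) ℓ ℓ)))) & power-cancel Sε a₂ ℓ

   L-v : ∀ j -> L j ≈ log (v j) - log η
   L-v j = by 2 (\ a b -> a := a :+ b :- b) & +ʳ (sym (log-* (#>0 j) 0<η))

   L-v-difference : ∀ i j -> L i - L j ≈ log (v i) - log (v j)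
   L-v-difference i j = +-cong (L-v i) (-ᶜ (L-v j)) & by 3 (\ a b c -> a :- c :- (b :- c) := a :- b)

   0≤2Δ = *≥0 (#≥0 2) (<≤ 0<Δ)

   ½≤S½ = sym (1* ½) ~> *≤ʳ ½ (<≤ 0<½) 1≤S

   8Δ≤θ = *≤ʳ Δ (<≤ 0<Δ) (#-mono {8} {40} (N.m≤m+n 8 32)) >> 40Δ≤θ

   θ≤1 = sym (1* θ) ~> *≤ʳ θ (<≤ 0<θ) (1≤# 7) >> 8θ≤1

   0≤G⁻ : 0# ≤ Cmp.G⁻
   0≤G⁻ = *≥0 (exp≥0 _) (sub≥0 (slack≤ τ 0≤τ kb massBound N≤m₁ >> *≤ʳ _ (<≤ (U>0 τ 0≤τ kb massBound)) θ≤1 >~ 1* _))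

   error-total : ℝ
   error-total = # 41 * θ + # 2 * E

  module _ {X Y : ℕ} (X≤Y : X N.≤ Y) (S≤LX : S ≤ L X) (LY≤2S : L Y ≤ # 2 * S) where
   private
    y = primesBetween X Y
    T = log (L Y) - log (L X)

    LX≤LY = L-mono X≤Y

    0<LX = <-≤-trans 0<S S≤LX
    0<LY = <-≤-trans 0<LX LX≤LY

    ½≤LX = ½≤1 >> 1≤S >> S≤LX

    η≤LX = η≤Δ >> Δ≤½ >> ½≤LX

    cX = cell {η} {L X} 0<η η≤LX
    cY = cell {η} {L Y} 0<η (η≤LX >> LX≤LY)
    ja = fst cX
    jb = fst cY

    ja≤jb = cell-mono {j = ja} {j' = jb} 0<η (fst (snd cX)) LX≤LY (snd (snd cY))

    T≤1 = sym (log-/ 0<LY 0<LX) ~> log-≤ (/>0 0<LY 0<LX) >> lin (/-≤ {z = # 2} 0<LX (LY≤2S >> *≤ˡ _ (#≥0 2) S≤LX)) (by 1 \ r -> r :- :1 :+ con 2 := r :+ :1)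

    admissible : ∀ {A I} -> L X ≤ v A + Δ -> (∀ i -> i N.< A N.+ I -> v i ≤ L Y + Δ) -> Admissible A I
    admissible {A} {I} lo hi r lt =
     lin (S≤LX ⊞ lo ⊞ Δ≤½ ⊞ ½≤S½) (+ʳ refl & by 6 (\ s h x v d H -> s :* h :+ (x :+ (v :+ d :+ (H :+ s :* h))) := s :* h :+ s :* h :+ (x :+ (d :+ H)) :+ v) {_} {S} {½} {L X} {v A} {Δ} {½} & +ʳ (+ʳ (half+half S)) & by 5 \ s x d H v -> s :+ (x :+ (d :+ H)) :+ v := s :+ (x :+ (d :+ H)) :+ v) >> v-mono {A} {A N.+ r} (N.m≤m+n A r) ,
     hi (A N.+ r) (N.+-monoʳ-< A lt) >> lin (LY≤2S ⊞ Δ≤1 ⊞ 1≤S ⊞ <≤ 0<S) (by 3 \ y s d -> y :+ d :+ (con 2 :* s :+ (:1 :+ (s :+ s))) := y :+ (d :+ (:1 :+ :0)) :+ con 4 :* s)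

    upper =
     let (b′ , ja≡ , m≤) = start-index 1≤m 3m≤ja
         A = suc b′ N.+ m
         A≤ja = E.subst (A N.≤_) (E.sym ja≡) (N.m≤m+n A m)
         (I , AI≡) = excess {A} {suc (jb N.+ m)} (N.≤-trans A≤ja (N.≤-trans ja≤jb (N.m≤n⇒m≤1+n (N.m≤m+n jb m))))
         (w , w≡) = excess {suc b′} {suc (jb N.+ m N.+ m)} (N.≤-trans (N.m≤m+n (suc b′) m) (N.≤-trans A≤ja (N.≤-trans ja≤jb (N.m≤n⇒m≤1+n (N.≤-trans (N.m≤m+n jb m) (N.m≤m+n (jb N.+ m) m))))))
         adm = admissible {A} {I} (lower-end A ja≡) (\ i lt -> top i (N.≤-pred (E.subst (i N.<_) (E.sym AI≡) lt)))
         bound = Bnd.prime-sum-upper X≤Y S≤LX (snd cX) (snd cY) {b′} {A} {I} {w} ja≡ ok m≤ (E.sym AI≡) (E.sym w≡) adm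
         z = L (jb N.+ m N.+ m) - L b′
         z≤ = z-upper b′ ja≡
         b′≤ = N.≤-pred (E.subst (suc b′ N.≤_) (E.sym w≡) (N.m≤m+n (suc b′) w))
     in combine-upper {θ} {Smt.x} {Cmp.U} {Cmp.slack} {E} (<≤ 0<θ) 8θ≤1 (x≤θ τ 0≤τ kb massBound) (slack≤ τ 0≤τ kb massBound N≤m₁) (U>0 τ 0≤τ kb massBound) {y} {z}
      0≤E (primesBetween≥0 X Y) (sub≥0 (L-mono b′≤)) (z≤ >> (T≤1 ⊞ 8Δ≤θ >> θ≤1) >> 2≤4)
      (bound >> +-assoc _ _ _ ~> +-monoʳ-≤ _ (total-error A I adm)) >> (z≤ ⊞ ≤-refl) >> lin 8Δ≤θ (by 4 \ T d t E -> T :+ con 8 :* d :+ (con 40 :* t :+ con 2 :* E) :+ t := con 8 :* d :+ (T :+ (con 41 :* t :+ con 2 :* E)))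
     where
     2≤4 = by 0 (:1 :+ :1 := con 2) ~> #-mono {2} {4} (N.s≤s (N.s≤s N.z≤n))
     3m≤ja = #-cancel-≤ (*-cancelˡ-≤ η 0<η (lin (<≤ (snd (snd cX)) ⊞ 1≤S >> S≤LX ⊞ mη≤Δ ⊞ mη≤Δ ⊞ mη≤Δ ⊞ η≤Δ ⊞ η≤Δ ⊞ 5Δ≤1)
      (+ʳ (*ˡ (#-+ (m N.+ m) m & +ʳ (#-+ m m))) & by 5 \ h m j x d -> h :* (m :+ m :+ m) :+ ((:1 :+ (:1 :+ j)) :* h :+ (x :+ (d :+ (d :+ (d :+ (d :+ (d :+ :1))))))) := x :+ (:1 :+ (m :* h :+ (m :* h :+ (m :* h :+ (h :+ (h :+ con 5 :* d)))))) :+ h :* j)))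
      where 5Δ≤1 = *≤ʳ Δ (<≤ 0<Δ) (#-mono {5} {320} (N.m≤m+n 5 315)) >> 320Δ≤1
     top : ∀ i -> i N.≤ jb N.+ m -> v i ≤ L Y + Δ
     top i le = v-mono le >> lin (fst (snd cY) ⊞ mη≤Δ) (+ʳ (*ʳ (+ˡ (#-+ jb m))) & by 5 \ j m h y d -> (:1 :+ (j :+ m)) :* h :+ (y :+ d) := (:1 :+ j) :* h :+ m :* h :+ (y :+ d))
     lower-end : ∀ A -> ja ≡ A N.+ m -> L X ≤ v A + Δ
     lower-end A eq = lin (<≤ (snd (snd cX)) ⊞ ≈⇒≤ suc-m-η) (+ˡ (+ʳ (*ʳ (+ˡ (+ˡ (reflexive (E.cong # eq) & #-+ A m))))) & by 5 \ x A m h d -> x :+ ((:1 :+ (:1 :+ (A :+ m))) :* h :+ d) := x :+ (:1 :+ m) :* h :+ ((:1 :+ A) :* h :+ d))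
     z-upper : ∀ b′ -> ja ≡ suc b′ N.+ m N.+ m -> L (jb N.+ m N.+ m) - L b′ ≤ T + # 8 * Δ
     z-upper b′ eq = L-v-difference (jb N.+ m N.+ m) b′ ~> lin (log-mono (v>0 (jb N.+ m N.+ m)) vtop >> log-shift (½≤LX >> LX≤LY) 0≤2Δ ⊞ log-mono 0<LX vbot >> log-shift ½≤vb 0≤2Δ)
      (by 5 \ p q y x d -> p :- q :+ (y :+ con 2 :* (con 2 :* d) :+ (q :+ con 2 :* (con 2 :* d))) := p :+ x :+ (y :- x :+ con 8 :* d))
      where
      vtop = lin (fst (snd cY) ⊞ mη≤Δ ⊞ mη≤Δ) (+ʳ (*ʳ (+ˡ (#-+ (jb N.+ m) m & +ʳ (#-+ jb m)))) & by 5 \ j m h y d -> (:1 :+ (j :+ m :+ m)) :* h :+ (y :+ (d :+ d)) := (:1 :+ j) :* h :+ (m :* h :+ m :* h) :+ (y :+ con 2 :* d))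
      vbot = lin (<≤ (snd (snd cX)) ⊞ ≈⇒≤ suc-m-η ⊞ ≈⇒≤ suc-m-η)
       (+ˡ (+ʳ (*ʳ (+ˡ (+ˡ (reflexive (E.cong # eq) & #-+ (suc b′ N.+ m) m & +ʳ (#-+ (suc b′) m)))))) & by 5 \ x b m h d -> x :+ ((:1 :+ (:1 :+ (:1 :+ b :+ m :+ m))) :* h :+ (d :+ d)) := x :+ ((:1 :+ m) :* h :+ (:1 :+ m) :* h) :+ ((:1 :+ b) :* h :+ con 2 :* d))
      ½≤vb = lin (vbot ⊞ 1≤S >> S≤LX ⊞ 2Δ≤½) (+ˡ (+ˡ (+ˡ refl & refl)) & +ˡ (+ˡ (+-comm _ _)) & by 4 (\ H x v d -> H :+ (v :+ d :+ (H :+ x)) := H :+ H :+ (x :+ d) :+ v) & +ʳ (+ʳ ½+½≈1) & by 3 \ x v d -> :1 :+ (x :+ d) :+ v := x :+ (:1 :+ d) :+ v)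

    lower = [ long , short ]′ (N.≤-<-connex (suc (ja N.+ m) N.+ m N.+ m N.+ m) jb)
     where
     rest = 8Δ≤θ >> lin (*≥0 (#≥0 40) (<≤ 0<θ)) (by 1 \ t -> t :+ con 40 :* t := :0 :+ con 41 :* t) >> x≤x+y (*≥0 (#≥0 2) 0≤E)
     short : jb N.< suc (ja N.+ m) N.+ m N.+ m N.+ m -> T ≤ y + error-total
     short lt = T≤8Δ >> rest >> x≤y+x (primesBetween≥0 X Y)
      where
      LY≤ = lin (<≤ (snd (snd cY)) ⊞ *≤ʳ η (<≤ 0<η) (#-mono {suc jb} lt) ⊞ fst (snd cX) ⊞ mη≤Δ ⊞ mη≤Δ ⊞ mη≤Δ ⊞ ≈⇒≤ suc-m-η)
       (+ˡ (+ˡ (+ʳ (*ʳ (#-+ (suc (ja N.+ m) N.+ m N.+ m) m & +ʳ (#-+ (suc (ja N.+ m) N.+ m) m & +ʳ (#-+ (suc (ja N.+ m)) m & +ʳ (+ˡ (#-+ ja m)))))))) & by 7 \ y j a m h z d -> y :+ ((:1 :+ (:1 :+ j)) :* h :+ ((:1 :+ (a :+ m) :+ m :+ m :+ m) :* h :+ (z :+ (d :+ (d :+ (d :+ d))))))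
        := y :+ ((:1 :+ j) :* h :+ ((:1 :+ a) :* h :+ (m :* h :+ (m :* h :+ (m :* h :+ (:1 :+ m) :* h))))) :+ (z :+ con 4 :* d))
      T≤8Δ = lin (log-mono 0<LY LY≤ >> log-shift ½≤LX (*≥0 (#≥0 4) (<≤ 0<Δ))) (by 3 \ y x d -> y :- x :+ (x :+ con 2 :* (con 4 :* d)) := y :+ con 8 :* d)
     long : suc (ja N.+ m) N.+ m N.+ m N.+ m N.≤ jb -> T ≤ y + error-total
     long le =
      let (w , jb≡) = excess le
          eqs = arrange A m w
          adm = admissible {A} {I w} (<≤ LX<vA >> x≤x+y (<≤ 0<Δ)) (\ i lt -> v-mono (N.<⇒≤ (N.≤-trans lt (below w jb≡))) >> fst (snd cY) >> x≤x+y (<≤ 0<Δ))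
          bound = Bnd.prime-sum-lower X≤Y S≤LX (snd cX) (snd cY) {A} {I w} {w} (η≤Δ >> Δ≤½) m≤ja 0≤G⁻ ok (E.trans (fst eqs) (E.sym jb≡)) (snd eqs) adm
          z = L (A N.+ m N.+ w) - L (A N.+ m)
      in T≤z w jb≡ >> (combine-lower {θ} {Smt.x} {Cmp.U} {Cmp.slack} {E} (<≤ 0<θ) 8θ≤1 (x≤θ τ 0≤τ kb massBound) (slack≤ τ 0≤τ kb massBound N≤m₁) (U>0 τ 0≤τ kb massBound) {z} {y}
       0≤E (sub≥0 (L-mono (N.m≤m+n (A N.+ m) w))) (primesBetween≥0 X Y) (z≤T w jb≡ >> T≤1 >> 1≤# 3)
       (bound >> +-assoc _ _ _ ~> +-monoʳ-≤ _ (total-error A (I w) adm)) ⊞ ≤-refl) >> lin 8Δ≤θ (by 4 \ y d t E -> y :+ (con 40 :* t :+ con 2 :* E) :+ con 8 :* d :+ t := con 8 :* d :+ (y :+ (con 41 :* t :+ con 2 :* E)))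
      where
      A = suc (ja N.+ m)
      I : ℕ -> ℕ
      I w = m N.+ w N.+ m
      arrange : ∀ A m w -> A N.+ (m N.+ w N.+ m) N.+ m ≡ A N.+ m N.+ m N.+ m N.+ w × A N.+ m N.+ w N.+ m ≡ A N.+ (m N.+ w N.+ m)
      arrange A m w = S.solve 3 (\ A m w -> A S.:+ (m S.:+ w S.:+ m) S.:+ m S.:= A S.:+ m S.:+ m S.:+ m S.:+ w) ok A m w , S.solve 3 (\ A m w -> A S.:+ m S.:+ w S.:+ m S.:= A S.:+ (m S.:+ w S.:+ m)) ok A m w
       where module S = +-*-Solver
      below : ∀ w -> jb ≡ A N.+ m N.+ m N.+ m N.+ w -> A N.+ I w N.≤ jb
      below w eq = N.≤-trans (N.m≤m+n (A N.+ I w) m) (N.≤-reflexive (E.trans (fst (arrange A m w)) (E.sym eq)))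
      m≤ja = #-cancel-≤ (*-cancelˡ-≤ η 0<η (lin (<≤ (snd (snd cX)) ⊞ 1≤S >> S≤LX ⊞ mη≤Δ ⊞ η≤Δ ⊞ η≤Δ ⊞ 3Δ≤1)
       (by 5 \ h m j x d -> h :* m :+ ((:1 :+ (:1 :+ j)) :* h :+ (x :+ (d :+ (d :+ (d :+ :1))))) := x :+ (:1 :+ (m :* h :+ (h :+ (h :+ con 3 :* d)))) :+ h :* j)))
       where 3Δ≤1 = *≤ʳ Δ (<≤ 0<Δ) (#-mono {3} {320} (N.m≤m+n 3 317)) >> 320Δ≤1
      LX<vA = <-≤-trans (snd (snd cX)) (v-mono {suc ja} {A} (N.s≤s (N.m≤m+n ja m)))
      z≤T : ∀ w -> jb ≡ A N.+ m N.+ m N.+ m N.+ w -> L (A N.+ m N.+ w) - L (A N.+ m) ≤ T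
      z≤T w eq = L-v-difference (A N.+ m N.+ w) (A N.+ m) ~> (log-mono (v>0 (A N.+ m N.+ w)) (v-mono (N.≤-trans (N.m≤m+n _ m) (N.≤-trans (N.≤-reflexive (snd (arrange A m w))) (below w eq))) >> fst (snd cY)) ⊞ neg-mono (log-mono 0<LX (<≤ LX<vA >> v-mono (N.m≤m+n A m))))
      T≤z : ∀ w -> jb ≡ A N.+ m N.+ m N.+ m N.+ w -> T ≤ L (A N.+ m N.+ w) - L (A N.+ m) + # 8 * Δ
      T≤z w eq = lin (log-mono 0<LY vtop >> log-shift ½≤vt 0≤2Δ ⊞ log-mono (v>0 (A N.+ m)) vbot >> log-shift ½≤LX 0≤2Δ ⊞ ≈⇒≤ (sym (L-v-difference (A N.+ m N.+ w) (A N.+ m))))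
       (by 6 \ y x p q d z -> y :- x :+ (p :+ con 2 :* (con 2 :* d) :+ (x :+ con 2 :* (con 2 :* d) :+ z)) := y :+ (q :+ (p :- q)) :+ (z :+ con 8 :* d))
       where
       vt = v (A N.+ m N.+ w)
       ½≤vt = ½≤LX >> <≤ LX<vA >> v-mono (N.≤-trans (N.m≤m+n A m) (N.m≤m+n (A N.+ m) w))
       vtop = lin (<≤ (snd (snd cY)) ⊞ mη≤Δ ⊞ ≈⇒≤ suc-m-η)
        (+ˡ (+ˡ refl) & +ˡ (+ʳ (*ʳ (+ˡ (+ˡ (reflexive (E.cong # (E.trans eq (rearrange A m w))) & #-+ (A N.+ m N.+ w) (m N.+ m) & +ˡ (#-+ m m)))))) & +ˡ refl & by 5 \ y a m h d -> y :+ ((:1 :+ (:1 :+ (a :+ (m :+ m)))) :* h :+ (d :+ d)) := y :+ (m :* h :+ (:1 :+ m) :* h) :+ ((:1 :+ a) :* h :+ con 2 :* d))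
        where
        rearrange : ∀ A m w -> A N.+ m N.+ m N.+ m N.+ w ≡ A N.+ m N.+ w N.+ (m N.+ m)
        rearrange A m w = S.solve 3 (\ A m w -> A S.:+ m S.:+ m S.:+ m S.:+ w S.:= A S.:+ m S.:+ w S.:+ (m S.:+ m)) ok A m w
         where module S = +-*-Solver
       vbot = lin (fst (snd cX) ⊞ mη≤Δ ⊞ ≈⇒≤ suc-m-η) (+ʳ (*ʳ (+ˡ (#-+ A m & +ʳ (+ˡ (#-+ ja m))))) & by 5 \ x a m h d -> (:1 :+ (:1 :+ (a :+ m) :+ m)) :* h :+ (x :+ (d :+ d)) := (:1 :+ a) :* h :+ (m :* h :+ (:1 :+ m) :* h) :+ (x :+ con 2 :* d))

   -- Over a window of bounded ratio the sum of 1/p follows log log up to S^(-ℓ).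
   window-sum = abs-≤ (lin upper (by 3 \ y T e -> y :- T :+ (T :+ e) := y :+ e)) (lin lower (by 3 \ y T e -> :- (y :- T) :+ (y :+ e) := T :+ e)) >> (*≤ˡ _ (#≥0 41) (sym (1* θ) ~> *≤ʳ θ (<≤ 0<θ) (1≤# 7) >~ 8θ) ⊞ ≤-refl) >~ by 3 (\ a c t -> a :* t :+ con 2 :* (c :* t) := (a :+ con 2 :* c) :* t)

 -- The window theorem

 open Complex using (cos; cos-cong; cos-0)

 -- The length m of the head satisfies m + 2 ≤ ratioᶜ S^(q + 1).
 q : ℕ -> ℕ
 q ℓ = N.pred (eN ℓ N.* 4)

 ratioᶜ : ℝ
 ratioᶜ = # 2 * # 6 ^ 4

 -- The bound of the kernel estimate is linear in the scale.
 kernelᶜ : ℕ -> ℝ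
 kernelᶜ ℓ = # 2 * (∣ primeᶜ (k ℓ) ∣ * (expBound (primeᵉ (k ℓ)) (recip (q ℓ)) * ratioᶜ) + # 2)

 1≤ratio = 1≤^ 4 (1≤# 5) >> sym (1* _) ~> *≤ʳ _ (^≥0 4 (#≥0 6)) (1≤# 1)

 0<Bᵠ : ∀ ℓ -> 0# < expBound (primeᵉ (k ℓ)) (recip (q ℓ))
 0<Bᵠ ℓ = expBound>0 (primeᵉ (k ℓ)) (recip>0 (q ℓ))

 0≤kernelᶜ : ∀ ℓ -> 0# ≤ kernelᶜ ℓ
 0≤kernelᶜ ℓ = *≥0 (#≥0 2) (+≥0 (*≥0 (0≤abs _) (*≥0 (<≤ (0<Bᵠ ℓ)) (0≤1 >> 1≤ratio))) (#≥0 2))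

 module AtScale (ℓ σ : ℕ) (4≤S : # 4 ≤ # σ) (t₀-S : t₀ ⁻¹ ≤ # σ) where
  private
   S = # σ
   ε = S ⁻¹
   h = ε * ε
   N = σ N.^ eN ℓ
   1≤S = 1≤# 3 >> 4≤S
   0<S = <-≤-trans 0<1 1≤S
   0<ε = ⁻¹>0 0<S
   ε≤1 = ⁻¹-anti 0<1 1≤S >~ 1⁻¹
   0<h = *>0 0<ε 0<ε
   h≤1 = *-mono (<≤ 0<ε) ε≤1 (<≤ 0<ε) ε≤1 >~ 1* 1#
   1≤N = 1≤^ (eN ℓ) 1≤S >~ sym (#-^ σ (eN ℓ))
   -- Frequencies up to T occur; W bounds the sizes, and R the logarithm of the head length m.
   W T R : ℝ
   w m : ℕ
   w = 6 N.* N
   W = # w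
   T = # (N N.+ N) * h
   m = N.pred (w N.^ 4)
   R = L (suc m)
   W≈ = #-* 6 N
   1≤W = 1≤N >> sym (1* _) ~> *≤ʳ _ (#≥0 N) (1≤# 5) >~ sym W≈
   0<W = <-≤-trans 0<1 1≤W
   1≤w : 1 N.≤ w
   1≤w = #-cancel-≤ (#-1 ~> 1≤W)
   suc-pred : ∀ {n} -> 1 N.≤ n -> suc (N.pred n) ≡ n
   suc-pred {suc n} _ = ok
   suc-m = reflexive (E.cong # (suc-pred (N.^-monoʳ-≤ w {{N.>-nonZero 1≤w}} {0} {4} N.z≤n))) & #-^ w 4
   0≤T = *≥0 (#≥0 (N N.+ N)) (<≤ 0<h)
   T≤ = *≤ˡ _ (#≥0 (N N.+ N)) h≤1 >~ *1 _ & #-+ N N & by 1 (\ n -> n :+ n := con 2 :* n)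
   W-bound : ε + 1# + # 2 * T ≤ W
   W-bound = lin (ε≤1 ⊞ *≤ˡ _ (#≥0 2) T≤ ⊞ 1≤N ⊞ 1≤N) (by 3 \ e t n -> e :+ :1 :+ t :+ (:1 :+ (con 2 :* (con 2 :* n) :+ (n :+ n))) := e :+ (t :+ (:1 :+ :1)) :+ con 6 :* n) >~ sym W≈
   W-m : W * W ≤ exp (½ * L m)
   W-m = ≈⇒≤ (sym (exp-cong eq & exp-log (*>0 0<W 0<W)))
    where
    LW : L m ≈ # 4 * log W
    LW = log-cong (#>0 m) suc-m & log-^ 4 0<W
    eq : ½ * L m ≈ log (W * W)
    eq = *ˡ LW & by 2 (\ h l -> h :* (con 4 :* l) := con 2 :* h :* (l :+ l)) & *ʳ 2½ & 1* _ & sym (log-* 0<W 0<W)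
   ε≤t₀ : ε ≤ t₀
   ε≤t₀ = ⁻¹-anti (⁻¹>0 0<t₀) t₀-S >~ ⁻¹⁻¹ 0<t₀

  module Kn = Kernel (k ℓ) ε W R T m 0<ε ε≤t₀ 1≤W 0≤T W-bound W-m ≤-refl

  private
   d = recip (q ℓ)
   0<d = recip>0 (q ℓ)
   0<r = <-≤-trans 0<1 1≤ratio
   R≤ : exp (d * R) ≤ ratioᶜ * S
   R≤ = exp-mono (begin d * R ≤⟨ *≤ˡ d (<≤ 0<d) (log-mono (#>0 (suc m)) top) ⟩
    d * log (ratioᶜ * S ^ suc (q ℓ)) ≈⟨ *ˡ (log-* 0<r (^>0 (suc (q ℓ)) 0<S) & +ˡ (log-^ (suc (q ℓ)) 0<S)) ⟩
    d * (log ratioᶜ + # (suc (q ℓ)) * log S) ≈⟨ by 4 (\ d r n s -> d :* (r :+ n :* s) := d :* r :+ n :* d :* s) & +ˡ (*ʳ (suc*recip (q ℓ)) & 1* _) ⟩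
    d * log ratioᶜ + log S ≤⟨ *≤ʳ _ (log≥0 1≤ratio) (recip≤1 (q ℓ)) >~ 1* _ ⊞ ≤-refl ⟩
    log ratioᶜ + log S ≈⟨ sym (log-* 0<r 0<S) ⟩
    log (ratioᶜ * S) ∎) >~ exp-log (*>0 0<r 0<S)
    where
    top : # (suc (suc m)) ≤ ratioᶜ * S ^ suc (q ℓ)
    top = begin 1# + # (suc m) ≤⟨ 1≤^ 4 1≤W >~ sym suc-m ⊞ ≤-refl ⟩
     # (suc m) + # (suc m) ≈⟨ by 1 (\ n -> n :+ n := con 2 :* n) & *ˡ (suc-m & ^-congˡ 4 W≈ & ^-distrib-* _ _ 4) ⟩
     # 2 * (# 6 ^ 4 * # N ^ 4) ≈⟨ sym (*-assoc _ _ _) & *ˡ (^-congˡ 4 (#-^ σ (eN ℓ)) & ^-assocʳ S (eN ℓ) 4) ⟩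
     ratioᶜ * S ^ (eN ℓ N.* 4) ∎

  bound≤ : Kn.kernelBound ≤ kernelᶜ ℓ * S
  bound≤ = begin # 2 * (primeᶜ (k ℓ) * (1# + R) ^ primeᵉ (k ℓ) + # 2) ≤⟨ *≤ˡ _ (#≥0 2) (*≤ʳ _ (^≥0 (primeᵉ (k ℓ)) (+≥0 0≤1 0≤R)) (≤abs _) >> *≤ˡ _ (0≤abs _) (power≤exp (primeᵉ (k ℓ)) 0<d 0≤R >> *≤ˡ _ (<≤ (0<Bᵠ ℓ)) R≤) ⊞ sym (*1 _) ~> *≤ˡ _ (#≥0 2) 1≤S) ⟩
   # 2 * (∣ primeᶜ (k ℓ) ∣ * (expBound (primeᵉ (k ℓ)) d * (ratioᶜ * S)) + # 2 * S) ≈⟨ by 5 (\ t p b r s -> t :* (p :* (b :* (r :* s)) :+ t :* s) := t :* (p :* (b :* r) :+ t) :* s) ⟩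
   kernelᶜ ℓ * S ∎
   where
    0≤R = L≥0 (suc m)

  abstract
   -- m₁ is chosen so large that the mesh is fine enough.
   fine : ∃[ Q ] (Kn.mesh ⁻¹ < # Q)
   fine = archimedean (Kn.mesh ⁻¹)

  -- Large enough for the kernel estimate at this scale
  m₁ : ℕ
  m₁ = suc (N N.+ fst fine)

  private
   N≤m₁ : N N.≤ m₁
   N≤m₁ = N.m≤n⇒m≤1+n (N.m≤m+n N (fst fine))
   0<m₁ : 1 N.≤ m₁
   0<m₁ = N.s≤s N.z≤n
   module Sc = Scale ℓ σ m₁ 4≤S 0<m₁
   η≤mesh : Sc.η ≤ Kn.mesh
   η≤mesh = begin Sc.Δ * recip Sc.m ≤⟨ *≤ʳ _ (recip≥0 Sc.m) Sc.Δ≤1 >~ 1* _ ⟩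
    recip Sc.m ≤⟨ ⁻¹-anti (⁻¹>0 Kn.mesh>0) (<≤ (snd fine) >> #-mono (N.≤-trans (N.m≤n⇒m≤1+n (N.m≤n+m (fst fine) N)) (N.m≤n⇒m≤1+n Sc.m₁≤m))) ⟩
    Kn.mesh ⁻¹ ⁻¹ ≈⟨ ⁻¹⁻¹ Kn.mesh>0 ⟩
    Kn.mesh ∎

   agree : ∀ w -> Agree Sc.η Kn.kernelBound (\ u -> u ^ k ℓ * exp (- (ε * u)) * CosinePower.K h Sc.0<h N (u - w))
   agree w = agree-cong {Sc.η} {Kn.kernelBound} {g = \ u -> u ^ k ℓ * exp (- (ε * u)) * CosinePower.K h Sc.0<h N (u - w)} (\ u -> *ˡ (cos-cong (zeroˡ (u - w)) & cos-0) & *1 _)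
    (Kn.kernel-agree Sc.η Sc.0<η η≤mesh (N N.+ N) h w (<≤ 0<h) 0# (≈⇒≤ (+ʳ (abs≥0 ≤-refl) & 0+ _)))

   0≤kb : 0# ≤ Kn.kernelBound
   0≤kb = 0≤abs _ >> snd (agree 0#) (fst (agree 0#)) N.≤-refl

  open Window ℓ σ m₁ 4≤S 0<m₁ N≤m₁ (kernelᶜ ℓ) Kn.kernelBound (0≤kernelᶜ ℓ) 0≤kb bound≤ agree public using (window-sum)

 -- Constant of the window theorem
 windowᶜ : ℕ -> ℝ
 windowᶜ ℓ = # 41 + # 2 * errorᶜ ℓ (kernelᶜ ℓ)

 0≤windowᶜ : ∀ ℓ -> 0# ≤ windowᶜ ℓ
 0≤windowᶜ ℓ = +≥0 (#≥0 41) (*≥0 (#≥0 2) (errorᶜ≥0 ℓ (0≤kernelᶜ ℓ)))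

 window-theorem : ∀ ℓ σ {X Y} -> # 4 + t₀ ⁻¹ ≤ # σ -> X N.≤ Y -> # σ ≤ L X -> L Y ≤ # 2 * # σ -> ∣ primesBetween X Y - (log (L Y) - log (L X)) ∣ ≤ windowᶜ ℓ * # σ ⁻¹ ^ ℓ
 window-theorem ℓ σ big = AtScale.window-sum ℓ σ (x≤x+y (⁻¹≥0 0<t₀) >> big) (x≤y+x (#≥0 4) >> big)

 -- Sums of reciprocals of primes

 -- Sum of 1/p over the primes p ≤ n + 1, and its deviation from log log (n + 1)
 recipSum : ℕ -> ℝ
 recipSum n = Σ (suc n) 1/p

 deviation : ℕ -> ℝ
 deviation n = recipSum n - log (L n)

 primesBetween-difference : ∀ {X Y} -> X N.≤ Y -> primesBetween X Y ≈ recipSum Y - recipSum X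
 primesBetween-difference {X} {Y} le = by 2 (\ a b -> b := a :+ b :- a) & +ʳ
  (sym (Σ-split (suc X) (Y N.∸ X) 1/p) & reflexive (E.cong (\ n -> Σ n 1/p) (E.cong suc (N.m+[n∸m]≡n le))))

 -- A sequence passing the value c does so between two consecutive indices.
 crossing : ∀ (f : ℕ -> ℝ) c {X} Y -> X N.≤ Y -> f X ≤ c -> c < f Y -> ∃[ Z ] (X N.≤ Z × Z N.< Y × f Z ≤ c × c < f (suc Z))
 crossing f c {X} zero le lo hi = ⊥-elim (<⇒≱ hi (E.subst (\ n -> f n ≤ c) (N.n≤0⇒n≡0 le) lo))
 crossing f c {X} (suc Y) le lo hi = [ before , (\ eq -> ⊥-elim (<⇒≱ hi (E.subst (\ n -> f n ≤ c) eq lo))) ]′ (N.m≤n⇒m<n∨m≡n le)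
  where
  before : X N.< suc Y -> ∃[ Z ] (X N.≤ Z × Z N.< suc Y × f Z ≤ c × c < f (suc Z))
  before lt = [ (\ fY≤c -> Y , N.≤-pred lt , N.n<1+n Y , fY≤c , hi) ,
   (\ c<fY -> let (Z , p , q , r , s) = crossing f c Y (N.≤-pred lt) lo c<fY in Z , p , N.m<n⇒m<1+n q , r , s) ]′ (≤-or-> (f Y) c)

 split-abs : ∀ {a b c x y} -> ∣ b - a ∣ ≤ x -> ∣ c - b ∣ ≤ y -> ∣ c - a ∣ ≤ x + y
 split-abs {a} {b} {c} h k = abs-cong (by 3 \ a b c -> c :- a := b :- a :+ (c :- b)) ~> abs-+ _ _ >> (h ⊞ k)

 module Chain (ℓ : ℕ) where
  -- Overlapping windows: the scale of each is twice that of the previous one, less 1.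
  σ : ℕ -> ℕ
  σ s = suc (2 N.^ s)

  -- The error of the window with scale 2^s + 1, up to a constant
  saving : ℕ -> ℝ
  saving s = (½ ^ s) ^ suc ℓ

  C : ℝ
  C = windowᶜ (suc ℓ)

  0≤C = 0≤windowᶜ (suc ℓ)

  saving≥0 : ∀ s -> 0# ≤ saving s
  saving≥0 s = ^≥0 (suc ℓ) (^≥0 s (<≤ 0<½))

  saving-suc : ∀ s -> saving (suc s) ≤ saving s * ½
  saving-suc s = ^-distrib-* ½ (½ ^ s) (suc ℓ) ~> *≤ʳ _ (saving≥0 s) (*≤ˡ ½ (<≤ 0<½) (^≤1 ℓ (<≤ 0<½) ½≤1) >~ *1 ½) >~ *-comm _ _

  #σ : ∀ s -> # (σ s) ≈ 1# + # 2 ^ s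
  #σ s = +ˡ (#-^ 2 s)

  2σ : ∀ s -> # 2 * # (σ s) ≈ # (σ (suc s)) + 1#
  2σ s = *ˡ (#σ s) & by 1 (\ x -> con 2 :* (:1 :+ x) := :1 :+ con 2 :* x :+ :1) & +ʳ (sym (#σ (suc s)))

  σ-mono : ∀ s -> # (σ s) ≤ # (σ (suc s))
  σ-mono s = #-mono (N.s≤s (N.m≤m+n (2 N.^ s) _))

  σ≤2σ : ∀ s -> # (σ (suc s)) ≤ # 2 * # (σ s)
  σ≤2σ s = x≤x+y 0≤1 >~ sym (2σ s)

  inverse≤ : ∀ s -> # (σ s) ⁻¹ ^ suc ℓ ≤ saving s
  inverse≤ s = ^-mono (suc ℓ) (⁻¹≥0 (#>0 (2 N.^ s))) (⁻¹-anti (^>0 s (#>0 1)) (x≤y+x 0≤1 >~ sym (#σ s)) >~ sym (⁻¹-^ s (#>0 1)))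

  window : ∀ s {X Y} -> # 4 + t₀ ⁻¹ ≤ # (σ s) -> X N.≤ Y -> # (σ s) ≤ L X -> L Y ≤ # 2 * # (σ s) -> ∣ deviation Y - deviation X ∣ ≤ C * saving s
  window s {X} {Y} big X≤Y lo hi = abs-cong (by 4 (\ a b c d -> a :- b :- (c :- d) := a :- c :- (b :- d)) & +ʳ (sym (primesBetween-difference X≤Y))) ~> window-theorem (suc ℓ) (σ s) big X≤Y lo hi >> *≤ˡ C 0≤C (inverse≤ s)

  chain : ∀ n s {X Y} -> # 4 + t₀ ⁻¹ ≤ # (σ s) -> X N.≤ Y -> # (σ s) ≤ L X -> L Y ≤ # 2 * # (σ (n N.+ s)) -> ∣ deviation Y - deviation X ∣ ≤ # 2 * C * saving s
  chain-last : ∀ s {X Y} -> # 4 + t₀ ⁻¹ ≤ # (σ s) -> X N.≤ Y -> # (σ s) ≤ L X -> L Y ≤ # 2 * # (σ s) -> ∣ deviation Y - deviation X ∣ ≤ # 2 * C * saving s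
  chain-last s big X≤Y lo hi = window s big X≤Y lo hi >> *≤ʳ _ (saving≥0 s) (sym (1* C) ~> *≤ʳ C 0≤C (1≤# 1))

  chain zero s big X≤Y lo hi = chain-last s big X≤Y lo hi
  chain (suc n) s {X} {Y} big X≤Y lo hi = [ chain-last s big X≤Y lo , beyond ]′ (≤-or-> (L Y) (# 2 * # (σ s)))
   where
   big′ = big >> σ-mono s
   hi′ = hi >~ *ˡ (reflexive (E.cong (\ i -> # (σ i)) (E.sym (N.+-suc n s))))
   next≤ = *≤ˡ _ (*≥0 (#≥0 2) 0≤C) (saving-suc s) >~ by 4 (\ t c q h -> t :* c :* (q :* h) := c :* q :* (t :* h)) & *ˡ 2½ & *1 _
   beyond : # 2 * # (σ s) < L Y -> ∣ deviation Y - deviation X ∣ ≤ # 2 * C * saving s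
   beyond lt = [ split , (\ far -> chain n (suc s) big′ X≤Y (σ≤2σ s >> <≤ far) hi′ >> next≤ >> x≤x+y (*≥0 0≤C (saving≥0 s)) >~ by 2 \ c q -> c :* q :+ c :* q := con 2 :* c :* q) ]′ (≤-or-> (L X) (# 2 * # (σ s)))
    where
    split : L X ≤ # 2 * # (σ s) -> ∣ deviation Y - deviation X ∣ ≤ # 2 * C * saving s
    split near = let (Z , X≤Z , Z<Y , LZ≤ , <LZ′) = crossing L (# 2 * # (σ s)) Y X≤Y near lt
                     start = lin (<≤ <LZ′ ⊞ δ≤1 Z ⊞ ≈⇒≤ (sym (2σ s))) (by 4 \ a z w t -> a :+ (w :+ (:1 :+ t)) := t :+ (w :- z :+ (a :+ :1)) :+ z)
     in split-abs (window s big X≤Z lo LZ≤) (chain n (suc s) big′ (N.<⇒≤ Z<Y) start hi′ >> next≤) >~ by 2 (\ c q -> c :* q :+ c :* q := con 2 :* c :* q)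

 n≤2^n : ∀ n -> n N.≤ 2 N.^ n
 n≤2^n zero = N.z≤n
 n≤2^n (suc n) = N.≤-trans (N.+-mono-≤ (N.^-monoʳ-≤ 2 {0} {n} N.z≤n) (n≤2^n n)) (N.≤-reflexive (E.cong (2 N.^ n N.+_) (E.sym (N.+-identityʳ (2 N.^ n)))))

 -- Every real number at least 1 lies between consecutive powers of 2.
 binary-scale : ∀ {y} -> 1# ≤ y -> ∃[ s ] (# 2 ^ s ≤ y × y < # 2 ^ suc s)
 binary-scale {y} h = let (N , lt) = archimedean y
                          (s , _ , _ , p , q) = crossing (# 2 ^_) y N N.z≤n h (<-≤-trans lt (#-mono (n≤2^n N) >~ #-^ 2 N))
  in s , p , q

 -- The scale from which the estimates hold
 S₁ : ℝ
 S₁ = # 9 + # 2 * t₀ ⁻¹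

 -- Constant of the bound for the deviation
 tailᶜ : ℕ -> ℝ
 tailᶜ ℓ = # 2 * windowᶜ (suc ℓ) * # 4 ^ ℓ

 0≤tailᶜ : ∀ ℓ -> 0# ≤ tailᶜ ℓ
 0≤tailᶜ ℓ = *≥0 (*≥0 (#≥0 2) (0≤windowᶜ (suc ℓ))) (^≥0 ℓ (#≥0 4))

 0<S₁ : 0# < S₁
 0<S₁ = +>≥ (#>0 8) (*≥0 (#≥0 2) (⁻¹≥0 0<t₀))

 deviation-cauchy : ∀ ℓ {X Y} -> S₁ ≤ L X -> X N.≤ Y -> ∣ deviation Y - deviation X ∣ ≤ tailᶜ ℓ * L X ⁻¹ ^ ℓ
 deviation-cauchy ℓ {X} {Y} big X≤Y =
  let (s , 2ˢ≤ , <2ˢ⁺¹) = binary-scale 1≤y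
      (n , LY<) = archimedean (L Y)
  in chain n s (big′ s <2ˢ⁺¹) X≤Y (lower s 2ˢ≤) (upper n s LY<) >> *≤ˡ _ (*≥0 (#≥0 2) 0≤C) (saving≤ s <2ˢ⁺¹) >~ sym (*-assoc _ _ _)
  where
  open Chain ℓ
  y = L X - 1#
  0≤t = *≥0 (#≥0 2) (⁻¹≥0 0<t₀)
  0<LX = <-≤-trans 0<S₁ big
  1≤y = lin (big ⊞ 0≤t ⊞ #≥0 7) (by 2 \ t x -> :1 :+ (x :+ (t :+ con 7)) := con 9 :+ t :+ (:0 :+ :0) :+ (x :- :1))
  big′ : ∀ s -> y < # 2 ^ suc s -> # 4 + t₀ ⁻¹ ≤ # (σ s)
  big′ s lt = *-cancelˡ-≤ (# 2) (#>0 1) (lin (big ⊞ <≤ lt) (by 3 \ t x p -> con 2 :* (con 4 :+ t) :+ (x :+ con 2 :* p) := con 9 :+ con 2 :* t :+ (x :- :1) :+ con 2 :* p)) >> x≤y+x 0≤1 >~ sym (#σ s)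
  lower : ∀ s -> # 2 ^ s ≤ y -> # (σ s) ≤ L X
  lower s le = #σ s ~> lin le (by 2 \ p x -> :1 :+ p :+ (x :- :1) := p :+ x)
  upper : ∀ n s -> L Y < # n -> L Y ≤ # 2 * # (σ (n N.+ s))
  upper n s lt = <≤ lt >> #-mono (N.≤-trans (n≤2^n n) (N.≤-trans (N.^-monoʳ-≤ 2 (N.m≤m+n n s)) (N.n≤1+n _))) >> sym (1* _) ~> *≤ʳ _ (#≥0 (σ (n N.+ s))) (1≤# 1)
  saving≤ : ∀ s -> y < # 2 ^ suc s -> saving s ≤ # 4 ^ ℓ * L X ⁻¹ ^ ℓ
  saving≤ s lt = begin ½ ^ s * (½ ^ s) ^ ℓ ≤⟨ *≤ʳ _ (^≥0 ℓ (^≥0 s (<≤ 0<½))) (^≤1 s (<≤ 0<½) ½≤1) ⟩ 1# * (½ ^ s) ^ ℓ ≈⟨ 1* _ ⟩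
   (½ ^ s) ^ ℓ ≤⟨ ^-mono ℓ (^≥0 s (<≤ 0<½)) (≤-/ 0<LX (*≤ˡ _ (^≥0 s (<≤ 0<½)) LX≤ >> ≈⇒≤
    (by 3 (\ h p t -> h :* (t :* p) := h :* p :* t) & *ʳ (sym (^-distrib-* ½ (# 2) s) & ^-congˡ s (*-comm _ _ & 2½) & 1^ s) & 1* _))) ⟩
   (# 4 * L X ⁻¹) ^ ℓ ≈⟨ ^-distrib-* _ _ ℓ ⟩
   # 4 ^ ℓ * L X ⁻¹ ^ ℓ ∎
   where
   LX≤ = lin (<≤ lt ⊞ <≤ lt ⊞ 1≤y) (by 2 \ x p -> x :+ (con 2 :* p :+ (con 2 :* p :+ (x :- :1))) := x :- :1 :+ (x :- :1 :+ :1) :+ con 4 :* p)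

 abstract
  deviation-converges : ∃[ c ] deviation ℝᴮ.⟶ᴮ c
  deviation-converges = NormedAlgebra.cauchy-complete realAlgebra deviation \ e he ->
   let (X₁ , h₁) = L-unbounded S₁
       (X₂ , h₂) = L-unbounded (tailᶜ 1 / e)
       X = X₁ N.⊔ X₂
       S₁≤ = h₁ X (N.m≤m⊔n X₁ X₂)
       0<LX = <-≤-trans 0<S₁ S₁≤
   in X , \ n le -> deviation-cauchy 1 S₁≤ le >> *ˡ (*1 _) ~> (/-≤ 0<LX (sym (*-comm _ _ & /-cancel he) ~> *≤ˡ e (<≤ he) (h₂ X (N.m≤n⊔m X₁ X₂))))

 -- The limit of the sum of 1/p minus log log
 meisselMertens : ℝ
 meisselMertens = fst deviation-converges

 deviation-bound : ∀ ℓ {X} -> S₁ ≤ L X -> ∣ deviation X - meisselMertens ∣ ≤ tailᶜ ℓ * L X ⁻¹ ^ ℓ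
 deviation-bound ℓ {X} big = ≤-limit \ e he -> let (N , h) = snd deviation-converges e he
                                                   n = N N.⊔ X in
  abs-cong (by 3 \ x c y -> x :- c := :- (y :- x) :+ (y :- c)) ~> abs-+ _ _ >> (abs-neg _ ~> deviation-cauchy ℓ big (N.m≤n⊔m N X) ⊞ h n (N.m≤m⊔n N X))

 -- Lists of primes and the series of the logarithm

 -- The value a at (the integer after) i if that is a prime, and b otherwise
 atPrime : ℝ -> (ℕ -> ℝ) -> ℕ -> ℝ
 atPrime b f i = if isPrime (suc i) then f (suc i) else b

 head-sum : ∀ x xs f -> ∑ (filter prime? (x ∷ xs)) f ≈ (if isPrime x then f x else 0#) + ∑ (filter prime? xs) f
 head-sum x xs f with does (prime? x)
 ... | true = refl
 ... | false = sym (0+ _)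

 head-product : ∀ x xs f -> ∏ (filter prime? (x ∷ xs)) f ≈ (if isPrime x then f x else 1#) * ∏ (filter prime? xs) f
 head-product x xs f with does (prime? x)
 ... | true = refl
 ... | false = sym (1* _)

 -- Sums and products over the primes up to n as sums and products over ranges
 ∑-primes : ∀ n f -> ∑ (primesUpTo n) f ≈ Σ n (atPrime 0# f)
 ∑-primes n f = go (suc n) (\ x -> x) & Σ-front n _ & 0+ _
  where
  go : ∀ n (g : ℕ -> ℕ) -> ∑ (filter prime? (applyUpTo g n)) f ≈ Σ n (\ i -> if isPrime (g i) then f (g i) else 0#)
  go zero g = refl
  go (suc n) g = head-sum (g 0) (applyUpTo (g ∘ suc) n) f & +ˡ (go n (g ∘ suc)) & sym (Σ-front n _)

 -- Product of the first n values
 ∏ᵣ : ℕ -> (ℕ -> ℝ) -> ℝ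
 ∏ᵣ zero f = 1#
 ∏ᵣ (suc n) f = ∏ᵣ n f * f n

 ∏ᵣ-front : ∀ n f -> ∏ᵣ (suc n) f ≈ f 0 * ∏ᵣ n (f ∘ suc)
 ∏ᵣ-front zero f = 1* _ & sym (*1 _)
 ∏ᵣ-front (suc n) f = *ʳ (∏ᵣ-front n f) & *-assoc _ _ _

 ∏-primes : ∀ n f -> ∏ (primesUpTo n) f ≈ ∏ᵣ n (atPrime 1# f)
 ∏-primes n f = go (suc n) (\ x -> x) & ∏ᵣ-front n _ & 1* _
  where
  go : ∀ n (g : ℕ -> ℕ) -> ∏ (filter prime? (applyUpTo g n)) f ≈ ∏ᵣ n (\ i -> if isPrime (g i) then f (g i) else 1#)
  go zero g = refl
  go (suc n) g = head-product (g 0) (applyUpTo (g ∘ suc) n) f & *ˡ (go n (g ∘ suc)) & sym (∏ᵣ-front n _)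

 ∏ᵣ>0 : ∀ n {f} -> (∀ i -> 0# < f i) -> 0# < ∏ᵣ n f
 ∏ᵣ>0 zero h = 0<1
 ∏ᵣ>0 (suc n) h = *>0 (∏ᵣ>0 n h) (h n)

 log-∏ᵣ : ∀ n {f} -> (∀ i -> 0# < f i) -> log (∏ᵣ n f) ≈ Σ n (log ∘ f)
 log-∏ᵣ zero h = log-1
 log-∏ᵣ (suc n) h = log-* (∏ᵣ>0 n h) (h n) & +ʳ (log-∏ᵣ n h)

 floor-spec : ∀ {x} -> 0# ≤ x -> # ⌊ x ⌋ ≤ x × x < # (suc ⌊ x ⌋)
 floor-spec {x} h = the-spec 0 (\ n -> # n ≤ x × x < # (suc n))
  (let (N , lt) = archimedean x ; (n , _ , _ , p , q) = crossing # x N N.z≤n h lt in n , p , q)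

 floor-unique : ∀ {x} n -> # n ≤ x -> x < # (suc n) -> ⌊ x ⌋ ≡ n
 floor-unique {x} n p q = let (p′ , q′) = floor-spec {x} (#≥0 n >> p) in
  N.≤-antisym (N.≤-pred (#-cancel-< {⌊ x ⌋} {suc n} (≤-<-trans p′ q))) (N.≤-pred (#-cancel-< {n} {suc ⌊ x ⌋} (≤-<-trans p q′)))

 floor-mono : ∀ {x y} -> 0# ≤ x -> x ≤ y -> ⌊ x ⌋ N.≤ ⌊ y ⌋
 floor-mono {x} {y} h le = N.≤-pred (#-cancel-< {⌊ x ⌋} {suc ⌊ y ⌋} (≤-<-trans (fst (floor-spec h) >> le) (snd (floor-spec (h >> le)))))

 -- A bounded nondecreasing sequence converges.
 monotone-converges : ∀ (a : ℕ -> ℝ) c -> (∀ {m n} -> m N.≤ n -> a m ≤ a n) -> (∀ n -> a n ≤ c) -> ∃[ l ] (a ℝᴮ.⟶ᴮ l × (∀ n -> a n ≤ l))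
 monotone-converges a c mono bound =
  let (l , h) = NormedAlgebra.cauchy-complete realAlgebra a \ e he -> let (N , p) = monotone-cauchy a c mono bound e he in
       N , \ n le -> abs≥0 (sub≥0 (mono le)) ~> p n le
  in l , h , \ n -> lim-≤ {a} n h (\ k le -> mono le)

 antitone-converges : ∀ (a : ℕ -> ℝ) -> (∀ {m n} -> m N.≤ n -> a n ≤ a m) -> (∀ n -> 0# ≤ a n) -> ∃ (a ℝᴮ.⟶ᴮ_)
 antitone-converges a anti nn = negate (monotone-converges (\ n -> - a n) 0# (\ le -> neg-mono (anti le)) (\ n -> lin (nn n) (by 1 \ x -> :- x :+ x := :0 :+ :0)))
  where
  negate : ∃[ l ] ((\ n -> - a n) ℝᴮ.⟶ᴮ l × (∀ n -> - a n ≤ l)) -> ∃ (a ℝᴮ.⟶ᴮ_)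
  negate (l , h , _) = - l , \ e he -> let (N , p) = h e he in N , \ n le ->
   abs-cong (by 2 (\ a l -> a :- :- l := :- (:- a :- l)) {_} {a n} {l}) & abs-neg _ ~> p n le

 power-difference-≤ : ∀ k {x y} -> 0# ≤ x -> x ≤ y -> y ^ suc k - x ^ suc k ≤ # (suc k) * ((y - x) * y ^ k)
 power-difference-≤ zero {x} {y} hx h = ≈⇒≤ (by 2 \ x y -> y :* :1 :- x :* :1 := (:1 :+ :0) :* ((y :- x) :* :1))
 power-difference-≤ (suc k) {x} {y} hx h = lin (*≤ˡ y (hx >> h) (power-difference-≤ k hx h) ⊞ *≤ˡ (y - x) (sub≥0 h) (^-mono (suc k) hx h))
  (by 5 \ x y p q k -> y :* (y :* q) :- x :* (x :* p) :+ (y :* ((:1 :+ k) :* ((y :- x) :* q)) :+ (y :- x) :* (y :* q)) := y :* (y :* q :- x :* p) :+ (y :- x) :* (x :* p) :+ (:1 :+ (:1 :+ k)) :* ((y :- x) :* (y :* q)))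

 power-difference-≥ : ∀ k {x y} -> 0# ≤ x -> x ≤ y -> # (suc k) * ((y - x) * x ^ k) ≤ y ^ suc k - x ^ suc k
 power-difference-≥ zero {x} {y} hx h = ≈⇒≤ (by 2 \ x y -> (:1 :+ :0) :* ((y :- x) :* :1) := y :* :1 :- x :* :1)
 power-difference-≥ (suc k) {x} {y} hx h = lin (*≤ˡ x hx (power-difference-≥ k hx h) ⊞ *≤ˡ (y - x) (sub≥0 h) (^-mono (suc k) hx h))
  (by 5 \ x y p q k -> (:1 :+ (:1 :+ k)) :* ((y :- x) :* (x :* p)) :+ (x :* (y :* q :- x :* p) :+ (y :- x) :* (y :* q)) := x :* ((:1 :+ k) :* ((y :- x) :* p)) :+ (y :- x) :* (x :* p) :+ (y :* (y :* q) :- x :* (x :* p)))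

 geometric : ∀ K y -> Σ K (y ^_) * (1# - y) ≈ 1# - y ^ K
 geometric zero y = zeroˡ _ & sym (-‿inverseʳ 1#)
 geometric (suc K) y = distribʳ _ _ _ & +ʳ (geometric K y) & by 2 (\ y p -> :1 :- p :+ p :* (:1 :- y) := :1 :- y :* p)

 -- Partial sums of the logarithm series
 logSum : ℕ -> ℝ -> ℝ
 logSum K y = Σ K (\ k -> recip k * y ^ suc k)

 -- The function 1 / (1 - y), whose integral is the logarithm
 ρ : ℝ -> ℝ
 ρ y = (1# - y) ⁻¹

 -- Both sides of the series change by about (y - x)/(1 - x) between x and y.
 sum-upper : ∀ K {x y} -> 0# ≤ x -> x ≤ y -> y < 1# -> logSum K y - logSum K x ≤ (y - x) * ρ y
 sum-upper K {x} {y} hx h hy = begin logSum K y - logSum K x ≈⟨ sym (Σ-sub K _ _) ⟩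
  Σ K (\ k -> recip k * y ^ suc k - recip k * x ^ suc k) ≤⟨ Σ-mono′ K (\ k -> by 3 (\ r p q -> r :* p :- r :* q := r :* (p :- q)) ~> *≤ˡ _ (recip≥0 k) (power-difference-≤ k hx h) >~ sym (*-assoc _ _ _) & *ʳ (*-comm _ _ & suc*recip k) & 1* _) ⟩
  Σ K (\ k -> (y - x) * y ^ k) ≈⟨ Σ-* K _ _ ⟩
  (y - x) * Σ K (y ^_) ≤⟨ *≤ˡ _ (sub≥0 h) (≤-resp refl (1* _) (≤-/ (sub>0 hy) (geometric K y ~> lin (^≥0 K (hx >> h)) (by 1 \ p -> :1 :- p :+ p := :0 :+ :1)))) ⟩
  (y - x) * ρ y ∎

 sum-lower : ∀ K {x y} -> 0# ≤ x -> x ≤ y -> y < 1# -> (y - x) * ((1# - x ^ K) * ρ x) ≤ logSum K y - logSum K x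
 sum-lower K {x} {y} hx h hy = begin
  (y - x) * ((1# - x ^ K) * ρ x) ≈⟨ *ˡ (*ʳ (sym (geometric K x)) & *-assoc _ _ _ & *ˡ (inv (sub>0 (≤-<-trans h hy))) & *1 _) ⟩
  (y - x) * Σ K (x ^_) ≈⟨ sym (Σ-* K _ _) ⟩
  Σ K (\ k -> (y - x) * x ^ k) ≤⟨ Σ-mono′ K (\ k -> sym (1* _) & *ʳ (sym (*-comm _ _ & suc*recip k)) & *-assoc _ _ _ ~> *≤ˡ _ (recip≥0 k) (power-difference-≥ k hx h) >~ by 3 \ r p q -> r :* (p :- q) := r :* p :- r :* q) ⟩
  Σ K (\ k -> recip k * y ^ suc k - recip k * x ^ suc k) ≈⟨ Σ-sub K _ _ ⟩
  logSum K y - logSum K x ∎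

 module _ {x y : ℝ} (h : x ≤ y) (hy : y < 1#) where
  private
   a = 1# - x
   b = 1# - y
   0<a = sub>0 (≤-<-trans h hy)
   0<b = sub>0 hy
  log-upper = sym (log-/ 0<a 0<b) ~> log-≤ (/>0 0<a 0<b) >~ +ˡ (-ᶜ (sym (inv 0<b))) & by 3 (\ x y r -> (:1 :- x) :* r :- (:1 :- y) :* r := (y :- x) :* r)
  log-lower = lin (log-≤ (/>0 0<b 0<a)) (+ˡ (+ˡ (-ᶜ (sym (inv 0<a)))) & by 3 (\ x y r -> (y :- x) :* r :+ ((:1 :- y) :* r :- (:1 :- x) :* r) := :0) & sym (+ʳ (log-/ 0<b 0<a) & by 2 \ p q -> q :- p :+ (p :- q) := :0))

 module LogGrid (K : ℕ) (r : ℝ) (0≤r : 0# ≤ r) (r<1 : r < 1#) (n : ℕ) where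
  h = r * recip n
  0≤h = *≥0 0≤r (recip≥0 n)
  y : ℕ -> ℝ
  y j = # j * h
  y-end = by 3 (\ a b c -> a :* (b :* c) := b :* (a :* c)) & *ˡ (suc*recip n) & *1 r
  y≤r : ∀ {j} -> j N.≤ suc n -> y j ≤ r
  y≤r le = *≤ʳ h 0≤h (#-mono le) >~ y-end
  0≤y : ∀ j -> 0# ≤ y j
  0≤y j = *≥0 (#≥0 j) 0≤h
  y-step : ∀ j -> y (suc j) - y j ≈ h
  y-step j = by 2 (\ j h -> (:1 :+ j) :* h :- j :* h := h)
  y≤ : ∀ j -> y j ≤ y (suc j)
  y≤ j = *≤ʳ h 0≤h (#-mono (N.n≤1+n j))
  g : ℕ -> ℝ
  g j = logSum K (y j) + log (1# - y j)
  start : g 0 ≈ 0#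
  start = +-cong (Σ-zero K (\ k _ -> *ˡ (*ʳ (zeroˡ h) & zeroˡ _) & zeroʳ _)) (log-cong (<-resp refl (by 1 \ h -> :1 := :1 :- :0 :* h) 0<1) (by 1 \ h -> :1 :- :0 :* h := :1) & log-1) & +0 0#
  ρ0 : ρ (y 0) ≈ 1#
  ρ0 = ⁻¹-cong (by 1 \ h -> :1 :- :0 :* h := :1) & 1⁻¹
  ρ-mono : ∀ {x} -> x ≤ r -> ρ x ≤ ρ r
  ρ-mono le = ⁻¹-anti (sub>0 r<1) (+-monoʳ-≤ 1# (neg-mono le))
  ρ≥0 : ∀ {x} -> x ≤ r -> 0# ≤ ρ x
  ρ≥0 le = ⁻¹≥0 (sub>0 (≤-<-trans le r<1))
  upper : ∀ j -> j N.≤ suc n -> g j ≤ h * (ρ (y j) - 1#)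
  upper zero _ = ≈⇒≤ (start & sym (*ˡ (+ʳ ρ0 & -‿inverseʳ 1#) & zeroʳ h))
  upper (suc j) le = let lt = ≤-<-trans (y≤r le) r<1 in
   lin (upper j (N.<⇒≤ le) ⊞ sum-upper K (0≤y j) (y≤ j) lt >~ *ʳ (y-step j) ⊞ *ʳ (sym (y-step j)) ~> log-lower (y≤ j) lt)
    (by 7 \ s s' l l' h p q -> s' :+ l' :+ (h :* (p :- :1) :+ (h :* q :+ (l :- l'))) := s :+ l :+ (s' :- s :+ h :* p) :+ h :* (q :- :1))
  e = r ^ K * ρ r
  lower : ∀ j -> j N.≤ suc n -> - (h * (ρ (y j) - 1#)) - y j * e ≤ g j
  lower zero _ = ≈⇒≤ (+-cong (-ᶜ (*ˡ (+ʳ ρ0 & -‿inverseʳ 1#) & zeroʳ h)) (-ᶜ (*ʳ (zeroˡ h) & zeroˡ e)) & by 0 (:- :0 :- :0 := :0) & sym start)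
  lower (suc j) le = let lt = ≤-<-trans (y≤r le) r<1 ; yj≤r = y≤r (N.<⇒≤ le) in
   lin (lower j (N.<⇒≤ le) ⊞ *ʳ (sym (y-step j)) ~> sum-lower K (0≤y j) (y≤ j) lt ⊞ log-upper (y≤ j) lt >~ *ʳ (y-step j) ⊞ *≤ˡ h 0≤h (*-mono (^≥0 K (0≤y j)) (^-mono K (0≤y j) yj≤r) (ρ≥0 yj≤r) (ρ-mono yj≤r)))
    (+ʳ (+ˡ (-ᶜ (*ʳ {e} (by 2 (\ a b -> b := a :+ (b :- a)) {_} {y j} & +ˡ (y-step j))))) & by 10 \ s s' l l' h p q a b e -> :- (h :* (q :- :1)) :- (a :+ h) :* e :+ (s :+ l :+ (s' :- s :+ (h :* q :+ h :* e))) := :- (h :* (p :- :1)) :- a :* e :+ (h :* ((:1 :- b) :* p) :+ (l :- l' :+ h :* (b :* p))) :+ (s' :+ l'))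

 -- The logarithm series, with an explicit error
 module _ (K : ℕ) {r : ℝ} (0≤r : 0# ≤ r) (r<1 : r < 1#) where
  private
   module G = LogGrid K r 0≤r r<1
   c = r * (ρ r - 1#) + 1#
   1≤ρ = sym 1⁻¹ ~> ⁻¹-anti (sub>0 r<1) (lin 0≤r (by 1 \ r -> :1 :- r :+ r := :0 :+ :1))
   0<c = +≥> (*≥0 0≤r (sub≥0 1≤ρ)) 0<1
   -- A fine grid leaves an arbitrarily small error.
   small : ∀ e -> 0# < e -> ∃[ n ] (G.h n * (ρ (G.y n (suc n)) - 1#) ≤ e)
   small e he = let (n , lt) = archimedean⁻¹ (/>0 he 0<c) in n ,
    *ˡ (+ʳ (⁻¹-cong (+ˡ (-ᶜ (G.y-end n))))) & by 3 (\ a b c -> a :* b :* c := b :* (a :* c)) ~> *-mono (recip≥0 n) (<≤ lt) (*≥0 0≤r (sub≥0 1≤ρ)) (x≤x+y 0≤1) >~ /-cancel 0<c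

  logSum≤ = ≤-limit \ e he -> let (n , le) = small e he in
   lin (sym (end n) ~> G.upper n (suc n) N.≤-refl >> le) (by 3 \ s l e -> s :+ e := s :+ l :+ (:- l :+ e))
   where
   end : ∀ n -> G.g n (suc n) ≈ logSum K r + log (1# - r)
   end n = +-cong (Σ-cong′ K (\ k -> *ˡ (^-congˡ (suc k) (G.y-end n)))) (log-cong (sub>0 (≤-<-trans (≈⇒≤ (G.y-end n)) r<1)) (+ˡ (-ᶜ (G.y-end n))))

  ≤logSum = ≤-limit \ e he -> let (n , le) = small e he in
   lin (G.lower n (suc n) N.≤-refl >~ end n ⊞ le ⊞ ≈⇒≤ (*ʳ (G.y-end n)))
    (by 6 \ s l e h y q -> :- l :+ (s :+ l :+ (e :+ q)) := :- h :- y :+ (h :+ y) :+ (s :+ q :+ e))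
   where
   end : ∀ n -> G.g n (suc n) ≈ logSum K r + log (1# - r)
   end n = +-cong (Σ-cong′ K (\ k -> *ˡ (^-congˡ (suc k) (G.y-end n)))) (log-cong (sub>0 (≤-<-trans (≈⇒≤ (G.y-end n)) r<1)) (+ˡ (-ᶜ (G.y-end n))))

 -- Euler's constant

 open ℝᴮ using (_⟶ᴮ_)

 ⟶-along : ∀ {a : ℕ -> ℝ} {l} (s : ℕ -> ℕ) -> (∀ M -> ∃[ N ] (∀ n -> N N.≤ n -> M N.≤ s n)) -> a ⟶ᴮ l -> (\ n -> a (s n)) ⟶ᴮ l
 ⟶-along s grow h e he = let (M , p) = h e he ; (N , q) = grow M in N , \ n le -> p (s n) (q n le)

 -- H(n + 1) - log(n + 1), with H the harmonic sums
 harmonicExcess : ℕ -> ℝ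
 harmonicExcess n = Σ (suc n) recip - L n

 harmonicExcess-step : ∀ n -> harmonicExcess (suc n) ≤ harmonicExcess n
 harmonicExcess-step n = lin (recip≤δ n) (by 4 \ s r a b -> s :+ r :- b :+ (b :- a) := r :+ (s :- a))

 harmonicExcess-anti : ∀ {m n} -> m N.≤ n -> harmonicExcess n ≤ harmonicExcess m
 harmonicExcess-anti {m} {n} le = E.subst (\ k₁ -> harmonicExcess k₁ ≤ harmonicExcess m) (N.m∸n+n≡m le) (go (n N.∸ m))
  where go : ∀ k₁ -> harmonicExcess (k₁ N.+ m) ≤ harmonicExcess m
        go zero = ≤-refl
        go (suc k₁) = harmonicExcess-step (k₁ N.+ m) >> go k₁

 harmonicExcess≥0 : ∀ n -> 0# ≤ harmonicExcess n
 harmonicExcess≥0 n = lin (≤-recip-sum 0 n ⊞ ≈⇒≤ L-0 ⊞ recip≥0 n) (by 4 \ l l₀ s r -> :0 :+ (s :+ (:0 :+ r)) := l :- l₀ :+ (l₀ :+ :0) :+ (s :+ r :- l))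

 abstract
  euler-limit : ∃[ γ ] harmonicExcess ⟶ᴮ γ
  euler-limit = antitone-converges harmonicExcess harmonicExcess-anti harmonicExcess≥0

 γ : ℝ
 γ = fst euler-limit

 γᴱ≈γ : γᴱ ≈ γ
 γᴱ≈γ = lim-unique \ e he -> let (N , h) = snd euler-limit e he in suc N , \ where
  (suc n) (N.s≤s le) -> abs-cong (+ʳ (+ʳ (∑-upTo (suc n) _ & Σ-cong′ (suc n) (\ k₁ -> 1* _)))) ~> h n le

 -- The sum of 1/p over log p ≤ u minus the harmonic sum up to u, at u = log (i + 1)
 part : ℕ -> ℕ
 part i = ⌊ L i ⌋

 part-spec : ∀ i -> # (part i) ≤ L i × L i < # (suc (part i))
 part-spec i = floor-spec (L≥0 i)

 part-grows : ∀ M -> ∃[ N ] (∀ n -> N N.≤ n -> M N.≤ part n)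
 part-grows M = let (N , h) = L-unbounded (# M) in N , \ n le -> N.≤-pred (#-cancel-< {M} {suc (part n)} (≤-<-trans (h n le) (snd (part-spec n))))

 -- The harmonic sum up to log (i + 1)
 harmonic : ℕ -> ℝ
 harmonic i = Σ (part i) recip

 gap : ℕ -> ℝ
 gap i = recipSum i - harmonic i

 gap-limit : gap ⟶ᴮ meisselMertens - γ
 gap-limit = ℝᴮ.⟶-diff {a = model} model-limit \ e he ->
  let (n₀ , lt) = archimedean⁻¹ he
      (N , large) = part-grows (suc n₀)
  in N , \ i le -> abs-cong (by 1 \ x -> x :- :0 := x) ~> close-to i n₀ (large i le) (<≤ lt)
  where
  model : ℕ -> ℝ
  model i = deviation i - harmonicExcess (N.pred (part i))
  model-limit = ℝᴮ.⟶-sub (snd deviation-converges) (⟶-along {harmonicExcess} (\ i -> N.pred (part i))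
   (\ M -> let (N , h) = part-grows (suc M) in N , \ n le -> N.≤-pred (N.≤-trans (h n le) (N.≤-reflexive (E.sym (suc-pred (N.≤-trans (N.s≤s N.z≤n) (h n le))))))) (snd euler-limit))
   where
   suc-pred : ∀ {n} -> 1 N.≤ n -> suc (N.pred n) ≡ n
   suc-pred {suc n} _ = ok
  -- log L differs from log of its integer part by little.
  close-to : ∀ i n₀ -> suc n₀ N.≤ part i -> ∀ {e} -> # (suc n₀) ⁻¹ ≤ e -> ∣ gap i - model i ∣ ≤ e
  close-to i n₀ le {e} le′ = go (part i) le (part-spec i)
   where
   go : ∀ F -> suc n₀ N.≤ F -> (# F ≤ L i × L i < # (suc F)) -> ∣ (recipSum i - Σ F recip) - (deviation i - harmonicExcess (N.pred F)) ∣ ≤ e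
   go (suc F) le (lo , hi) = abs-cong (by 4 \ r s l m -> r :- s :- (r :- l :- (s :- m)) := l :- m) & abs≥0 (sub≥0 (log-mono (#>0 F) lo)) ~> sym (log-/ 0<L (#>0 F)) ~> log-≤ (/>0 0<L (#>0 F)) >> ratio >> ⁻¹-anti (#>0 n₀) (#-mono le) >> le′
    where
    0<L = <-≤-trans (#>0 F) lo
    ratio = lin (*≤ʳ _ (⁻¹≥0 (#>0 F)) (<≤ hi)) (+ˡ (distribʳ _ _ _ & +ˡ (inv (#>0 F))) & by 2 \ a b -> a :- :1 :+ (:1 :* b :+ :1) := a :+ b)

 gap-0 : gap 0 ≈ 0#
 gap-0 = +-cong (0+ _) (-ᶜ (reflexive (E.cong (\ n -> Σ n recip) (floor-unique 0 (≈⇒≤ (sym L-0)) (<-resp (sym L-0) (sym #-1) 0<1))))) & -‿inverseʳ 0#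

 -- An Abelian theorem: a convergent series is summed to its limit by weights close to 1.
 ≤Σ-abs : ∀ n (f : ℕ -> ℝ) i -> i N.< n -> ∣ f i ∣ ≤ Σ n (\ j -> ∣ f j ∣)
 ≤Σ-abs (suc n) f i lt = [ (\ i<n -> ≤Σ-abs n f i i<n >> x≤x+y (0≤abs _)) , (\ i≡n -> E.subst (\ k₁ -> ∣ f k₁ ∣ ≤ Σ n (\ j -> ∣ f j ∣) + ∣ f n ∣) (E.sym i≡n) (x≤y+x (Σ≥0 n (\ j -> 0≤abs (f j))))) ]′ (N.m≤n⇒m<n∨m≡n (N.≤-pred lt))

 abelian : ∀ {g κ} -> g ⟶ᴮ κ -> g 0 ≈ 0# -> ∀ e -> 0# < e -> ∃[ I ] ∃[ G ] (0# ≤ G × (∀ (w : ℕ -> ℝ) -> w 0 ≈ 1# -> (∀ i -> 0# ≤ w i) -> (∀ i -> w (suc i) ≤ w i) -> ∀ n -> I N.≤ n -> ∣ Σ n (\ i -> (g (suc i) - g i) * w (suc i)) - κ ∣ ≤ # 2 * e + G * (1# - w I)))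
 abelian {g} {κ} h g0 e he = let (I , p) = h e he in I , Σ I (\ j -> ∣ g j - κ ∣) , Σ≥0 I (\ j -> 0≤abs _) , \ w w0 w≥0 anti n le -> bound I p w w0 w≥0 anti n le
  where
  by-parts : ∀ (w : ℕ -> ℝ) n -> Σ n (\ i -> (g (suc i) - g i) * w (suc i)) ≈ (g n - κ) * w n - (g 0 - κ) * w 0 + Σ n (\ i -> (g i - κ) * (w i - w (suc i)))
  by-parts w zero = by 2 (\ a b -> :0 := a :* b :- a :* b :+ :0)
  by-parts w (suc n) = +ʳ (by-parts w n) & by 7 (\ a b k₁ x y s t -> (a :- k₁) :* x :- t :+ s :+ (b :- a) :* y := (b :- k₁) :* y :- t :+ (s :+ (a :- k₁) :* (x :- y))) {_} {g n} {g (suc n)} {κ} {w n} {w (suc n)} {Σ n (\ i -> (g i - κ) * (w i - w (suc i)))} {(g 0 - κ) * w 0}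
  abs-Σ : ∀ n {f : ℕ -> ℝ} {c} {w : ℕ -> ℝ} -> (∀ i -> w (suc i) ≤ w i) -> (∀ i -> i N.< n -> ∣ f i ∣ ≤ c) -> ∣ Σ n (\ i -> f i * (w i - w (suc i))) ∣ ≤ c * (w 0 - w n)
  abs-Σ n {f} {c} {w} anti k₁ = ℝᴮ.norm-Σ n _ >> Σ-mono n (\ i lt -> abs-* _ _ & *ˡ (abs≥0 (sub≥0 (anti i))) ~> *≤ʳ _ (sub≥0 (anti i)) (k₁ i lt)) >~ Σ-* n c _ & *ˡ (Σ-telescope n w)
  bound : ∀ I -> (∀ n -> I N.≤ n -> ∣ g n - κ ∣ ≤ e) -> ∀ (w : ℕ -> ℝ) -> w 0 ≈ 1# -> (∀ i -> 0# ≤ w i) -> (∀ i -> w (suc i) ≤ w i) -> ∀ n -> I N.≤ n -> ∣ Σ n (\ i -> (g (suc i) - g i) * w (suc i)) - κ ∣ ≤ # 2 * e + Σ I (\ j -> ∣ g j - κ ∣) * (1# - w I)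
  bound I p w w0 w≥0 anti n le = begin
   ∣ Σ n (\ i -> (g (suc i) - g i) * w (suc i)) - κ ∣ ≈⟨ abs-cong (+ʳ (by-parts w n & +-cong (+ˡ (-ᶜ (*-cong (+ʳ g0 & 0+ _) w0 & *1 _))) split) & by 4 \ a k₁ s t -> a :- :- k₁ :+ (s :+ t) :- k₁ := a :+ (s :+ t)) ⟩
   ∣ (g n - κ) * w n + (A + B) ∣ ≤⟨ abs-+ _ _ >> +-monoʳ-≤ _ (abs-+ _ _) ⟩
   ∣ (g n - κ) * w n ∣ + (∣ A ∣ + ∣ B ∣) ≤⟨ abs-* _ _ ~> *-mono (0≤abs _) (p n le) (0≤abs _) (abs≥0 (w≥0 n) ~> w≤1 n) ⊞ abs-Σ I {\ i -> g i - κ} {G} {w} anti (≤Σ-abs I (\ i -> g i - κ))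
    ⊞ abs-Σ k₁ {\ r -> g (I N.+ r) - κ} {e} {\ r -> w (I N.+ r)} (\ r -> E.subst (\ m -> w m ≤ w (I N.+ r)) (E.sym (N.+-suc I r)) (anti (I N.+ r))) (\ r _ -> p (I N.+ r) (N.m≤m+n I r)) ⟩
   e * 1# + (G * (w 0 - w I) + e * (w (I N.+ 0) - w (I N.+ k₁))) ≤⟨ ≤-refl ⊞ ≈⇒≤ (*ˡ (+ʳ w0)) ⊞ *≤ˡ e (<≤ he) (lin (w≤1 (I N.+ 0) ⊞ w≥0 (I N.+ k₁)) (by 2 \ a b -> a :- b :+ (:1 :+ b) := a :+ :0 :+ :1)) ⟩
   e * 1# + (G * (1# - w I) + e * 1#) ≈⟨ by 2 (\ e x -> e :* :1 :+ (x :+ e :* :1) := con 2 :* e :+ x) ⟩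
   # 2 * e + G * (1# - w I) ∎
   where
   k₁ = n N.∸ I
   G = Σ I (\ j -> ∣ g j - κ ∣)
   A = Σ I (\ i -> (g i - κ) * (w i - w (suc i)))
   B = Σ k₁ (\ r -> (g (I N.+ r) - κ) * (w (I N.+ r) - w (I N.+ suc r)))
   split : Σ n (\ i -> (g i - κ) * (w i - w (suc i))) ≈ A + B
   split = reflexive (E.cong (\ m -> Σ m (\ i -> (g i - κ) * (w i - w (suc i)))) (E.sym (N.m+[n∸m]≡n le))) & Σ-split I k₁ _ & +ˡ (Σ-cong′ k₁ (\ r -> *ˡ (+ˡ (-ᶜ (reflexive (E.cong w (E.sym (N.+-suc I r))))))))
   w≤1 : ∀ i -> w i ≤ 1#
   w≤1 zero = ≈⇒≤ w0
   w≤1 (suc i) = anti i >> w≤1 i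

 -- The real zeta function

 open ℝᴮ using (_⟶ᴮ_)

 exp-neg-upper : ∀ {y} -> 0# ≤ y -> exp (- y) ≤ 1# - y + y * y
 exp-neg-upper {y} hy = exp-neg y ~> ⁻¹-anti 0<1+y (1+x≤exp y) >> ≤-resp (1* _) refl (/-≤ 0<1+y (lin (*≥0 hy (sq≥0 y)) (by 1 \ y -> :1 :+ y :* (y :* y) := :0 :+ (:1 :- y :+ y :* y) :* (:1 :+ y))))
  where 0<1+y = +>≥ 0<1 hy

 primeRecip≤½ : ∀ i -> 1/p i ≤ ½
 primeRecip≤½ zero = <≤ 0<½
 primeRecip≤½ (suc i) = go (isPrime (suc (suc i)))
  where go : ∀ b -> (if b then recip (suc i) else 0#) ≤ ½
        go true = recip-mono {1} {suc i} (N.s≤s N.z≤n)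
        go false = <≤ 0<½

 primeRecip≤recip : ∀ i -> 1/p i ≤ recip i
 primeRecip≤recip i = go (isPrime (suc i))
  where go : ∀ b -> (if b then recip i else 0#) ≤ recip i
        go true = ≤-refl
        go false = recip≥0 i

 ½<1 : ½ < 1#
 ½<1 = lin< 0<½ (+-cong (sym (1* ½)) (sym (1* ½)) & half+half 1# & sym (0+ 1#))

 -- The quadratic part of -log(1 - x)
 remainder : ℝ -> ℝ
 remainder x = - log (1# - x) - x

 remainder-0 : ∀ {x} -> x ≈ 0# -> remainder x ≈ 0#
 remainder-0 {x} p = +-cong (-ᶜ (log-cong (<-resp refl (sym eq) 0<1) eq & log-1)) (-ᶜ p) & by 0 (:- :0 :- :0 := :0)
  where eq : 1# - x ≈ 1#
        eq = +ˡ (-ᶜ p) & by 0 (:1 :- :0 := :1)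

 module _ {x y : ℝ} (hx : 0# ≤ x) (h : x ≤ y) (hy : y ≤ ½) where
  private y<1 = ≤-<-trans hy ½<1

  remainder-mono = lin (log-lower h y<1 ⊞ *≤ˡ (y - x) (sub≥0 h) 1≤ρ) (by 5 \ x y a b p -> :- a :- x :+ (a :- b :+ (y :- x) :* p) := (y :- x) :* p :+ (y :- x) :* :1 :+ (:- b :- y))
   where 1≤ρ : 1# ≤ ρ x
         1≤ρ = sym 1⁻¹ ~> ⁻¹-anti (sub>0 (≤-<-trans h y<1)) (lin hx (by 1 \ r -> :1 :- r :+ r := :0 :+ :1))

  remainder-increase : remainder y - remainder x ≤ (y - x) * (# 2 * y)
  remainder-increase = lin (log-upper h y<1 ⊞ *≤ˡ (y - x) (sub≥0 h) ρ≤) (by 5 \ x y a b p -> :- b :- y :- (:- a :- x) :+ ((y :- x) :* p :+ (y :- x) :* (:1 :+ con 2 :* y)) := a :- b :+ (y :- x) :* p :+ (y :- x) :* (con 2 :* y))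
   where ρ≤ : ρ y ≤ 1# + # 2 * y
         ρ≤ = ≤-resp (1* _) refl (/-≤ (sub>0 y<1) (lin (*≥0 (hx >> h) (sub≥0 (*≤ˡ _ (#≥0 2) hy >~ 2½))) (by 1 \ y -> :1 :+ y :* (:1 :- con 2 :* y) := :0 :+ (:1 :+ con 2 :* y) :* (:1 :- y))))

 module AtExponent (δ′ : ℝ) (0<δ : 0# < δ′) (δ≤1 : δ′ ≤ 1#) where

  χ : Character realAlgebra δ′ 1# 1# 0
  χ = record
   { E = \ u -> exp (- (δ′ * u)) ; w = δ′
   ; E-cong = \ p -> exp-cong (-ᶜ (*ˡ p))
   ; E-0 = exp-cong (by 1 \ d -> :- (d :* :0) := :0) & exp-0
   ; E-+ = \ u v -> exp-cong (by 3 \ d u v -> :- (d :* (u :+ v)) := :- (d :* u) :+ :- (d :* v)) & exp-+ _ _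
   ; E-bound = \ {u} _ -> ≈⇒≤ (abs≥0 (exp≥0 _) & by 1 \ e -> e := :1 :* (:1 :* e))
   ; w-bound = abs≥0 (<≤ 0<δ) ~> δ≤1
   ; E-first-order = \ {u} 0≤u _ -> first-order 0≤u
   }
   where
   first-order : ∀ {u} -> 0# ≤ u -> ∣ 1# - exp (- (δ′ * u)) - u * δ′ ∣ ≤ 1# * (u * u)
   first-order {u} hu = abs-≤ (lin (1+x≤exp (- (δ′ * u))) (by 3 \ d u e -> :1 :- e :- u :* d :+ e := :1 :+ :- (d :* u) :+ :0) >> *≥0 0≤1 (sq≥0 u))
    (lin (exp-neg-upper (*≥0 (<≤ 0<δ) hu) ⊞ *≤ʳ (u * u) (sq≥0 u) δδ≤1)
     (by 3 \ d u e -> :- (:1 :- e :- u :* d) :+ (:1 :- d :* u :+ d :* u :* (d :* u) :+ :1 :* (u :* u)) := e :+ d :* d :* (u :* u) :+ :1 :* (u :* u)))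
    where δδ≤1 : δ′ * δ′ ≤ 1#
          δδ≤1 = *-mono (<≤ 0<δ) δ≤1 (<≤ 0<δ) δ≤1 >~ 1* 1#

  module Zχ = Zeta χ 0<δ 0≤1
  module Eχ = Euler χ 0<δ 0≤1
  open Zχ using (Z; Z-series)

  -- 1/δ ≤ ζ(1 + δ) ≤ 1 + 1/δ
  Z≤ : Z ≤ 1# + δ′ ⁻¹
  Z≤ = ≤-lim 0 Z-series (\ n _ -> decay-total 0<δ n)

  ≤Z : 1# ≤ δ′ * Z
  ≤Z = ≤-limit \ e he -> let (N , h) = decay-null 0<δ e he in
   lin (lower N ⊞ h N N.≤-refl ⊞ *≤ˡ δ′ (<≤ 0<δ) (partial N)) (by 4 \ e s d z -> :1 :+ (s :+ (e :+ z)) := :1 :- d :+ (d :+ s) :+ (z :+ e)) >> ≤-refl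
   where
   partial : ∀ N -> Σ N (\ i -> recip i * decay δ′ i) ≤ Z
   partial N = lim-≤ N Z-series (\ n le -> Σ-length-mono (\ i -> *≥0 (recip≥0 i) (decay≥0 δ′ i)) le)
   step : ∀ i -> decay δ′ i - decay δ′ (suc i) ≤ δ′ * (recip i * decay δ′ i)
   step i = lin (*≤ʳ _ (decay≥0 δ′ i) (+-monoʳ-≤ 1# (neg-mono (*≤ˡ δ′ (<≤ 0<δ) (δ≤recip i))) >> 1+x≤exp (- (δ′ * δ i))) ⊞ ≈⇒≤ (sym (exp-+ _ _) & exp-cong (by 3 \ d a b -> :- (d :* (b :- a)) :+ :- (d :* a) := :- (d :* b))))
    (by 5 \ x y d r z -> x :- y :+ (z :+ y) := (:1 :+ :- (d :* r)) :* x :+ z :+ d :* (r :* x))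
   lower : ∀ N -> 1# - decay δ′ N ≤ δ′ * Σ N (\ i -> recip i * decay δ′ i)
   lower N = +ʳ (sym (exp-cong (-ᶜ (*ˡ L-0) & by 1 \ d -> :- (d :* :0) := :0) & exp-0)) ~> ≈⇒≤ (sym (Σ-telescope N (decay δ′))) >> Σ-mono′ N step >~ Σ-* N δ′ _

  0<Z : 0# < Z
  0<Z = <-resp (zeroʳ (δ′ ⁻¹)) (sym (*-assoc _ _ _) & *ʳ (*-comm _ _ & inv 0<δ) & 1* Z) (*-monoˡ-< (δ′ ⁻¹) (⁻¹>0 0<δ) (<-≤-trans 0<1 ≤Z))

  log-Z-lower : - log δ′ ≤ log Z
  log-Z-lower = lin (sym log-1 ~> log-mono 0<1 ≤Z >~ log-* 0<δ 0<Z) (by 2 \ d z -> :- d :+ (d :+ z) := :0 :+ z)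

  log-Z-upper : log Z ≤ - log δ′ + δ′
  log-Z-upper = lin (sym (log-* 0<δ 0<Z) ~> log-≤ (*>0 0<δ 0<Z) ⊞ *≤ˡ δ′ (<≤ 0<δ) Z≤ ⊞ ≈⇒≤ (inv 0<δ))
   (by 5 \ l z d Z i -> z :+ (d :* Z :- :1 :+ (d :* (:1 :+ i) :+ :1)) := l :+ z :+ (d :* Z :+ d :* i) :+ (:- l :+ d))

  -- p^(-1-δ) at a prime p = i + 1
  x : ℕ -> ℝ
  x i = 1/p i * decay δ′ i

  x≥0 : ∀ i -> 0# ≤ x i
  x≥0 i = *≥0 (primeRecip≥0 i) (decay≥0 δ′ i)

  x≤ : ∀ i -> x i ≤ 1/p i
  x≤ i = *≤ˡ _ (primeRecip≥0 i) (decay≤1 i (<≤ 0<δ)) >~ *1 _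

  1-x>0 : ∀ i -> 0# < 1# - x i
  1-x>0 i = sub>0 (≤-<-trans (x≤ i >> primeRecip≤½ i) ½<1)

  P≈ : ∀ n -> Eχ.P n ≈ ∏ᵣ n (\ i -> 1# - x i)
  P≈ zero = refl
  P≈ (suc n) = *-cong (P≈ n) (go (isPrime (suc n)))
   where go : ∀ b -> (if b then 1# - recip n * decay δ′ n else 1#) ≈ 1# - (if b then recip n else 0#) * decay δ′ n
         go true = refl
         go false = by 1 (\ d -> :1 := :1 :- :0 :* d)

  -- The logarithm of the Euler product
  log-euler : (\ n -> Σ n x + Σ n (\ i -> remainder (x i))) ⟶ᴮ log Z
  log-euler e he = near (Eχ.euler-product e′ 0<e′)
   where
   e′ = e / (# 2 * (1# + e))
   0<1+e = +>≥ 0<1 (<≤ he)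
   0<2+ = *>0 (#>0 1) 0<1+e
   0<e′ = />0 he 0<2+
   2e′ : # 2 * e′ ≤ e
   2e′ = x≤x+y (*≥0 (*≥0 (#≥0 2) (<≤ he)) (<≤ 0<e′)) >~ by 2 (\ q e -> con 2 :* q :+ con 2 :* e :* q := q :* (con 2 :* (:1 :+ e))) & /-cancel 0<2+
   2e′≤1 : # 2 * e′ ≤ 1#
   2e′≤1 = *-cancelˡ-≤ (1# + e) 0<1+e (by 2 (\ q e -> (:1 :+ e) :* (con 2 :* q) := q :* (con 2 :* (:1 :+ e))) & /-cancel 0<2+ ~> x≤y+x 0≤1 >~ sym (*1 _))
   log-product : ∀ n -> Σ n x + Σ n (\ i -> remainder (x i)) ≈ - log (∏ᵣ n (\ i -> 1# - x i))
   log-product n = sym (Σ-+ n _ _) & Σ-cong′ n (\ i -> by 2 \ x l -> x :+ (:- l :- x) := :- l) & Σ-neg n _ & -ᶜ (sym (log-∏ᵣ n 1-x>0))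
   near : (∃[ N ] (∀ n -> N N.≤ n -> ∣ Eχ.P n * Z - 1# ∣ ≤ e′)) -> ∃[ N ] (∀ n -> N N.≤ n -> ∣ Σ n x + Σ n (\ i -> remainder (x i)) - log Z ∣ ≤ e)
   near (N , h) = N , \ n le -> abs-cong (+ʳ (log-product n) & by 2 \ p z -> :- p :- z := :- (p :+ z)) & abs-neg _ ~> bound {∏ᵣ n (\ i -> 1# - x i)} (∏ᵣ>0 n 1-x>0) (abs-cong (+ʳ (*ʳ (sym (P≈ n)))) ~> h n le)
    where
    bound : ∀ {p} -> 0# < p -> ∣ p * Z - 1# ∣ ≤ e′ -> ∣ log p + log Z ∣ ≤ e
    bound {p} hp close = abs-cong (sym (log-* hp 0<Z)) ~> abs-≤
     (log-≤ 0<q >> ≤abs _ >> close >> x≤x+y (<≤ 0<e′) >> by 1 (\ q -> q :+ q := con 2 :* q) ~> 2e′)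
     (neg-mono (≤-log 0<q) >> lin inverse≤ (by 2 \ r e -> :- (:1 :- r) :+ (:1 :+ con 2 :* e) := r :+ con 2 :* e) >> 2e′ >> ≤-refl)
     where
     0<q = *>0 hp 0<Z
     inverse≤ : (p * Z) ⁻¹ ≤ 1# + # 2 * e′
     inverse≤ = ≤-resp (1* _) refl (/-≤ 0<q (lin (*≤ˡ (1# + # 2 * e′) (+≥0 0≤1 (*≥0 (#≥0 2) (<≤ 0<e′))) (-≤abs _ >> close) ⊞ *≤ˡ e′ (<≤ 0<e′) 2e′≤1)
      (by 2 \ q e -> :1 :+ ((:1 :+ con 2 :* e) :* e :+ e :* :1) := (:1 :+ con 2 :* e) :* :- (q :- :1) :+ e :* (con 2 :* e) :+ (:1 :+ con 2 :* e) :* q)))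

  -- The remainders at 1 + δ and at 1 differ by O(δ).
  remainders-close : ∀ n -> Σ n (\ i -> remainder (1/p i)) ≤ Σ n (\ i -> remainder (x i)) + # 12 * δ′
  remainders-close n = begin Σ n (\ i -> remainder (1/p i)) ≤⟨ Σ-mono′ n step ⟩
   Σ n (\ i -> remainder (x i) + # 4 * δ′ * (recip i * decay ½ i)) ≈⟨ Σ-+ n _ _ & +ˡ (Σ-* n _ _) ⟩
   Σ n (\ i -> remainder (x i)) + # 4 * δ′ * Σ n (\ i -> recip i * decay ½ i) ≤⟨ ≤-refl ⊞ *≤ˡ _ (*≥0 (#≥0 4) (<≤ 0<δ)) (decay-total 0<½ n >~ +ˡ (⁻¹⁻¹ (#>0 1))) ⟩
   Σ n (\ i -> remainder (x i)) + # 4 * δ′ * (1# + # 2) ≈⟨ +ˡ (by 1 \ d -> con 4 :* d :* (:1 :+ con 2) := con 12 :* d) ⟩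
   Σ n (\ i -> remainder (x i)) + # 12 * δ′ ∎
   where
   -- 1 - exp(-y) ≤ y and L ≤ 2 exp(L/2)
   step : ∀ i -> remainder (1/p i) ≤ remainder (x i) + # 4 * δ′ * (recip i * decay ½ i)
   step i = lin (remainder-increase (x≥0 i) (x≤ i) (primeRecip≤½ i) ⊞ main) (by 4 \ a b y z -> a :+ (y :+ z) := a :- b :+ y :+ (b :+ z))
    where
    r = 1/p i
    half-L : L i * recip i ≤ # 2 * decay ½ i
    half-L = begin L i * recip i ≈⟨ sym (1* _) & *ʳ (sym 2½) & by 4 (\ t h l r -> t :* h :* (l :* r) := t :* (h :* l :* r)) ⟩
     # 2 * (½ * L i * recip i) ≤⟨ *≤ˡ _ (#≥0 2) (*-mono (*≥0 (<≤ 0<½) (L≥0 i)) (x≤y+x 0≤1 >> 1+x≤exp _) (recip≥0 i) (≈⇒≤ (sym (exp-neg-L i)))) ⟩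
     # 2 * (exp (½ * L i) * exp (- L i)) ≈⟨ *ˡ (sym (exp-+ _ _) & exp-cong (+ˡ (-ᶜ (sym (half+half (L i)))) & by 2 \ h l -> h :* l :+ :- (l :* h :+ l :* h) := :- (h :* l))) ⟩
     # 2 * decay ½ i ∎
    -- The main term exp (- γ) / log x
    main : (r - x i) * (# 2 * r) ≤ # 4 * δ′ * (recip i * decay ½ i)
    main = begin (r - x i) * (# 2 * r) ≈⟨ by 2 (\ r d -> (r :- r :* d) :* (con 2 :* r) := con 2 :* (r :* r) :* (:1 :- d)) ⟩
     # 2 * (r * r) * (1# - decay δ′ i) ≤⟨ *-mono (*≥0 (#≥0 2) (sq≥0 r)) (*≤ˡ _ (#≥0 2) (*-mono (primeRecip≥0 i) (primeRecip≤recip i) (primeRecip≥0 i) (primeRecip≤recip i)))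
      (sub≥0 (decay≤1 i (<≤ 0<δ))) (lin (1+x≤exp (- (δ′ * L i))) (by 2 \ d e -> :1 :- e :+ e := :1 :+ :- d :+ d)) ⟩
     # 2 * (recip i * recip i) * (δ′ * L i) ≈⟨ by 3 (\ r d l -> con 2 :* (r :* r) :* (d :* l) := con 2 :* d :* r :* (l :* r)) ⟩
     # 2 * δ′ * recip i * (L i * recip i) ≤⟨ *≤ˡ _ (*≥0 (*≥0 (#≥0 2) (<≤ 0<δ)) (recip≥0 i)) half-L ⟩
     # 2 * δ′ * recip i * (# 2 * decay ½ i) ≈⟨ by 3 (\ r d l -> con 2 :* d :* r :* (con 2 :* l) := con 4 :* d :* (r :* l)) ⟩
     # 4 * δ′ * (recip i * decay ½ i) ∎

  remainders-mono : ∀ n -> Σ n (\ i -> remainder (x i)) ≤ Σ n (\ i -> remainder (1/p i))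
  remainders-mono n = Σ-mono′ n (\ i -> remainder-mono (x≥0 i) (x≤ i) (primeRecip≤½ i))

 -- The constant of Mertens

 open ℝᴮ using (_⟶ᴮ_)

 -- The limit of the gap; the aim is to identify it with a sum over primes.
 κ : ℝ
 κ = meisselMertens - γ

 part-mono : ∀ {i j} -> i N.≤ j -> part i N.≤ part j
 part-mono {i} le = floor-mono (L≥0 i) (L-mono le)

 -- A sum over the integers k, each weighted by w(i) for the first i with log (i + 1) ≥ k
 block-sum : ∀ (f : ℕ -> ℝ) {F F′} -> F N.≤ F′ -> Σ F′ f - Σ F f ≈ Σ (F′ N.∸ F) (\ r -> f (F N.+ r))
 block-sum f {F} {F′} le = +ʳ (reflexive (E.cong (\ n -> Σ n f) (E.sym (N.m+[n∸m]≡n le))) & Σ-split F (F′ N.∸ F) f) & by 2 (\ a b -> a :+ b :- a := b)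

 module AtParameter (δ′ : ℝ) (0<δ : 0# < δ′) (δ′≤1 : δ′ ≤ 1#) where
  open AtExponent δ′ 0<δ δ′≤1 public

  open Zχ using (Z)

  w : ℕ -> ℝ
  w = decay δ′

  w-0 : w 0 ≈ 1#
  w-0 = exp-cong (-ᶜ (*ˡ L-0) & by 1 \ d -> :- (d :* :0) := :0) & exp-0

  w-anti : ∀ i -> w (suc i) ≤ w i
  w-anti i = exp-mono (neg-mono (*≤ˡ δ′ (<≤ 0<δ) (L-mono (N.n≤1+n i))))

  1-w≤ : ∀ i -> 1# - w i ≤ δ′ * L i
  1-w≤ i = lin (1+x≤exp (- (δ′ * L i))) (by 2 \ d e -> :1 :- e :+ e := :1 :+ :- d :+ d)

  q₁ : ℝ
  q₁ = exp (- δ′)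

  q-power : ∀ k -> q₁ ^ k ≈ exp (- (δ′ * # k))
  q-power k = sym (exp-#* k (- δ′)) & exp-cong (by 2 \ k d -> k :* :- d := :- (d :* k))

  q<1 = <-resp refl exp-0 (exp-mono-< (lin< 0<δ (by 1 \ d -> :- d :+ d := :0 :+ :0)))

  -- The harmonic counterpart of the sum of 1/p^(1 + δ)
  Y : ℕ -> ℝ
  Y n = Σ n (\ i -> (harmonic (suc i) - harmonic i) * w (suc i))

  private
   block≤ : ∀ i -> (harmonic (suc i) - harmonic i) * w (suc i) ≤ logSum (part (suc i)) q₁ - logSum (part i) q₁
   block≤ i = *ʳ (block-sum recip (part-mono (N.n≤1+n i))) & *-comm _ _ & sym (Σ-* n _ _) ~> Σ-mono n (\ r lt -> *-comm _ _ ~> *≤ˡ _ (recip≥0 (part i N.+ r)) (term r lt)) >~ sym (block-sum _ (part-mono (N.n≤1+n i)))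
    where
    n = part (suc i) N.∸ part i
    term : ∀ r -> r N.< n -> w (suc i) ≤ q₁ ^ suc (part i N.+ r)
    term r lt = exp-mono (neg-mono (*≤ˡ δ′ (<≤ 0<δ) (#-mono {suc (part i N.+ r)} {part (suc i)}
     (E.subst (suc (part i N.+ r) N.≤_) (N.m+[n∸m]≡n (part-mono (N.n≤1+n i))) (N.+-monoʳ-< (part i) lt)) >> fst (part-spec (suc i))))) >~ sym (q-power (suc (part i N.+ r)))

   ≤block : ∀ i -> q₁ * (logSum (part (suc i)) q₁ - logSum (part i) q₁) ≤ (harmonic (suc i) - harmonic i) * w (suc i)
   ≤block i = *ˡ (block-sum _ (part-mono (N.n≤1+n i))) & sym (Σ-* n _ _) ~> Σ-mono′ n (\ r -> by 3 (\ q₁ r p -> q₁ :* (r :* p) := r :* (q₁ :* p)) ~> *≤ˡ _ (recip≥0 (part i N.+ r)) (term r) >~ *-comm _ _) >~ Σ-* n _ _ & *-comm _ _ & *ʳ (sym (block-sum recip (part-mono (N.n≤1+n i))))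
    where
    n = part (suc i) N.∸ part i
    term : ∀ r -> q₁ ^ suc (suc (part i N.+ r)) ≤ w (suc i)
    term r = q-power (suc (suc (part i N.+ r))) ~> exp-mono (neg-mono (*≤ˡ δ′ (<≤ 0<δ)
     (lin (<≤ (snd (part-spec i)) ⊞ δ≤1 i ⊞ #≥0 r) (+ˡ (+ˡ refl) & +ˡ (+ʳ refl) & sym (+ˡ (+ˡ (+ˡ (#-+ (part i) r))) & by 4 \ a b p r -> a :+ (b :- a :+ :0) :+ (:1 :+ (:1 :+ (p :+ r))) := b :+ (:1 :+ p :+ (:1 :+ r)))))))

  Y≤ : ∀ n -> Y n ≤ logSum (part n) q₁
  Y≤ zero = Σ≥0 (part 0) (\ k -> *≥0 (recip≥0 k) (^≥0 (suc k) (exp≥0 _)))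
  Y≤ (suc n) = (Y≤ n ⊞ block≤ n) >~ by 2 (\ a b -> a :+ (b :- a) := b)

  private
   part-0 = floor-unique 0 (≈⇒≤ (sym L-0)) (<-resp (sym L-0) (sym #-1) 0<1)

  ≤Y : ∀ n -> q₁ * logSum (part n) q₁ ≤ Y n
  ≤Y zero = ≈⇒≤ (*ˡ (reflexive (E.cong (\ K -> logSum K q₁) part-0)) & zeroʳ q₁)
  ≤Y (suc n) = by 3 (\ q₁ a b -> q₁ :* b := q₁ :* a :+ q₁ :* (b :- a)) ~> (≤Y n ⊞ ≤block n)

  -- -log(1 - exp(-δ)) is -log δ up to δ.
  log-q-upper = lin (log-mono (*>0 0<δ (exp>0 _)) 1-q≥ ⊞ ≈⇒≤ (sym (log-* 0<δ (exp>0 _) & +ˡ (log-exp (- δ′))))) (by 4 \ a d l m -> :- m :+ (m :+ a) := a :+ (l :+ :- d) :+ (:- l :+ d))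
   where
   1-q≥ = lin (*≤ʳ q₁ (exp≥0 _) (1+x≤exp δ′) ⊞ ≈⇒≤ (exp-inverse δ′)) (by 3 \ d q₁ e -> d :* q₁ :+ (e :* q₁ :+ :1) := (:1 :+ d) :* q₁ :+ e :* q₁ :+ (:1 :- q₁))

  log-q-lower = neg-mono (log-mono (sub>0 q<1) (lin (1+x≤exp (- δ′)) (by 2 \ d q₁ -> :1 :- q₁ :+ q₁ := :1 :+ :- d :+ d)))

  -- The logarithm series is summed up to any error by the first terms.
  logSum-limit : ∀ e -> 0# < e -> ∃[ N ] (∀ n -> N N.≤ n -> - log (1# - q₁) - e ≤ logSum (part n) q₁)
  logSum-limit e he = let (K₀ , lt) = archimedean (ρ q₁ / (δ′ * e)) ; (N , h) = part-grows K₀ in N , \ n le -> bound (part n) (<≤ lt >> #-mono (h n le))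
   where
   0≤ρ = ⁻¹≥0 (sub>0 q<1)
   bound : ∀ K -> ρ q₁ / (δ′ * e) ≤ # K -> - log (1# - q₁) - e ≤ logSum K q₁
   bound K big = lin (≤logSum K (exp≥0 _) q<1 ⊞ small) (by 4 \ l e s x -> l :- e :+ (s :+ x :+ e) := l :+ x :+ s)
    where
    ρ≤ = sym (/-cancel (*>0 0<δ he)) ~> *≤ʳ _ (*≥0 (<≤ 0<δ) (<≤ he)) big >> by 3 (\ k d e -> k :* (d :* e) := e :* (d :* k)) ~> *≤ˡ e (<≤ he) (x≤y+x 0≤1 >> 1+x≤exp _)
    small = *≤ʳ _ (*≥0 (^≥0 K (exp≥0 _)) 0≤ρ) (<≤ q<1) >> 1* _ ~> *≤ˡ _ (^≥0 K (exp≥0 _)) ρ≤ >~ *ʳ (q-power K) & by 3 (\ a e b -> a :* (e :* b) := e :* (b :* a)) & *ˡ (exp-inverse _) & *1 e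

  -- If the gap sums to κ up to error A, then κ is minus the sum of the remainders up to A and O(δ log(1/δ)).
  compare : ∀ {A} e -> 0# < e -> 0# ≤ - log δ′ -> ∀ N -> (∀ n -> N N.≤ n -> ∣ Σ n (\ i -> (gap (suc i) - gap i) * w (suc i)) - κ ∣ ≤ A) -> ∃[ N′ ] (∀ n -> N′ N.≤ n -> ∣ Σ (suc n) (\ i -> remainder (1/p i)) + κ ∣ ≤ A + # 2 * e + # 15 * δ′ + δ′ * - log δ′)
  compare {A} e he 0≤u N close = combine (log-euler e he) (logSum-limit e he)
   where
   u = - log δ′
   combine : ∃[ N₁ ] (∀ n -> N₁ N.≤ n -> ∣ Σ n x + Σ n (\ i -> remainder (x i)) - log Z ∣ ≤ e) -> ∃[ N₂ ] (∀ n -> N₂ N.≤ n -> - log (1# - q₁) - e ≤ logSum (part n) q₁) -> ∃[ N′ ] (∀ n -> N′ N.≤ n -> ∣ Σ (suc n) (\ i -> remainder (1/p i)) + κ ∣ ≤ A + # 2 * e + # 15 * δ′ + δ′ * u)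
   combine (N₁ , h₁) (N₂ , h₂) = N N.⊔ (N₁ N.⊔ N₂) , \ n le ->
    let n≥N = N.m⊔n≤o⇒m≤o N (N₁ N.⊔ N₂) le
        n≥ = N.m⊔n≤o⇒n≤o N (N₁ N.⊔ N₂) le
    in final n (close n n≥N) (h₁ (suc n) (N.m≤n⇒m≤1+n (N.m⊔n≤o⇒m≤o N₁ N₂ n≥))) (h₂ n (N.m⊔n≤o⇒n≤o N₁ N₂ n≥))
    where
    final : ∀ n -> ∣ Σ n (\ i -> (gap (suc i) - gap i) * w (suc i)) - κ ∣ ≤ A -> ∣ (Σ (suc n) x + Σ (suc n) (\ i -> remainder (x i))) - log Z ∣ ≤ e -> - log (1# - q₁) - e ≤ logSum (part n) q₁ -> ∣ Σ (suc n) (\ i -> remainder (1/p i)) + κ ∣ ≤ A + # 2 * e + # 15 * δ′ + δ′ * u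
    final n hA hB hC = abs-≤
     (lin (remainders-close (suc n) ⊞ -≤abs _ >> abs-cong (+ʳ (sym gap-sum)) ~> hA ⊞ ≤abs _ >> hB ⊞ log-Z-upper ⊞ Y-lower ⊞ *≥0 (#≥0 2) (<≤ 0<δ))
      (by 11 (\ T T′ X Y κ Z l d A e du -> T :+ κ :+ (T′ :+ con 12 :* d :+ (A :+ (e :+ (l :+ d :+ (Y :+ con 2 :* d))))) := T :+ (:- (X :- Y :- κ) :+ (X :+ T′ :- Z :+ (Z :+ (l :- du :- e :+ :0)))) :+ (A :+ con 2 :* e :+ con 15 :* d :+ du)) {_}
       {T₀} {T′} {X} {Yn} {κ} {log Z} {u} {δ′} {A} {e} {δ′ * u}))
     (lin (remainders-mono (suc n) ⊞ ≤abs _ >> abs-cong (+ʳ (sym gap-sum)) ~> hA ⊞ -≤abs _ >> hB ⊞ log-Z-lower ⊞ Y-upper ⊞ rest)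
      (by 11 (\ T T′ X Y κ Z l d A e du -> :- (T :+ κ) :+ (T :+ (A :+ (e :+ (Z :+ (l :+ d :+ (e :+ con 14 :* d :+ du)))))) := T′ :+ (X :- Y :- κ :+ (:- (X :+ T′ :- Z) :+ (l :+ (Y :+ :0)))) :+ (A :+ con 2 :* e :+ con 15 :* d :+ du)) {_}
       {T₀} {T′} {X} {Yn} {κ} {log Z} {u} {δ′} {A} {e} {δ′ * u}))
     where
     T₀ = Σ (suc n) (\ i -> remainder (1/p i))
     T′ = Σ (suc n) (\ i -> remainder (x i))
     X = Σ (suc n) x
     Yn = Y n
     rest = +≥0 (+≥0 (<≤ he) (*≥0 (#≥0 14) (<≤ 0<δ))) (*≥0 (<≤ 0<δ) 0≤u)
     gap-sum : Σ n (\ i -> (gap (suc i) - gap i) * w (suc i)) ≈ X - Yn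
     gap-sum = Σ-cong′ n (\ i -> by 5 (\ s r h h′ w -> (s :+ r :- h′ :- (s :- h)) :* w := r :* w :- (h′ :- h) :* w) {_} {recipSum i} {1/p (suc i)} {harmonic i} {harmonic (suc i)} {w (suc i)}) & Σ-sub n _ _ & +ʳ (sym (Σ-front n x & +ʳ (zeroˡ (w 0)) & 0+ _))
     Y-upper = Y≤ n >> logSum≤ (part n) (exp≥0 _) q<1 >> log-q-upper
     Y-lower = lin (*≤ʳ u 0≤u (1+x≤exp (- δ′)) ⊞ *≤ˡ q₁ (exp≥0 _) log-q-lower ⊞ *≤ˡ q₁ (exp≥0 _) hC ⊞ *≤ʳ e (<≤ he) (<≤ q<1))
      (by 6 \ u d e q₁ l s -> u :- d :* u :- e :+ (q₁ :* u :+ (q₁ :* l :+ (q₁ :* s :+ :1 :* e))) := (:1 :+ :- d) :* u :+ (q₁ :* u :+ (q₁ :* (l :- e) :+ q₁ :* e)) :+ q₁ :* s) >> ≤Y n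

 -- u exp(-u) is arbitrarily small.
 small-exp : ∀ {c} -> 0# < c -> ∃[ n ] (exp (- # (suc n)) * # (suc n) ≤ c)
 small-exp {c} hc = let (n , lt) = archimedean⁻¹ (/>0 hc (#>0 3)) in n , bound (suc n) (#>0 n) (<≤ lt)
  where
  bound : ∀ m -> 0# < # m -> # m ⁻¹ ≤ c / # 4 -> exp (- # m) * # m ≤ c
  bound m hm le = begin exp (- u) * u ≈⟨ sym (*1 _) & *ˡ (sym (inv hm)) & by 3 (\ e u i -> e :* u :* (u :* i) := e :* (u :* u) :* i) ⟩
   exp (- u) * (u * u) * u ⁻¹ ≤⟨ *-mono (*≥0 (exp≥0 _) (sq≥0 u)) (*≤ˡ _ (exp≥0 _) uu≤) (⁻¹≥0 hm) le ⟩
   exp (- u) * (# 4 * exp u) * (c / # 4) ≈⟨ by 4 (\ a f b q₁ -> a :* (f :* b) :* q₁ := b :* a :* (q₁ :* f)) & *-cong (exp-inverse u) (/-cancel (#>0 3)) & 1* c ⟩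
   c ∎
   where
   u = # m
   h = u * ½
   half≤ = x≤y+x 0≤1 >> 1+x≤exp h
   0≤h = <≤ (half>0 hm)
   uu≤ = *-cong (sym (half+half u)) (sym (half+half u)) & by 1 (\ h -> (h :+ h) :* (h :+ h) := con 4 :* (h :* h)) ~> *≤ˡ _ (#≥0 4) (*-mono 0≤h half≤ 0≤h half≤ >~ sym (exp-+ h h) & exp-cong (half+half u))

 remainder-sum : (\ n -> Σ n (\ i -> remainder (1/p i))) ⟶ᴮ - κ
 remainder-sum e he = use-abelian (abelian gap-limit gap-0 e′ 0<e′)
  where
  e′ = e / # 5
  0<e′ = />0 he (#>0 4)
  use-abelian : ∃[ I ] ∃[ G ] (0# ≤ G × (∀ (w : ℕ -> ℝ) -> w 0 ≈ 1# -> (∀ i -> 0# ≤ w i) -> (∀ i -> w (suc i) ≤ w i) -> ∀ n -> I N.≤ n -> ∣ Σ n (\ i -> (gap (suc i) - gap i) * w (suc i)) - κ ∣ ≤ # 2 * e′ + G * (1# - w I))) -> ∃[ N ] (∀ n -> N N.≤ n -> ∣ Σ n (\ i -> remainder (1/p i)) - - κ ∣ ≤ e)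
  use-abelian (I , G , 0≤G , bound) = choose (small-exp (/>0 0<e′ 0<C))
   where
   C = G * L I + # 16
   0<C = +≥> (*≥0 0≤G (L≥0 I)) (#>0 15)
   choose : ∃[ n ] (exp (- # (suc n)) * # (suc n) ≤ e′ / C) -> ∃[ N ] (∀ n -> N N.≤ n -> ∣ Σ n (\ i -> remainder (1/p i)) - - κ ∣ ≤ e)
   choose (m , small) = shift (compare e′ 0<e′ (#≥0 (suc m) >~ sym -log) I (\ n le -> bound w w-0 (\ i -> decay≥0 δ′ i) w-anti n le))
    where
    u = # (suc m)
    δ′ = exp (- u)
    δ′≤1 = exp-mono (lin (#≥0 (suc m)) (by 1 \ u -> :- u :+ u := :0 :+ :0)) >~ exp-0
    open AtParameter δ′ (exp>0 _) δ′≤1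
    -log = -ᶜ (log-exp (- u)) & by 1 (\ u -> :- (:- u) := u)
    total = begin # 2 * e′ + G * (1# - w I) + # 2 * e′ + # 15 * δ′ + δ′ * - log δ′ ≤⟨ lin (*≤ˡ G 0≤G (1-w≤ I) ⊞ *≤ˡ (δ′ * (G * L I + # 15)) (*≥0 (exp≥0 _) (+≥0 (*≥0 0≤G (L≥0 I)) (#≥0 15))) (1≤# m) ⊞ ≈⇒≤ (*ˡ {δ′} -log))
     (by 7 (\ e a g d l ln u -> con 2 :* e :+ a :+ con 2 :* e :+ con 15 :* d :+ ln :+ (g :* (d :* l) :+ (d :* (g :* l :+ con 15) :* u :+ d :* u)) := a :+ (d :* (g :* l :+ con 15) :* :1 :+ ln) :+ (con 4 :* e :+ d :* u :* (g :* l :+ con 16))) {_} {e′} {G * (1# - w I)} {G} {δ′} {L I} {δ′ * - log δ′} {u}) ⟩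
     # 4 * e′ + δ′ * u * C ≤⟨ ≤-refl ⊞ *≤ʳ C (<≤ 0<C) small >~ /-cancel 0<C ⟩
     # 4 * e′ + e′ ≈⟨ by 1 (\ e -> con 4 :* e :+ e := e :* con 5) & /-cancel (#>0 4) ⟩
     e ∎
    shift : ∃[ N ] (∀ n -> N N.≤ n -> ∣ Σ (suc n) (\ i -> remainder (1/p i)) + κ ∣ ≤ # 2 * e′ + G * (1# - w I) + # 2 * e′ + # 15 * δ′ + δ′ * - log δ′) -> ∃[ N ] (∀ n -> N N.≤ n -> ∣ Σ n (\ i -> remainder (1/p i)) - - κ ∣ ≤ e)
    shift (N , h) = suc N , \ where
     (suc n) (N.s≤s le) -> abs-cong (+ˡ (by 1 \ k -> :- (:- k) := k)) ~> h n le >> total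

 -- The summand of M at a prime, and 0 otherwise
 M-summand : ∀ i -> atPrime 0# (\ p -> log (1# - 1# / # p) + 1# / # p) i ≈ - remainder (1/p i)
 M-summand zero = by 0 (:0 := :- :0) & -ᶜ (sym (remainder-0 refl))
 M-summand (suc i) = go (isPrime (suc (suc i)))
  where
  p = # (suc (suc i))
  r = recip (suc i)
  r<1 = ≤-<-trans (recip-mono {1} {suc i} (N.s≤s N.z≤n)) ½<1
  go : ∀ b -> (if b then log (1# - 1# / p) + 1# / p else 0#) ≈ - remainder (if b then r else 0#)
  go true = +-cong (log-cong (<-resp refl (+ˡ (-ᶜ (sym (1* r)))) (sub>0 r<1)) (+ˡ (-ᶜ (1* r)))) (1* r) & by 2 (\ l r -> l :+ r := :- (:- l :- r))
  go false = by 0 (:0 := :- :0) & -ᶜ (sym (remainder-0 refl))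

 M≈ : M ≈ meisselMertens
 M≈ = +-cong γᴱ≈γ (lim-unique limit) & by 2 (\ g c -> g :+ (c :- g) := c)
  where
  limit : (\ n -> ∑ (primesUpTo n) (\ p -> log (1# - 1# / # p) + 1# / # p)) ⟶ᴮ κ
  limit e he = go (remainder-sum e he)
   where
   go : ∃[ N ] (∀ n -> N N.≤ n -> ∣ Σ n (\ i -> remainder (1/p i)) - - κ ∣ ≤ e) -> ∃[ N ] (∀ n -> N N.≤ n -> ∣ ∑ (primesUpTo n) (\ p -> log (1# - 1# / # p) + 1# / # p) - κ ∣ ≤ e)
   go (N , h) = N , \ n le -> abs-cong (+ʳ (∑-primes n _ & Σ-cong′ n M-summand & Σ-neg n _) & by 2 \ s k -> :- s :- k := :- (s :- :- k)) & abs-neg _ ~> h n le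

 -- The product over the primes

 -- The quantities of the theorem
 reciprocals product discrepancy : ℝ -> ℝ
 reciprocals x = ∑ (primes≤ x) (\ p -> 1# / # p)
 product x = ∏ (primes≤ x) (\ p -> 1# - 1# / # p)
 discrepancy x = reciprocals x - log (log x) - M

 -- Sum of -log(1 - 1/p) - 1/p over the primes p > n
 tailRemainder : ℕ -> ℝ
 tailRemainder n = - κ - Σ n (\ i -> remainder (1/p i))

 remainder≥0 : ∀ i -> 0# ≤ remainder (1/p i)
 remainder≥0 i = sym (remainder-0 refl) ~> remainder-mono ≤-refl (primeRecip≥0 i) (primeRecip≤½ i)

 tailRemainder≥0 : ∀ n -> 0# ≤ tailRemainder n
 tailRemainder≥0 n = sub≥0 (lim-≤ {\ k -> Σ k (\ i -> remainder (1/p i))} n remainder-sum (\ k le -> Σ-length-mono remainder≥0 le))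

 tailRemainder-≤ : ∀ n {c} -> (∀ k -> Σ k (\ r -> remainder (1/p (n N.+ r))) ≤ c) -> tailRemainder n ≤ c
 tailRemainder-≤ n {c} h = lin (≤-lim {\ k -> Σ k (\ i -> remainder (1/p i))} n remainder-sum (\ k le -> reflexive (E.cong (\ j -> Σ j (\ i -> remainder (1/p i))) (E.sym (N.m+[n∸m]≡n le))) & Σ-split n (k N.∸ n) _ ~> +-monoʳ-≤ _ (h (k N.∸ n))))
  (by 3 \ k s c -> :- k :- s :+ (s :+ c) := :- k :+ c)

 reciprocals≈ : ∀ x -> reciprocals x ≈ Σ ⌊ x ⌋ 1/p
 reciprocals≈ x = ∑-primes ⌊ x ⌋ _ & Σ-cong′ ⌊ x ⌋ (\ i -> go (isPrime (suc i)) i)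
  where go : ∀ b i -> (if b then 1# / # (suc i) else 0#) ≈ (if b then recip i else 0#)
        go true i = 1* _
        go false i = refl

 product≈ : ∀ x -> product x ≈ ∏ᵣ ⌊ x ⌋ (\ i -> 1# - 1/p i)
 product≈ x = ∏-primes ⌊ x ⌋ _ & go′ ⌊ x ⌋
  where go : ∀ b i -> (if b then 1# - 1# / # (suc i) else 1#) ≈ 1# - (if b then recip i else 0#)
        go true i = +ˡ (-ᶜ (1* _))
        go false i = by 0 (:1 := :1 :- :0)
        go′ : ∀ n -> ∏ᵣ n (atPrime 1# (\ p -> 1# - 1# / # p)) ≈ ∏ᵣ n (\ i -> 1# - 1/p i)
        go′ zero = refl
        go′ (suc n) = *-cong (go′ n) (go (isPrime (suc n)) n)

 -- The product in terms of the discrepancy of the sum of reciprocals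
 product-formula : ∀ {x} -> 0# < log x -> product x ≈ exp (- γᴱ) / log x * exp (tailRemainder ⌊ x ⌋ - discrepancy x)
 product-formula {x} 0<log = begin-equality product x ≈⟨ product≈ x & sym (exp-log (∏ᵣ>0 n positive)) ⟩
  exp (log (∏ᵣ n (\ i -> 1# - 1/p i))) ≈⟨ exp-cong exponent ⟩
  exp (- γᴱ + - log (log x) + (tailRemainder n - discrepancy x)) ≈⟨ exp-+ _ _ & *ʳ (exp-+ _ _ & *ˡ (exp-neg _ & ⁻¹-cong (exp-log 0<log))) ⟩
  exp (- γᴱ) / log x * exp (tailRemainder n - discrepancy x) ∎
  where
  n = ⌊ x ⌋
  positive : ∀ i -> 0# < 1# - 1/p i
  positive i = sub>0 (≤-<-trans (primeRecip≤½ i) ½<1)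
  exponent : log (∏ᵣ n (\ i -> 1# - 1/p i)) ≈ - γᴱ + - log (log x) + (tailRemainder n - discrepancy x)
  exponent = begin-equality log (∏ᵣ n (\ i -> 1# - 1/p i)) ≈⟨ log-∏ᵣ n positive ⟩
   Σ n (\ i -> log (1# - 1/p i)) ≈⟨ Σ-cong′ n (\ i -> by 2 \ l r -> l := :- (:- l :- r) :- r) & Σ-sub n _ _ & +ʳ (Σ-neg n _) ⟩
   - Σ n (\ i -> remainder (1/p i)) - Σ n 1/p ≈⟨ by 5 (\ R s c g l -> :- R :- s := :- g :+ :- l :+ (:- (c :- g) :- R :- (s :- l :- c))) ⟩
   - γ + - log (log x) + (tailRemainder n - (Σ n 1/p - log (log x) - meisselMertens)) ≈⟨ +-cong (+ʳ (-ᶜ (sym γᴱ≈γ))) (+ˡ (-ᶜ (+-cong (+ʳ (sym (reciprocals≈ x))) (-ᶜ (sym M≈))))) ⟩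
   - γᴱ + - log (log x) + (tailRemainder n - discrepancy x) ∎

 -- The integer part of x ≥ 2, and its logarithm
 module Floor {x : ℝ} (2≤x : # 2 ≤ x) where

  0<x = <-≤-trans (#>0 1) 2≤x

  1<x = <-≤-trans (lin< 0<1 (by 0 (:1 :+ :1 := :0 :+ con 2))) 2≤x

  0<log = log>0 1<x

  -- Indices are shifted by one, so that X + 1 is the integer part of x.
  X : ℕ
  X = N.pred ⌊ x ⌋

  private
   spec = floor-spec (<≤ 0<x)
   2≤⌊x⌋ = N.≤-pred (#-cancel-< {2} {suc ⌊ x ⌋} (≤-<-trans 2≤x (snd spec)))
   pred-suc : ∀ n -> 2 N.≤ n -> n ≡ suc (N.pred n)
   pred-suc (suc n) _ = ok

  floor≡ = pred-suc ⌊ x ⌋ 2≤⌊x⌋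

  1≤X = N.≤-pred (E.subst (2 N.≤_) floor≡ 2≤⌊x⌋)

  X≤x = E.subst (\ n -> # n ≤ x) floor≡ (fst spec)

  x<X = E.subst (\ n -> x < # (suc n)) floor≡ (snd spec)

  LX≤ = log-mono (#>0 X) X≤x

  ≤LX = log-mono 0<x (<≤ x<X)

  0<LX = <-≤-trans (log>0 (<-≤-trans (lin< 0<1 (by 0 (:1 :+ :1 := :0 :+ con 2))) (#-mono {2} {2} N.≤-refl))) (L-mono 1≤X)

 ^-ratio : ∀ ℓ {a b c} -> 0# < a -> 0# < b -> b ≤ c * a -> a ⁻¹ ^ ℓ ≤ c ^ ℓ / b ^ ℓ
 ^-ratio ℓ {a} {b} {c} ha hb h = ^-mono ℓ (⁻¹≥0 ha) (≤-/ hb (*≤ˡ _ (⁻¹≥0 ha) h >~ by 3 (\ i c a -> i :* (c :* a) := c :* (a :* i)) & *ˡ (inv ha) & *1 c)) >~ ^-distrib-* c (b ⁻¹) ℓ & *ˡ (⁻¹-^ ℓ hb)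

 module Discrepancy (ℓ : ℕ) where

  -- Powers of log n are dominated by n.
  B : ℝ
  B = expBound ℓ 1#

  0<B = expBound>0 ℓ 0<1

  exp-power : ∀ {u} -> 0# < u -> exp (- u) ≤ B * u ⁻¹ ^ ℓ
  exp-power {u} hu = ≤-/ (^>0 ℓ hu) (*≤ˡ _ (exp≥0 _) (^-mono ℓ (<≤ hu) (x≤y+x 0≤1) >> power≤exp ℓ 0<1 (<≤ hu)) >~ *ˡ (*ˡ (exp-cong (1* u))) & by 3 (\ a b e -> a :* (b :* e) := b :* (e :* a)) & *ˡ (exp-inverse u) & *1 B) >~ *ˡ (sym (⁻¹-^ ℓ hu))

  private
   -- Constants for x beyond and below the range of the bound for the deviation
   largeᶜ smallᶜ : ℝ
   largeᶜ = (tailᶜ ℓ + B) * # 2 ^ ℓ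
   smallᶜ = (# 2 + S₁ + (∣ log (L 1) ∣ + ∣ log (S₁ + 1#) ∣) + ∣ M ∣) * (S₁ + 1#) ^ ℓ

   0<S₁+1 = +>≥ 0<S₁ 0≤1

   0≤largeᶜ = *≥0 (+≥0 (0≤tailᶜ ℓ) (<≤ 0<B)) (^≥0 ℓ (#≥0 2))

   0≤part : 0# ≤ # 2 + S₁ + (∣ log (L 1) ∣ + ∣ log (S₁ + 1#) ∣) + ∣ M ∣
   0≤part = +≥0 (+≥0 (+≥0 (#≥0 2) (<≤ 0<S₁)) (+≥0 (0≤abs _) (0≤abs _))) (0≤abs _)

   0≤smallᶜ = *≥0 0≤part (^≥0 ℓ (<≤ 0<S₁+1))

  bound : ℝ
  bound = largeᶜ + smallᶜ + 1#

  bound>0 = +≥> (+≥0 0≤largeᶜ 0≤smallᶜ) 0<1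

  module _ {x : ℝ} (2≤x : # 2 ≤ x) where
   open Floor 2≤x
   private
    0<logℓ = ^>0 ℓ 0<log

    discrepancy≈ = +-cong (+ʳ (reciprocals≈ x & reflexive (E.cong (\ n -> Σ n 1/p) floor≡))) (-ᶜ M≈) & by 4 (\ s l m c -> s :- m :- c := s :- l :- c :+ (l :- m)) {_} {recipSum X} {log (L X)} {log (log x)} {meisselMertens}

    large : S₁ ≤ L X -> ∣ discrepancy x ∣ ≤ largeᶜ / log x ^ ℓ
    large big = begin ∣ discrepancy x ∣ ≤⟨ abs-cong discrepancy≈ ~> abs-+ _ _ ⟩
     ∣ deviation X - meisselMertens ∣ + ∣ log (L X) - log (log x) ∣ ≤⟨ deviation-bound ℓ {X} big ⊞ abs-sub _ _ & abs≥0 (sub≥0 (log-mono 0<LX LX≤)) ~> second ⟩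
     tailᶜ ℓ * L X ⁻¹ ^ ℓ + B * L X ⁻¹ ^ ℓ ≈⟨ sym (distribʳ _ _ _) ⟩
     (tailᶜ ℓ + B) * L X ⁻¹ ^ ℓ ≤⟨ *≤ˡ _ (+≥0 (0≤tailᶜ ℓ) (<≤ 0<B)) (^-ratio ℓ {c = # 2} 0<LX 0<log log≤2LX) ⟩
     (tailᶜ ℓ + B) * (# 2 ^ ℓ / log x ^ ℓ) ≈⟨ sym (*-assoc _ _ _) ⟩
     largeᶜ / log x ^ ℓ ∎
     where
     1≤LX = 1≤# 8 >> x≤x+y (*≥0 (#≥0 2) (⁻¹≥0 0<t₀)) >> big
     log≤2LX = lin (≤LX ⊞ δ≤1 X ⊞ 1≤LX) (by 3 \ a b l -> a :+ (b :+ (:1 :+ l)) := a :+ (b :- l :+ :1) :+ con 2 :* l)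
     second = sym (log-/ 0<log 0<LX) ~> log-≤ (/>0 0<log 0<LX) >> ratio >> exp-power 0<LX
      where
      ratio = lin (/-≤ {z = exp (- L X) + 1#} 0<LX (lin (≤LX ⊞ δ≤recip X ⊞ *≤ˡ (recip X) (recip≥0 X) 1≤LX ⊞ ≈⇒≤ (*ʳ (sym (exp-neg-L X)))) (by 5 \ x a l r e -> x :+ (a :+ (r :+ (r :* l :+ e :* l))) := x :+ (a :- l :+ (r :* :1 :+ r :* l)) :+ (e :+ :1) :* l))) (by 2 \ a e -> a :- :1 :+ (e :+ :1) := a :+ e) >> ≤-refl

    small : L X ≤ S₁ -> ∣ discrepancy x ∣ ≤ smallᶜ / log x ^ ℓ
    small le = ≤-/ 0<logℓ (*-mono (0≤abs _) crude (^≥0 ℓ (<≤ 0<log)) (^-mono ℓ (<≤ 0<log) log≤))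
     where
     log≤ = lin (≤LX ⊞ δ≤1 X ⊞ le) (by 4 \ x a l s -> x :+ (a :+ (:1 :+ s)) := x :+ (a :- l :+ l) :+ (s :+ :1))
     sum≤ = reciprocals≈ x & reflexive (E.cong (\ n -> Σ n 1/p) floor≡) ~> Σ-mono′ (suc X) primeRecip≤recip >> harmonic≤ X >> +-monoʳ-≤ 1# le >> lin 0≤1 (by 1 \ s -> :1 :+ s :+ :1 := :0 :+ (con 2 :+ s))
     sum≥ = Σ≥0 ⌊ x ⌋ primeRecip≥0 >~ sym (reciprocals≈ x)
     0<L1 = log>0 (lin< 0<1 (by 0 (:1 :+ :1 := :0 :+ con 2)))
     loglog = abs-≤ (log-mono 0<log log≤ >> ≤abs _ >> x≤y+x (0≤abs _)) (neg-mono (log-mono 0<L1 (L-mono 1≤X >> LX≤)) >> -≤abs _ >> x≤x+y (0≤abs _))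
     crude = abs-+ _ _ >> (abs-+ _ _ >> (abs≥0 sum≥ ~> sum≤ ⊞ abs-neg _ ~> loglog) ⊞ ≈⇒≤ (abs-neg _))

   -- The prime number theorem in the form of Mertens: the discrepancy is smaller than any power of 1/log x.
   discrepancy-bound = [ (\ h -> small h >> /-mono 0<logℓ (x≤y+x 0≤largeᶜ >> x≤x+y 0≤1)) , (\ h -> large (<≤ h) >> /-mono 0<logℓ (x≤x+y 0≤smallᶜ >> x≤x+y 0≤1)) ]′ (≤-or-> (L X) S₁)

   -- The tail of the remainders is also smaller than any power of 1/log x.
   tail-crude = begin tailRemainder ⌊ x ⌋ ≡⟨ E.cong tailRemainder floor≡ ⟩
    tailRemainder (suc X) ≤⟨ tailRemainder-≤ (suc X) {# 2 * recip X} (\ k -> Σ-mono′ k (\ r -> term (suc X N.+ r)) >> Σ-* k _ _ ~> *≤ˡ _ (#≥0 2) (decay-sum 0<1 X k >~ *-cong (exp-cong (-ᶜ (1* _))) 1⁻¹ & *1 _ & exp-neg-L X)) ⟩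
    # 2 * recip X ≤⟨ *≤ˡ _ (#≥0 2) (≤-/ 0<x (*≤ˡ _ (recip≥0 X) x≤ >~ by 2 (\ r n -> r :* (con 2 :* n) := con 2 :* (n :* r)) & *ˡ (suc*recip X) & *1 _) >> ≤-refl) ⟩
    # 2 * (# 2 / x) ≈⟨ by 1 (\ i -> con 2 :* (con 2 :* i) := con 4 :* i) & *ˡ (⁻¹-cong (sym (exp-log 0<x)) & sym (exp-neg _)) ⟩
    # 4 * exp (- log x) ≤⟨ *≤ˡ _ (#≥0 4) (exp-power 0<log >~ *ˡ (⁻¹-^ ℓ 0<log)) ⟩
    # 4 * (B / log x ^ ℓ) ≈⟨ sym (*-assoc _ _ _) ⟩
    # 4 * B / log x ^ ℓ ∎
    where
    x≤ = <≤ x<X >> lin (#≥0 X) (by 1 \ n -> :1 :+ (:1 :+ n) :+ n := :0 :+ con 2 :* (:1 :+ n))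
    term : ∀ i -> remainder (1/p i) ≤ # 2 * (recip i * decay 1# i)
    term i = lin (remainder-increase ≤-refl (primeRecip≥0 i) (primeRecip≤½ i) ⊞ ≈⇒≤ (remainder-0 refl)) (by 3 \ a b r -> a :+ ((r :- :0) :* (con 2 :* r) :+ :0) := a :- b :+ b :+ con 2 :* (r :* r)) >>
     *≤ˡ _ (#≥0 2) (*-mono (primeRecip≥0 i) (primeRecip≤recip i) (primeRecip≥0 i) (primeRecip≤recip i >~ sym (exp-neg-L i) & exp-cong (-ᶜ (sym (1* _)))))

 -- The tail of the product

 -- s ≤ sinh s
 -- The hyperbolic sine is at least doubled when its argument is doubled.
 sinh-step : ∀ n {s} -> 0# ≤ s -> # 2 * s - s * s * ½ ^ n ≤ exp s - exp (- s)
 sinh-step zero {s} hs = lin (1+x≤exp s ⊞ exp-neg-upper hs) (by 3 \ s a b -> con 2 :* s :- s :* s :* :1 :+ (a :+ (:1 :- s :+ s :* s)) := :1 :+ s :+ b :+ (a :- b))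
 sinh-step (suc n) {s} hs = begin # 2 * s - s * s * (½ * ½ ^ n) ≈⟨ double s (half+half s) ⟩
  # 2 * (# 2 * h - h * h * ½ ^ n) ≤⟨ *≤ˡ _ (#≥0 2) (sinh-step n 0≤h) ⟩
  # 2 * (a - b) ≤⟨ lin (*≤ʳ (a - b) (sub≥0 b≤a) a+b≥2) (by 2 \ a b -> con 2 :* (a :- b) :+ (a :+ b) :* (a :- b) := con 2 :* (a :- b) :+ (a :* a :- b :* b)) ⟩
  a * a - b * b ≈⟨ +-cong (sym (exp-+ h h) & exp-cong (half+half s)) (-ᶜ (sym (exp-+ _ _) & exp-cong (by 1 (\ h -> :- h :+ :- h := :- (h :+ h)) & -ᶜ (half+half s)))) ⟩
  exp s - exp (- s) ∎
  where
  h = s * ½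
  a = exp h
  b = exp (- h)
  0≤h = *≥0 hs (<≤ 0<½)
  b≤a = exp-mono (lin (0≤h ⊞ 0≤h) (by 1 \ h -> :- h :+ (h :+ h) := :0 :+ :0 :+ h))
  a+b≥2 = lin (1+x≤exp h ⊞ 1+x≤exp (- h)) (by 3 \ h a b -> con 2 :+ (a :+ b) := :1 :+ h :+ (:1 :+ :- h) :+ (a :+ b))
  double : ∀ s -> h + h ≈ s -> # 2 * s - s * s * (½ * ½ ^ n) ≈ # 2 * (# 2 * h - h * h * ½ ^ n)
  double s e = +-cong (*ˡ (sym e)) (-ᶜ (*ʳ (*-cong (sym e) (sym e)))) & by 3 (\ h i p -> con 2 :* (h :+ h) :- (h :+ h) :* (h :+ h) :* (i :* p) := con 2 :* (con 2 :* h :- h :* h :* (p :* (con 2 :* i)))) & *ˡ (+ˡ (-ᶜ (*ˡ (*ˡ 2½ & *1 _))))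

 sinh-bound : ∀ {s} -> 0# ≤ s -> # 2 * s ≤ exp s - exp (- s)
 sinh-bound {s} hs = ≤-limit \ e he -> let (n , lt) = archimedean (s * s / e) in
  lin (sinh-step n hs ⊞ small e he n (<≤ lt)) (by 4 \ s d q e -> s :+ (d :+ e) := s :- q :+ q :+ (d :+ e))
  where
  small : ∀ e -> 0# < e -> ∀ n -> s * s / e ≤ # n -> s * s * ½ ^ n ≤ e
  small e he n le = begin s * s * ½ ^ n ≤⟨ *≤ʳ _ (^≥0 n (<≤ 0<½)) (sym (/-cancel he) ~> *≤ʳ e (<≤ he) (le >> n≤2ⁿ)) ⟩
   # 2 ^ n * e * ½ ^ n ≈⟨ by 3 (\ a e b -> a :* e :* b := a :* b :* e) & *ʳ (sym (^-distrib-* (# 2) ½ n) & ^-congˡ n 2½ & 1^ n) & 1* e ⟩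
   e ∎
   where
   n≤2ⁿ = x≤y+x 0≤1 >> +ˡ (sym (*1 _)) ~> bernoulli n (lin (0≤1 ⊞ 0≤1) (by 0 (:- :1 :+ (:1 :+ :1) := :0 :+ :0 :+ :1))) >~ ^-congˡ n (by 0 (:1 :+ :1 := con 2))

 -- -log(1 - 1/p) - 1/p ≤ 1/(2p(p - 1))
 remainder-recip : ∀ j -> remainder (recip (suc j)) ≤ ½ * (recip (suc j) * recip j)
 remainder-recip j = *-cancelˡ-≤ (# 2) (#>0 1) (begin # 2 * (- log (1# - r) - r) ≈⟨ *ˡ (+ʳ (sym s≈)) ⟩
  # 2 * (s - r) ≤⟨ lin (sinh-bound (δ≥0 j)) (by 4 \ s r a b -> con 2 :* (s :- r) :+ (a :- b) := con 2 :* s :+ (a :- b :- con 2 :* r)) ⟩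
  exp s - exp (- s) - # 2 * r ≈⟨ +ʳ (+-cong exp-s (-ᶜ exp-neg-s)) ⟩
  (1# + r') - (1# - r) - # 2 * r ≈⟨ by 2 (\ r r' -> :1 :+ r' :- (:1 :- r) :- con 2 :* r := r' :- r) ⟩
  r' - r ≈⟨ sym difference ⟩
  r * r' ≈⟨ sym (sym (*-assoc _ _ _) & *ʳ 2½ & 1* _) ⟩
  # 2 * (½ * (r * r')) ∎)
  where
  r = recip (suc j)
  r' = recip j
  s = δ j
  difference = sym (+-cong (sym (1* _) & *ʳ (sym (suc*recip (suc j)))) (-ᶜ (sym (1* _) & *ʳ (sym (suc*recip j)))) & by 3 \ n r r' -> (:1 :+ n) :* r :* r' :- n :* r' :* r := r :* r')
  exp-s = exp-+ _ _ & *-cong (exp-L (suc j)) (exp-neg-L j) & by 2 (\ n r -> (:1 :+ n) :* r := n :* r :+ r) & +ʳ (suc*recip j)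
  exp-neg-s = exp-cong (by 2 \ a b -> :- (a :- b) := b :+ :- a) & exp-+ _ _ & *-cong (exp-L j) (exp-neg-L (suc j)) & by 2 (\ n r -> n :* r := (:1 :+ n) :* r :- r) & +ʳ (suc*recip (suc j))
  s≈ = by 1 (\ s -> s := :- (:- s)) & -ᶜ (sym (log-exp (- s)) & log-cong (exp>0 _) exp-neg-s)

 -- Chebyshev's function at the integers
 θ : ℕ -> ℝ
 θ n = Σ n (\ i -> if isPrime (suc i) then L i else 0#)

 ϑ≈θ : ∀ n -> ϑ (# n) ≈ θ n
 ϑ≈θ n = reflexive (E.cong (\ m -> ∑ (primesUpTo m) (\ p -> log (# p))) (floor-unique n ≤-refl (lin< 0<1 (by 1 \ n -> n :+ :1 := :0 :+ (:1 :+ n))))) & ∑-primes n _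

 0<Z₁ : 0# < Z₁
 0<Z₁ = +>≥ 0<1 (*≥0 (#≥0 193378) (⁻¹≥0 (^>0 13 (#>0 9))))

 0≤Z₁ : 0# ≤ Z₁
 0≤Z₁ = <≤ 0<Z₁

 module _ (ϑ-bound : ∀ x -> 0# < x -> ϑ x < Z₁ * x) where

  θ≤ : ∀ n -> θ (suc n) ≤ Z₁ * # (suc n)
  θ≤ n = sym (ϑ≈θ (suc n)) ~> <≤ (ϑ-bound (# (suc n)) (#>0 n))

  module _ (X : ℕ) where
   private
    -- Partial summation with the weight 1/(2p(p - 1) log p) at p = j + 2
    W : ℕ -> ℝ
    W j = ½ * (recip (suc j) * recip j) * L (suc j) ⁻¹

    0<L : ∀ j -> 0# < L (suc j)
    0<L j = log>0 (<-≤-trans (lin< 0<1 (by 0 (:1 :+ :1 := :0 :+ con 2))) (#-mono {2} {suc (suc j)} (N.s≤s (N.s≤s N.z≤n))))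

    W≥0 : ∀ j -> 0# ≤ W j
    W≥0 j = *≥0 (*≥0 (<≤ 0<½) (*≥0 (recip≥0 (suc j)) (recip≥0 j))) (⁻¹≥0 (0<L j))

    W-anti : ∀ j -> W (suc j) ≤ W j
    W-anti j = *-mono (*≥0 (<≤ 0<½) (*≥0 (recip≥0 (suc (suc j))) (recip≥0 (suc j))))
     (*≤ˡ ½ (<≤ 0<½) (*-mono (recip≥0 (suc (suc j))) (recip-mono (N.n≤1+n (suc j))) (recip≥0 (suc j)) (recip-mono (N.n≤1+n j))))
     (⁻¹≥0 (0<L (suc j))) (⁻¹-anti (0<L j) (L-mono (N.n≤1+n (suc j))))

    D₁ : ℕ -> ℝ
    D₁ n = Z₁ * # n - θ n

    term≤ : ∀ j -> remainder (1/p (suc j)) ≤ (θ (suc (suc j)) - θ (suc j)) * W j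
    term≤ j = go (isPrime (suc (suc j)))
     where
     go : ∀ b -> remainder (if b then recip (suc j) else 0#) ≤ (θ (suc j) + (if b then L (suc j) else 0#) - θ (suc j)) * W j
     go true = remainder-recip j >~ sym (by 4 (\ t l h i -> (t :+ l :- t) :* (h :* i) := h :* (l :* i)) & *ˡ (inv (0<L j)) & *1 _)
     go false = ≈⇒≤ (remainder-0 refl & sym (by 2 \ t w -> (t :+ :0 :- t) :* w := :0))

    partial : ∀ k -> Σ k (\ r -> remainder (1/p (suc X N.+ r))) + D₁ (suc X N.+ k) * W (X N.+ k) ≤ Z₁ * Σ k (\ r -> W (X N.+ r)) + D₁ (suc X) * W X
    partial zero = ≈⇒≤ (+ˡ (reflexive (E.cong₂ (\ a b -> D₁ a * W b) (N.+-identityʳ (suc X)) (N.+-identityʳ X))) & by 2 \ z d -> :0 :+ d := z :* :0 :+ d)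
    partial (suc k) = +ˡ (reflexive (E.cong (\ a -> D₁ (suc a) * W a) (N.+-suc X k))) ~> lin (partial k ⊞ term≤ (X N.+ k) ⊞ *≤ˡ (D₁ (suc (suc (X N.+ k)))) (sub≥0 (θ≤ (suc (X N.+ k)))) (W-anti (X N.+ k)))
     (by 11 (\ S t z n θ₀ θ₁ w w′ S′ d₀ u -> S :+ t :+ (z :* (:1 :+ n) :- θ₁) :* w′ :+ (z :* S′ :+ d₀ :+ ((θ₁ :- θ₀) :* w :+ (z :* (:1 :+ n) :- θ₁) :* w)) := S :+ (z :* n :- θ₀) :* w :+ (t :+ (z :* (:1 :+ n) :- θ₁) :* w′) :+ (z :* (S′ :+ w) :+ d₀)) {_}
      {Σ k (\ r -> remainder (1/p (suc X N.+ r)))} {remainder (1/p (suc (X N.+ k)))} {Z₁} {# (suc (X N.+ k))} {θ (suc (X N.+ k))} {θ (suc (suc (X N.+ k)))} {W (X N.+ k)} {W (suc (X N.+ k))} {Σ k (\ r -> W (X N.+ r))} {D₁ (suc X) * W X} {0#})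

    i⁻¹ = L (suc X) ⁻¹
    0≤i = ⁻¹≥0 (0<L X)

    telescope : ∀ k -> Σ k (\ r -> W (X N.+ r)) ≤ ½ * i⁻¹ * (recip X - recip (X N.+ k))
    telescope k = Σ-mono′ k (\ r -> *≤ˡ _ (*≥0 (<≤ 0<½) (*≥0 (recip≥0 (suc (X N.+ r))) (recip≥0 (X N.+ r)))) (⁻¹-anti (0<L X) (L-mono (N.s≤s (N.m≤m+n X r)))) >~ by 3 (\ h p i -> h :* p :* i := h :* i :* p) & *ˡ (difference (X N.+ r) & +ˡ (-ᶜ (reflexive (E.cong recip (E.sym (N.+-suc X r))))))) >>
     Σ-* k _ _ & *ˡ (Σ-telescope k (\ r -> recip (X N.+ r))) ~> ≈⇒≤ (*ˡ (+ʳ (reflexive (E.cong recip (N.+-identityʳ X)))))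
     where
     difference : ∀ j -> recip (suc j) * recip j ≈ recip j - recip (suc j)
     difference j = sym (+-cong (sym (1* _) & *ʳ (sym (suc*recip (suc j)))) (-ᶜ (sym (1* _) & *ʳ (sym (suc*recip j)))) & by 3 \ n r r' -> (:1 :+ n) :* r :* r' :- n :* r' :* r := r :* r')

   -- The tail beyond n = X + 1 is at most Z₁/(n log(n + 1)).
   tail-theta = tailRemainder-≤ (suc X) \ k -> begin Σ k (\ r -> remainder (1/p (suc X N.+ r))) ≤⟨ x≤x+y (*≥0 (sub≥0 (θ≤ (X N.+ k))) (W≥0 (X N.+ k))) ⟩
    Σ k (\ r -> remainder (1/p (suc X N.+ r))) + D₁ (suc X N.+ k) * W (X N.+ k) ≤⟨ partial k ⟩
    Z₁ * Σ k (\ r -> W (X N.+ r)) + D₁ (suc X) * W X ≤⟨ *≤ˡ Z₁ 0≤Z₁ (telescope k >> *≤ˡ _ 0≤hi (lin (recip≥0 (X N.+ k)) (by 2 \ a b -> a :- b :+ b := :0 :+ a))) ⊞ *≤ʳ (W X) (W≥0 X) (lin θ≥0 (by 2 \ z t -> z :- t :+ t := :0 :+ z)) ⟩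
    Z₁ * (½ * i⁻¹ * recip X) + Z₁ * # (suc X) * W X ≈⟨ +ˡ (by 6 (\ z n h r' r i -> z :* n :* (h :* (r' :* r) :* i) := z :* (h :* i :* (n :* r :* r'))) & *ˡ (*ˡ (*ʳ (suc*recip X) & 1* _))) ⟩
    Z₁ * (½ * i⁻¹ * recip X) + Z₁ * (½ * i⁻¹ * recip (suc X)) ≤⟨ ≤-refl ⊞ *≤ˡ Z₁ 0≤Z₁ (*≤ˡ _ 0≤hi (recip-mono (N.n≤1+n X))) ⟩
    Z₁ * (½ * i⁻¹ * recip X) + Z₁ * (½ * i⁻¹ * recip X) ≈⟨ by 4 (\ z h i r -> z :* (h :* i :* r) :+ z :* (h :* i :* r) := z :* (r :* i) :* (con 2 :* h)) & *ˡ 2½ & *1 _ ⟩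
    Z₁ * (recip X * i⁻¹) ∎
    where
    0≤hi = *≥0 (<≤ 0<½) 0≤i
    θ≥0 = Σ≥0 (suc X) (\ i -> go (isPrime (suc i)) i)
     where go : ∀ b i -> 0# ≤ (if b then L i else 0#)
           go true i = L≥0 i
           go false i = ≤-refl

  tail-theta-bound : ∀ {x} -> # 2 ≤ x -> tailRemainder ⌊ x ⌋ ≤ Z₁ / ((x - 1#) * log x)
  tail-theta-bound {x} 2≤x = begin tailRemainder ⌊ x ⌋ ≡⟨ E.cong tailRemainder floor≡ ⟩ tailRemainder (suc X) ≤⟨ tail-theta X ⟩
   Z₁ * (recip X * L (suc X) ⁻¹) ≈⟨ *ˡ (sym (⁻¹-* (#>0 X) (<-≤-trans 0<log ≤LX))) ⟩
   Z₁ / (# (suc X) * L (suc X)) ≤⟨ /-anti 0≤Z₁ (*>0 (sub>0 1<x) 0<log) (*-mono (<≤ (sub>0 1<x)) (lin (<≤ x<X) (by 2 \ x n -> x :- :1 :+ (:1 :+ n) := x :+ n)) (<≤ 0<log) ≤LX) ⟩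
   Z₁ / ((x - 1#) * log x) ∎
   where
   open Floor 2≤x

 -- Maxima of upper semicontinuous functions

 decide : (Q : Set) -> Q ⊎ ¬ Q
 decide Q = from (em {Q})
  where from : Dec Q -> Q ⊎ ¬ Q
        from (yes q) = inj₁ q
        from (no n) = inj₂ n

 -- Upper semicontinuity on [x₀, ∞)
 UpperSemicontinuous : ℝ -> (ℝ -> ℝ) -> Set
 UpperSemicontinuous x₀ f = ∀ t -> x₀ ≤ t -> ∀ e -> 0# < e -> ∃[ d ] (0# < d × (∀ x -> x₀ ≤ x -> ∣ x - t ∣ ≤ d -> f x ≤ f t + e))

 -- A bounded upper semicontinuous function that is eventually at most its first value attains a maximum:
 -- the supremum s is approached on [t, ∞) for t up to some t*, and f t* = s.
 module _ (f : ℝ -> ℝ) (x₀ X c : ℝ) (usc : UpperSemicontinuous x₀ f) (far : ∀ x -> X ≤ x -> f x ≤ f x₀) (bounded : ∀ x -> x₀ ≤ x -> f x ≤ c) where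
  private
   Values : ℝ -> Set
   Values y = ∃[ x ] (x₀ ≤ x × y ≈ f x)

   sup = complete Values (f x₀ , x₀ , ≤-refl , refl) (c , \ { y (x , h , p) -> p ~> bounded x h })
   s = fst sup
   ≤s : ∀ x -> x₀ ≤ x -> f x ≤ s
   ≤s x h = fst (snd sup) (f x) (x , h , refl)

   -- Points beyond which the supremum s is still approached
   Approached : ℝ -> Set
   Approached t = x₀ ≤ t × (∀ e -> 0# < e -> ∃[ x ] (t ≤ x × s - e < f x))

   start : Approached x₀
   start = ≤-refl , \ e he -> [ (\ w -> w) , (\ none -> ⊥-elim (<⇒≱ he (lin (snd (snd sup) (s - e) (\ { y (x , h , p) -> p ~> (by-contradiction \ lt -> none (x , h , lt)) })) (by 2 \ s e -> e :+ (s :- e) := s :+ :0)))) ]′ (decide _)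

   module Interior (first< : f x₀ < s) where
    approached≤ : ∀ t -> Approached t -> t ≤ X
    approached≤ t (_ , h) = by-contradiction \ X<t -> let (x , t≤x , lt) = h (s - f x₀) (sub>0 first<) in
     <⇒≱ lt (far x (<≤ X<t >> t≤x) >~ by 2 \ s a -> a := s :- (s :- a))

    last = complete Approached (x₀ , start) (X , approached≤)
    t* = fst last
    x₀≤t* = fst (snd last) x₀ start

    attained = ≤-antisym (≤s t* x₀≤t*) (by-contradiction below)
     where
     below : ¬ (f t* < s)
     below lt = contradict (usc t* x₀≤t* e 0<e)
      where
      e = (s - f t*) * ½
      0<e = half>0 (sub>0 lt)
      gap₁ = by 3 (\ s e a -> s :- e := s :- a :+ (a :- e)) {_} {s} {e} {f t*} & +ʳ (sym (half+half (s - f t*))) & by 2 (\ e a -> e :+ e :+ (a :- e) := a :+ e)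
      contradict : ¬ (∃[ d ] (0# < d × (∀ x -> x₀ ≤ x -> ∣ x - t* ∣ ≤ d -> f x ≤ f t* + e)))
      contradict (d , 0<d , near) = <⇒≱ 0<d (lin (snd (snd last) (t* - d) bound) (by 2 \ t d -> d :+ (t :- d) := t :+ :0))
       where
       -- If the supremum were approached beyond t* - d, it would be so beyond t* + d.
       push : ∀ t -> Approached t -> t* - d < t -> Approached (t* + d)
       push t (x₀≤t , h) t*-d<t = x₀≤t* >> x≤x+y (<≤ 0<d) , witness
        where
        witness : ∀ e′ -> 0# < e′ -> ∃[ x ] (t* + d ≤ x × s - e′ < f x)
        witness e′ he′ = [ (\ e≤ -> pick e 0<e ≤-refl e≤) , (\ e′< -> pick e′ he′ (<≤ e′<) ≤-refl) ]′ (≤-or-> e e′)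
         where
         pick : ∀ e₁ -> 0# < e₁ -> e₁ ≤ e -> e₁ ≤ e′ -> ∃[ x ] (t* + d ≤ x × s - e′ < f x)
         pick e₁ he₁ ≤e ≤e′ = let (x , t≤x , lt′) = h e₁ he₁ in x , by-contradiction (\ x<t*+d -> <⇒≱ lt′ (near x (x₀≤t >> t≤x)
          (abs-≤ (lin (<≤ x<t*+d) (by 3 \ x t d -> x :- t :+ (t :+ d) := x :+ d)) (lin (<≤ t*-d<t >> t≤x) (by 3 \ x t d -> :- (x :- t) :+ x := t :- d :+ d))) >> sym gap₁ ~> +-monoʳ-≤ s (neg-mono ≤e))) , ≤-<-trans (+-monoʳ-≤ s (neg-mono ≤e′)) lt′
       bound : IsUpperBound Approached (t* - d)
       bound t ht = by-contradiction \ lt′ -> <⇒≱ 0<d (lin (fst (snd last) (t* + d) (push t ht lt′)) (by 2 \ t d -> d :+ t := t :+ d :+ :0))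

  maximum-exists : ∃[ K ] IsMaximumOn (x₀ ≤_) f K
  maximum-exists = [ (\ s≤ -> s , (x₀ , ≤-refl , ≤-antisym (≤s x₀ ≤-refl) s≤) , ≤s) ,
   (\ lt -> let module I = Interior lt in s , (I.t* , I.x₀≤t* , I.attained) , ≤s) ]′ (≤-or-> s (f x₀))

 -- The function whose maximum enters the upper bound
 majorant : ℕ -> ℝ -> ℝ
 majorant ℓ x = log x ^ᶻ (ℓ ⊖ 1) / (x - 1#)

 module _ {x₀ : ℝ} (2≤x₀ : # 2 ≤ x₀) where
  private
   1<2 = lin< 0<1 (by 0 (:1 :+ :1 := :0 :+ con 2))

   1≤x-1 : ∀ {x} -> x₀ ≤ x -> 1# ≤ x - 1#
   1≤x-1 h = lin (2≤x₀ >> h) (by 1 \ x -> :1 :+ x := con 2 :+ (x :- :1))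

   0<x-1 : ∀ {x} -> x₀ ≤ x -> 0# < x - 1#
   0<x-1 h = <-≤-trans 0<1 (1≤x-1 h)

   1<x : ∀ {x} -> x₀ ≤ x -> 1# < x
   1<x h = <-≤-trans 1<2 (2≤x₀ >> h)

   0<x : ∀ {x} -> x₀ ≤ x -> 0# < x
   0<x h = ≤-<-trans 0≤1 (1<x h)

  majorant>0 : ∀ ℓ {x} -> x₀ ≤ x -> 0# < majorant ℓ x
  majorant>0 zero h = />0 (⁻¹>0 (*>0 (log>0 (1<x h)) 0<1)) (0<x-1 h)
  majorant>0 (suc ℓ) h = />0 (^>0 ℓ (log>0 (1<x h))) (0<x-1 h)

  private
   module Power (k : ℕ) where
    f : ℝ -> ℝ
    f x = log x ^ k / (x - 1#)

    power-increase : ∀ {a d} -> 0# ≤ a -> 0# ≤ d -> d ≤ 1# -> (a + d) ^ k ≤ a ^ k + d * (# k * (a + 1#) ^ k)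
    power-increase = go k
     where
     go : ∀ k {a d} -> 0# ≤ a -> 0# ≤ d -> d ≤ 1# -> (a + d) ^ k ≤ a ^ k + d * (# k * (a + 1#) ^ k)
     go zero {a} {d} ha hd h = ≈⇒≤ (by 2 (\ a d -> :1 := :1 :+ d :* (:0 :* :1)) {_} {a})
     go (suc k) {a} {d} ha hd h = begin (a + d) ^ suc k ≈⟨ by 2 (\ p q -> p := q :+ (p :- q)) ⟩
      a ^ suc k + ((a + d) ^ suc k - a ^ suc k) ≤⟨ +-monoʳ-≤ _ (power-difference-≤ k ha (x≤x+y hd)) ⟩
      a ^ suc k + # (suc k) * ((a + d - a) * (a + d) ^ k) ≈⟨ +ˡ (*ˡ (*ʳ (by 2 \ a d -> a :+ d :- a := d)) & by 3 \ n d p -> n :* (d :* p) := d :* (n :* p)) ⟩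
      a ^ suc k + d * (# (suc k) * (a + d) ^ k) ≤⟨ +-monoʳ-≤ _ (*≤ˡ d hd (*≤ˡ _ (#≥0 (suc k)) below)) ⟩
      a ^ suc k + d * (# (suc k) * (a + 1#) ^ suc k) ∎
      where
      below = ^-mono k (+≥0 ha hd) (+-monoʳ-≤ a h) >> sym (1* _) ~> *≤ʳ _ (^≥0 k (+≥0 ha 0≤1)) (x≤y+x ha)

    inverse-increase : ∀ {y d} -> 1# ≤ y -> 0# ≤ d -> d ≤ ½ -> (y - d) ⁻¹ ≤ y ⁻¹ + # 2 * d
    inverse-increase {y} {d} hy hd h = ≤-resp (1* _) refl (/-≤ 0<y-d (lin (*≥0 hd (sub≥0 r≤))
     (+ʳ (sym (inv 0<y)) & by 3 \ y d r -> y :* r :+ d :* (con 2 :* (y :- d) :- r) := :0 :+ (r :+ con 2 :* d) :* (y :- d))))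
     where
     0<y = <-≤-trans 0<1 hy
     ½≤ = lin (hy ⊞ h) (by 3 (\ h y d -> h :+ (y :+ h) := h :+ h :+ y) {_} {½} {y} {d} & +ʳ ½+½≈1 & by 2 \ y d -> :1 :+ y := :1 :+ d :+ (y :- d))
     0<y-d = <-≤-trans 0<½ ½≤
     r≤ = ⁻¹-anti 0<1 hy >> 1⁻¹ & sym 2½ ~> *≤ˡ _ (#≥0 2) ½≤

    usc : UpperSemicontinuous x₀ f
    usc t h e he = d , 0<d , near
     where
     a = log t
     b = (t - 1#) ⁻¹
     A = a ^ k
     C = # k * (a + 1#) ^ k
     0≤a = log≥0 (<≤ (1<x h))
     0≤A = ^≥0 k 0≤a
     0≤C = *≥0 (#≥0 k) (^≥0 k (+≥0 0≤a 0≤1))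
     0≤b = ⁻¹≥0 (0<x-1 h)
     b≤1 = ⁻¹-anti 0<1 (1≤x-1 h) >~ 1⁻¹
     Q = # 2 * A + # 2 * C + # 2 * e
     0<Q = +≥> (+≥0 (*≥0 (#≥0 2) 0≤A) (*≥0 (#≥0 2) 0≤C)) (*>0 (#>0 1) he)
     d = e / Q
     0<d = />0 he 0<Q
     0≤d = <≤ 0<d
     2d≤1 = *-cancelˡ-≤ e he (by 2 (\ e d -> e :* (con 2 :* d) := d :* (con 2 :* e)) ~> *≤ˡ d 0≤d (x≤y+x (+≥0 (*≥0 (#≥0 2) 0≤A) (*≥0 (#≥0 2) 0≤C))) >~ /-cancel 0<Q & sym (*1 e))
     d≤½ = *-cancelˡ-≤ (# 2) (#>0 1) (2d≤1 >~ sym 2½)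
     dQ = *≤ˡ d 0≤d (x≤x+y (*≥0 (#≥0 2) (<≤ he))) >~ /-cancel 0<Q
     near : ∀ x -> x₀ ≤ x -> ∣ x - t ∣ ≤ d -> f x ≤ f t + e
     near x hx close′ = begin
      log x ^ k * (x - 1#) ⁻¹ ≤⟨ *-mono (^≥0 k (log≥0 (<≤ (1<x hx)))) (^-mono k (log≥0 (<≤ (1<x hx))) log≤ >> power-increase 0≤a 0≤d (d≤½ >> ½≤1))
       (⁻¹≥0 (0<x-1 hx)) (⁻¹-anti 0<t-1-d (lin (-≤abs _ >> close′) (by 3 \ x t d -> t :- :1 :- d :+ d := :- (x :- t) :+ (x :- :1))) >> inverse-increase (1≤x-1 h) 0≤d d≤½) ⟩
      (A + d * C) * (b + # 2 * d) ≤⟨ lin (*≤ˡ (d * C) (*≥0 0≤d 0≤C) b≤1 ⊞ *≤ˡ (d * C) (*≥0 0≤d 0≤C) 2d≤1 ⊞ dQ)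
       (by 6 (\ A d C b e x -> (A :+ d :* C) :* (b :+ con 2 :* d) :+ (d :* C :* :1 :+ (d :* C :* :1 :+ e)) := d :* C :* b :+ (d :* C :* (con 2 :* d) :+ d :* (con 2 :* A :+ con 2 :* C)) :+ (A :* b :+ e)) {_} {A} {d} {C} {b} {e} {0#}) ⟩
      A * b + e ∎
      where
      log≤ = log-≤-exp (0<x hx) (lin (≤abs _ >> close′ ⊞ *≤ˡ d 0≤d (<≤ (1<x h))) (by 3 \ x t d -> x :+ (d :+ d :* t) := x :- t :+ d :* :1 :+ t :* (:1 :+ d)) >> *≤ˡ t (<≤ (0<x h)) (1+x≤exp d) >~ sym (exp-+ a d & *ʳ (exp-log (0<x h))))
      0<t-1-d = <-≤-trans 0<½ (lin (1≤x-1 h ⊞ d≤½) (by 3 (\ i t d -> i :+ (t :- :1 :+ i) := i :+ i :+ (t :- :1)) {_} {½} {t} {d} & +ʳ ½+½≈1 & by 2 \ y d -> :1 :+ y := :1 :+ d :+ (y :- d)))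

    B = expBound k ½

    -- f x ≤ 2 B x^(-1/2)
    decays : ∀ {x} -> x₀ ≤ x -> f x ≤ # 2 * B * exp (- (½ * log x))
    decays {x} h = /-≤ (0<x-1 h) (begin u ^ k ≤⟨ ^-mono k 0≤u (x≤y+x 0≤1) >> power≤exp k 0<½ 0≤u ⟩
     B * exp (½ * u) ≈⟨ *ˡ (exp-cong (by 2 (\ h u -> h :* u := :- (h :* u) :+ (u :* h :+ u :* h)) & +ˡ (half+half u)) & exp-+ _ _ & *ˡ (exp-log (0<x h))) ⟩
     B * (exp (- (½ * u)) * x) ≤⟨ *≤ˡ B (<≤ (expBound>0 k 0<½)) (*≤ˡ _ (exp≥0 _) (lin (2≤x₀ >> h) (by 1 \ x -> x :+ x := con 2 :+ con 2 :* (x :- :1)))) ⟩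
     B * (exp (- (½ * u)) * (# 2 * (x - 1#))) ≈⟨ by 3 (\ b e y -> b :* (e :* (con 2 :* y)) := con 2 :* b :* e :* y) ⟩
     # 2 * B * exp (- (½ * u)) * (x - 1#) ∎)
     where
     u = log x
     0≤u = log≥0 (<≤ (1<x h))

    0≤2B = *≥0 (#≥0 2) (<≤ (expBound>0 k 0<½))

    bounded : ∀ x -> x₀ ≤ x -> f x ≤ # 2 * B
    bounded x h = decays h >> *≤ˡ _ 0≤2B (exp-neg≤1 (*≥0 (<≤ 0<½) (log≥0 (<≤ (1<x h))))) >~ *1 _

    0<f = majorant>0 (suc k) ≤-refl

    X : ℝ
    X = x₀ + exp (# 2 * (# 2 * B / f x₀))

    far : ∀ x -> X ≤ x -> f x ≤ f x₀
    far x h = decays (x≤x+y (exp≥0 _) >> h) >> *ˡ (exp-neg _) ~> ≤-resp (sym (*ˡ refl)) refl (/-≤ (exp>0 _) (begin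
     # 2 * B ≈⟨ sym (*-comm _ _ & /-cancel 0<f) ⟩
     f x₀ * (# 2 * B / f x₀) ≤⟨ *≤ˡ _ (<≤ 0<f) (q≤ >> x≤y+x 0≤1 >> 1+x≤exp _) ⟩
     f x₀ * exp (½ * log x) ∎))
     where
     q≤ = *-cancelˡ-≤ (# 2) (#>0 1) (exp-≤-log (0<x (x≤x+y (exp≥0 _) >> h)) (x≤y+x (<≤ (0<x ≤-refl)) >> h) >~ sym (sym (*-assoc _ _ _) & *ʳ 2½ & 1* _))

  majorant-maximum : ∀ ℓ -> ∃[ K ] IsMaximumOn (x₀ ≤_) (majorant ℓ) K
  majorant-maximum zero = majorant 0 x₀ , (x₀ , ≤-refl , refl) , \ x h -> *-mono (⁻¹≥0 (*>0 (log>0 (1<x h)) 0<1)) (⁻¹-anti (*>0 (log>0 (1<x ≤-refl)) 0<1) (*≤ʳ 1# 0≤1 (log-mono (0<x ≤-refl) h)))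
   (⁻¹≥0 (0<x-1 h)) (⁻¹-anti (0<x-1 ≤-refl) (h ⊞ ≤-refl))
  majorant-maximum (suc k) = maximum-exists f x₀ X (# 2 * B) usc far bounded
   where open Power k

 -- The two inequalities

 -- By convexity, the exponential lies below its chord over [0, m].
 exp-chord : ∀ {y m} -> 0# < m -> 0# ≤ y -> y ≤ m -> exp y ≤ 1# + y * ((exp m - 1#) / m)
 exp-chord {y} {m} hm hy h = begin exp y ≈⟨ by 3 (\ e y l -> e := e :* (:1 :+ y :- y)) {_} {exp y} {y} {0#} ⟩
  exp y * (1# + y - y) ≈⟨ *ˡ (+ʳ (+ˡ (sym (/-cancel hm)))) ⟩
  exp y * (1# + l * m - y) ≤⟨ lin (*≤ˡ l 0≤l far ⊞ *≤ˡ (1# - l) (sub≥0 l≤1) origin) (by 5 \ e l m y f -> e :* (:1 :+ l :* m :- y) :+ (l :* f :+ (:1 :- l) :* :1) := l :* (e :* (:1 :+ (m :- y))) :+ (:1 :- l) :* (e :* (:1 :+ :- y)) :+ (:1 :+ l :* (f :- :1))) ⟩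
  1# + l * (exp m - 1#) ≈⟨ +ˡ (by 3 \ y i f -> y :* i :* f := y :* (f :* i)) ⟩
  1# + y * ((exp m - 1#) / m) ∎
  where
  l = y / m
  0≤l = /≥0 hy hm
  l≤1 = /-≤ hm (h >~ sym (1* m))
  -- The tangent at y evaluated at m and at 0
  far = *≤ˡ _ (exp≥0 y) (1+x≤exp (m - y)) >~ sym (exp-+ _ _) & exp-cong (by 2 \ y m -> y :+ (m :- y) := m)
  origin = *≤ˡ _ (exp≥0 y) (1+x≤exp (- y)) >~ exp-inverse y

 chord>0 : ∀ {m} -> 0# < m -> 0# < (exp m - 1#) / m
 chord>0 hm = />0 (sub>0 (<-resp exp-0 refl (exp-mono-< hm))) hm

 module Bounds (ℓ : ℕ) (x₀ : ℝ) (2≤x₀ : # 2 ≤ x₀) where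

  main : ℝ -> ℝ
  main x = exp (- γᴱ) / log x

  private
   module F {x} (h : x₀ ≤ x) = Floor (2≤x₀ >> h)

   0<main : ∀ {x} -> x₀ ≤ x -> 0# < main x
   0<main h = />0 (exp>0 _) (F.0<log h)

   log-increases : ∀ {x} -> x₀ ≤ x -> log x₀ ≤ log x
   log-increases h = log-mono (F.0<x ≤-refl) h

   0<logℓ : ∀ {x} -> x₀ ≤ x -> 0# < log x ^ ℓ
   0<logℓ h = ^>0 ℓ (F.0<log h)

   decreasing : ∀ {C x} -> 0# ≤ C -> x₀ ≤ x -> C / log x ^ ℓ ≤ C / log x₀ ^ ℓ
   decreasing hC h = /-anti hC (0<logℓ ≤-refl) (^-mono ℓ (<≤ (F.0<log ≤-refl)) (log-increases h))

  module _ (A : ℝ) (hyp : ∀ x -> x₀ ≤ x -> ∣ discrepancy x ∣ ≤ A / log x ^ ℓ) where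

   lower-bound : ∀ x -> x₀ ≤ x -> main x * (1# - A / log x ^ ℓ) ≤ product x
   lower-bound x h = *≤ˡ _ (<≤ (0<main h)) (lin (≤abs _ >> hyp x h ⊞ tailRemainder≥0 ⌊ x ⌋) (by 3 \ a E t -> :1 :- a :+ (a :+ t) := E :+ :0 :+ (:1 :+ (t :- E))) >> 1+x≤exp _) >~ sym (product-formula (F.0<log h))

   -- If the exponent is at most y ≤ m, and y ≤ C/(log x)^ℓ, the chord bounds the product.
   upper-bound : ∀ {m C y} x -> x₀ ≤ x -> 0# < m -> 0# ≤ y -> y ≤ m -> A / log x ^ ℓ + tailRemainder ⌊ x ⌋ ≤ y -> y ≤ C / log x ^ ℓ -> product x ≤ main x * (1# + C * ((exp m - 1#) / m) / log x ^ ℓ)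
   upper-bound {m} {C} {y} x h hm 0≤y y≤m exponent≤ y≤ = product-formula (F.0<log h) ~> *≤ˡ _ (<≤ (0<main h)) (begin
    exp (tailRemainder ⌊ x ⌋ - discrepancy x) ≤⟨ exp-mono (lin (-≤abs _ >> hyp x h) (by 3 \ t E a -> t :- E :+ a := :- E :+ (a :+ t)) >> exponent≤) ⟩
    exp y ≤⟨ exp-chord hm 0≤y y≤m ⟩
    1# + y * ((exp m - 1#) / m) ≤⟨ +-monoʳ-≤ 1# (*≤ʳ _ (<≤ (chord>0 hm)) y≤) ⟩
    1# + C / log x ^ ℓ * ((exp m - 1#) / m) ≈⟨ +ˡ (by 3 \ c i e -> c :* i :* e := c :* e :* i) ⟩
    1# + C * ((exp m - 1#) / m) / log x ^ ℓ ∎)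

  -- The first part of the theorem, with the constants of the prime number theorem
  open Discrepancy ℓ using (B; 0<B; bound; bound>0; discrepancy-bound; tail-crude)

  C₀ m₀ A₀′ : ℝ
  C₀ = bound + # 4 * B
  m₀ = C₀ / log x₀ ^ ℓ
  A₀′ = C₀ * ((exp m₀ - 1#) / m₀)

  private
   0<C₀ = +>≥ bound>0 (*≥0 (#≥0 4) (<≤ 0<B))
   0<m₀ = />0 0<C₀ (0<logℓ ≤-refl)

  A₀′>0 = *>0 0<C₀ (chord>0 0<m₀)

  discrepancy₀ : ∀ x -> x₀ ≤ x -> ∣ discrepancy x ∣ ≤ bound / log x ^ ℓ
  discrepancy₀ x h = discrepancy-bound (2≤x₀ >> h)

  upper₀ : ∀ x -> x₀ ≤ x -> product x ≤ main x * (1# + A₀′ / log x ^ ℓ)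
  upper₀ x h = upper-bound bound discrepancy₀ {m₀} {C₀} {C₀ / log x ^ ℓ} x h 0<m₀ (/≥0 (<≤ 0<C₀) (0<logℓ h)) (decreasing (<≤ 0<C₀) h)
   (+-monoʳ-≤ _ (tail-crude (2≤x₀ >> h)) >~ sym (distribʳ _ _ _)) ≤-refl

  -- The second part, with explicit constants
  module Explicit (ϑ-bound : ∀ x -> 0# < x -> ϑ x < Z₁ * x) (A : ℝ) (0<A : 0# < A) (hyp : ∀ x -> x₀ ≤ x -> ∣ discrepancy x ∣ ≤ A / log x ^ ℓ)
   (K : ℝ) (isMax : IsMaximumOn (x₀ ≤_) (majorant ℓ) K) where

   m A′ : ℝ
   m = A / log x₀ ^ ℓ + Z₁ / ((x₀ - 1#) * log x₀)
   A′ = (A + Z₁ * K) * ((exp m - 1#) / m)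

   private
    0<y : ∀ {x} -> x₀ ≤ x -> 0# < (x - 1#) * log x
    0<y h = *>0 (sub>0 (F.1<x h)) (F.0<log h)

    0<m = +>≥ (/>0 0<A (0<logℓ ≤-refl)) (/≥0 0≤Z₁ (0<y ≤-refl))

    0<K = <-≤-trans (majorant>0 2≤x₀ ℓ ≤-refl) (snd isMax x₀ ≤-refl)

    reciprocal : ∀ {x} -> x₀ ≤ x -> ((x - 1#) * log x) ⁻¹ ≈ majorant ℓ x / log x ^ ℓ
    reciprocal {x} h = go ℓ
     where
     0<x-1 = sub>0 (F.1<x h)
     0<l = F.0<log h
     go : ∀ ℓ -> ((x - 1#) * log x) ⁻¹ ≈ majorant ℓ x / log x ^ ℓ
     go zero = ⁻¹-* 0<x-1 0<l & *-comm _ _ & *ʳ (⁻¹-cong (sym (*1 (log x)))) & sym (*ˡ 1⁻¹ & *1 _)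
     go (suc k) = ⁻¹-* 0<x-1 0<l & sym (1* _) & *ʳ (sym (inv (^>0 k 0<l))) & by 4 (\ p q a b -> p :* q :* (a :* b) := p :* a :* (b :* q)) & *ˡ (sym (⁻¹-* 0<l (^>0 k 0<l)))

   A′>0 = *>0 (+>≥ 0<A (*≥0 0≤Z₁ (<≤ 0<K))) (chord>0 0<m)

   upper : ∀ x -> x₀ ≤ x -> product x ≤ main x * (1# + A′ / log x ^ ℓ)
   upper x h = upper-bound A hyp {m} {A + Z₁ * K} {A / log x ^ ℓ + Z₁ / ((x - 1#) * log x)} x h 0<m (+≥0 (/≥0 (<≤ 0<A) (0<logℓ h)) (/≥0 0≤Z₁ (0<y h)))
    (decreasing (<≤ 0<A) h ⊞ /-anti 0≤Z₁ (0<y ≤-refl) (*-mono (<≤ (sub>0 (F.1<x ≤-refl))) (h ⊞ ≤-refl) (<≤ (F.0<log ≤-refl)) (log-increases h)))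
    (+-monoʳ-≤ _ (tail-theta-bound ϑ-bound (2≤x₀ >> h)))
    (+-monoʳ-≤ _ (*ˡ (reciprocal h) ~> *≤ˡ Z₁ 0≤Z₁ (/-mono (0<logℓ h) (snd isMax x h)) >~ sym (*-assoc _ _ _)) >~ sym (distribʳ _ _ _))

theorem5 :
  (em : ExcludedMiddle 0ℓ) (reals : CompleteOrderedField) →
  let open Analysis em reals
  in (ℓ : ℕ) (x₀ : ℝ) → fromℕ 2 ≤ x₀ →
  let ProductBounds : ℝ → ℝ → Set
      ProductBounds A A′ = ∀ x → x₀ ≤ x →
        (exp (- γᴱ) / log x * (1# - A / log x ^ ℓ)
           ≤ ∏ (primes≤ x) (λ p → 1# - 1# / fromℕ p))
        × (∏ (primes≤ x) (λ p → 1# - 1# / fromℕ p)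
           ≤ exp (- γᴱ) / log x * (1# + A′ / log x ^ ℓ))
  in
  (∃[ A ] ∃[ A′ ] (0# < A × 0# < A′ × ProductBounds A A′))
  ×
  ((∀ x → 0# < x → ϑ x < Z₁ * x) →
   (A : ℝ) → 0# < A →
   (∀ x → x₀ ≤ x →
     ∣ ∑ (primes≤ x) (λ p → 1# / fromℕ p) - log (log x) - M ∣ ≤ A / log x ^ ℓ) →
   ∃[ K ]
     (IsMaximumOn (x₀ ≤_) (λ x → log x ^ᶻ (ℓ ⊖ 1) / (x - 1#)) K
     × (let m  = A / log x₀ ^ ℓ + Z₁ / ((x₀ - 1#) * log x₀)
            A′ = (A + Z₁ * K) * ((exp m - 1#) / m)
        in 0# < A′ × ProductBounds A A′)))
theorem5 em reals ℓ x₀ 2≤x₀ = (bound , A₀′ , bound>0 , A₀′>0 , \ x h -> lower-bound bound discrepancy₀ x h , upper₀ x h) , \ ϑ-bound A 0<A hyp ->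
 let (K , isMax) = majorant-maximum 2≤x₀ ℓ
     module Ex = Explicit ϑ-bound A 0<A hyp K isMax
 in K , isMax , Ex.A′>0 , \ x h -> lower-bound A hyp x h , Ex.upper x h
 where
 open Proof em reals
 open Bounds ℓ x₀ 2≤x₀
 open Discrepancy ℓ using (bound; bound>0)
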